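{- Assume the free odd generation conjecture: $\mathfrak{dm}_0$, with the Ihara bracket, is isomorphic as a weight-graded Lie algebra to the free Lie algebra on one generator in each odd weight $\ge 3$. Then for all $N\ge 2$, $$\ker(D_{<N})\cap\mathcal Z^f_N=\mathbb Q\,\zeta^f(N),\qquad\text{where } D_{<N}=\bigoplus_{3\le 2r+1<N}D_{2r+1}.$$
   Context: Let $X=\{x_0,x_1\}$ and let $\mathbb Q\langle X\rangle$ be the free non-commutative $\mathbb Q$-algebra on $X$, with word basis, empty word $\mathbf 1$ and weight equal to length. Write $(f\mid w)$ for coefficients. Shuffle product: $\mathbf 1\sqcup\!\sqcup w=w\sqcup\!\sqcup\mathbf 1=w$ and $au\sqcup\!\sqcup bv=a(u\sqcup\!\sqcup bv)+b(au\sqcup\!\sqcup v)$. Stuffle product on $\mathbb Q\langle Y\rangle$, $Y=\{y_1,y_2,\dots\}$: $\mathbf 1*w=w*\mathbf 1=w$ and $y_iu*y_jv=y_i(u*y_jv)+y_j(y_iu*v)+y_{i+j}(u*v)$. Let $\iota(y_{k_1}\cdots y_{k_d})=x_0^{k_1-1}x_1\cdots x_0^{k_d-1}x_1$, $\mathfrak h^0=\mathbb Q\mathbf 1+x_0\mathbb Q\langle X\rangle x_1$ and $\mathfrak h^1=\mathbb Q\mathbf 1+\mathbb Q\langle X\rangle x_1$. $\mathcal Z^f=(\mathbb Q\langle X\rangle,\sqcup\!\sqcup)/R$, with $R$ the ideal generated by $x_0$, $x_1$ and all $u\sqcup\!\sqcup v-\iota(\iota^{ -1}(u)*\iota^{ -1}(v))$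 ($u\in\mathfrak h^0$, $v\in\mathfrak h^1$). It is weight-graded with pieces $\mathcal Z^f_N$. $\zeta^f$ is the projection, and $\zeta^f(N)=\zeta^f(x_0^{N-1}x_1)$. Let $\mathcal A^f=\mathcal Z^f/(\zeta^f(2))$ with projection $\pi$. Goncharov coproduct $\Delta_{\mathrm{Gon}}$ on $\mathbb Q\langle X\rangle$. Let $S(\varepsilon_1\cdots\varepsilon_n)=(-1)^n\varepsilon_n\cdots\varepsilon_1$. Set $I(a;f;b)=f$ if $(a,b)=(x_1,x_0)$, $S(f)$ if $(a,b)=(x_0,x_1)$, and $(f\mid\mathbf 1)\mathbf 1$ if $a=b$. With $\varepsilon_0=x_1$ and $\varepsilon_{n+1}=x_0$, $$\Delta_{\mathrm{Gon}}(\varepsilon_1\cdots\varepsilon_n)=\sum_{0=i_0<i_1<\dots<i_k<i_{k+1}=n+1}\Big(\mathop{\sqcup\!\sqcup}_{p=0}^k I(\varepsilon_{i_p};\varepsilon_{i_p+1}\cdots\varepsilon_{i_{p+1}-1};\varepsilon_{i_{p+1}})\Big)\otimes\varepsilon_{i_1}\cdots\varepsilon_{i_k}.$$ The coaction $\Delta:\mathcal Z^f\to\mathcal A^f\otimes\mathcal Z^f$ is $\Delta(\xi)=(\pi\circ\zeta^f\otimes\zeta^f)(\Delta_{\mathrm{Gon}}(w))$ for any $w$ with $\zeta^f(w)=\xi$; this is well defined. Let $\mathcal L=\mathcal A^f_{>0}/(\mathcal A^f_{>0})^2$ be the weight-graded space of indecomposables, and let $\pi_{2r+1}:\mathcal A^f_{>0}\to\mathcal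 L_{2r+1}$ be the projection. Define $$D_{2r+1}=(\pi_{2r+1}\otimes\mathrm{id})\circ(\Delta-\mathbf 1\otimes\mathrm{id}):\mathcal Z^f\to\mathcal L_{2r+1}\otimes\mathcal Z^f.$$ Double shuffle Lie algebra. $\mathfrak{dm}_0$ is the space of $\psi\in\mathbb Q\langle X\rangle$ satisfying: (i) $(\psi\mid x_0)=(\psi\mid x_1)=0$; (ii) $\psi$ is primitive for the concatenation-multiplicative coproduct with $x_0,x_1$ primitive; (iii) $\psi_*=\Pi_Y(\psi)+\sum_{n\ge2}\frac{(-1)^{n-1}}{n}(\Pi_Y(\psi)\mid y_n)y_1^n$ is primitive for the concatenation-multiplicative coproduct $\Delta_*(y_i)=y_i\otimes\mathbf 1+\mathbf 1\otimes y_i+\sum_{j=1}^{i-1}y_j\otimes y_{i-j}$; (iv) $(\psi\mid x_0x_1)=0$. Here $\Pi_Y$ sends $x_0^{k_1-1}x_1\cdots x_0^{k_d-1}x_1\mapsto y_{k_1}\cdots y_{k_d}$ and words ending in $x_0$ to $0$. The bracket is the Ihara bracket $\{f,g\}=d_f(g)-d_g(f)+fg-gf$, with $d_f$ the concatenation derivation $d_f(x_0)=0$, $d_f(x_1)=x_1f-fx_1$. -}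

module Defs where

open import Data.Rational using (ℚ; 0ℚ; 1ℚ; _+_; _*_; -_; _/_)
open import Data.Integer as ℤ using (ℤ)
open import Data.Nat as ℕ using (ℕ; zero; suc; _≤_; _<_)
import Data.Nat.Properties as ℕP
open import Data.List using (List; []; _∷_; _++_; map; concatMap; length; reverse; replicate; filter; upTo)
open import Data.List.Properties using (≡-dec)
open import Data.List.Relation.Unary.All using (All)
open import Data.Maybe using (Maybe; just; nothing; fromMaybe)
import Data.Maybe as Maybe
open import Data.Product using (Σ; _×_; _,_; proj₁; proj₂)
open import Data.Sum using (_⊎_)
open import Relation.Binary.PropositionalEquality using (_≡_; refl)
open import Relation.Binary.Definitions using (DecidableEquality)
open import Relation.Nullary using (¬_; yes; no)
open import Relation.Nullary.Decidable using (⌊_⌋)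

-- Non-commutative polynomials Q<A> over a decidable alphabet A,
-- represented by finite lists of (coefficient, word); two polynomials
-- are equal iff all their coefficients (f | w) agree.

module FreeAlg {A : Set} (_≟A_ : DecidableEquality A) where

  Word : Set
  Word = List A

  Poly : Set
  Poly = List (ℚ × Word)

  coeff : Poly → Word → ℚ
  coeff [] w = 0ℚ
  coeff ((c , u) ∷ f) w with ≡-dec _≟A_ u w
  ... | yes _ = c + coeff f w
  ... | no _  = coeff f w

  infix 4 _≈_
  _≈_ : Poly → Poly → Set
  f ≈ g = ∀ w → coeff f w ≡ coeff g w

  word : Word → Poly
  word w = (1ℚ , w) ∷ []

  zeroP : Poly
  zeroP = []

  infixl 6 _⊕_ _⊖_
  _⊕_ : Poly → Poly → Poly
  f ⊕ g = f ++ g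

  scale : ℚ → Poly → Poly
  scale c f = map (λ p → (c * proj₁ p , proj₂ p)) f

  _⊖_ : Poly → Poly → Poly
  f ⊖ g = f ++ scale (- 1ℚ) g

  infixl 7 _·_
  _·_ : Poly → Poly → Poly
  f · g = concatMap (λ p → map (λ q → (proj₁ p * proj₁ q , proj₂ p ++ proj₂ q)) g) f

  linP : (Word → Poly) → Poly → Poly
  linP φ f = concatMap (λ p → scale (proj₁ p) (φ (proj₂ p))) f

  prefix : A → Poly → Poly
  prefix a f = map (λ p → (proj₁ p , a ∷ proj₂ p)) f

  shW : Word → Word → Poly
  shW [] v = word v
  shW (a ∷ u) [] = word (a ∷ u)
  shW (a ∷ u) (b ∷ v) = prefix a (shW u (b ∷ v)) ⊕ prefix b (shW (a ∷ u) v)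

  shP : Poly → Poly → Poly
  shP f g = concatMap (λ p → concatMap (λ q → scale (proj₁ p * proj₁ q) (shW (proj₂ p) (proj₂ q))) g) f

  Homogeneous : ℕ → Poly → Set
  Homogeneous N f = ∀ w → ¬ (coeff f w ≡ 0ℚ) → length w ≡ N

  Tens : Set
  Tens = List (ℚ × Word × Word)

  coeff₂ : Tens → Word → Word → ℚ
  coeff₂ [] u v = 0ℚ
  coeff₂ ((c , a , b) ∷ T) u v with ≡-dec _≟A_ a u | ≡-dec _≟A_ b v
  ... | yes _ | yes _ = c + coeff₂ T u v
  ... | _     | _     = coeff₂ T u v

  infix 4 _≈₂_
  _≈₂_ : Tens → Tens → Set
  S ≈₂ T = ∀ u v → coeff₂ S u v ≡ coeff₂ T u v

  infixl 7 _⊗_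
  _⊗_ : Poly → Poly → Tens
  f ⊗ g = concatMap (λ p → map (λ q → (proj₁ p * proj₁ q , proj₂ p , proj₂ q)) g) f

  _·₂_ : Tens → Tens → Tens
  S ·₂ T = concatMap (λ s → map (λ t → (proj₁ s * proj₁ t , proj₁ (proj₂ s) ++ proj₁ (proj₂ t)
                                                         , proj₂ (proj₂ s) ++ proj₂ (proj₂ t))) T) S

  linT : (Word → Tens) → Poly → Tens
  linT φ f = concatMap (λ p → map (λ t → (proj₁ p * proj₁ t , proj₂ t)) (φ (proj₂ p))) f

  IsPrimitive : (Word → Tens) → Poly → Set
  IsPrimitive Δ ψ = linT Δ ψ ≈₂ (ψ ⊗ word []) ++ (word [] ⊗ ψ)

  -- the concatenation-multiplicative coproduct with all letters primitive
  Δsh : Word → Tens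
  Δsh [] = (1ℚ , [] , []) ∷ []
  Δsh (a ∷ w) = concatMap (λ t → (proj₁ t , a ∷ proj₁ (proj₂ t) , proj₂ (proj₂ t))
                                ∷ (proj₁ t , proj₁ (proj₂ t) , a ∷ proj₂ (proj₂ t)) ∷ []) (Δsh w)

data Letter : Set where
  x0 x1 : Letter

_≟L_ : DecidableEquality Letter
x0 ≟L x0 = yes refl
x0 ≟L x1 = no λ ()
x1 ≟L x0 = no λ ()
x1 ≟L x1 = yes refl

module PX = FreeAlg _≟L_
-- alphabet ℕ : used both for Y (the letter k stands for y_k, k ≥ 1)
-- and for the free generators σ_k of the free Lie algebra
module PN = FreeAlg ℕ._≟_

open PX using (Word; Poly; Tens; word; _⊕_; _⊖_; _·_; scale; shW; shP; _⊗_; _≈_; _≈₂_; coeff; linP; linT)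

YWord : Set
YWord = List ℕ

stW : YWord → YWord → PN.Poly
stW [] v = PN.word v
stW (i ∷ u) [] = PN.word (i ∷ u)
stW (i ∷ u) (j ∷ v) = PN.prefix i (stW u (j ∷ v)) PN.⊕ PN.prefix j (stW (i ∷ u) v)
                      PN.⊕ PN.prefix (i ℕ.+ j) (stW u v)

ιW : YWord → Word
ιW [] = []
ιW (k ∷ y) = replicate (k ℕ.∸ 1) x0 ++ x1 ∷ ιW y

ιP : PN.Poly → Poly
ιP f = map (λ p → (proj₁ p , ιW (proj₂ p))) f

-- Π_Y on words: nothing means the word ends in x0 (image 0)
piYAux : ℕ → Word → Maybe YWord
piYAux zero [] = just []
piYAux (suc k) [] = nothing
piYAux k (x0 ∷ w) = piYAux (suc k) w
piYAux k (x1 ∷ w) = Maybe.map (suc k ∷_) (piYAux zero w)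

piYW : Word → Maybe YWord
piYW = piYAux zero

ΠY : Poly → PN.Poly
ΠY f = concatMap (λ p → Maybe.maybe (λ y → (proj₁ p , y) ∷ []) [] (piYW (proj₂ p))) f

-- ι⁻¹ on words of 𝔥¹ (total version; only used on 𝔥¹-words)
ιinvW : Word → YWord
ιinvW w = fromMaybe [] (piYW w)

In𝔥⁰ : Word → Set
In𝔥⁰ u = (u ≡ []) ⊎ Σ Word (λ w → u ≡ x0 ∷ (w ++ x1 ∷ []))

In𝔥¹ : Word → Set
In𝔥¹ v = (v ≡ []) ⊎ Σ Word (λ w → v ≡ w ++ x1 ∷ [])

InShIdeal : {G : Set} → (G → Poly) → Poly → Set
InShIdeal {G} g f = Σ (List (Poly × G)) λ l → f ≈ concatMap (λ p → shP (proj₁ p) (g (proj₂ p))) l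

-- generators of R (double shuffle relations with u, v words; by bilinearity
-- these generate the same ideal as all u ∈ 𝔥⁰, v ∈ 𝔥¹)
data RGen : Set where
  gx0 gx1 : RGen
  gds : (u v : Word) → In𝔥⁰ u → In𝔥¹ v → RGen

rgen : RGen → Poly
rgen gx0 = word (x0 ∷ [])
rgen gx1 = word (x1 ∷ [])
rgen (gds u v _ _) = shW u v ⊖ ιP (stW (ιinvW u) (ιinvW v))

-- f ∈ R, i.e. ζ^f(f) = 0 in Z^f
InR : Poly → Set
InR = InShIdeal rgen

-- generators of the kernel K of Q<X>_{>0} → A^f_{>0} → L:
-- R, ζ(2) = x0x1, and products of positive-weight elements
data KGen : Set where
  kR : RGen → KGen
  kζ2 : KGen
  kprod : (u v : Word) → 0 < length u → 0 < length v → KGen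

kgen : KGen → Poly
kgen (kR g) = rgen g
kgen kζ2 = word (x0 ∷ x1 ∷ [])
kgen (kprod u v _ _) = shW u v

InK : Poly → Set
InK = InShIdeal kgen

-- a tensor represents 0 in L ⊗ Z^f
TensZero : Tens → Set
TensZero T = Σ (List (Poly × Poly)) λ A → Σ (List (Poly × Poly)) λ B →
  All (λ p → InK (proj₁ p)) A × All (λ p → InR (proj₂ p)) B ×
  (T ≈₂ concatMap (λ p → proj₁ p ⊗ proj₂ p) A ++ concatMap (λ p → proj₁ p ⊗ proj₂ p) B)

sgn : ℕ → ℚ
sgn zero = 1ℚ
sgn (suc n) = - sgn n

Iseg : Letter → Word → Letter → Poly
Iseg x1 w x0 = word w
Iseg x0 w x1 = scale (sgn (length w)) (word (reverse w))
Iseg x0 [] x0 = word []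
Iseg x0 (_ ∷ _) x0 = []
Iseg x1 [] x1 = word []
Iseg x1 (_ ∷ _) x1 = []

-- boundary letter, current segment, remaining letters
gonAux : Letter → Word → Word → List (Poly × Word)
gonAux a seg [] = (Iseg a seg x0 , []) ∷ []
gonAux a seg (e ∷ rest) =
  gonAux a (seg ++ e ∷ []) rest ++
  map (λ p → (shP (Iseg a seg e) (proj₁ p) , e ∷ proj₂ p)) (gonAux e [] rest)

ΔGonW : Word → Tens
ΔGonW w = concatMap (λ p → map (λ q → (proj₁ q , proj₂ q , proj₂ p)) (proj₁ p)) (gonAux x1 [] w)

ΔGon : Poly → Tens
ΔGon = linT ΔGonW

leftWeight : ℕ → Tens → Tens
leftWeight n T = filter (λ t → length (proj₁ (proj₂ t)) ℕ.≟ n) T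

DVanishes : ℕ → Poly → Set
DVanishes r f = TensZero (leftWeight (2 ℕ.* r ℕ.+ 1) (ΔGon f))

InKerD< : ℕ → Poly → Set
InKerD< N f = ∀ r → 3 ≤ 2 ℕ.* r ℕ.+ 1 → 2 ℕ.* r ℕ.+ 1 < N → DVanishes r f

zetaWord : ℕ → Word
zetaWord N = replicate (N ℕ.∸ 1) x0 ++ x1 ∷ []

InQζ : ℕ → Poly → Set
InQζ N f = Σ ℚ λ c → InR (f ⊖ scale c (word (zetaWord N)))

Δ*y : ℕ → PN.Tens
Δ*y i = (1ℚ , i ∷ [] , []) ∷ (1ℚ , [] , i ∷ []) ∷
        map (λ j → (1ℚ , j ∷ [] , (i ℕ.∸ j) ∷ [])) (map suc (upTo (i ℕ.∸ 1)))

Δ* : YWord → PN.Tens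
Δ* [] = (1ℚ , [] , []) ∷ []
Δ* (i ∷ w) = Δ*y i PN.·₂ Δ* w

-- correction Σ_{n≥2} (-1)^{n-1}/n (Π_Y ψ | y_n) y_1^n, computed termwise
corrTerm : ℚ × YWord → PN.Poly
corrTerm (c , suc (suc m) ∷ []) = (c * (sgn (suc m) * (ℤ.+ 1 / suc (suc m))) , replicate (suc (suc m)) 1) ∷ []
corrTerm _ = []

ψ* : Poly → PN.Poly
ψ* ψ = ΠY ψ PN.⊕ concatMap corrTerm (ΠY ψ)

In𝔡𝔪₀ : Poly → Set
In𝔡𝔪₀ ψ = (coeff ψ (x0 ∷ []) ≡ 0ℚ) × (coeff ψ (x1 ∷ []) ≡ 0ℚ)
        × PX.IsPrimitive PX.Δsh ψ
        × PN.IsPrimitive Δ* (ψ* ψ)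
        × (coeff ψ (x0 ∷ x1 ∷ []) ≡ 0ℚ)

dLetter : Poly → Letter → Poly
dLetter f x0 = []
dLetter f x1 = word (x1 ∷ []) · f ⊖ f · word (x1 ∷ [])

dWord : Poly → Word → Poly
dWord f [] = []
dWord f (a ∷ w) = dLetter f a · word w ⊕ word (a ∷ []) · dWord f w

ihara : Poly → Poly → Poly
ihara f g = linP (dWord f) g ⊖ linP (dWord g) f ⊕ f · g ⊖ g · f

-- Free Lie algebra on generators σ_k (k : ℕ), σ_k of weight 2k+3, realised
-- (standardly) as the Lie subalgebra of Q<σ_0,σ_1,...> generated by the letters.

data LTree : Set where
  lgen : ℕ → LTree
  lbr : LTree → LTree → LTree

LieComb : Set
LieComb = List (ℚ × LTree)

evalFree : LTree → PN.Poly
evalFree (lgen k) = PN.word (k ∷ [])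
evalFree (lbr s t) = evalFree s PN.· evalFree t PN.⊖ evalFree t PN.· evalFree s

evalFreeC : LieComb → PN.Poly
evalFreeC t = concatMap (λ p → PN.scale (proj₁ p) (evalFree (proj₂ p))) t

evalIh : (ℕ → Poly) → LTree → Poly
evalIh σ (lgen k) = σ k
evalIh σ (lbr s t) = ihara (evalIh σ s) (evalIh σ t)

evalIhC : (ℕ → Poly) → LieComb → Poly
evalIhC σ t = concatMap (λ p → scale (proj₁ p) (evalIh σ (proj₂ p))) t

-- Free odd generation conjecture: there are homogeneous σ_{2k+3} ∈ 𝔡𝔪₀ of weight
-- 2k+3 such that the Lie morphism from the free Lie algebra sending the k-th
-- generator to σ k (for the Ihara bracket) is well-defined, injective, lands
-- in 𝔡𝔪₀ and is surjective onto 𝔡𝔪₀, i.e. a graded Lie algebra isomorphism.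
FreeOddGeneration : Set
FreeOddGeneration = Σ (ℕ → Poly) λ σ →
    (∀ k → PX.Homogeneous (2 ℕ.* k ℕ.+ 3) (σ k))
  × (∀ (t : LieComb) → In𝔡𝔪₀ (evalIhC σ t))
  × (∀ (t : LieComb) → (evalFreeC t PN.≈ PN.zeroP → evalIhC σ t ≈ PX.zeroP)
                     × (evalIhC σ t ≈ PX.zeroP → evalFreeC t PN.≈ PN.zeroP))
  × (∀ ψ → In𝔡𝔪₀ ψ → Σ LieComb λ t → ψ ≈ evalIhC σ t)

module Submission where

open import Defs
open import Data.Rational as ℚ using (ℚ; 0ℚ; 1ℚ)
import Data.Rational.Properties as ℚP
open import Relation.Binary.PropositionalEquality using (_≡_; _≢_; refl; sym; trans; cong; cong₂; subst; subst₂)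
open import Relation.Binary.Definitions using (DecidableEquality; Tri; tri<; tri≈; tri>)
open import Algebra.Bundles using (CommutativeRing)
open import Algebra.Structures using (IsCommutativeRing)
open import Level using (0ℓ)
open import Data.Nat as ℕ using (ℕ; zero; suc; z≤n; s≤s; _≤_; _<_)
import Data.Nat.Properties as ℕP
import Data.Integer as ℤ
open import Data.List using (List; []; _∷_; _++_; map; concatMap; length; reverse; replicate; _∷ʳ_)
import Data.List.Properties as LP
open import Data.List.Relation.Unary.All using (All; []; _∷_)
open import Data.Maybe using (Maybe; just; nothing)
import Data.Maybe as Maybe
open import Data.Product using (Σ; _×_; _,_; proj₁; proj₂; ∃)
open import Data.Sum using (_⊎_; inj₁; inj₂)
open import Data.Empty using (⊥; ⊥-elim)
open import Data.Unit using (⊤; tt)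
open import Function using (_∘_; id)
open import Relation.Nullary using (¬_; Dec; yes; no)
open import Relation.Nullary.Decidable.Core using (dec⇒maybe)
import Algebra.Solver.Ring as Solver
import Algebra.Solver.Ring.AlmostCommutativeRing as ACR
import Data.Rational.Unnormalised as ℚᵘ
import Data.Rational.Unnormalised.Properties as ℚᵘP
import Data.Integer.Properties as ℤP
open import Data.List.Membership.Propositional using (_∈_; lose)
import Data.List.Membership.Propositional.Properties as MP
import Data.List.Relation.Unary.All as All
import Data.List.Relation.Unary.All.Properties as AllP
open import Data.List.Relation.Unary.Any using (here; there)
open import Data.Nat.Solver using (module +-*-Solver)
module NS = +-*-Solver
import Data.Product.Properties as ProductP
open PX using (Word; Poly; Tens; word; _⊕_; _⊖_; _·_; scale; shW; shP; _⊗_; _≈_; _≈₂_; coeff; linP)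

-- Elements ψ of 𝔡𝔪₀ of weight n are the linear forms on weight n that kill R, ζ(2) and all products, so they
-- are dual to 𝓛. Pairing the left factor of the Goncharov coproduct with ψ gives the operator
-- D_ψ "cut out one segment and evaluate ψ on it"; it is the transpose of f ↦ ψ f + d_ψ(f), is a derivation
-- for ⧢, and preserves R by Racinet's argument (extended to even weights, where Euler's formula
-- ζ(2a) ∈ ℚ ζ(2)^a forces the depth one coefficient of ψ to vanish). Hence D_{<N} f = 0 says that
-- D_ψ f ∈ R for every ψ of odd weight < N.
--
-- Since D_{ {ψ , φ} } is the commutator of D_φ and D_ψ, under the free odd generation conjecture it is enough to look
-- at the D_{σ_k}. Subtracting a multiple of ζ(N) makes the last one, 2k+3 = N, vanish as well. Then D_ψ f ∈ R for
-- all ψ, so the operator Σ a_j ⧢ D_{ψ_j}, for a basis a_j of the indecomposables with dual basis ψ_j, sends f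
-- into R. This operator multiplies a product of m generators by m up to products of more generators and powers of ζ(2),
-- so f is a multiple of ζ(2)^{N/2} modulo R.
--
-- The subtraction needs ⟨σ_k , ζ(N)⟩ ≠ 0; otherwise the same argument would give ζ(N) ∈ R. That ζ(N) ∉ R is seen
-- analytically but over ℚ: truncated multiple harmonic sums at 2^m, shuffle-regularised, kill R up to
-- O(m^k / 2^m), whereas the truncation of ζ(N) is at least 1.

-- Polynomials are lists, so all identities are transposed: a polynomial is tested by every function
-- on words, and products, coproducts and operators become formulas for functions on words, where
-- equality is a ring identity in ℚ. `δ-test` leads back to coefficients.
--
-- Iterated brackets of odd generators also occur in even weight, so D_ψ must preserve R for every
-- homogeneous ψ. The obstacle is the reversal of words, which acts on ψ of weight N by the sign
-- -(-1)^N: comparing cuts from the left with cuts from the right requires the depth one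
-- coefficients to be fixed by this sign. In odd weight the sign is 1; in even weight those
-- coefficients must vanish.
--
-- The operator Σ a_j ⧢ D_{ψ_j} is not diagonalised; it is controlled only on the steps of a
-- filtration, ordered lexicographically by the power of ζ(2) and the number of factors. Both are
-- bounded by the weight, so repeated division by the number of factors pushes an element of the
-- kernel into R or onto a pure power of ζ(2). Euler's formula, whose constants are positive and
-- hence invertible, turns such a power back into a multiple of ζ(N).

-- Opaque copies of the field operations are injective for unification, so the
-- ring solver below can infer the atoms of a goal.
opaque
  infixl 6 _+_
  infixl 7 _*_
  infix 8 -_
  _+_ _*_ : ℚ → ℚ → ℚ
  _+_ = ℚ._+_
  _*_ = ℚ._*_
  -_ : ℚ → ℚ
  -_ x = ℚ.- x

  +-def : ∀ x y → x ℚ.+ y ≡ x + y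
  +-def _ _ = refl

  *-def : ∀ x y → x ℚ.* y ≡ x * y
  *-def _ _ = refl

  neg-def : ∀ x → ℚ.- x ≡ - x
  neg-def _ = refl

  isCommutativeRing : IsCommutativeRing _≡_ _+_ _*_ -_ 0ℚ 1ℚ
  isCommutativeRing = ℚP.+-*-isCommutativeRing

K-ring : CommutativeRing 0ℓ 0ℓ
K-ring = record { isCommutativeRing = isCommutativeRing }

open CommutativeRing K-ring public using (+-assoc; +-comm; +-identityˡ; +-identityʳ; *-assoc; *-comm; *-identityˡ; *-identityʳ; distribˡ; distribʳ; zeroˡ; zeroʳ; -‿inverseˡ; -‿inverseʳ)

coefficients : CommutativeRing.rawRing ℚP.+-*-commutativeRing ACR.-Raw-AlmostCommutative⟶ ACR.fromCommutativeRing K-ring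
coefficients = record
  { ⟦_⟧ = id ; +-homo = +-def ; *-homo = *-def ; -‿homo = neg-def ; 0-homo = refl ; 1-homo = refl }

open Solver (CommutativeRing.rawRing ℚP.+-*-commutativeRing) (ACR.fromCommutativeRing K-ring) coefficients (λ x y → dec⇒maybe (x ℚP.≟ y)) public
  using (solve; _:+_; _:*_; :-_; _:=_; con)

-- Linear combination: the hypotheses are added up into one equation `c ≡ d` by `⊞` and `⊠`, and the
-- ring solver settles what remains. Most computations below have this shape.
lin : ∀ {a b c d : ℚ} → c ≡ d → a + d ≡ b + c → a ≡ b
lin {a} {b} {c} {d} p q =
  trans (solve 2 (λ a d → a := a :+ d :+ :- d) refl _ _)
  (trans (cong (_+ - d) q)
  (trans (cong (λ z → b + c + - z) (sym p)) (solve 2 (λ b c → b :+ c :+ :- c := b) refl _ _)))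

infixl 6 _⊞_
_⊞_ : ∀ {a b c d : ℚ} → a ≡ b → c ≡ d → a + c ≡ b + d
_⊞_ = cong₂ _+_

infixr 7 _⊠_
_⊠_ : ∀ {a b : ℚ} (k : ℚ) → a ≡ b → k * a ≡ k * b
k ⊠ p = cong (k *_) p

+0 : ∀ {a b : ℚ} → b ≡ 0ℚ → a + b ≡ a
+0 {a} p = trans (cong (a +_) p) (+-identityʳ a)

0+ : ∀ {a b : ℚ} → a ≡ 0ℚ → a + b ≡ b
0+ {b = b} p = trans (cong (_+ b) p) (+-identityˡ b)

0+0 : ∀ {a b : ℚ} → a ≡ 0ℚ → b ≡ 0ℚ → a + b ≡ 0ℚ
0+0 p q = trans (p ⊞ q) (+-identityˡ 0ℚ)

0* : ∀ {a b : ℚ} → a ≡ 0ℚ → a * b ≡ 0ℚ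
0* {b = b} p = trans (cong (_* b) p) (zeroˡ b)

*0 : ∀ {a b : ℚ} → b ≡ 0ℚ → a * b ≡ 0ℚ
*0 {a = a} p = trans (cong (a *_) p) (zeroʳ a)

+-swap : ∀ a b c d → (a + b) + (c + d) ≡ (a + c) + (b + d)
+-swap = solve 4 (λ a b c d → (a :+ b) :+ (c :+ d) := (a :+ c) :+ (b :+ d)) refl

neg0 : - 0ℚ ≡ 0ℚ
neg0 = solve 0 (:- con 0ℚ := con 0ℚ) refl

neg-injective-zero : ∀ {a} → - a ≡ 0ℚ → a ≡ 0ℚ
neg-injective-zero {a} p = trans (solve 1 (λ a → a := :- (:- a)) refl a) (trans (cong -_ p) neg0)

-- Linear functionals on finite formal combinations

module _ {B : Set} where

  ev : (B → ℚ) → List (ℚ × B) → ℚ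
  ev F [] = 0ℚ
  ev F ((c , b) ∷ p) = c * F b + ev F p

  ev-cong : ∀ {F G : B → ℚ} → (∀ b → F b ≡ G b) → ∀ p → ev F p ≡ ev G p
  ev-cong e [] = refl
  ev-cong e ((c , b) ∷ p) = (c ⊠ e b) ⊞ ev-cong e p

  ev-+ : ∀ (F G : B → ℚ) p → ev (λ b → F b + G b) p ≡ ev F p + ev G p
  ev-+ F G [] = sym (+-identityˡ 0ℚ)
  ev-+ F G ((c , b) ∷ p) = lin (ev-+ F G p)
    (solve 6 (λ c f g x y z → (c :* (f :+ g) :+ x) :+ (y :+ z) := ((c :* f :+ y) :+ (c :* g :+ z)) :+ x) refl _ _ _ _ _ _)

  ev-* : ∀ k (F : B → ℚ) p → ev (λ b → k * F b) p ≡ k * ev F p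
  ev-* k F [] = sym (zeroʳ k)
  ev-* k F ((c , b) ∷ p) = lin (ev-* k F p)
    (solve 5 (λ c f k x y → (c :* (k :* f) :+ x) :+ k :* y := k :* (c :* f :+ y) :+ x) refl _ _ _ _ _)

  ev-neg : ∀ (F : B → ℚ) p → ev (λ b → - F b) p ≡ - ev F p
  ev-neg F [] = sym neg0
  ev-neg F ((c , b) ∷ p) = lin (ev-neg F p)
    (solve 4 (λ c f x y → (c :* :- f :+ x) :+ :- y := :- (c :* f :+ y) :+ x) refl _ _ _ _)

  ev-zero : ∀ {F : B → ℚ} p → (∀ b → F b ≡ 0ℚ) → ev F p ≡ 0ℚ
  ev-zero [] e = refl
  ev-zero ((c , b) ∷ p) e = 0+0 (*0 (e b)) (ev-zero p e)

  ev-All : ∀ {P : B → Set} {F G : B → ℚ} {p} → All (P ∘ proj₂) p → (∀ b → P b → F b ≡ G b) → ev F p ≡ ev G p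
  ev-All [] e = refl
  ev-All {p = (c , b) ∷ _} (q ∷ qs) e = (c ⊠ e b q) ⊞ ev-All qs e

  ev-++ : ∀ (F : B → ℚ) p q → ev F (p ++ q) ≡ ev F p + ev F q
  ev-++ F [] q = sym (+-identityˡ _)
  ev-++ F ((c , b) ∷ p) q = trans (cong (c * F b +_) (ev-++ F p q)) (sym (+-assoc _ _ _))

  ev-single : ∀ (F : B → ℚ) b → ev F ((1ℚ , b) ∷ []) ≡ F b
  ev-single F b = trans (+-identityʳ _) (*-identityˡ _)

  ev-scale : ∀ (F : B → ℚ) c p → ev F (map (λ t → (c ℚ.* proj₁ t , proj₂ t)) p) ≡ c * ev F p
  ev-scale F c [] = sym (zeroʳ c)
  ev-scale F c ((k , b) ∷ p) = lin (ev-scale F c p)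
    (trans (cong (λ z → z * F b + _ + _) (*-def c k))
      (solve 5 (λ c f k x y → ((c :* k) :* f :+ x) :+ c :* y := c :* (k :* f :+ y) :+ x) refl _ _ _ _ _))

  -- Equality in the free vector space in dual form: all functionals agree. As a record it lets `p`
  -- and `q` be inferred.
  infix 4 _~_
  record _~_ (p q : List (ℚ × B)) : Set where
    constructor tested
    field at : ∀ F → ev F p ≡ ev F q

  open _~_ public

  ~-refl : ∀ {p} → p ~ p
  ~-refl = tested λ F → refl

  ~-sym : ∀ {p q} → p ~ q → q ~ p
  ~-sym e = tested λ F → sym (at e F)

  ~-trans : ∀ {p q r} → p ~ q → q ~ r → p ~ r
  ~-trans e e′ = tested λ F → trans (at e F) (at e′ F)

module _ {B C : Set} where

  ev-mapʳ : ∀ (F : C → ℚ) (h : B → C) p → ev F (map (λ t → (proj₁ t , h (proj₂ t))) p) ≡ ev (F ∘ h) p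
  ev-mapʳ F h [] = refl
  ev-mapʳ F h (_ ∷ p) = cong (_ +_) (ev-mapʳ F h p)

  ev-scaleMap : ∀ (F : C → ℚ) (h : B → C) c p → ev F (map (λ t → (c ℚ.* proj₁ t , h (proj₂ t))) p) ≡ c * ev (F ∘ h) p
  ev-scaleMap F h c [] = sym (zeroʳ c)
  ev-scaleMap F h c ((k , b) ∷ p) = lin (ev-scaleMap F h c p)
    (trans (cong (λ z → z * F (h b) + _ + _) (*-def c k))
      (solve 5 (λ c f k x y → ((c :* k) :* f :+ x) :+ c :* y := c :* (k :* f :+ y) :+ x) refl _ _ _ _ _))

  ev-bind : ∀ (F : C → ℚ) (g : ℚ × B → List (ℚ × C)) (G : B → ℚ) →
            (∀ c b → ev F (g (c , b)) ≡ c * G b) → ∀ p → ev F (concatMap g p) ≡ ev G p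
  ev-bind F g G e [] = refl
  ev-bind F g G e ((c , b) ∷ p) = trans (ev-++ F (g (c , b)) (concatMap g p)) (e c b ⊞ ev-bind F g G e p)

  ev-swap : ∀ (F : B → C → ℚ) p q → ev (λ b → ev (F b) q) p ≡ ev (λ c → ev (λ b → F b c) p) q
  ev-swap F [] q = sym (ev-zero q (λ _ → refl))
  ev-swap F ((k , b) ∷ p) q = trans (sym (ev-* k (F b) q) ⊞ ev-swap F p q) (sym (ev-+ _ _ q))

module Coefficients {B : Set} (_≟_ : DecidableEquality B) where

  δ : B → B → ℚ
  δ b a with a ≟ b
  ... | yes _ = 1ℚ
  ... | no _ = 0ℚ

  δ-refl : ∀ b → δ b b ≡ 1ℚ
  δ-refl b with b ≟ b
  ... | yes _ = refl
  ... | no ¬p = ⊥-elim (¬p refl)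

  δ-≢ : ∀ {a b} → a ≢ b → δ b a ≡ 0ℚ
  δ-≢ {a} {b} ne with a ≟ b
  ... | yes p = ⊥-elim (ne p)
  ... | no _ = refl

  remove : B → List (ℚ × B) → List (ℚ × B)
  remove b [] = []
  remove b ((c , a) ∷ p) with a ≟ b
  ... | yes _ = remove b p
  ... | no _ = (c , a) ∷ remove b p

  remove-length : ∀ b p → length (remove b p) ≤ length p
  remove-length b [] = z≤n
  remove-length b ((c , a) ∷ p) with a ≟ b
  ... | yes _ = ℕP.m≤n⇒m≤1+n (remove-length b p)
  ... | no _ = s≤s (remove-length b p)

  ev-remove : ∀ F b p → ev F p ≡ ev (δ b) p * F b + ev F (remove b p)
  ev-remove F b [] = solve 1 (λ f → con 0ℚ := con 0ℚ :* f :+ con 0ℚ) refl _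
  ev-remove F b ((c , a) ∷ p) with a ≟ b
  ... | yes refl = lin (ev-remove F b p) (solve 5 (λ c f e d r → (c :* f :+ e) :+ (d :* f :+ r) := ((c :* con 1ℚ :+ d) :* f :+ r) :+ e) refl _ _ _ _ _)
  ... | no _ = lin (ev-remove F b p) (solve 6 (λ c g f e d r → (c :* g :+ e) :+ (d :* f :+ r) := ((c :* con 0ℚ :+ d) :* f :+ (c :* g :+ r)) :+ e) refl _ _ _ _ _ _)

  ev-δ-remove : ∀ b x p → ev (δ x) p ≡ 0ℚ → ev (δ x) (remove b p) ≡ 0ℚ
  ev-δ-remove b x p e with b ≟ x
  ... | yes refl = go p
    where
    go : ∀ p → ev (δ b) (remove b p) ≡ 0ℚ
    go [] = refl
    go ((c , a) ∷ p) with a ≟ b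
    ... | yes _ = go p
    ... | no ne = 0+0 (*0 (δ-≢ ne)) (go p)
  ... | no ne = trans (sym (trans (ev-remove (δ x) b p) (0+ (*0 (δ-≢ ne))))) e

  -- Strike out all occurrences of the leading basis element at once: their total coefficient is
  -- zero and the remaining list is shorter. `n` bounds the length, since `remove` is not
  -- structural.
  ev-null : ∀ n p → length p ≤ n → (∀ b → ev (δ b) p ≡ 0ℚ) → ∀ F → ev F p ≡ 0ℚ
  ev-null n [] le e F = refl
  ev-null (suc n) p@((c , a) ∷ q) (s≤s le) e F = trans (ev-remove F a p)
    (0+0 (0* (e a)) (ev-null n (remove a p) (ℕP.≤-trans shorter le) (λ b → ev-δ-remove a b p (e b)) F))
    where
    shorter : length (remove a p) ≤ length q
    shorter with a ≟ a
    ... | yes _ = remove-length a q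
    ... | no ne = ⊥-elim (ne refl)

  δ-test : ∀ {p q} → (∀ b → ev (δ b) p ≡ ev (δ b) q) → p ~ q
  δ-test {p} {q} e = tested λ F → lin
    (trans (sym (ev-++ F p (map (λ t → (ℚ.- 1ℚ ℚ.* proj₁ t , proj₂ t)) q)))
           (ev-null _ (p ++ map (λ t → (ℚ.- 1ℚ ℚ.* proj₁ t , proj₂ t)) q) ℕP.≤-refl null F))
    (trans (+-identityʳ _) (trans (solve 2 (λ x y → x := y :+ (x :+ con (ℚ.- 1ℚ) :* y)) refl _ _) (cong (λ z → ev F q + (ev F p + z)) (sym (ev-scale F (ℚ.- 1ℚ) q)))))
    where
    null : ∀ b → ev (δ b) (p ++ map (λ t → (ℚ.- 1ℚ ℚ.* proj₁ t , proj₂ t)) q) ≡ 0ℚ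
    null b = trans (ev-++ (δ b) p _) (trans (cong₂ _+_ (e b) (ev-scale (δ b) (ℚ.- 1ℚ) q))
      (solve 1 (λ x → x :+ con (ℚ.- 1ℚ) :* x := con 0ℚ) refl _))

-- Congruence is a field because pointwise equal functions need not be equal.
record IsLinear {Z : Set} (L : (Z → ℚ) → ℚ) : Set where
  field
    cong-lin : ∀ {f g} → (∀ z → f z ≡ g z) → L f ≡ L g
    add : ∀ f g → L (λ z → f z + g z) ≡ L f + L g
    hom : ∀ k f → L (λ z → k * f z) ≡ k * L f

  zero-lin : ∀ {f} → (∀ z → f z ≡ 0ℚ) → L f ≡ 0ℚ
  zero-lin {f} e = trans (cong-lin (λ z → trans (e z) (sym (zeroˡ (f z))))) (trans (hom 0ℚ f) (zeroˡ (L f)))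

  neg-lin : ∀ f → L (λ z → - f z) ≡ - L f
  neg-lin f = trans (cong-lin (λ z → solve 1 (λ x → :- x := con (ℚ.- 1ℚ) :* x) refl (f z)))
    (trans (hom (ℚ.- 1ℚ) f) (solve 1 (λ x → con (ℚ.- 1ℚ) :* x := :- x) refl (L f)))

  add₃ : ∀ f g h → L (λ z → f z + g z + h z) ≡ L f + L g + L h
  add₃ f g h = trans (add _ h) (cong (_+ L h) (add f g))

  ev-lin : ∀ {B : Set} (F : Z → B → ℚ) p → L (λ z → ev (F z) p) ≡ ev (λ b → L (λ z → F z b)) p
  ev-lin F [] = zero-lin (λ _ → refl)
  ev-lin F ((c , b) ∷ p) = trans (add _ _) (hom c _ ⊞ ev-lin F p)

open IsLinear public

ev-linear : ∀ {B : Set} (p : List (ℚ × B)) → IsLinear (λ F → ev F p)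
ev-linear p = record { cong-lin = λ e → ev-cong e p ; add = λ f g → ev-+ f g p ; hom = λ k f → ev-* k f p }

-- Deconcatenation sums and transposed derivations

module _ {A : Set} where

  -- Sum of `H x y` over all factorisations w = x y: the transpose of concatenation.
  spl : (List A → List A → ℚ) → List A → ℚ
  spl H [] = H [] []
  spl H (a ∷ w) = H [] (a ∷ w) + spl (λ x y → H (a ∷ x) y) w

  spl-cong : ∀ {H G} → (∀ x y → H x y ≡ G x y) → ∀ w → spl H w ≡ spl G w
  spl-cong e [] = e [] []
  spl-cong e (a ∷ w) = e [] (a ∷ w) ⊞ spl-cong (λ x y → e (a ∷ x) y) w

  spl-+ : ∀ H G w → spl (λ x y → H x y + G x y) w ≡ spl H w + spl G w
  spl-+ H G [] = refl
  spl-+ H G (a ∷ w) = trans (refl ⊞ spl-+ _ _ w) (+-swap _ _ _ _)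

  spl-* : ∀ k H w → spl (λ x y → k * H x y) w ≡ k * spl H w
  spl-* k H [] = refl
  spl-* k H (a ∷ w) = trans (refl ⊞ spl-* k _ w) (sym (distribˡ k _ _))

  spl-zero : ∀ {H} w → (∀ x y → H x y ≡ 0ℚ) → spl H w ≡ 0ℚ
  spl-zero [] e = e [] []
  spl-zero (a ∷ w) e = 0+0 (e _ _) (spl-zero w (λ x y → e (a ∷ x) y))

  spl-linear : ∀ w → IsLinear (λ (F : List A × List A → ℚ) → spl (λ x y → F (x , y)) w)
  spl-linear w = record
    { cong-lin = λ e → spl-cong (λ x y → e (x , y)) w ; add = λ f g → spl-+ _ _ w ; hom = λ k f → spl-* k _ w }

  lin-spl : ∀ {Z : Set} {L : (Z → ℚ) → ℚ} → IsLinear L → ∀ (H : Z → List A → List A → ℚ) w →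
            L (λ z → spl (H z) w) ≡ spl (λ x y → L (λ z → H z x y)) w
  lin-spl l H [] = refl
  lin-spl l H (a ∷ w) = trans (add l _ _) (refl ⊞ lin-spl l _ w)

  ifNil : List A → ℚ → ℚ
  ifNil [] x = x
  ifNil (_ ∷ _) x = 0ℚ

  ifNil-cong : ∀ w {x y} → x ≡ y → ifNil w x ≡ ifNil w y
  ifNil-cong [] e = e
  ifNil-cong (_ ∷ _) e = refl

  spl-ifNil : ∀ (f : List A → ℚ) w → spl (λ x y → ifNil x (f y)) w ≡ f w
  spl-ifNil f [] = refl
  spl-ifNil f (a ∷ w) = +0 (spl-zero w (λ _ _ → refl))

  spl-if : ∀ (f : List A → List A → ℚ) w → spl (λ x y → ifNil x (f x y)) w ≡ f [] w
  spl-if f w = trans (spl-cong (λ { [] y → refl ; (_ ∷ _) y → refl }) w) (spl-ifNil (f []) w)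

  snoc-view : ∀ (a : A) u → ∃ λ u′ → ∃ λ i → a ∷ u ≡ u′ ∷ʳ i
  snoc-view a [] = [] , a , refl
  snoc-view a (b ∷ u) with snoc-view b u
  ... | u′ , i , e = a ∷ u′ , i , cong (a ∷_) e

  ∷ʳ≢[] : ∀ (u : List A) {i} → u ∷ʳ i ≢ []
  ∷ʳ≢[] [] ()
  ∷ʳ≢[] (_ ∷ _) ()

  ifNil-snoc : ∀ (f : A → ℚ) b v v′ j → b ∷ v ≡ v′ ∷ʳ j → ifNil v′ (f j) ≡ ifNil v (f b)
  ifNil-snoc f b [] [] j refl = refl
  ifNil-snoc f b [] (_ ∷ []) j ()
  ifNil-snoc f b [] (_ ∷ _ ∷ _) j ()
  ifNil-snoc f b (_ ∷ _) (_ ∷ _) j e = refl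

  module Transpose (π : List A → ℚ) (C : List A → (A → ℚ) → ℚ) (C-lin : ∀ w → IsLinear (C w)) where

    κ : (List A → ℚ) → List A → ℚ
    κ G = spl (λ p q → C p (λ k → G (k ∷ q)))

    -- Sum over all ways to replace a factor p of the word by a letter, with weights `C p`, or to
    -- cut off a nonempty suffix p, with weight `π p`; `κ` is the case where the replaced factor is
    -- a prefix.
    s : (List A → ℚ) → List A → ℚ
    s G [] = 0ℚ
    s G (m ∷ w) = G [] * π (m ∷ w) + κ G (m ∷ w) + s (λ w → G (m ∷ w)) w

    κ-linear : ∀ w → IsLinear (λ G → κ G w)
    κ-linear w = record
      { cong-lin = λ e → spl-cong (λ p q → cong-lin (C-lin p) (λ k → e (k ∷ q))) w
      ; add = λ f g → trans (spl-cong (λ p q → add (C-lin p) _ _) w) (spl-+ _ _ w)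
      ; hom = λ k f → trans (spl-cong (λ p q → hom (C-lin p) k _) w) (spl-* k _ w) }

    s-cong : ∀ {F G} → (∀ w → F w ≡ G w) → ∀ w → s F w ≡ s G w
    s-cong e [] = refl
    s-cong e (m ∷ w) = cong (_* π (m ∷ w)) (e []) ⊞ cong-lin (κ-linear (m ∷ w)) e ⊞ s-cong (λ w → e (m ∷ w)) w

    s-+ : ∀ F G w → s (λ w → F w + G w) w ≡ s F w + s G w
    s-+ F G [] = sym (+-identityˡ 0ℚ)
    s-+ F G (m ∷ w) = lin (add (κ-linear (m ∷ w)) F G ⊞ s-+ (λ w → F (m ∷ w)) (λ w → G (m ∷ w)) w)
      (solve 9 (λ f g p k s k₁ k₂ s₁ s₂ → (((f :+ g) :* p :+ k) :+ s) :+ ((k₁ :+ k₂) :+ (s₁ :+ s₂))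
        := ((f :* p :+ k₁ :+ s₁) :+ (g :* p :+ k₂ :+ s₂)) :+ (k :+ s)) refl _ _ _ _ _ _ _ _ _)

    s-* : ∀ k F w → s (λ w → k * F w) w ≡ k * s F w
    s-* k F [] = sym (zeroʳ k)
    s-* k F (m ∷ w) = lin (hom (κ-linear (m ∷ w)) k F ⊞ s-* k (λ w → F (m ∷ w)) w)
      (solve 7 (λ k f p x y x′ y′ → ((k :* f) :* p :+ x :+ y) :+ (k :* x′ :+ k :* y′) := k :* (f :* p :+ x′ :+ y′) :+ (x :+ y)) refl _ _ _ _ _ _ _)

    s-linear : ∀ w → IsLinear (λ G → s G w)
    s-linear w = record { cong-lin = λ e → s-cong e w ; add = λ f g → s-+ f g w ; hom = λ k f → s-* k f w }

-- Quasi-shuffle products and their coderivations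

-- Hoffman's product for a partial product of letters: undefined everywhere it is the shuffle,
-- addition of indices gives the stuffle. `st F u v` is F evaluated on the product of u and v.
module QuasiShuffle {A : Set} (_⋄_ : A → A → Maybe A)
  (⋄-comm : ∀ a b → a ⋄ b ≡ b ⋄ a)
  (⋄-assoc : ∀ a b c → ((a ⋄ b) Maybe.>>= (_⋄ c)) ≡ ((b ⋄ c) Maybe.>>= (a ⋄_))) where

  μ : A → A → (A → ℚ) → ℚ
  μ a b X = Maybe.maybe′ X 0ℚ (a ⋄ b)

  μ-lin : ∀ a b → IsLinear (μ a b)
  μ-lin a b with a ⋄ b
  ... | just c = record { cong-lin = λ e → e c ; add = λ f g → refl ; hom = λ k f → refl }
  ... | nothing = record { cong-lin = λ e → refl ; add = λ f g → sym (+-identityˡ 0ℚ) ; hom = λ k f → sym (zeroʳ k) }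

  lin-μ : ∀ {Z : Set} {L : (Z → ℚ) → ℚ} → IsLinear L → ∀ a b (X : Z → A → ℚ) →
          L (λ z → μ a b (X z)) ≡ μ a b (λ c → L (λ z → X z c))
  lin-μ l a b X with a ⋄ b
  ... | just c = refl
  ... | nothing = zero-lin l (λ _ → refl)

  μ-comm : ∀ a b X → μ a b X ≡ μ b a X
  μ-comm a b X = cong (Maybe.maybe′ X 0ℚ) (⋄-comm a b)

  μ-bind : ∀ (m : Maybe A) (f : A → Maybe A) X →
           Maybe.maybe′ (λ d → Maybe.maybe′ X 0ℚ (f d)) 0ℚ m ≡ Maybe.maybe′ X 0ℚ (m Maybe.>>= f)
  μ-bind (just _) f X = refl
  μ-bind nothing f X = refl

  μ-assoc : ∀ a b c X → μ a b (λ d → μ d c X) ≡ μ b c (λ d → μ a d X)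
  μ-assoc a b c X = trans (μ-bind (a ⋄ b) (_⋄ c) X) (trans (cong (Maybe.maybe′ X 0ℚ) (⋄-assoc a b c)) (sym (μ-bind (b ⋄ c) (a ⋄_) X)))

  st : (List A → ℚ) → List A → List A → ℚ
  st F [] v = F v
  st F (a ∷ u) [] = F (a ∷ u)
  st F (a ∷ u) (b ∷ v) = st (λ w → F (a ∷ w)) u (b ∷ v) + st (λ w → F (b ∷ w)) (a ∷ u) v
                         + μ a b (λ c → st (λ w → F (c ∷ w)) u v)

  st-[] : ∀ F u → st F u [] ≡ F u
  st-[] F [] = refl
  st-[] F (a ∷ u) = refl

  st-cong : ∀ {F G} → (∀ w → F w ≡ G w) → ∀ u v → st F u v ≡ st G u v
  st-cong e [] v = e v
  st-cong e (a ∷ u) [] = e (a ∷ u)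
  st-cong e (a ∷ u) (b ∷ v) = st-cong (λ w → e (a ∷ w)) u (b ∷ v) ⊞ st-cong (λ w → e (b ∷ w)) (a ∷ u) v
    ⊞ cong-lin (μ-lin a b) (λ c → st-cong (λ w → e (c ∷ w)) u v)

  -- any linear functional commutes with st, because st is a sum of evaluations
  lin-st : ∀ {Z : Set} {L : (Z → ℚ) → ℚ} → IsLinear L → ∀ (F : Z → List A → ℚ) u v →
           L (λ z → st (F z) u v) ≡ st (λ w → L (λ z → F z w)) u v
  lin-st l F [] v = refl
  lin-st l F (a ∷ u) [] = refl
  lin-st l F (a ∷ u) (b ∷ v) = trans (add₃ l _ _ _) (lin-st l _ u (b ∷ v) ⊞ lin-st l _ (a ∷ u) v
    ⊞ trans (lin-μ l a b _) (cong-lin (μ-lin a b) (λ c → lin-st l _ u v)))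

  private
    -- Feeding this functional on a two-point set to `lin-st` yields additivity and homogeneity of
    -- `st` in F without a further induction.
    pair-linear : ∀ x y → IsLinear (λ (f : Maybe ⊤ → ℚ) → x * f nothing + y * f (just tt))
    pair-linear x y = record
      { cong-lin = λ e → (x ⊠ e nothing) ⊞ (y ⊠ e (just tt))
      ; add = λ f g → solve 6 (λ x y a b c d → x :* (a :+ b) :+ y :* (c :+ d) := (x :* a :+ y :* c) :+ (x :* b :+ y :* d)) refl _ _ _ _ _ _
      ; hom = λ k f → solve 5 (λ x y k a b → x :* (k :* a) :+ y :* (k :* b) := k :* (x :* a :+ y :* b)) refl _ _ _ _ _ }

  st-linear : ∀ u v → IsLinear (λ F → st F u v)
  st-linear u v = record
    { cong-lin = λ e → st-cong e u v
    ; add = λ f g → trans (st-cong (λ w → sym ((*-identityˡ (f w)) ⊞ (*-identityˡ (g w)))) u v)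
        (trans (sym (lin-st (pair-linear 1ℚ 1ℚ) (λ { nothing → f ; (just _) → g }) u v)) (*-identityˡ _ ⊞ *-identityˡ _))
    ; hom = λ k f → trans (st-cong (λ w → sym (+0 (zeroˡ (f w)))) u v)
        (trans (sym (lin-st (pair-linear k 0ℚ) (λ { nothing → f ; (just _) → f }) u v)) (+0 (zeroˡ _))) }

  st-comm : ∀ F u v → st F u v ≡ st F v u
  st-comm F [] v = sym (st-[] F v)
  st-comm F (a ∷ u) [] = refl
  st-comm F (a ∷ u) (b ∷ v) = trans (cong (_+ μ a b (λ c → st (λ w → F (c ∷ w)) u v)) (+-comm _ _))
    (st-comm _ (a ∷ u) v ⊞ st-comm _ u (b ∷ v)
     ⊞ trans (cong-lin (μ-lin a b) (λ c → st-comm (λ w → F (c ∷ w)) u v)) (μ-comm a b _))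

  -- Both sides are sorted by the leading letter of the triple product, which is a, b, c or one of
  -- the contractions ab, ac, bc, abc. On the left the terms starting with c, on the right those
  -- starting with a recombine into a triple product.
  st-assoc : ∀ F u v w → st (λ x → st F x w) u v ≡ st (λ x → st F u x) v w
  st-assoc F [] v w = refl
  st-assoc F (a ∷ u) [] w = refl
  st-assoc F (a ∷ u) (b ∷ v) [] = st-cong (λ x → st-[] F x) (a ∷ u) (b ∷ v)
  st-assoc F (a ∷ u) (b ∷ v) (c ∷ w) =
    trans (expandˡ a u (b ∷ v) ⊞ expandˡ b (a ∷ u) v ⊞ trans (cong-lin (μ-lin a b) (λ d → expandˡ d u v)) (add₃ (μ-lin a b) _ _ _))
    (trans (solve 9 (λ a₁ a₂ a₃ b₁ b₂ b₃ m₁ m₂ m₃ → (a₁ :+ a₂ :+ a₃) :+ (b₁ :+ b₂ :+ b₃) :+ (m₁ :+ m₂ :+ m₃)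
       := a₁ :+ (a₂ :+ b₂ :+ m₂) :+ a₃ :+ b₁ :+ b₃ :+ m₁ :+ m₃) refl _ _ _ _ _ _ _ _ _)
    (trans (st-assoc (λ x → F (a ∷ x)) u (b ∷ v) (c ∷ w)
      ⊞ st-assoc (λ x → F (c ∷ x)) (a ∷ u) (b ∷ v) w
      ⊞ cong-lin (μ-lin a c) (λ e → st-assoc (λ x → F (e ∷ x)) u (b ∷ v) w)
      ⊞ st-assoc (λ x → F (b ∷ x)) (a ∷ u) v (c ∷ w)
      ⊞ cong-lin (μ-lin b c) (λ e → st-assoc (λ x → F (e ∷ x)) (a ∷ u) v w)
      ⊞ cong-lin (μ-lin a b) (λ e → st-assoc (λ x → F (e ∷ x)) u v (c ∷ w))
      ⊞ trans (cong-lin (μ-lin a b) (λ d → cong-lin (μ-lin d c) (λ e → st-assoc (λ x → F (e ∷ x)) u v w))) (μ-assoc a b c _))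
    (trans (solve 9 (λ r₁ r₂ r₃ r₄ r₅ r₆ r₇ r₈ r₉ → (r₁ :+ r₄ :+ r₇) :+ r₅ :+ r₆ :+ r₂ :+ r₈ :+ r₃ :+ r₉
       := (r₁ :+ r₂ :+ r₃) :+ (r₄ :+ r₅ :+ r₆) :+ (r₇ :+ r₈ :+ r₉)) refl _ _ _ _ _ _ _ _ _)
    (sym (expandʳ b v (c ∷ w) ⊞ expandʳ c (b ∷ v) w ⊞ trans (cong-lin (μ-lin b c) (λ d → expandʳ d v w)) (add₃ (μ-lin b c) _ _ _))))))
    where
    expandˡ : ∀ e x y → st (λ z → st F (e ∷ z) (c ∷ w)) x y ≡
      st (λ z → st (λ t → F (e ∷ t)) z (c ∷ w)) x y + st (λ z → st (λ t → F (c ∷ t)) (e ∷ z) w) x y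
      + μ e c (λ d → st (λ z → st (λ t → F (d ∷ t)) z w) x y)
    expandˡ e x y = trans (add₃ (st-linear x y) _ _ _) (refl ⊞ refl ⊞ lin-μ (st-linear x y) e c _)
    expandʳ : ∀ e x y → st (λ z → st F (a ∷ u) (e ∷ z)) x y ≡
      st (λ z → st (λ t → F (a ∷ t)) u (e ∷ z)) x y + st (λ z → st (λ t → F (e ∷ t)) (a ∷ u) z) x y
      + μ a e (λ d → st (λ z → st (λ t → F (d ∷ t)) u z) x y)
    expandʳ e x y = trans (add₃ (st-linear x y) _ _ _) (refl ⊞ refl ⊞ lin-μ (st-linear x y) a e _)

  -- The recursion from the last letters gives access to operators that act at the end of a word,
  -- although words are built from the front.
  st-∷ʳ : ∀ F u a v b → st F (u ∷ʳ a) (v ∷ʳ b) ≡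
    st (λ w → F (w ∷ʳ a)) u (v ∷ʳ b) + st (λ w → F (w ∷ʳ b)) (u ∷ʳ a) v + μ a b (λ c → st (λ w → F (w ∷ʳ c)) u v)
  st-∷ʳ F [] a [] b = cong (_+ μ a b (λ c → F (c ∷ []))) (+-comm _ _)
  st-∷ʳ F [] a (b′ ∷ v) b = lin (st-∷ʳ (λ w → F (b′ ∷ w)) [] a v b)
    (solve 6 (λ x l m p q r → (x :+ l :+ m) :+ (p :+ q :+ r) := (p :+ (x :+ q :+ m) :+ r) :+ l) refl _ _ _ _ _ _)
  st-∷ʳ F (a′ ∷ u) a [] b = lin (st-∷ʳ (λ w → F (a′ ∷ w)) u a [] b
      ⊞ st-[] (λ w → F (a′ ∷ w ∷ʳ b)) (u ∷ʳ a) ⊞ cong-lin (μ-lin a b) (λ c → st-[] (λ w → F (a′ ∷ w ∷ʳ c)) u)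
      ⊞ cong-lin (μ-lin a′ b) (λ c → trans (st-[] (λ w → F (c ∷ w)) (u ∷ʳ a)) (sym (st-[] (λ w → F (c ∷ w ∷ʳ a)) u))))
    (solve 9 (λ l x m p m′ q′ r′ q r → (l :+ x :+ m) :+ ((p :+ q :+ r) :+ q′ :+ r′ :+ m′) := ((p :+ x :+ m′) :+ q′ :+ r′) :+ (l :+ q :+ r :+ m)) refl _ _ _ _ _ _ _ _ _)
  st-∷ʳ F (a′ ∷ u) a (b′ ∷ v) b = trans
    (st-∷ʳ (λ w → F (a′ ∷ w)) u a (b′ ∷ v) b ⊞ st-∷ʳ (λ w → F (b′ ∷ w)) (a′ ∷ u) a v b
      ⊞ trans (cong-lin (μ-lin a′ b′) (λ c → st-∷ʳ (λ w → F (c ∷ w)) u a v b)) (add₃ (μ-lin a′ b′) _ _ _))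
    (trans (solve 9 (λ a₁ a₂ a₃ b₁ b₂ b₃ m₁ m₂ m₃ → (a₁ :+ a₂ :+ a₃) :+ (b₁ :+ b₂ :+ b₃) :+ (m₁ :+ m₂ :+ m₃)
       := (a₁ :+ b₁ :+ m₁) :+ (a₂ :+ b₂ :+ m₂) :+ (a₃ :+ b₃ :+ m₃)) refl _ _ _ _ _ _ _ _ _)
    (refl ⊞ refl ⊞ sym (trans (add₃ (μ-lin a b) _ _ _) (refl ⊞ refl ⊞ lin-μ (μ-lin a b) a′ b′ _))))

  -- Deconcatenation is an algebra map for the quasi-shuffle product: the bialgebra axiom in
  -- transposed form.
  st-spl : ∀ H u v → st (spl H) u v ≡ spl (λ u₁ u₂ → spl (λ v₁ v₂ → st (λ a → st (H a) u₂ v₂) u₁ v₁) v) u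
  st-spl H [] v = refl
  st-spl H (a ∷ u) [] = refl ⊞ spl-cong (λ u₁ u₂ → sym (st-[] _ u₂)) u
  st-spl H (a ∷ u) (b ∷ v) =
    trans (add (st-linear u (b ∷ v)) _ _ ⊞ add (st-linear (a ∷ u) v) _ _ ⊞
           trans (cong-lin (μ-lin a b) (λ c → add (st-linear u v) _ _)) (add (μ-lin a b) _ _))
    (trans (solve 6 (λ x y z p q r → (x :+ p) :+ (y :+ q) :+ (z :+ r) := (x :+ y :+ z) :+ (p :+ q :+ r)) refl _ _ _ _ _ _)
    (trans (refl ⊞ (st-spl (λ x → H (a ∷ x)) u (b ∷ v) ⊞ st-spl (λ x → H (b ∷ x)) (a ∷ u) v
             ⊞ trans (cong-lin (μ-lin a b) (λ c → st-spl (λ x → H (c ∷ x)) u v))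
                 (trans (lin-spl (μ-lin a b) _ u) (spl-cong (λ u₁ u₂ → lin-spl (μ-lin a b) _ v) u))))
    (trans (solve 5 (λ x i j k m → x :+ (i :+ (j :+ k) :+ m) := (x :+ j) :+ (i :+ k :+ m)) refl _ _ _ _ _)
    (refl ⊞ sym split))))
    where
    split : spl (λ u₁ u₂ → spl (λ v₁ v₂ → st (λ x → st (H x) u₂ v₂) (a ∷ u₁) v₁) (b ∷ v)) u ≡ _
    split = trans
      (spl-cong (λ u₁ u₂ → trans (sym (st-[] (λ x → st (H (a ∷ x)) u₂ (b ∷ v)) u₁) ⊞ trans (spl-+ _ _ v) (spl-+ _ _ v ⊞ refl))
        (solve 4 (λ p x y z → p :+ (x :+ y :+ z) := (p :+ x) :+ y :+ z) refl _ _ _ _)) u)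
      (trans (spl-+ _ _ u) (spl-+ _ _ u ⊞ refl))

  -- Infinitesimal characters, dually the primitive series.
  Kills : (List A → ℚ) → Set
  Kills P = P [] ≡ 0ℚ × (∀ a u b v → st P (a ∷ u) (b ∷ v) ≡ 0ℚ)

  kills-≢ : ∀ P → Kills P → ∀ u v → u ≢ [] → v ≢ [] → st P u v ≡ 0ℚ
  kills-≢ P k [] v u≢ v≢ = ⊥-elim (u≢ refl)
  kills-≢ P k (a ∷ u) [] u≢ v≢ = ⊥-elim (v≢ refl)
  kills-≢ P k (a ∷ u) (b ∷ v) u≢ v≢ = proj₂ k a u b v

  -- A derivation of the concatenation algebra sending the unit to π and a letter k to
  -- Σ_w C w k · w is a coderivation as soon as π and the images of the letters satisfy the
  -- coproduct formula; everything is phrased by the transposed operator on words.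
  module Coderivation (π : List A → ℚ) (C : List A → (A → ℚ) → ℚ)
    (π-st : ∀ a u b v → st π (a ∷ u) (b ∷ v) ≡ 0ℚ)
    (C-[] : ∀ X → C [] X ≡ 0ℚ)
    (C-lin : ∀ w → IsLinear (C w))
    (C-st : ∀ a u b v X → st (λ w → C w X) (a ∷ u) (b ∷ v) ≡
            ifNil v (C (a ∷ u) (λ k → μ k b X)) + ifNil u (C (b ∷ v) (λ k → μ k a X))) where

    open Transpose π C C-lin public

    private
      κ-expand : ∀ G u b v → κ (λ x → st G x (b ∷ v)) u ≡
        spl (λ p q → C p (λ k → st (λ w → G (k ∷ w)) q (b ∷ v))) u + κ (λ x → st (λ w → G (b ∷ w)) x v) u
        + spl (λ p q → C p (λ k → μ k b (λ c → st (λ w → G (c ∷ w)) q v))) u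
      κ-expand G u b v = trans (spl-cong (λ p q → add₃ (C-lin p) _ _ _) u) (trans (spl-+ _ _ u) (spl-+ _ _ u ⊞ refl))

      -- By `st-spl` a prefix of the product is a product of prefixes. If both are nonempty, `C-st`
      -- leaves only the case where one of them is a single letter, and this is the contraction term
      -- of the unfolded product.
      κ-st : ∀ G a u b v → st (κ G) (a ∷ u) (b ∷ v) + κ (λ x → st (λ w → G (b ∷ w)) x v) (a ∷ u)
                             + κ (λ y → st (λ w → G (a ∷ w)) u y) (b ∷ v)
                           ≡ κ (λ x → st G x (b ∷ v)) (a ∷ u) + κ (λ y → st G (a ∷ u) y) (b ∷ v)
      κ-st G a u b v = lin
        (trans (st-spl (λ p q → C p (λ k → G (k ∷ q))) (a ∷ u) (b ∷ v)) (trans (spl-cong (λ u₁ u₂ → spl-cong (λ v₁ v₂ →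
            st-cong (λ p → sym (lin-st (C-lin p) (λ k w → G (k ∷ w)) u₂ v₂)) u₁ v₁) (b ∷ v)) (a ∷ u))
          (refl ⊞ trans (spl-cong (λ u₁ u₂ → refl ⊞ trans (spl-cong (λ v₁ v₂ → C-st a u₁ b v₁ _) v)
             (trans (spl-+ _ _ v) (spl-if _ v ⊞ merge u₁ u₂))) u)
             (trans (spl-+ _ _ u) (refl ⊞ trans (spl-+ _ _ u) (refl ⊞ spl-if _ u)))))
        ⊞ sym (κ-expand G (a ∷ u) b v) ⊞ sym symmetric
        ⊞ sym (C-[] (λ k → st (λ w → G (k ∷ w)) (a ∷ u) (b ∷ v))) ⊞ sym (C-[] (λ k → μ k b (λ c → st (λ w → G (c ∷ w)) (a ∷ u) v)))
        ⊞ sym (C-[] (λ k → μ k a (λ c → st (λ w → G (c ∷ w)) u (b ∷ v)))))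
        (solve 12 (λ L x y t₁ t₂ t₃ t₄ c₁ c₂ c₃ k₁ k₂ →
           (L :+ x :+ y) :+ (t₁ :+ (t₂ :+ (t₃ :+ t₄)) :+ k₁ :+ k₂ :+ c₁ :+ c₂ :+ c₃)
           := (k₁ :+ k₂) :+ (L :+ (c₁ :+ t₂ :+ x :+ (c₂ :+ t₃)) :+ (t₁ :+ y :+ (c₃ :+ t₄)) :+ con 0ℚ :+ con 0ℚ :+ con 0ℚ))
           refl _ _ _ _ _ _ _ _ _ _ _ _)
        where
        X : List A → List A → A → ℚ
        X p q k = st (λ w → G (k ∷ w)) p q
        merge : ∀ u₁ u₂ → spl (λ v₁ v₂ → ifNil u₁ (C (b ∷ v₁) (λ k → μ k a (X u₂ v₂)))) v
                          ≡ ifNil u₁ (spl (λ v₁ v₂ → C (b ∷ v₁) (λ k → μ k a (X u₂ v₂))) v)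
        merge [] u₂ = refl
        merge (_ ∷ _) u₂ = spl-zero v (λ _ _ → refl)
        symmetric : κ (λ y → st G (a ∷ u) y) (b ∷ v) ≡
          spl (λ p q → C p (λ k → st (λ w → G (k ∷ w)) (a ∷ u) q)) (b ∷ v)
          + κ (λ y → st (λ w → G (a ∷ w)) u y) (b ∷ v)
          + spl (λ p q → C p (λ k → μ k a (λ c → st (λ w → G (c ∷ w)) u q))) (b ∷ v)
        symmetric = trans
          (spl-cong {G = λ p q → t₁ p q + t₂ p q + t₃ p q} (λ p q → trans
            (cong-lin (C-lin p) (λ k → trans (refl ⊞ μ-comm a k (λ c → st (λ w → G (c ∷ w)) u q)) (+-comm _ _ ⊞ refl)))
            (add₃ (C-lin p) _ _ _)) (b ∷ v))
          (trans (spl-+ (λ p q → t₁ p q + t₂ p q) t₃ (b ∷ v)) (spl-+ t₁ t₂ (b ∷ v) ⊞ refl))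
          where
          t₁ t₂ t₃ : List A → List A → ℚ
          t₁ p q = C p (λ k → st (λ w → G (k ∷ w)) (a ∷ u) q)
          t₂ p q = C p (λ k → st (λ w → G (a ∷ w)) u (k ∷ q))
          t₃ p q = C p (λ k → μ k a (λ c → st (λ w → G (c ∷ w)) u q))

    -- The transposed operator is a derivation of the product. `κ-st` treats the replacement of a
    -- prefix, the cut of the whole word drops out because `π` kills products, and the rest is the
    -- induction hypothesis.
    s-st : ∀ G u v → st (s G) u v ≡ s (λ x → st G x v) u + s (λ y → st G u y) v
    s-st G [] v = sym (+-identityˡ _)
    s-st G (a ∷ u) [] = sym (+0 refl)
    s-st G (a ∷ u) (b ∷ v) = lin
      (trans (trans (st-cong {F = s G} {G = λ w → G [] * π w + κ G w + s′ w} expand (a ∷ u) (b ∷ v)) (add₃ (st-linear (a ∷ u) (b ∷ v)) (λ w → G [] * π w) (κ G) s′))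
        (trans (hom (st-linear (a ∷ u) (b ∷ v)) (G []) π) (*0 (π-st a u b v)) ⊞ refl ⊞ refl)
       ⊞ κ-st G a u b v
       ⊞ s-st (λ w → G (a ∷ w)) u (b ∷ v) ⊞ s-st (λ w → G (b ∷ w)) (a ∷ u) v
       ⊞ trans (cong-lin (μ-lin a b) (λ c → s-st (λ w → G (c ∷ w)) u v)) (add (μ-lin a b) _ _)
       ⊞ sym (trans (add₃ (s-linear u) (λ x → st (λ w → G (a ∷ w)) x (b ∷ v)) (λ x → st (λ w → G (b ∷ w)) (a ∷ x) v) _)
           (refl ⊞ refl ⊞ lin-μ (s-linear u) a b (λ x c → st (λ w → G (c ∷ w)) x v)))
       ⊞ sym (trans (add₃ (s-linear v) (λ y → st (λ w → G (a ∷ w)) u (b ∷ y)) (λ y → st (λ w → G (b ∷ w)) (a ∷ u) y) _)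
           (refl ⊞ refl ⊞ lin-μ (s-linear v) a b (λ y c → st (λ w → G (c ∷ w)) u y)))
       ⊞ cong (_* π (b ∷ v)) (st-[] (λ w → G (a ∷ w)) u))
      (solve 22 (λ L K A₁ A₂ A₃ k₁ k₂ p₁ gu′ gu πV y r₁ gv πU x r₂ q₂ p₃ q₃ W₁ W₂ →
         L :+ (con 0ℚ :+ K :+ (A₁ :+ A₂ :+ A₃) :+ (k₁ :+ k₂) :+ (p₁ :+ (gu′ :* πV :+ y :+ r₁)) :+ ((gv :* πU :+ x :+ r₂) :+ q₂)
               :+ (p₃ :+ q₃) :+ W₁ :+ W₂ :+ gu :* πV)
         := ((gv :* πU :+ k₁ :+ W₁) :+ (gu :* πV :+ k₂ :+ W₂))
            :+ (L :+ (K :+ x :+ y) :+ A₁ :+ A₂ :+ A₃ :+ (p₁ :+ r₂ :+ p₃) :+ (r₁ :+ q₂ :+ q₃) :+ gu′ :* πV))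
         refl _ _ _ _ _ _ _ _ _ _ _ _ _ _ _ _ _ _ _ _ _ _)
      where
      s′ : List A → ℚ
      -- `s` is zero on the empty word by definition; this value makes the expansion hold there too,
      -- so that it can be pushed through `st`.
      s′ [] = - (G [] * π [] + κ G [])
      s′ (m ∷ w) = s (λ w → G (m ∷ w)) w
      expand : ∀ w → s G w ≡ G [] * π w + κ G w + s′ w
      expand [] = sym (-‿inverseʳ _)
      expand (m ∷ w) = refl

-- The stuffle coderivation attached to a primitive series

module _ {A : Set} where

  rl : (List A → A → ℚ) → List A → ℚ
  rl H [] = 0ℚ
  rl H (m ∷ []) = H [] m
  rl H (m ∷ w@(_ ∷ _)) = rl (λ a → H (m ∷ a)) w

  rl-∷ʳ : ∀ H w m → rl H (w ∷ʳ m) ≡ H w m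
  rl-∷ʳ H [] m = refl
  rl-∷ʳ H (x ∷ []) m = refl
  rl-∷ʳ H (x ∷ y ∷ w) m = rl-∷ʳ (λ a → H (x ∷ a)) (y ∷ w) m

  rl-cong : ∀ {H G} → (∀ a m → H a m ≡ G a m) → ∀ w → rl H w ≡ rl G w
  rl-cong e [] = refl
  rl-cong e (m ∷ []) = e [] m
  rl-cong e (m ∷ w@(_ ∷ _)) = rl-cong (λ a → e (m ∷ a)) w

  rl-+ : ∀ H G w → rl (λ a m → H a m + G a m) w ≡ rl H w + rl G w
  rl-+ H G [] = sym (+-identityˡ 0ℚ)
  rl-+ H G (m ∷ []) = refl
  rl-+ H G (m ∷ w@(_ ∷ _)) = rl-+ _ _ w

  rl-* : ∀ k H w → rl (λ a m → k * H a m) w ≡ k * rl H w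
  rl-* k H [] = sym (zeroʳ k)
  rl-* k H (m ∷ []) = refl
  rl-* k H (m ∷ w@(_ ∷ _)) = rl-* k _ w

  lf : (A → List A → ℚ) → List A → ℚ
  lf H [] = 0ℚ
  lf H (m ∷ a) = H m a

-- Cauchy product in degree m.
conv : (ℕ → ℚ) → (ℕ → ℚ) → ℕ → ℚ
conv f X zero = f 0 * X 0
conv f X (suc m) = f (suc m) * X 0 + conv f (λ n → X (suc n)) m

conv-cong : ∀ {f g} X m → (∀ i → f i ≡ g i) → conv f X m ≡ conv g X m
conv-cong X zero e = cong (_* X 0) (e 0)
conv-cong X (suc m) e = cong (_* X 0) (e (suc m)) ⊞ conv-cong _ m e

conv-congʳ : ∀ f {X Y} m → (∀ i → X i ≡ Y i) → conv f X m ≡ conv f Y m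
conv-congʳ f zero e = cong (f 0 *_) (e 0)
conv-congʳ f (suc m) e = cong (f (suc m) *_) (e 0) ⊞ conv-congʳ f m (e ∘ suc)

conv-zero : ∀ {f} X m → (∀ i → f i ≡ 0ℚ) → conv f X m ≡ 0ℚ
conv-zero X zero e = 0* (e 0)
conv-zero X (suc m) e = 0+0 (0* (e (suc m))) (conv-zero _ m e)

conv-zeroʳ : ∀ f {X} m → (∀ i → X i ≡ 0ℚ) → conv f X m ≡ 0ℚ
conv-zeroʳ f zero e = *0 (e 0)
conv-zeroʳ f (suc m) e = 0+0 (*0 (e 0)) (conv-zeroʳ f m (e ∘ suc))

conv-+ : ∀ f g X m → conv (λ i → f i + g i) X m ≡ conv f X m + conv g X m
conv-+ f g X zero = distribʳ _ _ _
conv-+ f g X (suc m) = trans (distribʳ _ _ _ ⊞ conv-+ f g _ m) (+-swap _ _ _ _)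

conv-linear : ∀ f m → IsLinear (λ X → conv f X m)
conv-linear f m = record { cong-lin = conv-congʳ f m ; add = λ X Y → additive X Y m ; hom = λ k X → homogeneous k X m }
  where
  additive : ∀ X Y m → conv f (λ n → X n + Y n) m ≡ conv f X m + conv f Y m
  additive X Y zero = distribˡ _ _ _
  additive X Y (suc m) = trans (distribˡ _ _ _ ⊞ additive _ _ m) (+-swap _ _ _ _)
  homogeneous : ∀ k X m → conv f (λ n → k * X n) m ≡ k * conv f X m
  homogeneous k X zero = solve 3 (λ f k x → f :* (k :* x) := k :* (f :* x)) refl _ _ _
  homogeneous k X (suc m) = trans (refl ⊞ homogeneous k _ m) (solve 4 (λ f k x y → f :* (k :* x) :+ k :* y := k :* (f :* x :+ y)) refl _ _ _ _)

lin-conv : ∀ {Z : Set} {L : (Z → ℚ) → ℚ} → IsLinear L → ∀ (f : Z → ℕ → ℚ) X m →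
           L (λ z → conv (f z) X m) ≡ conv (λ i → L (λ z → f z i)) X m
lin-conv {L = L} l f X m = go m X
  where
  scaleʳ : ∀ g x → L (λ z → g z * x) ≡ L g * x
  scaleʳ g x = trans (cong-lin l (λ z → *-comm _ _)) (trans (hom l x g) (*-comm _ _))
  go : ∀ m X → L (λ z → conv (f z) X m) ≡ conv (λ i → L (λ z → f z i)) X m
  go zero X = scaleʳ _ _
  go (suc m) X = trans (add l _ _) (scaleʳ _ _ ⊞ go m _)

conv-split : ∀ f X j i → conv f X (suc (j ℕ.+ i)) ≡ conv (λ k → f (suc (k ℕ.+ i))) X j + conv f (λ n → X (suc (j ℕ.+ n))) i
conv-split f X zero i = refl
conv-split f X (suc j) i = trans (refl ⊞ conv-split f _ j i) (sym (+-assoc _ _ _))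

δ₀ : ℕ → ℚ
δ₀ zero = 1ℚ
δ₀ (suc _) = 0ℚ

conv-δ₀ : ∀ f m → conv f δ₀ m ≡ f m
conv-δ₀ f zero = *-identityʳ _
conv-δ₀ f (suc m) = trans (+0 (conv-zeroʳ f m (λ _ → refl))) (*-identityʳ _)

module Sh = QuasiShuffle {Letter} (λ _ _ → nothing) (λ _ _ → refl) (λ _ _ _ → refl)
open Sh public using () renaming (st to sh)

-- The letter k stands for y_{k+1}, so y_{i+1} and y_{j+1} contract to the letter i + j + 1.
module St = QuasiShuffle {ℕ} (λ i j → just (suc (i ℕ.+ j))) (λ i j → cong (just ∘ suc) (ℕP.+-comm i j))
  (λ i j k → cong (just ∘ suc) (trans (cong suc (ℕP.+-assoc i j k)) (sym (ℕP.+-suc i (j ℕ.+ k)))))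
open St public using (st)

-- In the intended case `P k a` and `Q k a` are the corrected coefficients of ψ at ι(a) x₀^k and at
-- x₀^k x₁ ι(a) without its final x₁. The derivation x₀ ↦ [ψ , x₀], x₁ ↦ 0 telescopes on y_{j+1} =
-- x₀^j x₁ to ψ x₀^j x₁ - x₀^j ψ x₁; the two terms are `R` and `L`.
module StuffleCoderivation (P Q : ℕ → List ℕ → ℚ) (P-kills : ∀ k → St.Kills (P k)) (Q-kills : ∀ k → St.Kills (Q k))
  (P-last≡Q-first : ∀ w → rl (λ a m → P m a) w ≡ lf (λ m a → Q m a) w)
  (P≡Q-letter : ∀ k i → P k (i ∷ []) ≡ Q k (i ∷ [])) where

  R L C : List ℕ → (ℕ → ℚ) → ℚ
  R w X = rl (λ a m → conv (λ k → P k a) X m) w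
  L w X = lf (λ m a → conv (λ k → Q k a) X m) w
  C w X = R w X + - L w X

  private
    module Core (P : ℕ → List ℕ → ℚ) (kills : ∀ k → St.Kills (P k)) (X : ℕ → ℚ) where
      cv : List ℕ → List ℕ → ℕ → ℚ
      cv u v = conv (λ k → st (P k) u v) X

      lower : List ℕ → ℕ → List ℕ → ℕ → ℚ
      lower U i u = conv (λ k → P k U + P (suc (k ℕ.+ i)) u) X

      upper : List ℕ → ℕ → ℕ → ℚ
      upper u j = conv (λ k → P k u) (λ n → X (suc (j ℕ.+ n)))

      join : ∀ U i u j → conv (λ k → P k U) X j + conv (λ k → P k u) X (suc (j ℕ.+ i)) ≡ lower U i u j + upper u j i
      join U i u j = trans (cong (conv (λ k → P k U) X j +_) (conv-split (λ k → P k u) X j i))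
        (trans (sym (+-assoc _ _ _)) (cong (_+ upper u j i) (sym (conv-+ (λ k → P k U) (λ k → P (suc (k ℕ.+ i)) u) X j))))

      -- Each `P k` kills products of nonempty words, so only an empty u or v contributes; there the
      -- contracted index i + j + 1 is divided by `conv-split`.
      core : ∀ u U i v V j → U ≢ [] → V ≢ [] →
        cv u V i + cv U v j + cv u v (suc (i ℕ.+ j)) ≡ ifNil v (lower U i u j + upper u j i) + ifNil u (lower V j v i + upper v i j)
      core [] U i [] V j _ _ = lin
        (conv-zero X (suc (i ℕ.+ j)) (λ k → proj₁ (kills k))
         ⊞ sym (conv-zero (λ n → X (suc (j ℕ.+ n))) i (λ k → proj₁ (kills k)))
         ⊞ sym (conv-zero (λ n → X (suc (i ℕ.+ n))) j (λ k → proj₁ (kills k)))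
         ⊞ conv-cong X j (λ k → trans (St.st-[] (P k) U) (sym (+0 (proj₁ (kills (suc (k ℕ.+ i)))))))
         ⊞ conv-cong X i (λ k → sym (+0 {P k V} (proj₁ (kills (suc (k ℕ.+ j)))))))
        (solve 7 (λ a b c d e f g → (a :+ b :+ c) :+ (con 0ℚ :+ d :+ e :+ f :+ g)
          := ((f :+ d) :+ (g :+ e)) :+ (c :+ con 0ℚ :+ con 0ℚ :+ b :+ a)) refl _ _ _ _ _ _ _)
      core u@(_ ∷ _) U i [] V j _ V≢ = trans
        (0+ (conv-zero X i (λ k → St.kills-≢ (P k) (kills k) u V (λ ()) V≢)) ⊞
          trans (conv-cong X (suc (i ℕ.+ j)) (λ k → St.st-[] (P k) u)) (cong (λ m → conv (λ k → P k u) X (suc m)) (ℕP.+-comm i j)))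
        (trans (conv-cong X j (λ k → St.st-[] (P k) U) ⊞ refl) (trans (join U i u j) (sym (+-identityʳ _))))
      core [] U i v@(_ ∷ _) V j U≢ _ = trans
        (cong (_+ cv [] v (suc (i ℕ.+ j))) (+0 (conv-zero X j (λ k → St.kills-≢ (P k) (kills k) U v U≢ (λ ())))))
        (trans (join V j v i) (sym (+-identityˡ _)))
      core u@(_ ∷ _) U i v@(_ ∷ _) V j U≢ V≢ = trans
        (0+0 (0+0 (conv-zero X i (λ k → St.kills-≢ (P k) (kills k) u V (λ ()) V≢)) (conv-zero X j (λ k → St.kills-≢ (P k) (kills k) U v U≢ (λ ()))))
          (conv-zero X (suc (i ℕ.+ j)) (λ k → St.kills-≢ (P k) (kills k) u v (λ ()) (λ ())))) (sym (+-identityˡ 0ℚ))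

    open Core

    -- Boundary weights. Multiplication by y_{b+1} raises letter indices by b + 1; these are the
    -- weights of the results with index at most b, as if they came from letters with negative index
    -- -1-k.
    R⁻ L⁻ : ℕ → List ℕ → ℚ
    R⁻ k w = P k w + rl (λ a m → P (suc (k ℕ.+ m)) a) w
    L⁻ k w = Q k w + lf (λ m a → Q (suc (k ℕ.+ m)) a) w

    shift : ℕ → (ℕ → ℚ) → ℕ → ℚ
    shift j X n = X (suc (j ℕ.+ n))

    R-st : ∀ a u b v X → st (λ w → R w X) (a ∷ u) (b ∷ v) ≡
      ifNil v (conv (λ k → R⁻ k (a ∷ u)) X b + R (a ∷ u) (shift b X))
      + ifNil u (conv (λ k → R⁻ k (b ∷ v)) X a + R (b ∷ v) (shift a X))
    R-st a u b v X with snoc-view a u | snoc-view b v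
    ... | u′ , i , e | v′ , j , e′ = trans (cong₂ (st (λ w → R w X)) e e′)
      (trans (St.st-∷ʳ (λ w → R w X) u′ i v′ j)
      (trans (unfold u′ (v′ ∷ʳ j) i ⊞ unfold (u′ ∷ʳ i) v′ j ⊞ unfold u′ v′ (suc (i ℕ.+ j)))
      (trans (core P P-kills X u′ (u′ ∷ʳ i) i v′ (v′ ∷ʳ j) j (∷ʳ≢[] u′) (∷ʳ≢[] v′))
      (trans (ifNil-cong v′ (conv-cong X j (λ k → refl ⊞ sym (rl-∷ʳ _ u′ i)) ⊞ sym (rl-∷ʳ _ u′ i))
              ⊞ ifNil-cong u′ (conv-cong X i (λ k → refl ⊞ sym (rl-∷ʳ _ v′ j)) ⊞ sym (rl-∷ʳ _ v′ j)))
      (trans (ifNil-snoc (λ j → conv (λ k → R⁻ k (u′ ∷ʳ i)) X j + R (u′ ∷ʳ i) (shift j X)) b v v′ j e′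
             ⊞ ifNil-snoc (λ i → conv (λ k → R⁻ k (v′ ∷ʳ j)) X i + R (v′ ∷ʳ j) (shift i X)) a u u′ i e)
      (cong₂ (λ U V → ifNil v (conv (λ k → R⁻ k U) X b + R U (shift b X)) + ifNil u (conv (λ k → R⁻ k V) X a + R V (shift a X))) (sym e) (sym e′)))))))
      where
      unfold : ∀ x y m → st (λ w → R (w ∷ʳ m) X) x y ≡ conv (λ k → st (P k) x y) X m
      unfold x y m = trans (St.st-cong (λ w → rl-∷ʳ _ w m) x y) (lin-conv (St.st-linear x y) (λ w k → P k w) X m)

    L-st : ∀ a u b v X → st (λ w → L w X) (a ∷ u) (b ∷ v) ≡
      ifNil v (conv (λ k → L⁻ k (a ∷ u)) X b + L (a ∷ u) (shift b X))
      + ifNil u (conv (λ k → L⁻ k (b ∷ v)) X a + L (b ∷ v) (shift a X))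
    L-st a u b v X = trans
      (lin-conv (St.st-linear u (b ∷ v)) (λ w k → Q k w) X a ⊞ lin-conv (St.st-linear (a ∷ u) v) (λ w k → Q k w) X b
        ⊞ lin-conv (St.st-linear u v) (λ w k → Q k w) X (suc (a ℕ.+ b)))
      (core Q Q-kills X u (a ∷ u) a v (b ∷ v) b (λ ()) (λ ()))

    -- Multiply the word by the single letter k and test against the letter 0 alone: for this test
    -- `R` and `L` agree by `P-last≡Q-first`, and the boundary weight is what remains. For a
    -- one-letter word a second boundary term would interfere, so there `P≡Q-letter` is used.
    R⁻≡L⁻ : ∀ k a u → R⁻ k (a ∷ u) ≡ L⁻ k (a ∷ u)
    R⁻≡L⁻ k a [] = P≡Q-letter k a ⊞ trans (proj₁ (P-kills (suc (k ℕ.+ a)))) (sym (proj₁ (Q-kills (suc (k ℕ.+ a)))))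
    R⁻≡L⁻ k a (a′ ∷ u) = trans (sym (project R⁻ (R (a ∷ a′ ∷ u) (shift k δ₀)) (R-shift-δ₀ (a ∷ a′ ∷ u))))
      (trans (sym (R-st a (a′ ∷ u) k [] δ₀)) (trans (St.st-cong R≡L (a ∷ a′ ∷ u) (k ∷ []))
        (trans (L-st a (a′ ∷ u) k [] δ₀) (project L⁻ (L (a ∷ a′ ∷ u) (shift k δ₀)) (conv-zeroʳ (λ n → Q n (a′ ∷ u)) a (λ _ → refl))))))
      where
      R≡L : ∀ w → R w δ₀ ≡ L w δ₀
      R≡L w = trans (rl-cong (λ x m → conv-δ₀ (λ n → P n x) m) w) (trans (P-last≡Q-first w) (lemma w))
        where
        lemma : ∀ w → lf (λ m x → Q m x) w ≡ L w δ₀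
        lemma [] = refl
        lemma (m ∷ x) = sym (conv-δ₀ (λ n → Q n x) m)
      R-shift-δ₀ : ∀ w → R w (shift k δ₀) ≡ 0ℚ
      R-shift-δ₀ w = trans (rl-cong {G = λ _ _ → 0ℚ * 0ℚ} (λ x m → trans (conv-zeroʳ (λ n → P n x) m (λ _ → refl)) (sym (zeroˡ 0ℚ))) w)
        (trans (rl-* 0ℚ (λ _ _ → 0ℚ) w) (zeroˡ _))
      project : ∀ (S : ℕ → List ℕ → ℚ) x → x ≡ 0ℚ → conv (λ n → S n (a ∷ a′ ∷ u)) δ₀ k + x + 0ℚ ≡ S k (a ∷ a′ ∷ u)
      project S x z = trans (+-identityʳ _) (trans (+0 z) (conv-δ₀ (λ n → S n (a ∷ a′ ∷ u)) k))

  C-linear : ∀ w → IsLinear (C w)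
  C-linear w = record
    { cong-lin = λ e → rl-cong (λ a m → conv-congʳ _ m e) w ⊞ cong -_ (L-cong w e)
    ; add = λ X Y → trans (trans (rl-cong (λ a m → add (conv-linear _ m) X Y) w) (rl-+ _ _ w) ⊞ cong -_ (L-add w X Y))
        (solve 4 (λ a b c d → (a :+ b) :+ :- (c :+ d) := (a :+ :- c) :+ (b :+ :- d)) refl _ _ _ _)
    ; hom = λ k X → trans (trans (rl-cong (λ a m → hom (conv-linear _ m) k X) w) (rl-* k _ w) ⊞ cong -_ (L-hom w k X))
        (solve 3 (λ k a b → k :* a :+ :- (k :* b) := k :* (a :+ :- b)) refl _ _ _) }
    where
    L-cong : ∀ w {X Y} → (∀ n → X n ≡ Y n) → L w X ≡ L w Y
    L-cong [] e = refl
    L-cong (m ∷ a) e = conv-congʳ _ m e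
    L-add : ∀ w X Y → L w (λ n → X n + Y n) ≡ L w X + L w Y
    L-add [] X Y = sym (+-identityˡ 0ℚ)
    L-add (m ∷ a) X Y = add (conv-linear _ m) X Y
    L-hom : ∀ w k X → L w (λ n → k * X n) ≡ k * L w X
    L-hom [] k X = sym (zeroʳ k)
    L-hom (m ∷ a) k X = hom (conv-linear _ m) k X

  C-[] : ∀ X → C [] X ≡ 0ℚ
  C-[] X = -‿inverseʳ 0ℚ

  C-st : ∀ a u b v X → st (λ w → C w X) (a ∷ u) (b ∷ v) ≡
         ifNil v (C (a ∷ u) (λ k → X (suc (k ℕ.+ b)))) + ifNil u (C (b ∷ v) (λ k → X (suc (k ℕ.+ a))))
  C-st a u b v X = trans (add (St.st-linear (a ∷ u) (b ∷ v)) (λ w → R w X) (λ w → - L w X))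
    (trans (R-st a u b v X ⊞ trans (neg-lin (St.st-linear (a ∷ u) (b ∷ v)) (λ w → L w X)) (cong -_ (L-st a u b v X)))
    (trans (solve 4 (λ x y z t → (x :+ y) :+ :- (z :+ t) := (x :+ :- z) :+ (y :+ :- t)) refl _ _ _ _)
      (half v b a u ⊞ half u a b v)))
    where
    half : ∀ v b a u → ifNil v (conv (λ k → R⁻ k (a ∷ u)) X b + R (a ∷ u) (shift b X))
                       + - ifNil v (conv (λ k → L⁻ k (a ∷ u)) X b + L (a ∷ u) (shift b X))
                     ≡ ifNil v (C (a ∷ u) (λ k → X (suc (k ℕ.+ b))))
    half (_ ∷ _) b a u = -‿inverseʳ 0ℚ
    half [] b a u = lin (conv-cong X b (λ k → R⁻≡L⁻ k a u) ⊞ cong-lin (C-linear (a ∷ u)) (λ k → cong (X ∘ suc) (ℕP.+-comm b k)))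
      (solve 5 (λ x r y l c → (x :+ r :+ :- (y :+ l)) :+ (y :+ c) := c :+ (x :+ (r :+ :- l))) refl _ _ _ _ _)

  module Stuffle = St.Coderivation (P 0) C (proj₂ (P-kills 0)) C-[] C-linear C-st

-- The operator D_ψ on words: as a derivation and by Goncharov's cuts

infixr 5 _⋆_
_⋆_ : (Word → ℚ) → (Word → ℚ) → Word → ℚ
(A ⋆ B) w = spl (λ p q → A p * B q) w

z₀ : Letter → ℚ
z₀ x0 = 1ℚ
z₀ x1 = 0ℚ

X₀ : Word → ℚ
X₀ (x0 ∷ []) = 1ℚ
X₀ _ = 0ℚ

lastX₀ firstX₀ comm₀ : (Word → ℚ) → Word → ℚ
lastX₀ Ψ = rl (λ a m → z₀ m * Ψ a)
firstX₀ Ψ = lf (λ m a → z₀ m * Ψ a)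
comm₀ Ψ w = lastX₀ Ψ w + - firstX₀ Ψ w

CX : (Word → ℚ) → Word → (Letter → ℚ) → ℚ
CX Ψ w X = comm₀ Ψ w * X x0

CX-linear : ∀ Ψ w → IsLinear (CX Ψ w)
CX-linear Ψ w = record
  { cong-lin = λ e → cong (comm₀ Ψ w *_) (e x0) ; add = λ f g → distribˡ _ _ _
  ; hom = λ k f → solve 3 (λ c k x → c :* (k :* x) := k :* (c :* x)) refl _ _ _ }

-- transpose of G ↦ ψ G + d_ψ(G), with d_ψ(x₀) = 0 and d_ψ(x₁) = [x₁ , ψ]: it is the derivation
-- x₀ ↦ [ψ , x₀], x₁ ↦ 0 followed by right multiplication by ψ on the unit
sX : (Word → ℚ) → (Word → ℚ) → Word → ℚ
sX Ψ = Transpose.s Ψ (CX Ψ) (CX-linear Ψ)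

comm₀-[] : ∀ Ψ → comm₀ Ψ [] ≡ 0ℚ
comm₀-[] Ψ = -‿inverseʳ 0ℚ

module ShuffleCoderivation (Ψ : Word → ℚ) (kills : Sh.Kills Ψ) where

  private
    unit : ∀ u v → v ≢ [] → sh Ψ u v ≡ ifNil u (Ψ v)
    unit [] v _ = refl
    unit (a ∷ u) [] ne = ⊥-elim (ne refl)
    unit (a ∷ u) (b ∷ v) _ = proj₂ kills a u b v

    first-sh : ∀ a u b v → sh (firstX₀ Ψ) (a ∷ u) (b ∷ v) ≡ z₀ a * ifNil u (Ψ (b ∷ v)) + z₀ b * ifNil v (Ψ (a ∷ u))
    first-sh a u b v = trans (+-identityʳ _)
      (trans (hom (Sh.st-linear u (b ∷ v)) (z₀ a) Ψ) (z₀ a ⊠ unit u (b ∷ v) (λ ()))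
       ⊞ trans (hom (Sh.st-linear (a ∷ u) v) (z₀ b) Ψ) (z₀ b ⊠ trans (Sh.st-comm Ψ (a ∷ u) v) (unit v (a ∷ u) (λ ()))))

    last-sh : ∀ a u b v → sh (lastX₀ Ψ) (a ∷ u) (b ∷ v) ≡ z₀ a * ifNil u (Ψ (b ∷ v)) + z₀ b * ifNil v (Ψ (a ∷ u))
    last-sh a u b v with snoc-view a u | snoc-view b v
    ... | u′ , i , e | v′ , j , e′ = trans (cong₂ (sh (lastX₀ Ψ)) e e′)
      (trans (Sh.st-∷ʳ (lastX₀ Ψ) u′ i v′ j) (trans (+-identityʳ _)
      (trans (half i u′ (v′ ∷ʳ j) (∷ʳ≢[] v′) ⊞ trans (Sh.st-comm _ (u′ ∷ʳ i) v′) (half j v′ (u′ ∷ʳ i) (∷ʳ≢[] u′)))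
      (trans (ifNil-snoc (λ i → z₀ i * Ψ (v′ ∷ʳ j)) a u u′ i e ⊞ ifNil-snoc (λ j → z₀ j * Ψ (u′ ∷ʳ i)) b v v′ j e′)
      (trans (cong₂ (λ U V → ifNil u (z₀ a * Ψ V) + ifNil v (z₀ b * Ψ U)) (sym e) (sym e′))
        (pull u (z₀ a) _ ⊞ pull v (z₀ b) _))))))
      where
      pull : ∀ (u : Word) k x → ifNil u (k * x) ≡ k * ifNil u x
      pull [] k x = refl
      pull (_ ∷ _) k x = sym (zeroʳ k)
      half : ∀ i u V → V ≢ [] → sh (λ w → lastX₀ Ψ (w ∷ʳ i)) u V ≡ ifNil u (z₀ i * Ψ V)
      half i u V ne = trans (Sh.st-cong (λ w → rl-∷ʳ _ w i) u V)
        (trans (hom (Sh.st-linear u V) (z₀ i) Ψ) (trans (z₀ i ⊠ unit u V ne) (sym (pull u (z₀ i) (Ψ V)))))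

    -- The commutator of ψ and x₀ is again primitive: left and right multiplication by x₀ have the
    -- same defect on a product, and it cancels in `comm₀`.
    C-st : ∀ a u b v X → sh (λ w → CX Ψ w X) (a ∷ u) (b ∷ v) ≡
           ifNil v (CX Ψ (a ∷ u) (λ _ → 0ℚ)) + ifNil u (CX Ψ (b ∷ v) (λ _ → 0ℚ))
    C-st a u b v X = trans
      (trans (trans (Sh.st-cong (λ w → *-comm (comm₀ Ψ w) (X x0)) (a ∷ u) (b ∷ v)) (hom (Sh.st-linear (a ∷ u) (b ∷ v)) (X x0) (comm₀ Ψ)))
        (*0 (trans (add (Sh.st-linear (a ∷ u) (b ∷ v)) (lastX₀ Ψ) (λ w → - firstX₀ Ψ w))
          (trans (cong (sh (lastX₀ Ψ) (a ∷ u) (b ∷ v) +_) (neg-lin (Sh.st-linear (a ∷ u) (b ∷ v)) (firstX₀ Ψ)))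
          (trans (cong₂ (λ x y → x + - y) (last-sh a u b v) (first-sh a u b v)) (-‿inverseʳ _))))))
      (sym (0+0 (vanish v (a ∷ u)) (vanish u (b ∷ v))))
      where
      vanish : ∀ (v : Word) w → ifNil v (CX Ψ w (λ _ → 0ℚ)) ≡ 0ℚ
      vanish [] w = zeroʳ _
      vanish (_ ∷ _) w = refl

  open Sh.Coderivation Ψ (CX Ψ) (proj₂ kills) (λ X → 0* (comm₀-[] Ψ)) (CX-linear Ψ) C-st public
    using (s-st; s-linear; s-cong)

-- Moving the dividing point across one letter: the last letter of the prefix becomes the first of
-- the suffix.
spl-rl : ∀ {A : Set} (H : List A → A → List A → ℚ) w → spl (λ p q → rl (λ a m → H a m q) p) w ≡ spl (λ p q → lf (λ m q → H p m q) q) w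
spl-rl H [] = refl
spl-rl {A} H (m ∷ w) = trans (+-identityˡ _) (trans (spl-cong split w) (trans (spl-+ _ _ w) (spl-ifNil (λ q → H [] m q) w ⊞ spl-rl (λ a → H (m ∷ a)) w)))
  where
  split : ∀ p q → rl (λ a m′ → H a m′ q) (m ∷ p) ≡ ifNil p (H [] m q) + rl (λ a m′ → H (m ∷ a) m′ q) p
  split [] q = sym (+-identityʳ _)
  split (_ ∷ _) q = sym (+-identityˡ _)

-- Weight of I(a; p; b) under an infinitesimal character, where b is the first letter of the rest or
-- the end point x₀. The value -1 is the antipode; altogether the weight is [b = x₀] - [a = x₀].
gap : Letter → Word → ℚ
gap x1 [] = 1ℚ
gap x1 (x0 ∷ _) = 1ℚ
gap x1 (x1 ∷ _) = 0ℚ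
gap x0 [] = 0ℚ
gap x0 (x0 ∷ _) = 0ℚ
gap x0 (x1 ∷ _) = ℚ.- 1ℚ

-- Goncharov's description: cut out a segment and weight it by its two boundary letters
gaps : (Word → ℚ) → Letter → (Word → ℚ) → Word → ℚ
gaps Ψ a F [] = gap a [] * Ψ [] * F []
gaps Ψ a F (b ∷ w) = spl (λ p q → gap a q * Ψ p * F q) (b ∷ w) + gaps Ψ b (λ w → F (b ∷ w)) w

gap-x0 : ∀ q → gap x0 q ≡ gap x1 q + - 1ℚ
gap-x0 [] = solve 0 (con 0ℚ := con 1ℚ :+ :- con 1ℚ) refl
gap-x0 (x0 ∷ q) = solve 0 (con 0ℚ := con 1ℚ :+ :- con 1ℚ) refl
gap-x0 (x1 ∷ q) = solve 0 (con (ℚ.- 1ℚ) := con 0ℚ :+ :- con 1ℚ) refl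

gaps-x0 : ∀ Ψ F w → gaps Ψ x0 F w ≡ gaps Ψ x1 F w + - (Ψ ⋆ F) w
gaps-x0 Ψ F [] = solve 2 (λ a b → con 0ℚ :* a :* b := con 1ℚ :* a :* b :+ :- (a :* b)) refl _ _
gaps-x0 Ψ F (m ∷ w) = lin (trans (spl-cong (λ p q → trans (cong (λ g → g * Ψ p * F q) (gap-x0 q))
    (solve 3 (λ g a b → (g :+ :- con 1ℚ) :* a :* b := g :* a :* b :+ con (ℚ.- 1ℚ) :* (a :* b)) refl (gap x1 q) (Ψ p) (F q))) (m ∷ w))
    (trans (spl-+ (λ p q → gap x1 q * Ψ p * F q) (λ p q → ℚ.- 1ℚ * (Ψ p * F q)) (m ∷ w)) (refl ⊞ spl-* (ℚ.- 1ℚ) (λ p q → Ψ p * F q) (m ∷ w))))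
  (solve 4 (λ x y z s → (x :+ z) :+ (y :+ con (ℚ.- 1ℚ) :* s) := (y :+ z :+ :- s) :+ x) refl _ _ _ _)

spl-end : ∀ {A : Set} (f : List A → ℚ) w → spl (λ p q → ifNil q (f p)) w ≡ f w
spl-end f [] = refl
spl-end f (a ∷ w) = trans (+-identityˡ _) (spl-end (λ p → f (a ∷ p)) w)

rl-*ʳ : ∀ {A : Set} (H : List A → A → ℚ) k w → rl H w * k ≡ rl (λ a m → H a m * k) w
rl-*ʳ H k [] = zeroˡ k
rl-*ʳ H k (m ∷ []) = refl
rl-*ʳ H k (m ∷ w@(_ ∷ _)) = rl-*ʳ _ k w

-- As the weight of a cut is [b = x₀] - [a = x₀], segments are removed positively in front of an x₀
-- or at the end of the word, negatively behind an x₀. These are the terms of ψ x₀ - x₀ ψ and of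
-- right multiplication by ψ.
sX≡gaps : ∀ Ψ → Ψ [] ≡ 0ℚ → ∀ F w → sX Ψ F w ≡ gaps Ψ x1 F w
sX≡gaps Ψ z F [] = sym (0* (trans (*-identityˡ _) z))
sX≡gaps Ψ z F (m ∷ w) = lin (sX≡gaps Ψ z (λ w → F (m ∷ w)) w ⊞ κ-formula ⊞ sym cut ⊞ sym (step m))
  (solve 9 (λ f P k s t g cut S gm → (f :* P :+ k :+ s) :+ (g :+ (cut :+ :- t) :+ S :+ gm)
     := (S :+ gm) :+ (s :+ k :+ (f :* P :+ cut) :+ (g :+ :- t))) refl _ _ _ _ _ _ _ _ _)
  where
  t : ℚ
  t = z₀ m * (Ψ ⋆ (λ q → F (x0 ∷ q))) w
  κ-formula : Transpose.κ Ψ (CX Ψ) (CX-linear Ψ) F (m ∷ w) ≡ spl (λ p q → lf (λ c q → z₀ c * Ψ p * F (x0 ∷ q)) q) (m ∷ w) + - t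
  κ-formula = trans (spl-cong (λ p q → distribʳ (F (x0 ∷ q)) (lastX₀ Ψ p) (- firstX₀ Ψ p)) (m ∷ w))
    (trans (spl-+ (λ p q → lastX₀ Ψ p * F (x0 ∷ q)) (λ p q → - firstX₀ Ψ p * F (x0 ∷ q)) (m ∷ w))
      (trans (spl-cong (λ p q → rl-*ʳ (λ a m → z₀ m * Ψ a) (F (x0 ∷ q)) p) (m ∷ w)) (spl-rl (λ a m q → z₀ m * Ψ a * F (x0 ∷ q)) (m ∷ w))
       ⊞ trans (0+ (0* neg0)) (trans (spl-cong (λ p q → solve 3 (λ x y f → :- (x :* y) :* f := (con (ℚ.- 1ℚ) :* x) :* (y :* f)) refl _ _ _) w)
           (trans (spl-* (ℚ.- 1ℚ * z₀ m) (λ p q → Ψ p * F (x0 ∷ q)) w) (solve 2 (λ x y → (con (ℚ.- 1ℚ) :* x) :* y := :- (x :* y)) refl _ _)))))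
  cut : spl (λ p q → gap x1 q * Ψ p * F q) (m ∷ w) ≡ F [] * Ψ (m ∷ w) + spl (λ p q → lf (λ c q → z₀ c * Ψ p * F (x0 ∷ q)) q) (m ∷ w)
  cut = trans (spl-cong {G = λ p q → ifNil q (F [] * Ψ p) + lf (λ c q → z₀ c * Ψ p * F (x0 ∷ q)) q} pointwise (m ∷ w))
    (trans (spl-+ (λ p q → ifNil q (F [] * Ψ p)) (λ p q → lf (λ c q → z₀ c * Ψ p * F (x0 ∷ q)) q) (m ∷ w)) (spl-end (λ p → F [] * Ψ p) (m ∷ w) ⊞ refl))
    where
    pointwise : ∀ p q → gap x1 q * Ψ p * F q ≡ ifNil q (F [] * Ψ p) + lf (λ c q → z₀ c * Ψ p * F (x0 ∷ q)) q
    pointwise p [] = solve 2 (λ a b → con 1ℚ :* a :* b := b :* a :+ con 0ℚ) refl _ _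
    pointwise p (x0 ∷ q) = sym (+-identityˡ _)
    pointwise p (x1 ∷ q) = solve 3 (λ a b c → con 0ℚ :* a :* b := con 0ℚ :+ con 0ℚ :* a :* c) refl _ _ _
  step : ∀ m → gaps Ψ m (λ w → F (m ∷ w)) w ≡ gaps Ψ x1 (λ w → F (m ∷ w)) w + - (z₀ m * (Ψ ⋆ (λ q → F (x0 ∷ q))) w)
  step x0 = trans (gaps-x0 Ψ (λ w → F (x0 ∷ w)) w) (cong (λ x → gaps Ψ x1 (λ w → F (x0 ∷ w)) w + - x) (sym (*-identityˡ _)))
  step x1 = solve 2 (λ g x → g := g :+ :- (con 0ℚ :* x)) refl _ _

-- The equation Ψ(ar ⧢ bw) = 0, unfolded by first letters, moves one letter of the second word to
-- the front of the first with a change of sign.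
antipode : ∀ Ψ → Sh.Kills Ψ → ∀ w → sgn (length w) * Ψ (reverse w) ≡ - Ψ w
antipode Ψ (z , k) [] = trans (cong (1ℚ *_) z) (trans (zeroʳ _) (trans (sym neg0) (cong -_ (sym z))))
antipode Ψ (z , k) (a ∷ w) = trans (trans (cong (_* Ψ (reverse (a ∷ w))) (neg-def _)) (solve 2 (λ x y → :- x :* y := :- (x :* y)) refl _ _))
  (cong -_ (trans (cong (λ v → sgn (length w) * Ψ v) (LP.unfold-reverse a w)) (sym (telescope a [] w))))
  where
  telescope : ∀ a r w → sh (λ v → Ψ (a ∷ v)) r w ≡ sgn (length w) * Ψ (reverse w ++ a ∷ r)
  telescope a r [] = trans (Sh.st-[] _ r) (sym (*-identityˡ _))
  telescope a r (b ∷ w) = lin (k a r b w ⊞ sym (telescope b (a ∷ r) w))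
    (trans (solve 4 (λ x y s p → x :+ (con 0ℚ :+ y) := :- s :* p :+ ((x :+ y :+ con 0ℚ) :+ s :* p)) refl _ _ (sgn (length w)) (Ψ (reverse w ++ b ∷ a ∷ r)))
      (cong₂ (λ s v → s * Ψ v) (sym (neg-def _)) (trans (sym (LP.++-assoc (reverse w) (b ∷ []) (a ∷ r))) (cong (_++ a ∷ r) (sym (LP.unfold-reverse b w)))) ⊞ refl))

-- Concatenation of series and the Ihara bracket

⋆-linearˡ : ∀ B w → IsLinear (λ A → (A ⋆ B) w)
⋆-linearˡ B w = record
  { cong-lin = λ e → spl-cong (λ p q → cong (_* B q) (e p)) w
  ; add = λ f g → trans (spl-cong (λ p q → distribʳ (B q) (f p) (g p)) w) (spl-+ _ _ w)
  ; hom = λ k f → trans (spl-cong (λ p q → *-assoc k (f p) (B q)) w) (spl-* k _ w) }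

⋆-linearʳ : ∀ A w → IsLinear (λ B → (A ⋆ B) w)
⋆-linearʳ A w = record
  { cong-lin = λ e → spl-cong (λ p q → cong (A p *_) (e q)) w
  ; add = λ f g → trans (spl-cong (λ p q → distribˡ (A p) (f q) (g q)) w) (spl-+ _ _ w)
  ; hom = λ k f → trans (spl-cong (λ p q → solve 3 (λ a k b → a :* (k :* b) := k :* (a :* b)) refl (A p) k (f q)) w) (spl-* k _ w) }

⋆-assoc : ∀ A B C w → ((A ⋆ B) ⋆ C) w ≡ (A ⋆ B ⋆ C) w
⋆-assoc A B C [] = *-assoc _ _ _
⋆-assoc A B C (m ∷ w) = lin
  (add (⋆-linearˡ C w) (λ w → A [] * B (m ∷ w)) ((λ w → A (m ∷ w)) ⋆ B) ⊞ hom (⋆-linearˡ C w) (A []) (λ w → B (m ∷ w))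
   ⊞ ⋆-assoc (λ w → A (m ∷ w)) B C w)
  (solve 8 (λ a b c X Y Y′ Z Z′ → ((a :* b) :* c :+ X) :+ (Y :+ Z :+ a :* Y′ :+ Z′) := (a :* (b :* c :+ Y′) :+ Z′) :+ (X :+ Y :+ Z)) refl _ _ _ _ _ _ _ _)

X₀-letter : ∀ m → X₀ (m ∷ []) ≡ z₀ m
X₀-letter x0 = refl
X₀-letter x1 = refl

lastX₀-⋆ : ∀ Ψ w → lastX₀ Ψ w ≡ (Ψ ⋆ X₀) w
lastX₀-⋆ Ψ [] = sym (zeroʳ _)
lastX₀-⋆ Ψ (m ∷ []) = trans (*-comm _ _) (trans (cong (Ψ [] *_) (sym (X₀-letter m))) (sym (+0 (zeroʳ _))))
lastX₀-⋆ Ψ (x0 ∷ m′ ∷ w) = trans (lastX₀-⋆ (λ a → Ψ (x0 ∷ a)) (m′ ∷ w)) (sym (0+ (zeroʳ _)))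
lastX₀-⋆ Ψ (x1 ∷ m′ ∷ w) = trans (lastX₀-⋆ (λ a → Ψ (x1 ∷ a)) (m′ ∷ w)) (sym (0+ (zeroʳ _)))

firstX₀-⋆ : ∀ Ψ w → firstX₀ Ψ w ≡ (X₀ ⋆ Ψ) w
firstX₀-⋆ Ψ [] = sym (zeroˡ _)
firstX₀-⋆ Ψ (x0 ∷ w) = sym (trans (0+ (zeroˡ _)) (trans (spl-cong {G = λ p q → ifNil p (1ℚ * Ψ q)} (λ { [] q → refl ; (_ ∷ _) q → zeroˡ _ }) w) (spl-ifNil (λ q → 1ℚ * Ψ q) w)))
firstX₀-⋆ Ψ (x1 ∷ w) = trans (zeroˡ _) (sym (0+0 (zeroˡ _) (spl-zero w (λ p q → zeroˡ _))))

sX-linear : ∀ Ψ w → IsLinear (λ G → sX Ψ G w)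
sX-linear Ψ = Transpose.s-linear Ψ (CX Ψ) (CX-linear Ψ)

-- `sX f` is a derivation plus right multiplication by f. On A ⋆ B that multiplication happens once,
-- in the two terms on the right twice; the surplus is A ⋆ f ⋆ B.
leibniz : ∀ f → f [] ≡ 0ℚ → ∀ A B w → sX f (A ⋆ B) w + (A ⋆ f ⋆ B) w ≡ (sX f A ⋆ B) w + (A ⋆ sX f B) w
leibniz f z A B [] = trans (0+ refl) (trans (*0 (0* z)) (sym (0+0 (zeroˡ _) (zeroʳ _))))
leibniz f z A B (m ∷ w) = lin
  (leibniz f z (λ w → A (m ∷ w)) B w
   ⊞ trans (add (⋆-linearʳ c (m ∷ w)) (λ q → A [] * B (x0 ∷ q)) (λ q → (A₀ ⋆ B) q)) (hom (⋆-linearʳ c (m ∷ w)) (A []) (λ q → B (x0 ∷ q)) ⊞ sym (⋆-assoc c A₀ B (m ∷ w)))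
   ⊞ trans (add (sX-linear f w) (λ v → A [] * B (m ∷ v)) (λ v → ((λ w → A (m ∷ w)) ⋆ B) v)) (hom (sX-linear f w) (A []) (λ v → B (m ∷ v)) ⊞ refl)
   ⊞ sym (trans (add₃ (⋆-linearˡ B w) (λ v → A [] * f (m ∷ v)) (λ v → (c ⋆ A₀) (m ∷ v)) (λ v → sX f (λ w → A (m ∷ w)) v))
       (hom (⋆-linearˡ B w) (A []) (λ v → f (m ∷ v)) ⊞ refl ⊞ refl))
   ⊞ cong (λ x → x * A₀ [] * B (m ∷ w)) (comm₀-[] f) ⊞ cong (λ x → A [] * (x * B (m ∷ w))) z)
  (solve 18 (λ a b fm bm K S f₀ G H I₁ I₂ c₁ c₀ a₀ c₂ s₁ s₂ J →
     (((a :* b) :* fm :+ K :+ S) :+ (a :* (f₀ :* bm :+ G) :+ H))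
       :+ ((I₁ :+ I₂) :+ (a :* c₁ :+ ((c₀ :* a₀) :* bm :+ c₂)) :+ (a :* s₁ :+ s₂) :+ J :+ con 0ℚ :* a₀ :* bm :+ a :* (con 0ℚ :* bm))
     := ((con 0ℚ :* bm :+ J) :+ (a :* (b :* fm :+ c₁ :+ s₁) :+ I₂))
       :+ ((s₂ :+ H) :+ K :+ S :+ (a :* G :+ c₂ :+ I₁) :+ c₀ :* a₀ :* bm :+ a :* (f₀ :* bm)))
     refl _ _ _ _ _ _ _ _ _ _ _ _ _ _ _ _ _ _)
  where
  c = comm₀ f
  A₀ : Word → ℚ
  A₀ q = A (x0 ∷ q)

sX-scalar : ∀ f → f [] ≡ 0ℚ → ∀ k w → sX f (λ v → ifNil v k) w ≡ k * f w
sX-scalar f z k [] = sym (*0 z)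
sX-scalar f z k (m ∷ w) = trans (+0 (zero-lin (sX-linear f w) {λ v → ifNil (m ∷ v) k} (λ _ → refl))) (+0 (spl-zero (m ∷ w) (λ p q → zeroʳ (comm₀ f p))))

sX-X₀ : ∀ f → f [] ≡ 0ℚ → ∀ w → sX f X₀ w ≡ (f ⋆ X₀) w
sX-X₀ f z [] = sym (zeroʳ _)
sX-X₀ f z (m ∷ w) = lin (unitˡ ⊞ lastX₀-⋆ f (m ∷ w) ⊞ tail m)
  (solve 6 (λ fm k fX l x s → (con 0ℚ :* fm :+ k :+ s) :+ ((l :+ :- x) :+ fX :+ x) := fX :+ (k :+ l :+ s)) refl _ _ _ _ _ _)
  where
  unitˡ : spl (λ p q → comm₀ f p * X₀ (x0 ∷ q)) (m ∷ w) ≡ lastX₀ f (m ∷ w) + - firstX₀ f (m ∷ w)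
  unitˡ = trans (spl-cong {H = λ p q → comm₀ f p * X₀ (x0 ∷ q)} {G = λ p q → ifNil q (comm₀ f p)} (λ { p [] → *-identityʳ _ ; p (_ ∷ _) → zeroʳ _ }) (m ∷ w)) (spl-end (comm₀ f) (m ∷ w))
  tail : ∀ m → sX f (λ v → X₀ (m ∷ v)) w ≡ firstX₀ f (m ∷ w)
  tail x0 = trans (cong-lin (sX-linear f w) (λ { [] → refl ; (_ ∷ _) → refl })) (sX-scalar f z 1ℚ w)
  tail x1 = trans (zero-lin (sX-linear f w) (λ _ → refl)) (sym (zeroˡ _))

module Bracket (f g : Word → ℚ) (f₀ : f [] ≡ 0ℚ) (g₀ : g [] ≡ 0ℚ) where

  h : Word → ℚ
  h w = sX f g w + - sX g f w

  private
    comm₀-⋆ : ∀ Ψ w → comm₀ Ψ w ≡ (Ψ ⋆ X₀) w + - (X₀ ⋆ Ψ) w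
    comm₀-⋆ Ψ w = lastX₀-⋆ Ψ w ⊞ cong -_ (firstX₀-⋆ Ψ w)

    sX-comm₀ : ∀ f g → f [] ≡ 0ℚ → ∀ w → sX f (comm₀ g) w ≡
      (sX f g ⋆ X₀) w + - (f ⋆ X₀ ⋆ g) w + (X₀ ⋆ f ⋆ g) w + - (X₀ ⋆ sX f g) w
    sX-comm₀ f g z w = lin
      (trans (cong-lin (sX-linear f w) (comm₀-⋆ g)) (trans (add (sX-linear f w) (g ⋆ X₀) (λ w → - (X₀ ⋆ g) w)) (refl ⊞ neg-lin (sX-linear f w) (X₀ ⋆ g)))
       ⊞ leibniz f z g X₀ w ⊞ cong-lin (⋆-linearʳ g w) (sX-X₀ f z)
       ⊞ cong -_ (leibniz f z X₀ g w) ⊞ cong -_ (trans (cong-lin (⋆-linearˡ g w) (sX-X₀ f z)) (⋆-assoc f X₀ g w)))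
      (solve 10 (λ s a b c d e k l m n → s :+ ((a :+ :- b) :+ (c :+ d) :+ e :+ :- (k :+ l) :+ :- m)
        := (c :+ :- m :+ n :+ :- l) :+ (s :+ (a :+ e) :+ d :+ :- (b :+ n) :+ :- k)) refl _ _ _ _ _ _ _ _ _ _)

    comm₀-⋆⋆ : ∀ f g w → (comm₀ g ⋆ f) w ≡ (g ⋆ X₀ ⋆ f) w + - (X₀ ⋆ g ⋆ f) w
    comm₀-⋆⋆ f g w = trans (cong-lin (⋆-linearˡ f w) (comm₀-⋆ g)) (trans (add (⋆-linearˡ f w) (g ⋆ X₀) (λ w → - (X₀ ⋆ g) w))
      (⋆-assoc g X₀ f w ⊞ trans (neg-lin (⋆-linearˡ f w) (X₀ ⋆ g)) (cong -_ (⋆-assoc X₀ g f w))))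

    comm₀-h : ∀ w → comm₀ h w + (comm₀ g ⋆ f) w + sX g (comm₀ f) w ≡ sX f (comm₀ g) w + (comm₀ f ⋆ g) w
    comm₀-h w = lin
      (comm₀-⋆ h w ⊞ trans (add (⋆-linearˡ X₀ w) (sX f g) (λ w → - sX g f w)) (refl ⊞ neg-lin (⋆-linearˡ X₀ w) (sX g f))
       ⊞ cong -_ (trans (add (⋆-linearʳ X₀ w) (sX f g) (λ w → - sX g f w)) (refl ⊞ neg-lin (⋆-linearʳ X₀ w) (sX g f)))
       ⊞ comm₀-⋆⋆ f g w ⊞ sX-comm₀ g f g₀ w ⊞ sym (sX-comm₀ f g f₀ w) ⊞ sym (comm₀-⋆⋆ g f w))
      (solve 15 (λ c u v h₁ h₂ a b p q m n r s k l →
        (c :+ u :+ v) :+ ((h₁ :+ :- h₂) :+ (a :+ :- b) :+ :- (p :+ :- q) :+ (m :+ :- n) :+ (b :+ :- m :+ n :+ :- q) :+ r :+ s)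
        := (r :+ s) :+ (c :+ h₁ :+ :- h₂ :+ u :+ v :+ (a :+ :- k :+ l :+ :- p) :+ (k :+ :- l))) refl _ _ _ _ _ _ _ _ _ _ _ _ _ _ _)

    shifted : (Word → ℚ) → (Word → ℚ) → Word → ℚ
    shifted g F [] = 0ℚ
    shifted g F (m ∷ v) = sX g (λ w → F (m ∷ w)) v

    expand : ∀ f g → f [] ≡ 0ℚ → g [] ≡ 0ℚ → ∀ F m w → sX f (sX g F) (m ∷ w) + (comm₀ g ⋆ f ⋆ (λ q → F (x0 ∷ q))) (m ∷ w) ≡
      F [] * sX f g (m ∷ w) + (sX f (comm₀ g) ⋆ (λ q → F (x0 ∷ q))) (m ∷ w) + (comm₀ g ⋆ sX f (λ q → F (x0 ∷ q))) (m ∷ w)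
      + (comm₀ f ⋆ sX g (λ q → F (x0 ∷ q))) (m ∷ w) + sX f (sX g (λ w → F (m ∷ w))) w
    expand f g zf zg F m w = lin
      (trans (cong-lin (sX-linear f (m ∷ w)) decompose) (add₃ (sX-linear f (m ∷ w)) (λ w → F [] * g w) (comm₀ g ⋆ (λ q → F (x0 ∷ q))) (shifted g F))
       ⊞ hom (sX-linear f (m ∷ w)) (F []) g ⊞ leibniz f zf (comm₀ g) (λ q → F (x0 ∷ q)) (m ∷ w))
      (solve 11 (λ s e t₁ t₂ f₁ D R F x A B → (s :+ e) :+ ((t₁ :+ t₂ :+ (con 0ℚ :* f₁ :+ D :+ R)) :+ F :* x :+ (A :+ B))
        := (F :* x :+ A :+ B :+ D :+ R) :+ (s :+ t₁ :+ (t₂ :+ e))) refl _ _ _ _ _ _ _ _ _ _ _)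
      where
      decompose : ∀ w → sX g F w ≡ F [] * g w + (comm₀ g ⋆ (λ q → F (x0 ∷ q))) w + shifted g F w
      decompose [] = sym (0+0 (0+0 (*0 zg) (0* (comm₀-[] g))) refl)
      decompose (m ∷ w) = refl

  -- Both sides are a derivation plus a right multiplication, so the induction on the word compares
  -- them on the unit, where `h` appears by definition, and on the letter x₀, where `comm₀-h` is
  -- needed.
  bracket : ∀ F w → sX f (sX g F) w + - sX g (sX f F) w ≡ sX h F w
  bracket F [] = -‿inverseʳ 0ℚ
  bracket F (m ∷ w) = lin
    (expand f g f₀ g₀ F m w ⊞ cong -_ (expand g f g₀ f₀ F m w) ⊞ bracket (λ w → F (m ∷ w)) w
     ⊞ sym (trans (sym (add₃ l (comm₀ h) (comm₀ g ⋆ f) (sX g (comm₀ f)))) (trans (cong-lin l comm₀-h) (add l (sX f (comm₀ g)) (comm₀ f ⋆ g))))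
     ⊞ ⋆-assoc (comm₀ g) f F₀ (m ∷ w) ⊞ cong -_ (⋆-assoc (comm₀ f) g F₀ (m ∷ w)))
    (solve 17 (λ s₁ s₂ e₁ e₂ F x y A₁ A₂ B D R₁ R₂ S K G G′ →
      (s₁ :+ :- s₂) :+ ((F :* x :+ A₁ :+ B :+ D :+ R₁) :+ :- (F :* y :+ A₂ :+ D :+ B :+ R₂) :+ S :+ (K :+ G′ :+ A₂) :+ e₁ :+ :- e₂)
      := (F :* (x :+ :- y) :+ K :+ S) :+ ((s₁ :+ e₁) :+ :- (s₂ :+ e₂) :+ (R₁ :+ :- R₂) :+ (A₁ :+ G) :+ G′ :+ :- G))
      refl _ _ _ _ _ _ _ _ _ _ _ _ _ _ _ _ _)
    where
    F₀ : Word → ℚ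
    F₀ q = F (x0 ∷ q)
    l = ⋆-linearˡ F₀ (m ∷ w)

-- Words in Y, their reversal, and the powers of y₁

blk : ℕ → Word → Word
blk zero w = x1 ∷ w
blk (suc m) w = x0 ∷ blk m w

-- Y-words are indexed from zero here: the letter k stands for y_{k+1}
ι : List ℕ → Word
ι [] = []
ι (m ∷ w) = blk m (ι w)

-- x₀^k x₁ ι(a) without its last letter
ι′ : ℕ → List ℕ → Word
ι′ zero [] = []
ι′ zero (a ∷ w) = x1 ∷ ι′ a w
ι′ (suc k) w = x0 ∷ ι′ k w

zs : ℕ → Word
zs k = ι′ k []

-- ι(a) x₀^k
ιz : List ℕ → ℕ → Word
ιz [] k = zs k
ιz (m ∷ a) k = blk m (ιz a k)

ιz-0 : ∀ a → ιz a 0 ≡ ι a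
ιz-0 [] = refl
ιz-0 (m ∷ a) = cong (blk m) (ιz-0 a)

ι′-∷ : ∀ m b w → ι′ m (b ∷ w) ≡ blk m (ι′ b w)
ι′-∷ zero b w = refl
ι′-∷ (suc m) b w = cong (x0 ∷_) (ι′-∷ m b w)

blk-++ : ∀ m x y → blk m x ++ y ≡ blk m (x ++ y)
blk-++ zero x y = refl
blk-++ (suc m) x y = cong (x0 ∷_) (blk-++ m x y)

zs-++ : ∀ m y → zs m ++ x1 ∷ y ≡ blk m y
zs-++ zero y = refl
zs-++ (suc m) y = cong (x0 ∷_) (zs-++ m y)

zs-∷ʳ : ∀ m → zs m ∷ʳ x0 ≡ x0 ∷ zs m
zs-∷ʳ zero = refl
zs-∷ʳ (suc m) = cong (x0 ∷_) (zs-∷ʳ m)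

reverse-zs : ∀ m → reverse (zs m) ≡ zs m
reverse-zs zero = refl
reverse-zs (suc m) = trans (LP.unfold-reverse x0 (zs m)) (trans (cong (_∷ʳ x0) (reverse-zs m)) (zs-∷ʳ m))

reverse-blk : ∀ m x → reverse (blk m x) ≡ reverse x ++ x1 ∷ zs m
reverse-blk zero x = LP.unfold-reverse x1 x
reverse-blk (suc m) x = trans (LP.unfold-reverse x0 (blk m x)) (trans (cong (_∷ʳ x0) (reverse-blk m x))
  (trans (LP.++-assoc (reverse x) (x1 ∷ zs m) (x0 ∷ [])) (cong (λ z → reverse x ++ x1 ∷ z) (zs-∷ʳ m))))

ιz-∷ʳ : ∀ w a k → ιz (w ∷ʳ a) k ≡ ιz w a ++ x1 ∷ zs k
ιz-∷ʳ [] a k = sym (zs-++ a (zs k))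
ιz-∷ʳ (m ∷ w) a k = trans (cong (blk m) (ιz-∷ʳ w a k)) (sym (blk-++ m (ιz w a) (x1 ∷ zs k)))

reverse-ι′ : ∀ k a → reverse (ι′ k a) ≡ ιz (reverse a) k
reverse-ι′ k [] = reverse-zs k
reverse-ι′ k (a ∷ w) = trans (cong reverse (ι′-∷ k a w)) (trans (reverse-blk k (ι′ a w))
  (trans (cong (_++ x1 ∷ zs k) (reverse-ι′ a w)) (trans (sym (ιz-∷ʳ (reverse w) a k)) (cong (λ v → ιz v k) (sym (LP.unfold-reverse a w))))))

st-reverse : ∀ F u v → st (λ w → F (reverse w)) u v ≡ st F (reverse u) (reverse v)
st-reverse F [] v = refl
st-reverse F (a ∷ u) [] = sym (St.st-[] F (reverse (a ∷ u)))
st-reverse F (a ∷ u) (b ∷ v) = trans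
  (step a u (b ∷ v) ⊞ step b (a ∷ u) v ⊞ step (suc (a ℕ.+ b)) u v)
  (trans (cong (st (λ w → F (w ∷ʳ a)) (reverse u)) (LP.unfold-reverse b v) ⊞ cong (λ U → st (λ w → F (w ∷ʳ b)) U (reverse v)) (LP.unfold-reverse a u) ⊞ refl)
  (trans (sym (St.st-∷ʳ F (reverse u) a (reverse v) b)) (sym (cong₂ (st F) (LP.unfold-reverse a u) (LP.unfold-reverse b v)))))
  where
  step : ∀ c x y → st (λ w → F (reverse (c ∷ w))) x y ≡ st (λ w → F (w ∷ʳ c)) (reverse x) (reverse y)
  step c x y = trans (St.st-cong (λ w → cong F (LP.unfold-reverse c w)) x y) (st-reverse (λ w → F (w ∷ʳ c)) x y)

-- The functional supported on the powers y₁^n, with value `c n`; it carries the correction in ψ_*.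
corr : (ℕ → ℚ) → List ℕ → ℚ
corr c [] = c 0
corr c (zero ∷ w) = corr (λ n → c (suc n)) w
corr c (suc _ ∷ w) = 0ℚ

data HasPos : List ℕ → Set where
  here : ∀ {m w} → HasPos (suc m ∷ w)
  there : ∀ {m w} → HasPos w → HasPos (m ∷ w)

corr-pos : ∀ c {w} → HasPos w → corr c w ≡ 0ℚ
corr-pos c here = refl
corr-pos c {zero ∷ w} (there p) = corr-pos _ p
corr-pos c {suc _ ∷ w} (there p) = refl

-- A letter y_n with n ≥ 2 can never turn into y₁ in a stuffle product.
st-pos : ∀ F u v → (∀ w → HasPos w → F w ≡ 0ℚ) → HasPos u → st F u v ≡ 0ℚ
st-pos F (a ∷ u) [] z p = z (a ∷ u) p
st-pos F (suc a ∷ u) (b ∷ v) z here =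
  0+0 (0+0 (zero-lin (St.st-linear u (b ∷ v)) (λ w → z _ here)) (st-pos _ (suc a ∷ u) v (λ w p → z _ (there p)) here))
    (zero-lin (St.st-linear u v) (λ w → z _ here))
st-pos F (a ∷ u) (b ∷ v) z (there p) =
  0+0 (0+0 (st-pos _ u (b ∷ v) (λ w p → z _ (there p)) p) (st-pos _ (a ∷ u) v (λ w p → z _ (there p)) (there p)))
    (zero-lin (St.st-linear u v) (λ w → z _ here))

corr-∷ : ∀ c m a → corr c (m ∷ a) ≡ δ₀ m * corr (λ n → c (suc n)) a
corr-∷ c zero a = sym (*-identityˡ _)
corr-∷ c (suc m) a = sym (zeroˡ _)

corr-∷ʳ : ∀ c a m → corr c (a ∷ʳ m) ≡ δ₀ m * corr (λ n → c (suc n)) a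
corr-∷ʳ c [] zero = sym (*-identityˡ _)
corr-∷ʳ c [] (suc m) = sym (zeroˡ _)
corr-∷ʳ c (zero ∷ a) m = corr-∷ʳ (λ n → c (suc n)) a m
corr-∷ʳ c (suc _ ∷ a) m = sym (zeroʳ _)

corr-reverse : ∀ c w → corr c (reverse w) ≡ corr c w
corr-reverse c [] = refl
corr-reverse c (m ∷ w) = trans (cong (corr c) (LP.unfold-reverse m w)) (trans (corr-∷ʳ c (reverse w) m)
  (trans (cong (δ₀ m *_) (corr-reverse (λ n → c (suc n)) w)) (sym (corr-∷ c m w))))

corr-last-first : ∀ c w → rl (λ a m → δ₀ m * corr c a) w ≡ lf (λ m a → δ₀ m * corr c a) w
corr-last-first c [] = refl
corr-last-first c (a ∷ u) with snoc-view a u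
... | u′ , i , e = trans (cong (rl _) e) (trans (rl-∷ʳ _ u′ i) (trans (sym (corr-∷ʳ (λ n → c (ℕ.pred n)) u′ i))
  (trans (cong (corr (λ n → c (ℕ.pred n))) (sym e)) (corr-∷ (λ n → c (ℕ.pred n)) a u))))

-- Racinet's argument for the stuffle product

nat : ℕ → ℚ
nat zero = 0ℚ
nat (suc n) = 1ℚ + nat n

-- Acts by y_n ↦ n y_{n+1} at one place: the part of x₀ ⧢ ι(w) that inserts x₀ in front of some x₁.
δY : (List ℕ → ℚ) → List ℕ → ℚ
δY F [] = 0ℚ
δY F (m ∷ w) = nat (suc m) * F (suc m ∷ w) + δY (λ w → F (m ∷ w)) w

δY-linear : ∀ w → IsLinear (λ F → δY F w)
δY-linear w = record { cong-lin = λ e → c e w ; add = λ f g → a f g w ; hom = λ k f → h k f w }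
  where
  c : ∀ {f g} → (∀ w → f w ≡ g w) → ∀ w → δY f w ≡ δY g w
  c e [] = refl
  c e (m ∷ w) = (nat (suc m) ⊠ e (suc m ∷ w)) ⊞ c (λ w → e (m ∷ w)) w
  a : ∀ f g w → δY (λ w → f w + g w) w ≡ δY f w + δY g w
  a f g [] = sym (+-identityˡ 0ℚ)
  a f g (m ∷ w) = trans (distribˡ _ _ _ ⊞ a (λ w → f (m ∷ w)) (λ w → g (m ∷ w)) w) (+-swap _ _ _ _)
  h : ∀ k f w → δY (λ w → k * f w) w ≡ k * δY f w
  h k f [] = sym (zeroʳ k)
  h k f (m ∷ w) = trans (refl ⊞ h k (λ w → f (m ∷ w)) w) (solve 4 (λ n k x y → n :* (k :* x) :+ k :* y := k :* (n :* x :+ y)) refl _ _ _ _)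

nat-+ : ∀ a b → nat (a ℕ.+ b) ≡ nat a + nat b
nat-+ zero b = sym (+-identityˡ _)
nat-+ (suc a) b = trans (cong (1ℚ +_) (nat-+ a b)) (sym (+-assoc _ _ _))

-- A derivation because the multiplicity n of y_n is additive under the contraction of y_m and y_n
-- to y_{m+n}.
δY-st : ∀ F u v → st (δY F) u v ≡ δY (λ x → st F x v) u + δY (λ y → st F u y) v
δY-st F [] v = sym (+-identityˡ _)
δY-st F (a ∷ u) [] = trans (cong-lin (δY-linear (a ∷ u)) (λ w → sym (St.st-[] F w))) (sym (+-identityʳ _))
δY-st F (a ∷ u) (b ∷ v) = lin
  (expand a u (b ∷ v) ⊞ expand b (a ∷ u) v ⊞ expand (suc (a ℕ.+ b)) u v
   ⊞ δY-st (λ w → F (a ∷ w)) u (b ∷ v) ⊞ δY-st (λ w → F (b ∷ w)) (a ∷ u) v ⊞ δY-st (λ w → F (suc (a ℕ.+ b) ∷ w)) u v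
   ⊞ sym (add₃ (δY-linear u) (λ x → st (λ w → F (a ∷ w)) x (b ∷ v)) (λ x → st (λ w → F (b ∷ w)) (a ∷ x) v) (λ x → st (λ w → F (suc (a ℕ.+ b) ∷ w)) x v))
   ⊞ sym (add₃ (δY-linear v) (λ y → st (λ w → F (a ∷ w)) u (b ∷ y)) (λ y → st (λ w → F (b ∷ w)) (a ∷ u) y) (λ y → st (λ w → F (suc (a ℕ.+ b) ∷ w)) u y))
   ⊞ cong (λ n → (1ℚ + n) * st (λ w → F (suc (suc (a ℕ.+ b)) ∷ w)) u v) (cong (1ℚ +_) (nat-+ a b))
   ⊞ cong (λ k → (1ℚ + nat b) * (st (λ w → F (k ∷ w)) u v)) (sym (cong suc (ℕP.+-suc a b))))
  (solve 23 (λ E₁ E₂ E₃ na nb nab p₁ p₂ p₃ q₁ q₂ q₃ G₁ G₂ G₃ H₁ H₂ H₃ K₁ K₂ K₃ D₁ D₂ →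
    (E₁ :+ E₂ :+ E₃) :+ (((con 1ℚ :+ na) :* p₁ :+ G₁) :+ ((con 1ℚ :+ nb) :* q₂ :+ G₂) :+ ((con 1ℚ :+ (con 1ℚ :+ nab)) :* p₃ :+ G₃)
      :+ (H₁ :+ ((con 1ℚ :+ nb) :* q₁ :+ K₁)) :+ (((con 1ℚ :+ na) :* p₂ :+ H₂) :+ K₂) :+ (H₃ :+ K₃) :+ D₁ :+ D₂
      :+ (con 1ℚ :+ (con 1ℚ :+ (na :+ nb))) :* p₃ :+ (con 1ℚ :+ nb) :* q₃)
    := (((con 1ℚ :+ na) :* (p₁ :+ p₂ :+ p₃) :+ D₁) :+ ((con 1ℚ :+ nb) :* (q₁ :+ q₂ :+ q₃) :+ D₂))
      :+ (E₁ :+ E₂ :+ E₃ :+ G₁ :+ G₂ :+ G₃ :+ (H₁ :+ H₂ :+ H₃) :+ (K₁ :+ K₂ :+ K₃)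
        :+ (con 1ℚ :+ (con 1ℚ :+ nab)) :* p₃ :+ (con 1ℚ :+ nb) :* p₃))
    refl _ _ _ _ _ _ _ _ _ _ _ _ _ _ _ _ _ _ _ _ _ _ _)
  where
  expand : ∀ c x y → st (λ w → δY F (c ∷ w)) x y ≡ nat (suc c) * st (λ w → F (suc c ∷ w)) x y + st (δY (λ w → F (c ∷ w))) x y
  expand c x y = trans (add (St.st-linear x y) _ _) (hom (St.st-linear x y) (nat (suc c)) (λ w → F (suc c ∷ w)) ⊞ refl)

sh-x₀-zs : ∀ F k → sh F (x0 ∷ []) (zs k) ≡ nat (suc k) * F (zs (suc k))
sh-x₀-zs F zero = solve 1 (λ x → x := (con 1ℚ :+ con 0ℚ) :* x) refl _
sh-x₀-zs F (suc k) = lin (sh-x₀-zs (λ w → F (x0 ∷ w)) k)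
  (solve 4 (λ x y n z → (x :+ y :+ con 0ℚ) :+ n :* x := (con 1ℚ :+ n) :* x :+ y) refl _ _ (nat (suc k)) 0ℚ)

sh-x₀-blk : ∀ F m x → sh F (x0 ∷ []) (blk m x) ≡ nat (suc m) * F (blk (suc m) x) + sh (λ w → F (blk m w)) (x0 ∷ []) x
sh-x₀-blk F zero x = solve 2 (λ x y → x :+ y :+ con 0ℚ := (con 1ℚ :+ con 0ℚ) :* x :+ y) refl _ _
sh-x₀-blk F (suc m) x = lin (sh-x₀-blk (λ w → F (x0 ∷ w)) m x)
  (solve 4 (λ x y n z → (x :+ y :+ con 0ℚ) :+ (n :* x :+ z) := ((con 1ℚ :+ n) :* x :+ z) :+ y) refl _ _ (nat (suc m)) _)

sh-x₀ : ∀ F a k → sh F (x0 ∷ []) (ιz a k) ≡ δY (λ a → F (ιz a k)) a + nat (suc k) * F (ιz a (suc k))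
sh-x₀ F [] k = trans (sh-x₀-zs F k) (sym (+-identityˡ _))
sh-x₀ F (m ∷ a) k = trans (sh-x₀-blk F m (ιz a k)) (trans (refl ⊞ sh-x₀ (λ w → F (blk m w)) a k) (sym (+-assoc _ _ _)))

δY-[] : ∀ F → (∀ a w → F (a ∷ w) ≡ 0ℚ) → ∀ w → δY F w ≡ 0ℚ
δY-[] F z [] = refl
δY-[] F z (m ∷ w) = 0+0 (*0 (z (suc m) w)) (zero-lin (δY-linear w) (λ v → z m v))

record NatInverse : Set where
  field
    inv : ℕ → ℚ
    inv-nat : ∀ n → inv n * nat (suc n) ≡ 1ℚ

  nat-cancel : ∀ n {x} → nat (suc n) * x ≡ 0ℚ → x ≡ 0ℚ
  nat-cancel n {x} e = trans (sym (trans (sym (*-assoc _ _ _)) (trans (cong (_* x) (inv-nat n)) (*-identityˡ x)))) (*0 {inv n} e)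

blk≢[] : ∀ m x → blk m x ≢ []
blk≢[] zero x ()
blk≢[] (suc m) x ()

starts₁ : (Word → ℚ) → Word → ℚ
starts₁ h = lf (λ { x0 _ → 0ℚ ; x1 q → h q })

spl-starts₁ : ∀ H m w → spl (λ p q → starts₁ (H p) q) (blk m (ι w)) ≡ spl (λ a q → H (ι′ m a) (ι q)) w
spl-starts₁ H zero [] = +-identityʳ _
spl-starts₁ H zero (b ∷ w) = refl ⊞ spl-starts₁ (λ p → H (x1 ∷ p)) b w
spl-starts₁ H (suc m) w = trans (+-identityˡ _) (spl-starts₁ (λ p → H (x0 ∷ p)) m w)

conv-first : ∀ f X m → conv f X (suc m) ≡ f 0 * X (suc m) + conv (λ i → f (suc i)) X m
conv-first f X zero = +-comm _ _
conv-first f X (suc m) = trans (refl ⊞ conv-first f (λ n → X (suc n)) m) (solve 3 (λ x y z → x :+ (y :+ z) := y :+ (x :+ z)) refl _ _ _)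

spl-blk : ∀ (f F : Word → ℚ) m x → spl (λ p q → f p * F q) (blk m x) ≡
  conv (λ i → f (zs i)) (λ n → F (blk n x)) m + spl (λ p q → f (blk m p) * F q) x
spl-blk f F zero x = refl
spl-blk f F (suc m) x = trans (refl ⊞ spl-blk (λ p → f (x0 ∷ p)) F m x)
  (trans (sym (+-assoc _ _ _)) (sym (conv-first (λ i → f (zs i)) (λ n → F (blk n x)) m) ⊞ refl))

spl-ι : ∀ (f F : Word → ℚ) w → spl (λ p q → f p * F q) (ι w) ≡
  F [] * f (ι w) + spl (λ a q → lf (λ m q → conv (λ i → f (ιz a i)) (λ n → F (blk n (ι q))) m) q) w
spl-ι f F [] = trans (*-comm _ _) (sym (+-identityʳ _))
spl-ι f F (m ∷ w) = trans (spl-blk f F m (ι w)) (trans (refl ⊞ spl-ι (λ p → f (blk m p)) F w)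
  (solve 3 (λ x y z → x :+ (y :+ z) := y :+ (x :+ z)) refl _ _ _))

-- Until the block x₀^m x₁ has been passed, the left boundary is x₀. So only cuts that stop in front
-- of an x₁ count, with sign -1; these form the `L` part.
gaps-blk : ∀ Ψ F m w → gaps Ψ x0 F (blk m (ι w)) ≡
  gaps Ψ x1 (λ v → F (blk m v)) (ι w) + - spl (λ a q → conv (λ j → Ψ (ι′ j a)) (λ k → F (blk k (ι q))) m) w
gaps-blk Ψ F m w = go m F
  where
  cut : ∀ F m → spl (λ p q → gap x0 q * Ψ p * F q) (blk m (ι w)) ≡ - spl (λ a q → Ψ (ι′ m a) * F (x1 ∷ ι q)) w
  cut F m = trans (spl-cong {G = λ p q → ℚ.- 1ℚ * starts₁ (λ q → Ψ p * F (x1 ∷ q)) q} pointwise (blk m (ι w)))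
    (trans (spl-* (ℚ.- 1ℚ) (λ p q → starts₁ (λ q → Ψ p * F (x1 ∷ q)) q) (blk m (ι w)))
    (trans (cong (ℚ.- 1ℚ *_) (spl-starts₁ (λ p q → Ψ p * F (x1 ∷ q)) m w)) (solve 1 (λ x → con (ℚ.- 1ℚ) :* x := :- x) refl _)))
    where
    pointwise : ∀ p q → gap x0 q * Ψ p * F q ≡ ℚ.- 1ℚ * starts₁ (λ q → Ψ p * F (x1 ∷ q)) q
    pointwise p [] = trans (0* (zeroˡ _)) (sym (zeroʳ _))
    pointwise p (x0 ∷ q) = trans (0* (zeroˡ _)) (sym (zeroʳ _))
    pointwise p (x1 ∷ q) = *-assoc _ _ _
  go : ∀ m F → gaps Ψ x0 F (blk m (ι w)) ≡
    gaps Ψ x1 (λ v → F (blk m v)) (ι w) + - spl (λ a q → conv (λ j → Ψ (ι′ j a)) (λ k → F (blk k (ι q))) m) w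
  go zero F = trans (cut F zero ⊞ refl) (+-comm _ _)
  go (suc m) F = lin (cut F (suc m) ⊞ go m (λ v → F (x0 ∷ v)) ⊞
      cong -_ (sym (spl-+ (λ a q → Ψ (ι′ (suc m) a) * F (x1 ∷ ι q)) (λ a q → conv (λ j → Ψ (ι′ j a)) (λ k → F (x0 ∷ blk k (ι q))) m) w)))
    (solve 6 (λ a b c d e f → (a :+ b) :+ (:- c :+ (d :+ :- e) :+ :- f) := (d :+ :- f) :+ (a :+ b :+ :- (c :+ e))) refl _ _ _ _ _ _)

data In𝔥⁰′ : List ℕ → Set where
  nil : In𝔥⁰′ []
  cons : ∀ {m u} → In𝔥⁰′ (suc m ∷ u)

-- ε is the sign by which reversal acts on Ψ. `Ψ-depth1` and `c-ε` ask depth one and the correction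
-- `c` to be fixed by it, which is automatic for ε = 1.
module Racinet (natInverse : NatInverse) (Ψ : Word → ℚ) (kills : Sh.Kills Ψ) (Ψ-x₀ : Ψ (x0 ∷ []) ≡ 0ℚ)
  (ε : ℚ) (ε² : ε * ε ≡ 1ℚ) (Ψ-reverse : ∀ w → Ψ (reverse w) ≡ ε * Ψ w)
  (Ψ-depth1 : ∀ k i → ε * Ψ (blk k (zs i)) ≡ Ψ (blk k (zs i)))
  (c : ℕ → ℚ) (c-ε : ∀ n → ε * c n ≡ c n) (c₀ : c 0 ≡ 0ℚ) (c₁ : c 1 ≡ 0ℚ)
  (Ψ-st : ∀ a u b v → st (λ w → Ψ (ι w) + corr c w) (a ∷ u) (b ∷ v) ≡ 0ℚ) where
  open NatInverse natInverse

  P Q : ℕ → List ℕ → ℚ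
  P k a = Ψ (ιz a k) + δ₀ k * corr c a
  Q k a = Ψ (ι′ k a) + δ₀ k * corr c a

  corr-ε : ∀ c → (∀ n → ε * c n ≡ c n) → ∀ w → ε * corr c w ≡ corr c w
  corr-ε c e [] = e 0
  corr-ε c e (zero ∷ w) = corr-ε (λ n → c (suc n)) (λ n → e (suc n)) w
  corr-ε c e (suc _ ∷ w) = zeroʳ ε

  Q≡εP : ∀ k a → Q k a ≡ ε * P k (reverse a)
  Q≡εP k a = lin (cong (_* Ψ (ι′ k a)) (sym ε²) ⊞ (ε ⊠ sym (trans (cong Ψ (sym (reverse-ι′ k a))) (Ψ-reverse (ι′ k a))))
      ⊞ (δ₀ k ⊠ sym (corr-ε c c-ε a)) ⊞ ((δ₀ k * ε) ⊠ sym (corr-reverse c a)))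
    (solve 6 (λ p d κ ε q κ′ → (p :+ d :* κ) :+ ((ε :* ε) :* p :+ ε :* q :+ d :* (ε :* κ) :+ (d :* ε) :* κ′)
      := ε :* (q :+ d :* κ′) :+ (con 1ℚ :* p :+ ε :* (ε :* p) :+ d :* κ :+ (d :* ε) :* κ)) refl _ _ _ _ _ _)

  private
    δY-corr : ∀ c w → δY (corr c) w ≡ 0ℚ
    δY-corr c [] = refl
    δY-corr c (zero ∷ w) = 0+0 (zeroʳ _) (δY-corr (λ n → c (suc n)) w)
    δY-corr c (suc m ∷ w) = 0+0 (zeroʳ _) (zero-lin (δY-linear w) (λ _ → refl))

    δY-P : ∀ k w → δY (P k) w ≡ δY (λ a → Ψ (ιz a k)) w
    δY-P k w = trans (add (δY-linear w) (λ a → Ψ (ιz a k)) (λ a → δ₀ k * corr c a))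
      (+0 (trans (hom (δY-linear w) (δ₀ k) (corr c)) (*0 (δY-corr c w))))

    killed : ∀ v → sh Ψ (x0 ∷ []) v ≡ 0ℚ
    killed [] = Ψ-x₀
    killed (b ∷ v) = proj₂ kills x0 [] b v

    recurrence : ∀ k a → nat (suc k) * P (suc k) a ≡ - δY (P k) a
    recurrence k a = lin (trans (sym (sh-x₀ Ψ a k)) (killed (ιz a k)) ⊞ δY-P k a)
      (solve 5 (λ n p d x y → n :* (p :+ con 0ℚ :* d) :+ (con 0ℚ :+ x) := :- y :+ ((x :+ n :* p) :+ y)) refl _ _ (corr c a) _ _)

  -- Induction on the number of trailing x₀: Ψ kills x₀ ⧢ ι(a) x₀^k, so up to the factor k + 1 the
  -- functional P (k+1) is minus the stuffle derivation `δY` of P k, and derivations preserve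
  -- infinitesimal characters.
  P-kills : ∀ k → St.Kills (P k)
  P-kills zero = 0+0 (proj₁ kills) (*0 c₀) , λ a u b v →
    trans (St.st-cong (λ w → cong₂ _+_ (cong Ψ (ιz-0 w)) (*-identityˡ (corr c w))) (a ∷ u) (b ∷ v)) (Ψ-st a u b v)
  P-kills (suc k) = nat-cancel k (trans (recurrence k []) neg0) , λ a u b v → nat-cancel k
    (trans (sym (hom (St.st-linear (a ∷ u) (b ∷ v)) (nat (suc k)) (P (suc k))))
    (trans (St.st-cong (recurrence k) (a ∷ u) (b ∷ v))
    (trans (neg-lin (St.st-linear (a ∷ u) (b ∷ v)) (δY (P k)))
    (trans (cong -_ (trans (δY-st (P k) (a ∷ u) (b ∷ v)) (0+0
      (δY-[] (λ x → st (P k) x (b ∷ v)) (λ x w → proj₂ (P-kills k) x w b v) (a ∷ u)) (δY-[] (λ y → st (P k) (a ∷ u) y) (λ y w → proj₂ (P-kills k) a u y w) (b ∷ v))))) neg0))))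

  -- `Q` is `P` read backwards, up to ε, and the stuffle product commutes with reversal.
  Q-kills : ∀ k → St.Kills (Q k)
  Q-kills k = trans (Q≡εP k []) (*0 (proj₁ (P-kills k))) , λ a u b v →
    trans (St.st-cong (Q≡εP k) (a ∷ u) (b ∷ v)) (trans (hom (St.st-linear (a ∷ u) (b ∷ v)) ε (λ w → P k (reverse w)))
      (*0 (trans (st-reverse (P k) (a ∷ u) (b ∷ v)) (St.kills-≢ (P k) (P-kills k) (reverse (a ∷ u)) (reverse (b ∷ v)) (reverse≢[] a u) (reverse≢[] b v)))))
    where
    reverse≢[] : ∀ a u → reverse (a ∷ u) ≢ []
    reverse≢[] a u e = ∷ʳ≢[] (reverse u) (trans (sym (LP.unfold-reverse a u)) e)

  P-last≡Q-first : ∀ w → rl (λ a m → P m a) w ≡ lf (λ m a → Q m a) w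
  P-last≡Q-first [] = refl
  P-last≡Q-first (m ∷ w) = trans (rl-+ (λ a m → Ψ (ιz a m)) (λ a m → δ₀ m * corr c a) (m ∷ w))
    (main Ψ m w ⊞ corr-last-first c (m ∷ w))
    where
    main : ∀ F m w → rl (λ a n → F (ιz a n)) (m ∷ w) ≡ F (ι′ m w)
    main F m [] = refl
    main F m (b ∷ w) = trans (main (λ v → F (blk m v)) b w) (cong F (sym (ι′-∷ m b w)))

  -- For a single Y-letter the two sides are Ψ at x₀^i x₁ x₀^k and at its reversal: this is where
  -- parity enters.
  P≡Q-letter : ∀ k i → P k (i ∷ []) ≡ Q k (i ∷ [])
  P≡Q-letter k i = trans (cong (λ x → Ψ (blk i (zs k)) + δ₀ k * x) (corr-letter i)) (trans (cong (_+ δ₀ k * 0ℚ) swap)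
    (cong (λ x → Ψ (ι′ k (i ∷ [])) + δ₀ k * x) (sym (corr-letter i))))
    where
    corr-letter : ∀ i → corr c (i ∷ []) ≡ 0ℚ
    corr-letter zero = c₁
    corr-letter (suc i) = refl
    swap : Ψ (blk i (zs k)) ≡ Ψ (ι′ k (i ∷ []))
    swap = trans (sym (Ψ-depth1 i k)) (trans (sym (Ψ-reverse (blk i (zs k)))) (cong Ψ
      (trans (reverse-blk i (zs k)) (trans (cong (_++ x1 ∷ zs i) (reverse-zs k)) (trans (zs-++ k (zs i)) (sym (ι′-∷ k i [])))))))

  open StuffleCoderivation P Q P-kills Q-kills P-last≡Q-first P≡Q-letter public using (module Stuffle; C; R; L)

  strip : (List ℕ → ℚ) → List ℕ → ℚ
  strip G = spl (λ p q → corr c p * G q)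

  -- `Stuffle.s` is built from ψ_* and `sX` from ψ. The corrections in `R` and `L` act as the inner
  -- derivation [c , ·], and together with right multiplication by c they leave left multiplication
  -- by c, which is `strip`.
  bridge : ∀ F w → sX Ψ F (ι w) + strip (λ v → F (ι v)) w ≡ Stuffle.s (λ v → F (ι v)) w
  bridge F [] = trans (+-identityˡ _) (0* c₀)
  bridge F (m ∷ w) = lin
    (sX≡gaps Ψ (proj₁ kills) F (blk m (ι w)) ⊞ sym (gaps-x0 Ψ F (blk m (ι w))) ⊞ gaps-blk Ψ F m w
     ⊞ spl-ι Ψ F (m ∷ w) ⊞ sym (sX≡gaps Ψ (proj₁ kills) (λ v → F (blk m v)) (ι w)) ⊞ bridge (λ v → F (blk m v)) w ⊞ cut ⊞ sym κ-formula
     ⊞ (F [] ⊠ cong Ψ (sym (ιz-0 (m ∷ w)))))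
    (solve 18 (λ s st F₀ pz cr κ S g₁ g₀ h₁ A pι Bz sm Cz B stm _ →
      (s :+ st) :+ (g₁ :+ g₀ :+ (h₁ :+ :- A) :+ (F₀ :* pι :+ Bz) :+ sm :+ S :+ (F₀ :* cr :+ Cz) :+ κ :+ F₀ :* pz)
      := (F₀ :* (pz :+ con 1ℚ :* cr) :+ κ :+ S)
        :+ (s :+ (g₁ :+ :- B) :+ g₀ :+ B :+ h₁ :+ (sm :+ stm) :+ st :+ (Bz :+ Cz :+ :- (A :+ stm)) :+ F₀ :* pι))
      refl _ _ _ _ _ _ _ _ _ _ _ _ _ _ _ _ _ 0ℚ)
    where
    G : List ℕ → ℚ
    G v = F (ι v)
    X : List ℕ → ℕ → ℚ
    X q k = G (k ∷ q)
    conv-corr : ∀ (f : ℕ → ℚ) x Y m → conv (λ k → f k + δ₀ k * x) Y m ≡ conv f Y m + x * Y m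
    conv-corr f x Y m = trans (conv-+ f (λ k → δ₀ k * x) Y m) (refl ⊞ unit Y m)
      where
      unit : ∀ Y m → conv (λ k → δ₀ k * x) Y m ≡ x * Y m
      unit Y zero = cong (_* Y 0) (*-identityˡ x)
      unit Y (suc m) = trans (0+ (0* (zeroˡ x))) (unit (λ n → Y (suc n)) m)
    right : spl (λ p q → R p (X q)) (m ∷ w) ≡
      spl (λ a q → lf (λ m q → conv (λ i → Ψ (ιz a i)) (X q) m) q) (m ∷ w) + spl (λ a q → lf (λ m q → corr c a * G (m ∷ q)) q) (m ∷ w)
    right = trans (spl-rl (λ a m q → conv (λ k → P k a) (X q) m) (m ∷ w))
      (trans (spl-cong {H = λ a q → lf (λ m q → conv (λ k → P k a) (X q) m) q}
          {G = λ a q → lf (λ m q → conv (λ i → Ψ (ιz a i)) (X q) m) q + lf (λ m q → corr c a * G (m ∷ q)) q}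
         (λ { a [] → sym (+-identityˡ 0ℚ) ; a (m ∷ q) → conv-corr (λ i → Ψ (ιz a i)) (corr c a) (X q) m }) (m ∷ w))
        (spl-+ (λ a q → lf (λ m q → conv (λ i → Ψ (ιz a i)) (X q) m) q) (λ a q → lf (λ m q → corr c a * G (m ∷ q)) q) (m ∷ w)))
    left : spl (λ p q → L p (X q)) (m ∷ w) ≡ spl (λ a q → conv (λ j → Ψ (ι′ j a)) (X q) m) w + strip (λ v → G (m ∷ v)) w
    left = trans (+-identityˡ _) (trans (spl-cong (λ a q → conv-corr (λ i → Ψ (ι′ i a)) (corr c a) (X q) m) w) (spl-+ _ _ w))
    κ-formula : Stuffle.κ G (m ∷ w) ≡ _
    κ-formula = trans (spl-+ (λ p q → R p (X q)) (λ p q → - L p (X q)) (m ∷ w))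
      (right ⊞ trans (neg-lin (spl-linear (m ∷ w)) (λ t → L (proj₁ t) (X (proj₂ t)))) (cong -_ left))
    cut : strip G (m ∷ w) ≡ G [] * corr c (m ∷ w) + spl (λ a q → lf (λ m q → corr c a * G (m ∷ q)) q) (m ∷ w)
    cut = trans (spl-cong {H = λ a q → corr c a * G q} {G = λ a q → ifNil q (G [] * corr c a) + lf (λ m q → corr c a * G (m ∷ q)) q}
        (λ { a [] → trans (*-comm _ _) (sym (+-identityʳ _)) ; a (m ∷ q) → sym (+-identityˡ _) }) (m ∷ w))
      (trans (spl-+ (λ a q → ifNil q (G [] * corr c a)) (λ a q → lf (λ m q → corr c a * G (m ∷ q)) q) (m ∷ w)) (spl-end (λ a → G [] * corr c a) (m ∷ w) ⊞ refl))

  strip-𝔥⁰ : ∀ G u → In𝔥⁰′ u → strip G u ≡ 0ℚ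
  strip-𝔥⁰ G [] nil = 0* c₀
  strip-𝔥⁰ G (suc m ∷ u) cons = 0+0 (0* c₀) (spl-zero u (λ p q → zeroˡ _))

  -- If u is nonempty it starts with y_n, n ≥ 2, and any prefix of the product that uses letters of
  -- u contains a letter beyond y₁. Hence the powers of y₁ read by `corr` come from v alone.
  strip-st : ∀ G u v → In𝔥⁰′ u → st (strip G) u v ≡ strip (λ y → st G u y) v
  strip-st G u v h = trans (st-spl′ u v) (trans (outer u h) refl)
    where
    product : ∀ u₁ u₂ v₁ v₂ → st (λ a → st (λ b → corr c a * G b) u₂ v₂) u₁ v₁ ≡ st (corr c) u₁ v₁ * st G u₂ v₂
    product u₁ u₂ v₁ v₂ = trans (St.st-cong (λ a → trans (hom (St.st-linear u₂ v₂) (corr c a) G) (*-comm _ _)) u₁ v₁)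
      (trans (hom (St.st-linear u₁ v₁) (st G u₂ v₂) (corr c)) (*-comm _ _))
    st-spl′ : ∀ u v → st (strip G) u v ≡ spl (λ u₁ u₂ → spl (λ v₁ v₂ → st (corr c) u₁ v₁ * st G u₂ v₂) v) u
    st-spl′ u v = trans (St.st-spl (λ p q → corr c p * G q) u v) (spl-cong (λ u₁ u₂ → spl-cong (λ v₁ v₂ → product u₁ u₂ v₁ v₂) v) u)
    outer : ∀ u → In𝔥⁰′ u → spl (λ u₁ u₂ → spl (λ v₁ v₂ → st (corr c) u₁ v₁ * st G u₂ v₂) v) u ≡ strip (λ y → st G u y) v
    outer [] nil = refl
    outer (suc m ∷ u) cons = +0 (spl-zero u (λ p q → spl-zero v (λ v₁ v₂ → 0* (st-pos (corr c) (suc m ∷ p) v₁ (λ w → corr-pos c) here))))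

  -- Convergence of u disposes of the correction: `strip` vanishes on u and commutes with the
  -- product by u. `ιinv` only reads the Y-word back from an X-word.
  racinet : (ιinv : Word → List ℕ) → (∀ w → ιinv (ι w) ≡ w) → ∀ F u v → In𝔥⁰′ u →
    st (λ w → sX Ψ F (ι w)) u v ≡ sX Ψ (λ z → st (λ w → F (ι w)) (ιinv z) v) (ι u) + sX Ψ (λ z → st (λ w → F (ι w)) u (ιinv z)) (ι v)
  racinet ιinv inverse F u v h = lin
    (trans (sym (add (St.st-linear u v) (λ w → sX Ψ F (ι w)) (strip G))) (trans (St.st-cong (bridge F) u v) (Stuffle.s-st G u v))
     ⊞ sym (strip-st G u v h)
     ⊞ sym (trans (bridge (λ z → st G (ιinv z) v) u) (Stuffle.s-cong (λ x → cong (λ y → st G y v) (inverse x)) u))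
     ⊞ sym (trans (bridge (λ z → st G u (ιinv z)) v) (Stuffle.s-cong (λ x → cong (λ y → st G u y) (inverse x)) v))
     ⊞ strip-𝔥⁰ (λ x → st G (ιinv (ι x)) v) u h
     ⊞ cong-lin (spl-linear v) (λ t → cong (λ y → corr c (proj₁ t) * st G u y) (inverse (proj₂ t))))
    (solve 9 (λ T Zst s₁ s₂ Z₂ U₁ Z₁ U₂ Z₂′ → T :+ ((s₁ :+ s₂) :+ Zst :+ (U₁ :+ Z₁) :+ (U₂ :+ Z₂′) :+ con 0ℚ :+ Z₂)
      := (U₁ :+ U₂) :+ ((T :+ Zst) :+ Z₂ :+ s₁ :+ s₂ :+ Z₁ :+ Z₂′)) refl _ _ _ _ _ _ _ _ _)
    where
    G : List ℕ → ℚ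
    G w = F (ι w)

-- Coefficients, tensors, ideals and the double shuffle relations

module FreeAlgProperties {A : Set} (_≟A_ : DecidableEquality A) where
  open FreeAlg _≟A_ using () renaming (Poly to FPoly; coeff to fcoeff; Tens to FTens; coeff₂ to fcoeff₂; _⊗_ to _⊗F_; linT to flinT; _·₂_ to _·F_; word to fword; IsPrimitive to FIsPrimitive)
  open Coefficients (LP.≡-dec _≟A_) public

  coeff-ev : ∀ f w → fcoeff f w ≡ ev (δ w) f
  coeff-ev [] w = refl
  coeff-ev ((c , u) ∷ f) w with LP.≡-dec _≟A_ u w
  ... | yes _ = trans (+-def _ _) (sym (*-identityʳ c) ⊞ coeff-ev f w)
  ... | no _ = trans (coeff-ev f w) (sym (0+ (zeroʳ c)))

  δ-∷ : ∀ a u b v → δ (a ∷ u) (b ∷ v) ≡ δ (a ∷ []) (b ∷ []) * δ u v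
  δ-∷ a u b v = go (b ≟A a) (LP.≡-dec _≟A_ v u)
    where
    go : Dec (b ≡ a) → Dec (v ≡ u) → δ (a ∷ u) (b ∷ v) ≡ δ (a ∷ []) (b ∷ []) * δ u v
    go (no ne) _ = trans (δ-≢ (λ e → ne (LP.∷-injectiveˡ e))) (sym (0* (δ-≢ (λ e → ne (LP.∷-injectiveˡ e)))))
    go (yes _) (no ne) = trans (δ-≢ (λ e → ne (LP.∷-injectiveʳ e))) (sym (*0 (δ-≢ ne)))
    go (yes refl) (yes refl) = trans (δ-refl (b ∷ v)) (sym (trans (cong₂ _*_ (δ-refl (b ∷ [])) (δ-refl v)) (*-identityˡ 1ℚ)))

  δ₂ : List A → List A → List A × List A → ℚ
  δ₂ u v (a , b) = δ u a * δ v b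

  coeff₂-ev : ∀ T u v → fcoeff₂ T u v ≡ ev (δ₂ u v) T
  coeff₂-ev [] u v = refl
  coeff₂-ev ((c , a , b) ∷ T) u v with LP.≡-dec _≟A_ a u | LP.≡-dec _≟A_ b v
  ... | yes _ | yes _ = trans (+-def _ _) (solve 1 (λ c → c := c :* (con 1ℚ :* con 1ℚ)) refl c ⊞ coeff₂-ev T u v)
  ... | yes _ | no _ = trans (coeff₂-ev T u v) (sym (0+ (*0 (zeroʳ _))))
  ... | no _ | yes _ = trans (coeff₂-ev T u v) (sym (0+ (*0 (zeroˡ _))))
  ... | no _ | no _ = trans (coeff₂-ev T u v) (sym (0+ (*0 (zeroˡ _))))

  ev-⊗ : ∀ (F : List A × List A → ℚ) f g → ev F (f ⊗F g) ≡ ev (λ u → ev (λ v → F (u , v)) g) f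
  ev-⊗ F f g = ev-bind F _ _ (λ c u → trans (ev-scaleMap F (u ,_) c g) refl) f

  ev-linT : ∀ F φ f → ev F (flinT φ f) ≡ ev (λ w → ev F (φ w)) f
  ev-linT F φ f = ev-bind F _ _ (λ c w → ev-scale F c (φ w)) f

  ev-·₂ : ∀ (F : List A × List A → ℚ) S T → ev F (S ·F T) ≡ ev (λ s → ev (λ t → F (proj₁ s ++ proj₁ t , proj₂ s ++ proj₂ t)) T) S
  ev-·₂ F S T = ev-bind F _ _ (λ c s → ev-scaleMap F (λ t → proj₁ s ++ proj₁ t , proj₂ s ++ proj₂ t) c T) S

  coeff-unit-right : ∀ f u v → ev (δ₂ u v) (f ⊗F fword []) ≡ fcoeff f u * δ v []
  coeff-unit-right f u v = trans (ev-⊗ (δ₂ u v) f (fword [])) (trans (ev-cong (λ x → trans (ev-single (λ y → δ₂ u v (x , y)) []) (*-comm _ _)) f)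
    (trans (ev-* (δ v []) (δ u) f) (trans (*-comm _ _) (cong (_* δ v []) (sym (coeff-ev f u))))))

  coeff-unit-left : ∀ f u v → ev (δ₂ u v) (fword [] ⊗F f) ≡ δ u [] * fcoeff f v
  coeff-unit-left f u v = trans (ev-⊗ (δ₂ u v) (fword []) f) (trans (ev-single (λ x → ev (λ y → δ₂ u v (x , y)) f) []) (trans (ev-* (δ u []) (δ v) f) (cong (δ u [] *_) (sym (coeff-ev f v)))))

  δ-[]∷ : ∀ a u → δ (a ∷ u) [] ≡ 0ℚ
  δ-[]∷ a u = δ-≢ {[]} {a ∷ u} (λ ())

  coproduct : (List A → FTens) → FPoly → List A → List A → ℚ
  coproduct Δ ψ u v = ev (λ w → ev (δ₂ u v) (Δ w)) ψ

  private
    coeff₂-sum : ∀ f u v → fcoeff₂ ((f ⊗F fword []) ++ (fword [] ⊗F f)) u v ≡ fcoeff f u * δ v [] + δ u [] * fcoeff f v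
    coeff₂-sum f u v = trans (coeff₂-ev ((f ⊗F fword []) ++ (fword [] ⊗F f)) u v)
      (trans (ev-++ (δ₂ u v) (f ⊗F fword []) (fword [] ⊗F f)) (coeff-unit-right f u v ⊞ coeff-unit-left f u v))

    coeff₂-linT : ∀ Δ f u v → fcoeff₂ (flinT Δ f) u v ≡ coproduct Δ f u v
    coeff₂-linT Δ f u v = trans (coeff₂-ev (flinT Δ f) u v) (ev-linT (δ₂ u v) Δ f)

  primitive⇒ : ∀ Δ ψ → FIsPrimitive Δ ψ → ∀ u v → coproduct Δ ψ u v ≡ fcoeff ψ u * δ v [] + δ u [] * fcoeff ψ v
  primitive⇒ Δ ψ p u v = trans (sym (coeff₂-linT Δ ψ u v)) (trans (p u v) (coeff₂-sum ψ u v))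

  ⇒primitive : ∀ Δ ψ → (∀ u v → coproduct Δ ψ u v ≡ fcoeff ψ u * δ v [] + δ u [] * fcoeff ψ v) → FIsPrimitive Δ ψ
  ⇒primitive Δ ψ p u v = trans (coeff₂-linT Δ ψ u v) (trans (p u v) (sym (coeff₂-sum ψ u v)))

module FX = FreeAlgProperties _≟L_
module FN = FreeAlgProperties ℕ._≟_
open FX public using (coeff-ev)

≈⇒~ : ∀ f g → f ≈ g → f ~ g
≈⇒~ f g e = FX.δ-test (λ w → trans (sym (coeff-ev f w)) (trans (e w) (coeff-ev g w)))

~⇒≈ : ∀ {f g} → f ~ g → f ≈ g
~⇒≈ {f} {g} e w = trans (coeff-ev f w) (trans (at e _) (sym (coeff-ev g w)))

ev-prefix : ∀ F a f → ev F (PX.prefix a f) ≡ ev (λ w → F (a ∷ w)) f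
ev-prefix F a f = ev-mapʳ F (a ∷_) f

ev-shW : ∀ F u v → ev F (shW u v) ≡ sh F u v
ev-shW F [] v = ev-single F v
ev-shW F (a ∷ u) [] = ev-single F (a ∷ u)
ev-shW F (a ∷ u) (b ∷ v) = trans (ev-++ F (PX.prefix a (shW u (b ∷ v))) _)
  (trans (trans (ev-prefix F a (shW u (b ∷ v))) (ev-shW _ u (b ∷ v)) ⊞ trans (ev-prefix F b (shW (a ∷ u) v)) (ev-shW _ (a ∷ u) v)) (sym (+-identityʳ _)))

ev-shP : ∀ F f g → ev F (shP f g) ≡ ev (λ u → ev (λ v → sh F u v) g) f
ev-shP F f g = ev-bind F _ _ (λ c u → trans
  (ev-bind F _ (λ v → c * sh F u v) (λ d v → trans (ev-scale F (c ℚ.* d) (shW u v)) (trans (cong₂ _*_ (*-def c d) (ev-shW F u v))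
    (solve 3 (λ c d x → (c :* d) :* x := d :* (c :* x)) refl _ _ _))) g)
  (ev-* c (λ v → sh F u v) g)) f

ev-⊖ : ∀ (F : Word → ℚ) f g → ev F (f ⊖ g) ≡ ev F f + - ev F g
ev-⊖ F f g = trans (ev-++ F f _) (cong (ev F f +_) (trans (ev-scale F (ℚ.- 1ℚ) g) (solve 1 (λ x → con (ℚ.- 1ℚ) :* x := :- x) refl _)))

ev-linP : ∀ F φ f → ev F (linP φ f) ≡ ev (λ w → ev F (φ w)) f
ev-linP F φ f = ev-bind F _ _ (λ c w → ev-scale F c (φ w)) f

sh₂ : (Word → ℚ) → Poly → Poly → ℚ
sh₂ F f g = ev (λ u → ev (λ v → sh F u v) g) f

sh₂-linearʳ : ∀ F f → (∀ g h → sh₂ F f (g ++ h) ≡ sh₂ F f g + sh₂ F f h)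
sh₂-linearʳ F f g h = trans (ev-cong (λ u → ev-++ (sh F u) g h) f) (ev-+ _ _ f)

sh₂-scaleʳ : ∀ F f c g → sh₂ F f (scale c g) ≡ c * sh₂ F f g
sh₂-scaleʳ F f c g = trans (ev-cong (λ u → ev-scale (sh F u) c g) f) (ev-* c _ f)

sh₂-comm : ∀ F f g → sh₂ F f g ≡ sh₂ F g f
sh₂-comm F f g = trans (ev-swap _ f g) (ev-cong (λ v → ev-cong (λ u → Sh.st-comm F u v) f) g)

sh₂-cong : ∀ F {f f′ g g′} → f ~ f′ → g ~ g′ → sh₂ F f g ≡ sh₂ F f′ g′
sh₂-cong F {f} {f′} {g} {g′} e e′ = trans (ev-cong (λ u → at e′ (sh F u)) f) (at e _)

shP-cong : ∀ {f f′ g g′} → f ~ f′ → g ~ g′ → shP f g ~ shP f′ g′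
shP-cong {f} {f′} {g} {g′} e e′ = tested λ F → trans (ev-shP F f g) (trans (sh₂-cong F e e′) (sym (ev-shP F f′ g′)))

shP-comm : ∀ f g → shP f g ~ shP g f
shP-comm f g = tested λ F → trans (ev-shP F f g) (trans (sh₂-comm F f g) (sym (ev-shP F g f)))

shP-assoc : ∀ f g h → shP (shP f g) h ~ shP f (shP g h)
shP-assoc f g h = tested λ F → trans (ev-shP F (shP f g) h) (trans (ev-shP _ f g)
  (trans (ev-cong (λ u → ev-cong (λ v → trans (sym (Sh.lin-st (ev-linear h) (λ w x → sh F x w) u v)) (ev-cong (λ w → Sh.st-assoc F u v w) h)) g) f)
  (trans (ev-cong (λ u → sym (ev-shP (λ y → sh F u y) g h)) f) (sym (ev-shP F f (shP g h))))))

shP-++ʳ : ∀ f g h → shP f (g ++ h) ~ shP f g ++ shP f h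
shP-++ʳ f g h = tested λ F → trans (ev-shP F f (g ++ h)) (trans (sh₂-linearʳ F f g h)
  (trans (sym (ev-shP F f g) ⊞ sym (ev-shP F f h)) (sym (ev-++ F (shP f g) (shP f h)))))

shP-[]ʳ : ∀ f → shP f [] ~ []
shP-[]ʳ f = tested λ F → trans (ev-shP F f []) (ev-zero f (λ _ → refl))

shP-unitˡ : ∀ f → shP (word []) f ~ f
shP-unitˡ f = tested λ F → trans (ev-shP F (word []) f) (ev-single (λ u → ev (λ v → sh F u v) f) [])

shP-unitʳ : ∀ f → shP f (word []) ~ f
shP-unitʳ f = ~-trans (shP-comm f (word [])) (shP-unitˡ f)

scale-cong : ∀ c {f g : Poly} → f ~ g → scale c f ~ scale c g
scale-cong c {f} {g} e = tested λ F → trans (ev-scale F c f) (trans (c ⊠ at e F) (sym (ev-scale F c g)))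

⊕-cong : ∀ {f f′ g g′ : Poly} → f ~ f′ → g ~ g′ → f ⊕ g ~ f′ ⊕ g′
⊕-cong {f} {f′} {g} {g′} e e′ = tested λ F → trans (ev-++ F f g) (trans (at e F ⊞ at e′ F) (sym (ev-++ F f′ g′)))

shP-scaleʳ : ∀ f c g → shP f (scale c g) ~ scale c (shP f g)
shP-scaleʳ f c g = tested λ F → trans (ev-shP F f (scale c g)) (trans (sh₂-scaleʳ F f c g) (trans (c ⊠ sym (ev-shP F f g)) (sym (ev-scale F c (shP f g)))))

shP-scaleˡ : ∀ f c g → shP (scale c f) g ~ scale c (shP f g)
shP-scaleˡ f c g = ~-trans (shP-comm (scale c f) g) (~-trans (shP-scaleʳ g c f) (scale-cong c (shP-comm g f)))

module Ideal {G : Set} (g : G → Poly) where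

  record I (f : Poly) : Set where
    constructor member
    field certificate : InShIdeal g f

  open I public

  private
    J : List (Poly × G) → Poly
    J l = concatMap (λ p → shP (proj₁ p) (g (proj₂ p))) l

    J-++ : ∀ l l′ → J (l ++ l′) ≡ J l ++ J l′
    J-++ l l′ = LP.concatMap-++ _ l l′

    make : ∀ {f} l → f ~ J l → I f
    make l e = member (l , ~⇒≈ e)

    open′ : ∀ f (p : InShIdeal g f) → f ~ J (proj₁ p)
    open′ f (l , e) = ≈⇒~ f (J l) e

  I-~ : ∀ {f f′} → f ~ f′ → I f → I f′
  I-~ {f} e (member p) = make (proj₁ p) (~-trans (~-sym e) (open′ f p))

  I-zero : ∀ {f} → f ~ [] → I f
  I-zero e = make [] e

  I-⊕ : ∀ {f f′} → I f → I f′ → I (f ⊕ f′)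
  I-⊕ {f} {f′} (member p) (member p′) = make (proj₁ p ++ proj₁ p′)
    (~-trans (⊕-cong (open′ f p) (open′ f′ p′)) (tested λ F → cong (ev F) (sym (J-++ (proj₁ p) (proj₁ p′)))))

  I-shP : ∀ q {f} → I f → I (shP q f)
  I-shP q {f} (member p) = make (map (λ t → shP q (proj₁ t) , proj₂ t) (proj₁ p)) (~-trans (shP-cong (~-refl {p = q}) (open′ f p)) (go (proj₁ p)))
    where
    go : ∀ l → shP q (J l) ~ J (map (λ t → shP q (proj₁ t) , proj₂ t) l)
    go [] = shP-[]ʳ q
    go ((r , i) ∷ l) = ~-trans (shP-++ʳ q (shP r (g i)) (J l)) (⊕-cong (~-sym (shP-assoc q r (g i))) (go l))

  I-shPˡ : ∀ {f} q → I f → I (shP f q)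
  I-shPˡ {f} q p = I-~ (shP-comm q f) (I-shP q p)

  I-gen : ∀ i → I (g i)
  I-gen i = make ((word [] , i) ∷ []) (~-trans (~-sym (shP-unitˡ (g i))) (tested λ F → sym (trans (ev-++ F (shP (word []) (g i)) []) (+-identityʳ _))))

  I-scale : ∀ c {f} → I f → I (scale c f)
  I-scale c {f} p = I-~ (~-trans (shP-scaleˡ (word []) c f) (scale-cong c (shP-unitˡ f))) (I-shP (scale c (word [])) p)

  I-⊖ : ∀ {f f′} → I f → I f′ → I (f ⊖ f′)
  I-⊖ p p′ = I-⊕ p (I-scale (ℚ.- 1ℚ) p′)

  I-linP : ∀ φ f → All (λ t → I (φ (proj₂ t))) f → I (linP φ f)
  I-linP φ [] [] = I-zero ~-refl
  I-linP φ ((c , w) ∷ f) (p ∷ ps) = I-⊕ (I-scale c p) (I-linP φ f ps)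

  I-elim : ∀ (Q : Poly → Set) → (∀ {f f′} → f ~ f′ → Q f → Q f′) → Q [] → (∀ {f f′} → Q f → Q f′ → Q (f ⊕ f′)) →
           (∀ p i → Q (shP p (g i))) → ∀ {f} → I f → Q f
  I-elim Q Q-~ Q-zero Q-⊕ Q-gen {f} (member p) = Q-~ (~-sym (open′ f p)) (go (proj₁ p))
    where
    go : ∀ l → Q (J l)
    go [] = Q-zero
    go ((p , i) ∷ l) = Q-⊕ (Q-gen p i) (go l)

module IR = Ideal rgen
module IK = Ideal kgen

piY′ : ℕ → Word → Maybe (List ℕ)
piY′ zero [] = just []
piY′ (suc k) [] = nothing
piY′ k (x0 ∷ w) = piY′ (suc k) w
piY′ k (x1 ∷ w) = Maybe.map (k ∷_) (piY′ zero w)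

piYAux-suc : ∀ k w → piYAux k w ≡ Maybe.map (map suc) (piY′ k w)
piYAux-suc zero [] = refl
piYAux-suc (suc k) [] = refl
piYAux-suc zero (x0 ∷ w) = piYAux-suc 1 w
piYAux-suc (suc k) (x0 ∷ w) = piYAux-suc (suc (suc k)) w
piYAux-suc zero (x1 ∷ w) = trans (cong (Maybe.map (1 ∷_)) (piYAux-suc zero w)) (commute (piY′ zero w))
  where
  commute : ∀ m → Maybe.map (1 ∷_) (Maybe.map (map suc) m) ≡ Maybe.map (map suc) (Maybe.map (0 ∷_) m)
  commute (just _) = refl
  commute nothing = refl
piYAux-suc (suc k) (x1 ∷ w) = trans (cong (Maybe.map (suc (suc k) ∷_)) (piYAux-suc zero w)) (commute (piY′ zero w))
  where
  commute : ∀ m → Maybe.map (suc (suc k) ∷_) (Maybe.map (map suc) m) ≡ Maybe.map (map suc) (Maybe.map (suc k ∷_) m)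
  commute (just _) = refl
  commute nothing = refl

ιinv : Word → List ℕ
ιinv w = Data.Maybe.fromMaybe [] (piY′ zero w)

ιinvW-suc : ∀ w → ιinvW w ≡ map suc (ιinv w)
ιinvW-suc w = trans (cong (Data.Maybe.fromMaybe []) (piYAux-suc zero w)) (from (piY′ zero w))
  where
  from : ∀ m → Data.Maybe.fromMaybe [] (Maybe.map (map suc) m) ≡ map suc (Data.Maybe.fromMaybe [] m)
  from (just _) = refl
  from nothing = refl

piY′-blk : ∀ k m x → piY′ k (blk m x) ≡ Maybe.map ((k ℕ.+ m) ∷_) (piY′ zero x)
piY′-blk zero zero x = refl
piY′-blk (suc k) zero x = cong (λ n → Maybe.map (n ∷_) (piY′ zero x)) (sym (ℕP.+-identityʳ (suc k)))
piY′-blk zero (suc m) x = piY′-blk 1 m x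
piY′-blk (suc k) (suc m) x = trans (piY′-blk (suc (suc k)) m x) (cong (λ n → Maybe.map (n ∷_) (piY′ zero x)) (cong suc (sym (ℕP.+-suc k m))))

piY′-ι : ∀ w → piY′ zero (ι w) ≡ just w
piY′-ι [] = refl
piY′-ι (m ∷ w) = trans (piY′-blk zero m (ι w)) (cong (Maybe.map (m ∷_)) (piY′-ι w))

ιinv-ι : ∀ w → ιinv (ι w) ≡ w
ιinv-ι w = cong (Data.Maybe.fromMaybe []) (piY′-ι w)

replicate-blk : ∀ m x → replicate m x0 ++ x1 ∷ x ≡ blk m x
replicate-blk zero x = refl
replicate-blk (suc m) x = cong (x0 ∷_) (replicate-blk m x)

ιW-suc : ∀ w → ιW (map suc w) ≡ ι w
ιW-suc [] = refl
ιW-suc (m ∷ w) = trans (replicate-blk m (ιW (map suc w))) (cong (blk m) (ιW-suc w))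

ev-stW : ∀ F u v → ev F (stW (map suc u) (map suc v)) ≡ st (λ w → F (map suc w)) u v
ev-stW F [] v = ev-single F _
ev-stW F (i ∷ u) [] = ev-single F _
ev-stW F (i ∷ u) (j ∷ v) = trans (ev-++ F (PN.prefix (suc i) (stW (map suc u) (map suc (j ∷ v))) ++ _) _)
  (trans (ev-++ F (PN.prefix (suc i) (stW (map suc u) (map suc (j ∷ v)))) _) (step i u (j ∷ v) ⊞ step j (i ∷ u) v)
   ⊞ trans (cong (λ n → ev F (PN.prefix (suc n) (stW (map suc u) (map suc v)))) (ℕP.+-suc i j)) (step (suc (i ℕ.+ j)) u v))
  where
  step : ∀ k x y → ev F (PN.prefix (suc k) (stW (map suc x) (map suc y))) ≡ st (λ w → F (map suc (k ∷ w))) x y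
  step k x y = trans (ev-mapʳ F (suc k ∷_) (stW (map suc x) (map suc y))) (ev-stW (λ w → F (suc k ∷ w)) x y)

rel : Word → Word → Poly
rel x y = shW x y ⊖ ιP (stW (ιinvW x) (ιinvW y))

ev-rel : ∀ F x y → ev F (rel x y) ≡ sh F x y + - st (λ w → F (ι w)) (ιinv x) (ιinv y)
ev-rel F x y = trans (ev-⊖ F (shW x y) _) (ev-shW F x y ⊞ cong -_ (trans (ev-mapʳ F ιW (stW (ιinvW x) (ιinvW y)))
  (trans (cong₂ (λ u v → ev (λ w → F (ιW w)) (stW u v)) (ιinvW-suc x) (ιinvW-suc y))
    (trans (ev-stW (λ w → F (ιW w)) (ιinv x) (ιinv y)) (St.st-cong (λ w → cong F (ιW-suc w)) (ιinv x) (ιinv y))))))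

In𝔥¹-ι : ∀ w → ∃ λ m → ∃ λ b → w ++ x1 ∷ [] ≡ ι (m ∷ b)
In𝔥¹-ι [] = 0 , [] , refl
In𝔥¹-ι (x0 ∷ w) with In𝔥¹-ι w
... | m , b , e = suc m , b , cong (x0 ∷_) e
In𝔥¹-ι (x1 ∷ w) with In𝔥¹-ι w
... | m , b , e = 0 , m ∷ b , cong (x1 ∷_) e

from-𝔥¹ : ∀ {v} → In𝔥¹ v → ∃ λ b → v ≡ ι b
from-𝔥¹ (inj₁ e) = [] , e
from-𝔥¹ (inj₂ (w , e)) with In𝔥¹-ι w
... | m , b , e′ = m ∷ b , trans e e′

from-𝔥⁰ : ∀ {u} → In𝔥⁰ u → ∃ λ a → In𝔥⁰′ a × u ≡ ι a
from-𝔥⁰ (inj₁ e) = [] , nil , e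
from-𝔥⁰ (inj₂ (w , e)) with In𝔥¹-ι w
... | m , b , e′ = suc m ∷ b , cons , trans e (cong (x0 ∷_) e′)

ends-x₁ : ∀ m b → ∃ λ w → ι (m ∷ b) ≡ w ++ x1 ∷ []
ends-x₁ zero [] = [] , refl
ends-x₁ zero (m ∷ b) with ends-x₁ m b
... | w , e = x1 ∷ w , cong (x1 ∷_) e
ends-x₁ (suc m) b with ends-x₁ m b
... | w , e = x0 ∷ w , cong (x0 ∷_) e

to-𝔥¹ : ∀ b → In𝔥¹ (ι b)
to-𝔥¹ [] = inj₁ refl
to-𝔥¹ (m ∷ b) = inj₂ (ends-x₁ m b)

to-𝔥⁰ : ∀ {a} → In𝔥⁰′ a → In𝔥⁰ (ι a)
to-𝔥⁰ nil = inj₁ refl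
to-𝔥⁰ (cons {m} {u}) with ends-x₁ m u
... | w , e = inj₂ (w , cong (x0 ∷_) e)

rel∈R : ∀ {a} b → In𝔥⁰′ a → IR.I (rel (ι a) (ι b))
rel∈R {a} b h = IR.I-gen (gds (ι a) (ι b) (to-𝔥⁰ h) (to-𝔥¹ b))

-- D_ψ preserves the double shuffle ideal

module _ {B : Set} {P : B → Set} (P? : ∀ b → Dec (P b)) where

  restrict : List (ℚ × B) → List (ℚ × B)
  restrict [] = []
  restrict ((c , b) ∷ p) with P? b
  ... | yes _ = (c , b) ∷ restrict p
  ... | no _ = restrict p

  restrict-All : ∀ p → All (λ t → P (proj₂ t)) (restrict p)
  restrict-All [] = []
  restrict-All ((c , b) ∷ p) with P? b
  ... | yes q = q ∷ restrict-All p
  ... | no _ = restrict-All p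

  private
    outside : (B → ℚ) → B → ℚ
    outside F b with P? b
    ... | yes _ = 0ℚ
    ... | no _ = F b

    split : ∀ F p → ev F p ≡ ev F (restrict p) + ev (outside F) p
    split F [] = sym (+-identityˡ 0ℚ)
    split F ((c , b) ∷ p) with P? b
    ... | yes _ = lin (split F p) (solve 5 (λ c x e f o → (c :* x :+ e) :+ (f :+ o) := ((c :* x :+ f) :+ (c :* con 0ℚ :+ o)) :+ e) refl _ _ _ _ _)
    ... | no _ = lin (split F p) (solve 4 (λ x e f o → (x :+ e) :+ (f :+ o) := (f :+ (x :+ o)) :+ e) refl _ _ _ _)

  -- Testing against functionals cut down to the complement of `P` shows that the discarded terms
  -- cancel.
  restrict-~ : ∀ p → (∀ F → (∀ b → P b → F b ≡ 0ℚ) → ev F p ≡ 0ℚ) → p ~ restrict p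
  restrict-~ p z = tested λ F → trans (split F p) (+0 (z (outside F) (vanish F)))
    where
    vanish : ∀ F b → P b → outside F b ≡ 0ℚ
    vanish F b q with P? b
    ... | yes _ = refl
    ... | no ¬q = ⊥-elim (¬q q)

cutsP : (Word → Word → ℚ) → Word → Poly
cutsP c [] = (c [] [] , []) ∷ []
cutsP c (a ∷ w) = (c [] (a ∷ w) , a ∷ w) ∷ cutsP (λ p q → c (a ∷ p) q) w

ev-cutsP : ∀ F c w → ev F (cutsP c w) ≡ spl (λ p q → c p q * F q) w
ev-cutsP F c [] = +-identityʳ _
ev-cutsP F c (a ∷ w) = refl ⊞ ev-cutsP F (λ p q → c (a ∷ p) q) w

gapsP : (Word → ℚ) → Letter → Word → Poly
gapsP Ψ a [] = (gap a [] * Ψ [] , []) ∷ []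
gapsP Ψ a (b ∷ w) = cutsP (λ p q → gap a q * Ψ p) (b ∷ w) ⊕ PX.prefix b (gapsP Ψ b w)

ev-gapsP : ∀ F Ψ a w → ev F (gapsP Ψ a w) ≡ gaps Ψ a F w
ev-gapsP F Ψ a [] = +-identityʳ _
ev-gapsP F Ψ a (b ∷ w) = trans (ev-++ F (cutsP (λ p q → gap a q * Ψ p) (b ∷ w)) _)
  (ev-cutsP F (λ p q → gap a q * Ψ p) (b ∷ w) ⊞ trans (ev-prefix F b (gapsP Ψ b w)) (ev-gapsP (λ w → F (b ∷ w)) Ψ b w))

D : (Word → ℚ) → Poly → Poly
D Ψ = linP (gapsP Ψ x1)

ev-D : ∀ F Ψ f → Ψ [] ≡ 0ℚ → ev F (D Ψ f) ≡ ev (sX Ψ F) f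
ev-D F Ψ f z = trans (ev-linP F (gapsP Ψ x1) f) (ev-cong (λ w → trans (ev-gapsP F Ψ x1 w) (sym (sX≡gaps Ψ z F w))) f)

D-~ : ∀ Ψ {f g} → Ψ [] ≡ 0ℚ → f ~ g → D Ψ f ~ D Ψ g
D-~ Ψ {f} {g} z e = tested λ F → trans (ev-D F Ψ f z) (trans (at e _) (sym (ev-D F Ψ g z)))

D-⊕ : ∀ Ψ f g → Ψ [] ≡ 0ℚ → D Ψ (f ⊕ g) ~ D Ψ f ⊕ D Ψ g
D-⊕ Ψ f g z = tested λ F → trans (ev-D F Ψ (f ⊕ g) z) (trans (ev-++ _ f g) (trans (sym (ev-D F Ψ f z) ⊞ sym (ev-D F Ψ g z)) (sym (ev-++ F (D Ψ f) (D Ψ g)))))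

D-scale : ∀ Ψ c f → Ψ [] ≡ 0ℚ → D Ψ (scale c f) ~ scale c (D Ψ f)
D-scale Ψ c f z = tested λ F → trans (ev-D F Ψ (scale c f) z) (trans (ev-scale _ c f) (trans (c ⊠ sym (ev-D F Ψ f z)) (sym (ev-scale F c (D Ψ f)))))

-- The outcome of Racinet's argument in terms of `sX`: `on-𝔥¹` says that words ending in x₁ (or
-- empty) are sent to combinations of such words, `on-stuffle` is the Leibniz rule with one
-- convergent factor.
record Admissible (Ψ : Word → ℚ) : Set where
  field
    kills : Sh.Kills Ψ
    Ψ-x₀ : Ψ (x0 ∷ []) ≡ 0ℚ
    Ψ-x₁ : Ψ (x1 ∷ []) ≡ 0ℚ
    Ψ-x₀x₁ : Ψ (x0 ∷ x1 ∷ []) ≡ 0ℚ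
    on-𝔥¹ : ∀ F → (∀ w → F (ι w) ≡ 0ℚ) → ∀ w → sX Ψ F (ι w) ≡ 0ℚ
    on-stuffle : ∀ F u v → In𝔥⁰′ u → st (λ w → sX Ψ F (ι w)) u v ≡
      sX Ψ (λ z → st (λ w → F (ι w)) (ιinv z) v) (ι u) + sX Ψ (λ z → st (λ w → F (ι w)) u (ιinv z)) (ι v)

In𝔥⁰? : ∀ w → Dec (∃ λ a → In𝔥⁰′ a × w ≡ ι a)
In𝔥⁰? w with LP.≡-dec _≟L_ w (ι (ιinv w)) | ιinv w in eq
... | no ne | _ = no (λ { (a , h , e) → ne (trans e (cong ι (sym (trans (cong ιinv e) (ιinv-ι a))))) })
... | yes e | [] = yes ([] , nil , trans e (cong ι eq))
... | yes e | suc m ∷ u = yes (suc m ∷ u , cons , trans e (cong ι eq))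
... | yes e | zero ∷ u = no (λ { (a , h , e′) → bad a h (trans (sym eq) (trans (cong ιinv e′) (ιinv-ι a))) })
  where
  bad : ∀ a → In𝔥⁰′ a → zero ∷ u ≡ a → ⊥
  bad .[] nil ()
  bad .(suc _ ∷ _) cons ()

In𝔥¹? : ∀ w → Dec (∃ λ b → w ≡ ι b)
In𝔥¹? w with LP.≡-dec _≟L_ w (ι (ιinv w))
... | yes e = yes (ιinv w , e)
... | no ne = no (λ { (b , e) → ne (trans e (cong ι (sym (trans (cong ιinv e) (ιinv-ι b))))) })

module _ {Ψ : Word → ℚ} (adm : Admissible Ψ) where
  open Admissible adm

  private
    module SC = ShuffleCoderivation Ψ kills
    Ψ-[] = proj₁ kills

  D-shP : ∀ f g → D Ψ (shP f g) ~ shP (D Ψ f) g ⊕ shP f (D Ψ g)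
  D-shP f g = tested λ F → trans (ev-D F Ψ (shP f g) Ψ-[]) (trans (ev-shP (sX Ψ F) f g)
    (trans (ev-cong (λ u → trans (ev-cong (λ v → SC.s-st F u v) g) (ev-+ _ _ g)) f) (trans (ev-+ _ _ f)
    (trans (trans (ev-cong (λ u → sym (ev-lin (SC.s-linear u) (λ x v → sh F x v) g)) f)
                  (trans (sym (ev-D (λ u → ev (λ v → sh F u v) g) Ψ f Ψ-[])) (sym (ev-shP F (D Ψ f) g)))
          ⊞ trans (ev-cong (λ u → sym (ev-D (λ y → sh F u y) Ψ g Ψ-[])) f) (sym (ev-shP F f (D Ψ g))))
      (sym (ev-++ F (shP (D Ψ f) g) _))))))

  -- Replacing a factor by x₀ or cutting off a suffix never makes a word starting with x₀ start with
  -- x₁. So the part of F living on words that start with x₁ contributes nothing, and the rest is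
  -- covered by `on-𝔥¹`.
  on-𝔥⁰ : ∀ F → (∀ w → (∃ λ a → In𝔥⁰′ a × w ≡ ι a) → F w ≡ 0ℚ) → ∀ a → In𝔥⁰′ a → sX Ψ F (ι a) ≡ 0ℚ
  on-𝔥⁰ F z [] nil = refl
  on-𝔥⁰ F z (suc m ∷ a) cons = trans (cong-lin (sX-linear Ψ (ι (suc m ∷ a))) split)
    (trans (add (sX-linear Ψ (ι (suc m ∷ a))) F₁ F₂) (0+0 (leading (blk m (ι a))) (on-𝔥¹ F₂ vanish (suc m ∷ a))))
    where
    F₁ F₂ : Word → ℚ
    F₁ [] = 0ℚ
    F₁ (x0 ∷ w) = 0ℚ
    F₁ (x1 ∷ w) = F (x1 ∷ w)
    F₂ [] = F []
    F₂ (x0 ∷ w) = F (x0 ∷ w)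
    F₂ (x1 ∷ w) = 0ℚ
    split : ∀ w → F w ≡ F₁ w + F₂ w
    split [] = sym (+-identityˡ _)
    split (x0 ∷ w) = sym (+-identityˡ _)
    split (x1 ∷ w) = sym (+-identityʳ _)
    vanish : ∀ w → F₂ (ι w) ≡ 0ℚ
    vanish [] = z [] ([] , nil , refl)
    vanish (zero ∷ w) = refl
    vanish (suc m ∷ w) = z _ (suc m ∷ w , cons , refl)
    leading : ∀ w → sX Ψ F₁ (x0 ∷ w) ≡ 0ℚ
    leading w = 0+0 (0+0 (zeroˡ _) (spl-zero (x0 ∷ w) (λ p q → zeroʳ (comm₀ Ψ p)))) (zero-lin (SC.s-linear w) (λ _ → refl))

  private
    D-letter : ∀ a → Ψ (a ∷ []) ≡ 0ℚ → D Ψ (word (a ∷ [])) ~ []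
    D-letter a z = tested λ F → trans (ev-linP F (gapsP Ψ x1) (word (a ∷ []))) (trans (ev-single (λ w → ev F (gapsP Ψ x1 w)) (a ∷ []))
      (trans (ev-gapsP F Ψ x1 (a ∷ [])) (0+0 (0+0 (0* (*0 Ψ-[])) (0* (*0 z))) (0* (*0 Ψ-[])))))

    -- Both products obey the Leibniz rule, so the image of a relation is a combination of
    -- relations; these belong to R because D keeps u in 𝔥⁰ and v in 𝔥¹, as the restrictions of the
    -- two supports make explicit.
    D-rel : ∀ u v → In𝔥⁰′ u → IR.I (D Ψ (rel (ι u) (ι v)))
    D-rel u v h = IR.I-~ (~-sym expand) (IR.I-⊕
      (IR.I-~ (linP-cong (λ x → rel x (ι v)) {restrict In𝔥⁰? (D Ψ (word (ι u)))} {D Ψ (word (ι u))} (~-sym du)) (IR.I-linP (λ x → rel x (ι v)) _ (mapAll (λ { x (a , h , refl) → rel∈R v h }) (restrict-All In𝔥⁰? (D Ψ (word (ι u)))))))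
      (IR.I-~ (linP-cong (λ y → rel (ι u) y) {restrict In𝔥¹? (D Ψ (word (ι v)))} {D Ψ (word (ι v))} (~-sym dv)) (IR.I-linP (λ y → rel (ι u) y) _ (mapAll (λ { y (b , refl) → rel∈R b h }) (restrict-All In𝔥¹? (D Ψ (word (ι v))))))))
      where
      mapAll : ∀ {P Q : Word → Set} {f : Poly} → (∀ w → P w → Q w) → All (P ∘ proj₂) f → All (Q ∘ proj₂) f
      mapAll g [] = []
      mapAll g (p ∷ ps) = g _ p ∷ mapAll g ps
      linP-cong : ∀ φ {f g} → f ~ g → linP φ f ~ linP φ g
      linP-cong φ {f} {g} e = tested λ F → trans (ev-linP F φ f) (trans (at e _) (sym (ev-linP F φ g)))
      D-word : ∀ F w → ev F (D Ψ (word w)) ≡ sX Ψ F w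
      D-word F w = trans (ev-D F Ψ (word w) Ψ-[]) (ev-single (sX Ψ F) w)
      du : D Ψ (word (ι u)) ~ restrict In𝔥⁰? (D Ψ (word (ι u)))
      du = restrict-~ In𝔥⁰? (D Ψ (word (ι u))) (λ F z → trans (D-word F (ι u)) (on-𝔥⁰ F (λ w → z w) u h))
      dv : D Ψ (word (ι v)) ~ restrict In𝔥¹? (D Ψ (word (ι v)))
      dv = restrict-~ In𝔥¹? (D Ψ (word (ι v))) (λ F z → trans (D-word F (ι v)) (on-𝔥¹ F (λ w → z (ι w) (w , refl)) v))
      expand : D Ψ (rel (ι u) (ι v)) ~ linP (λ x → rel x (ι v)) (D Ψ (word (ι u))) ⊕ linP (λ y → rel (ι u) y) (D Ψ (word (ι v)))
      expand = tested λ F → lin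
        (trans (ev-D F Ψ (rel (ι u) (ι v)) Ψ-[]) (trans (ev-rel (sX Ψ F) (ι u) (ι v)) (SC.s-st F (ι u) (ι v) ⊞
            cong -_ (trans (cong₂ (st (λ w → sX Ψ F (ι w))) (ιinv-ι u) (ιinv-ι v)) (on-stuffle F u v h))))
         ⊞ sym (trans (ev-++ F (linP (λ x → rel x (ι v)) (D Ψ (word (ι u)))) _)
            (trans (ev-linP F (λ x → rel x (ι v)) (D Ψ (word (ι u)))) (D-word _ (ι u)) ⊞ trans (ev-linP F (λ y → rel (ι u) y) (D Ψ (word (ι v)))) (D-word _ (ι v))))
         ⊞ sym (trans (cong-lin (sX-linear Ψ (ι u)) (λ x → trans (ev-rel F x (ι v)) (cong (λ b → sh F x (ι v) + - st (λ w → F (ι w)) (ιinv x) b) (ιinv-ι v))))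
             (trans (add (sX-linear Ψ (ι u)) (λ x → sh F x (ι v)) (λ x → - st (λ w → F (ι w)) (ιinv x) v)) (refl ⊞ neg-lin (sX-linear Ψ (ι u)) (λ x → st (λ w → F (ι w)) (ιinv x) v))))
         ⊞ sym (trans (cong-lin (sX-linear Ψ (ι v)) (λ y → trans (ev-rel F (ι u) y) (cong (λ b → sh F (ι u) y + - st (λ w → F (ι w)) b (ιinv y)) (ιinv-ι u))))
             (trans (add (sX-linear Ψ (ι v)) (λ y → sh F (ι u) y) (λ y → - st (λ w → F (ι w)) u (ιinv y))) (refl ⊞ neg-lin (sX-linear Ψ (ι v)) (λ y → st (λ w → F (ι w)) u (ιinv y))))))
        (solve 8 (λ a b s₁ s₂ t₁ t₂ e₁ e₂ → a :+ ((s₁ :+ s₂ :+ :- (t₁ :+ t₂)) :+ b :+ e₁ :+ e₂) := b :+ (a :+ (e₁ :+ e₂) :+ (s₁ :+ :- t₁) :+ (s₂ :+ :- t₂))) refl _ _ _ _ _ _ _ _)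

  D-R : ∀ {f} → IR.I f → IR.I (D Ψ f)
  D-R = IR.I-elim (λ f → IR.I (D Ψ f)) (λ e → IR.I-~ (D-~ Ψ Ψ-[] e)) (IR.I-zero ~-refl)
    (λ {f} {f′} p p′ → IR.I-~ (~-sym (D-⊕ Ψ f f′ Ψ-[])) (IR.I-⊕ p p′))
    (λ p i → IR.I-~ (~-sym (D-shP p (rgen i))) (IR.I-⊕ (IR.I-shP (D Ψ p) (IR.I-gen i)) (IR.I-shP p (gen i))))
    where
    gen : ∀ i → IR.I (D Ψ (rgen i))
    gen gx0 = IR.I-zero (D-letter x0 Ψ-x₀)
    gen gx1 = IR.I-zero (D-letter x1 Ψ-x₁)
    gen (gds u v hu hv) with from-𝔥⁰ hu | from-𝔥¹ hv
    ... | a , h , refl | b , refl = D-rel a b h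

-- The double shuffle Lie algebra in terms of coefficients

sh-δ : ∀ w u v → ev (FX.δ₂ u v) (PX.Δsh w) ≡ sh (λ x → FX.δ x w) u v
sh-δ w u v = trans (general (FX.δ₂ u v) w) (dual w u v)
  where
  cop : (Word → Word → ℚ) → Word → ℚ
  cop T [] = T [] []
  cop T (a ∷ w) = cop (λ p q → T (a ∷ p) q) w + cop (λ p q → T p (a ∷ q)) w
  cop-cong : ∀ {S T} → (∀ p q → S p q ≡ T p q) → ∀ w → cop S w ≡ cop T w
  cop-cong e [] = e [] []
  cop-cong e (a ∷ w) = cop-cong (λ p q → e (a ∷ p) q) w ⊞ cop-cong (λ p q → e p (a ∷ q)) w
  cop-* : ∀ k T w → cop (λ p q → k * T p q) w ≡ k * cop T w
  cop-* k T [] = refl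
  cop-* k T (a ∷ w) = trans (cop-* k _ w ⊞ cop-* k _ w) (sym (distribˡ _ _ _))
  cop-zero : ∀ {T} w → (∀ p q → T p q ≡ 0ℚ) → cop T w ≡ 0ℚ
  cop-zero [] e = e [] []
  cop-zero (a ∷ w) e = 0+0 (cop-zero w (λ p q → e (a ∷ p) q)) (cop-zero w (λ p q → e p (a ∷ q)))
  general : ∀ (T : Word × Word → ℚ) w → ev T (PX.Δsh w) ≡ cop (λ p q → T (p , q)) w
  general T [] = ev-single T ([] , [])
  general T (a ∷ w) = trans (ev-bind T _ (λ t → T (a ∷ proj₁ t , proj₂ t) + T (proj₁ t , a ∷ proj₂ t))
      (λ c t → solve 3 (λ c x y → c :* x :+ (c :* y :+ con 0ℚ) := c :* (x :+ y)) refl _ _ _) (PX.Δsh w))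
    (trans (ev-+ _ _ (PX.Δsh w)) (general (λ t → T (a ∷ proj₁ t , proj₂ t)) w ⊞ general (λ t → T (proj₁ t , a ∷ proj₂ t)) w))
  E : Word → Word → Word → ℚ
  E w u v = cop (λ p q → FX.δ u p * FX.δ v q) w
  left : ∀ a w u v → cop (λ p q → FX.δ u (a ∷ p) * FX.δ v q) w ≡ lf (λ c u → FX.δ (c ∷ []) (a ∷ []) * E w u v) u
  left a w [] v = cop-zero w (λ p q → trans (cong (_* FX.δ v q) (FX.δ-≢ {a ∷ p} {[]} (λ ()))) (zeroˡ _))
  left a w (c ∷ u) v = trans (cop-cong (λ p q → trans (cong (_* FX.δ v q) (FX.δ-∷ c u a p)) (*-assoc _ _ _)) w) (cop-* (FX.δ (c ∷ []) (a ∷ [])) _ w)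
  right : ∀ a w u v → cop (λ p q → FX.δ u p * FX.δ v (a ∷ q)) w ≡ lf (λ c v → FX.δ (c ∷ []) (a ∷ []) * E w u v) v
  right a w u [] = cop-zero w (λ p q → trans (cong (FX.δ u p *_) (FX.δ-≢ {a ∷ q} {[]} (λ ()))) (zeroʳ _))
  right a w u (c ∷ v) = trans (cop-cong (λ p q → trans (cong (FX.δ u p *_) (FX.δ-∷ c v a q)) (solve 3 (λ x d y → x :* (d :* y) := d :* (x :* y)) refl _ _ _)) w) (cop-* (FX.δ (c ∷ []) (a ∷ [])) _ w)
  step : ∀ a w c u v → sh (λ x → FX.δ (c ∷ x) (a ∷ w)) u v ≡ FX.δ (c ∷ []) (a ∷ []) * sh (λ x → FX.δ x w) u v
  step a w c u v = trans (Sh.st-cong (λ x → FX.δ-∷ c x a w) u v) (hom (Sh.st-linear u v) (FX.δ (c ∷ []) (a ∷ [])) (λ x → FX.δ x w))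
  dual : ∀ w u v → E w u v ≡ sh (λ x → FX.δ x w) u v
  dual [] [] v = *-identityˡ _
  dual [] (c ∷ u) [] = *-identityʳ _
  dual [] (c ∷ u) (d ∷ v) = trans (*0 (FX.δ-[]∷ d v)) (sym (0+0 (0+0 (zero-lin (Sh.st-linear u (d ∷ v)) (λ x → FX.δ-[]∷ c x)) (zero-lin (Sh.st-linear (c ∷ u) v) (λ x → FX.δ-[]∷ d x))) refl))
  dual (a ∷ w) [] [] = trans (0+0 (left a w [] []) (right a w [] [])) (sym (FX.δ-≢ {a ∷ w} {[]} (λ ())))
  dual (a ∷ w) [] (d ∷ v) = trans (0+ (left a w [] (d ∷ v))) (trans (right a w [] (d ∷ v)) (trans (FX.δ (d ∷ []) (a ∷ []) ⊠ dual w [] v) (sym (FX.δ-∷ d v a w))))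
  dual (a ∷ w) (c ∷ u) [] = trans (+0 (right a w (c ∷ u) [])) (trans (left a w (c ∷ u) []) (trans (FX.δ (c ∷ []) (a ∷ []) ⊠ trans (dual w u []) (Sh.st-[] _ u)) (sym (FX.δ-∷ c u a w))))
  dual (a ∷ w) (c ∷ u) (d ∷ v) = trans (left a w (c ∷ u) (d ∷ v) ⊞ right a w (c ∷ u) (d ∷ v))
    (trans (trans (FX.δ (c ∷ []) (a ∷ []) ⊠ dual w u (d ∷ v)) (sym (step a w c u (d ∷ v))) ⊞ trans (FX.δ (d ∷ []) (a ∷ []) ⊠ dual w (c ∷ u) v) (sym (step a w d (c ∷ u) v))) (sym (+-identityʳ _)))

sh-coproduct : ∀ ψ u v → FX.coproduct PX.Δsh ψ u v ≡ sh (coeff ψ) u v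
sh-coproduct ψ u v = trans (ev-cong (λ w → sh-δ w u v) ψ)
  (trans (Sh.lin-st (ev-linear ψ) (λ w x → FX.δ x w) u v) (Sh.st-cong (λ x → sym (coeff-ev ψ x)) u v))

kills⇒primitive : ∀ ψ → Sh.Kills (coeff ψ) → PX.IsPrimitive PX.Δsh ψ
kills⇒primitive ψ (z , k) = FX.⇒primitive PX.Δsh ψ (λ u v → trans (sh-coproduct ψ u v) (go u v))
  where
  go : ∀ u v → sh (coeff ψ) u v ≡ coeff ψ u * FX.δ v [] + FX.δ u [] * coeff ψ v
  go [] v = trans (sym (*-identityˡ _)) (sym (0+ (0* z)))
  go (a ∷ u) [] = sym (trans (+0 (0* (FX.δ-[]∷ a u))) (*-identityʳ _))
  go (a ∷ u) (b ∷ v) = trans (k a u b v) (sym (0+0 (*0 (FX.δ-[]∷ b v)) (0* (FX.δ-[]∷ a u))))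

primitive⇒kills : ∀ ψ → PX.IsPrimitive PX.Δsh ψ → Sh.Kills (coeff ψ)
primitive⇒kills ψ p = lin (sym (go [] [])) (solve 1 (λ x → x :+ x := con 0ℚ :+ (x :* con 1ℚ :+ con 1ℚ :* x)) refl _) , λ a u b v →
    trans (go (a ∷ u) (b ∷ v)) (0+0 (*0 (FX.δ-[]∷ b v)) (0* (FX.δ-[]∷ a u)))
  where
  go : ∀ u v → sh (coeff ψ) u v ≡ coeff ψ u * FX.δ v [] + FX.δ u [] * coeff ψ v
  go u v = trans (sym (sh-coproduct ψ u v)) (FX.primitive⇒ PX.Δsh ψ p u v)

-- Sum over i + j + 1 = m: the ways to obtain the letter m by contraction.
asum : ℕ → (ℕ → ℕ → ℚ) → ℚ
asum zero f = 0ℚ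
asum (suc m) f = f 0 m + asum m (λ i j → f (suc i) j)

asum-cong : ∀ m {f g} → (∀ i j → f i j ≡ g i j) → asum m f ≡ asum m g
asum-cong zero e = refl
asum-cong (suc m) e = e 0 m ⊞ asum-cong m (λ i j → e (suc i) j)

asum-zero : ∀ m {f} → (∀ i j → f i j ≡ 0ℚ) → asum m f ≡ 0ℚ
asum-zero zero e = refl
asum-zero (suc m) e = 0+0 (e 0 m) (asum-zero m (λ i j → e (suc i) j))

δN : ℕ → ℕ → ℚ
δN c i = FN.δ (c ∷ []) (i ∷ [])

δN-suc : ∀ c i → δN (suc c) (suc i) ≡ δN c i
δN-suc c i = go (i ℕ.≟ c)
  where
  go : Dec (i ≡ c) → δN (suc c) (suc i) ≡ δN c i
  go (yes refl) = trans (FN.δ-refl (suc c ∷ [])) (sym (FN.δ-refl (c ∷ [])))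
  go (no ne) = trans (FN.δ-≢ {suc i ∷ []} {suc c ∷ []} (λ e → ne (ℕP.suc-injective (LP.∷-injectiveˡ e))))
    (sym (FN.δ-≢ {i ∷ []} {c ∷ []} (λ e → ne (LP.∷-injectiveˡ e))))

δN-0suc : ∀ i → δN 0 (suc i) ≡ 0ℚ
δN-0suc i = FN.δ-≢ {suc i ∷ []} {0 ∷ []} (λ ())

δN-suc0 : ∀ i → δN (suc i) 0 ≡ 0ℚ
δN-suc0 i = FN.δ-≢ {0 ∷ []} {suc i ∷ []} (λ ())

asum-δ : ∀ m c d k → asum m (λ i j → δN c i * (δN d j * k)) ≡ δN (suc (c ℕ.+ d)) m * k
asum-δ zero c d k = sym (0* (δN-suc0 (c ℕ.+ d)))
asum-δ (suc m) zero d k = trans (cong (_* (δN d m * k)) (FN.δ-refl (0 ∷ [])) ⊞ asum-zero m (λ i j → 0* (δN-0suc i)))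
  (trans (+-identityʳ _) (trans (*-identityˡ _) (cong (_* k) (sym (δN-suc d m)))))
asum-δ (suc m) (suc c) d k = trans (0+ (0* (δN-suc0 c))) (trans (asum-cong m (λ i j → cong (_* (δN d j * k)) (δN-suc c i)))
  (trans (asum-δ m c d k) (cong (_* k) (sym (δN-suc (suc (c ℕ.+ d)) m)))))

δ-map-suc : ∀ u v → FN.δ (map suc u) (map suc v) ≡ FN.δ u v
δ-map-suc u v = go (LP.≡-dec ℕ._≟_ v u)
  where
  go : Dec (v ≡ u) → FN.δ (map suc u) (map suc v) ≡ FN.δ u v
  go (yes refl) = trans (FN.δ-refl (map suc u)) (sym (FN.δ-refl u))
  go (no ne) = trans (FN.δ-≢ (λ e → ne (LP.map-injective ℕP.suc-injective e))) (sym (FN.δ-≢ ne))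

stuffle-cop : (List ℕ → List ℕ → ℚ) → List ℕ → ℚ
stuffle-cop T [] = T [] []
stuffle-cop T (m ∷ w) = stuffle-cop (λ p q → T (m ∷ p) q) w + stuffle-cop (λ p q → T p (m ∷ q)) w
                        + asum m (λ i j → stuffle-cop (λ p q → T (i ∷ p) (j ∷ q)) w)

stuffle-cop-cong : ∀ {S T} → (∀ p q → S p q ≡ T p q) → ∀ w → stuffle-cop S w ≡ stuffle-cop T w
stuffle-cop-cong e [] = e [] []
stuffle-cop-cong e (m ∷ w) = stuffle-cop-cong (λ p q → e (m ∷ p) q) w ⊞ stuffle-cop-cong (λ p q → e p (m ∷ q)) w
  ⊞ asum-cong m (λ i j → stuffle-cop-cong (λ p q → e (i ∷ p) (j ∷ q)) w)

stuffle-cop-* : ∀ k T w → stuffle-cop (λ p q → k * T p q) w ≡ k * stuffle-cop T w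
stuffle-cop-* k T [] = refl
stuffle-cop-* k T (m ∷ w) = trans (stuffle-cop-* k _ w ⊞ stuffle-cop-* k _ w ⊞ trans (asum-cong m (λ i j → stuffle-cop-* k _ w)) (asum-* m))
  (solve 4 (λ k x y z → k :* x :+ k :* y :+ k :* z := k :* (x :+ y :+ z)) refl _ _ _ _)
  where
  asum-* : ∀ m {f} → asum m (λ i j → k * f i j) ≡ k * asum m f
  asum-* zero = sym (zeroʳ k)
  asum-* (suc m) = trans (refl ⊞ asum-* m) (sym (distribˡ k _ _))

stuffle-cop-zero : ∀ {T} w → (∀ p q → T p q ≡ 0ℚ) → stuffle-cop T w ≡ 0ℚ
stuffle-cop-zero {T} w e = trans (stuffle-cop-cong (λ p q → trans (e p q) (sym (zeroˡ (T p q)))) w) (trans (stuffle-cop-* 0ℚ T w) (zeroˡ _))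

ev-Δ* : ∀ (T : List ℕ × List ℕ → ℚ) w → ev T (Δ* (map suc w)) ≡ stuffle-cop (λ p q → T (map suc p , map suc q)) w
ev-Δ* T [] = ev-single T ([] , [])
ev-Δ* T (m ∷ w) = trans (FN.ev-·₂ T (Δ*y (suc m)) (Δ* (map suc w)))
  (trans (*-identityˡ _ ⊞ (*-identityˡ _ ⊞ third (λ i → i) m 0 m (sym (ℕP.+-identityʳ m)) (λ i → sym (ℕP.+-identityʳ i))))
  (trans (sym (+-assoc _ _ _)) (ev-Δ* (λ t → T (suc m ∷ proj₁ t , proj₂ t)) w ⊞ ev-Δ* (λ t → T (proj₁ t , suc m ∷ proj₂ t)) w
    ⊞ asum-cong m (λ i j → trans (ev-Δ* (λ t → T (suc (i ℕ.+ 0) ∷ proj₁ t , suc j ∷ proj₂ t)) w)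
        (cong (λ n → stuffle-cop (λ p q → T (suc n ∷ map suc p , suc j ∷ map suc q)) w) (ℕP.+-identityʳ i))))))
  where
  T′ : List ℕ × List ℕ → ℚ
  T′ s = ev (λ t → T (proj₁ s ++ proj₁ t , proj₂ s ++ proj₂ t)) (Δ* (map suc w))
  -- Generalised over the start s of the range, because `upTo` unfolds into `applyUpTo` of shifted
  -- functions.
  third : ∀ (g : ℕ → ℕ) n s M → M ≡ n ℕ.+ s → (∀ i → g i ≡ i ℕ.+ s) →
    ev T′ (map (λ j → (1ℚ , j ∷ [] , (suc M ℕ.∸ j) ∷ [])) (map suc (Data.List.applyUpTo g n)))
      ≡ asum n (λ i j → T′ (suc (i ℕ.+ s) ∷ [] , suc j ∷ []))
  third g zero s M e eg = refl
  third g (suc n) s M e eg = trans (*-identityˡ _) (cong₂ (λ a b → T′ (suc a ∷ [] , b ∷ [])) (eg 0)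
      (trans (cong₂ ℕ._∸_ e (eg 0)) (ℕP.m+n∸n≡m (suc n) s)))
    ⊞ trans (third (λ i → g (suc i)) n (suc s) M (trans e (sym (ℕP.+-suc n s))) (λ i → trans (eg (suc i)) (sym (ℕP.+-suc i s))))
        (asum-cong n (λ i j → cong (λ k → T′ (suc k ∷ [] , suc j ∷ [])) (ℕP.+-suc i s)))

st-δ : ∀ w u v → ev (FN.δ₂ (map suc u) (map suc v)) (Δ* (map suc w)) ≡ st (λ x → FN.δ x w) u v
st-δ w u v = trans (ev-Δ* (FN.δ₂ (map suc u) (map suc v)) w)
  (trans (stuffle-cop-cong (λ p q → cong₂ _*_ (δ-map-suc u p) (δ-map-suc v q)) w) (dual w u v))
  where
  E : List ℕ → List ℕ → List ℕ → ℚ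
  E w u v = stuffle-cop (λ p q → FN.δ u p * FN.δ v q) w
  left : ∀ a w u v → stuffle-cop (λ p q → FN.δ u (a ∷ p) * FN.δ v q) w ≡ lf (λ c u → δN c a * E w u v) u
  left a w [] v = stuffle-cop-zero w (λ p q → 0* (FN.δ-≢ {a ∷ p} {[]} (λ ())))
  left a w (c ∷ u) v = trans (stuffle-cop-cong (λ p q → trans (cong (_* FN.δ v q) (FN.δ-∷ c u a p)) (*-assoc _ _ _)) w) (stuffle-cop-* (δN c a) _ w)
  right : ∀ a w u v → stuffle-cop (λ p q → FN.δ u p * FN.δ v (a ∷ q)) w ≡ lf (λ c v → δN c a * E w u v) v
  right a w u [] = stuffle-cop-zero w (λ p q → *0 (FN.δ-≢ {a ∷ q} {[]} (λ ())))
  right a w u (c ∷ v) = trans (stuffle-cop-cong (λ p q → trans (cong (FN.δ u p *_) (FN.δ-∷ c v a q)) (solve 3 (λ x d y → x :* (d :* y) := d :* (x :* y)) refl _ _ _)) w) (stuffle-cop-* (δN c a) _ w)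
  both : ∀ m w u v → asum m (λ i j → stuffle-cop (λ p q → FN.δ u (i ∷ p) * FN.δ v (j ∷ q)) w)
    ≡ lf (λ c u → lf (λ d v → δN (suc (c ℕ.+ d)) m * E w u v) v) u
  both m w [] v = asum-zero m (λ i j → stuffle-cop-zero w (λ p q → 0* (FN.δ-≢ {i ∷ p} {[]} (λ ()))))
  both m w (c ∷ u) [] = asum-zero m (λ i j → stuffle-cop-zero w (λ p q → *0 (FN.δ-≢ {j ∷ q} {[]} (λ ()))))
  both m w (c ∷ u) (d ∷ v) = trans (asum-cong m factor) (asum-δ m c d (E w u v))
    where
    factor : ∀ i j → stuffle-cop (λ p q → FN.δ (c ∷ u) (i ∷ p) * FN.δ (d ∷ v) (j ∷ q)) w ≡ δN c i * (δN d j * E w u v)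
    factor i j = trans (stuffle-cop-cong (λ p q → trans (cong (_* FN.δ (d ∷ v) (j ∷ q)) (FN.δ-∷ c u i p)) (*-assoc _ _ _)) w)
      (trans (stuffle-cop-* (δN c i) _ w) (δN c i ⊠ right j w u (d ∷ v)))
  step : ∀ a w c u v → st (λ x → FN.δ (c ∷ x) (a ∷ w)) u v ≡ δN c a * st (λ x → FN.δ x w) u v
  step a w c u v = trans (St.st-cong (λ x → FN.δ-∷ c x a w) u v) (hom (St.st-linear u v) (δN c a) (λ x → FN.δ x w))
  dual : ∀ w u v → E w u v ≡ st (λ x → FN.δ x w) u v
  dual [] [] v = *-identityˡ _
  dual [] (c ∷ u) [] = *-identityʳ _
  dual [] (c ∷ u) (d ∷ v) = trans (*0 (FN.δ-[]∷ d v)) (sym (0+0 (0+0 (zero-lin (St.st-linear u (d ∷ v)) (λ x → FN.δ-[]∷ c x))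
    (zero-lin (St.st-linear (c ∷ u) v) (λ x → FN.δ-[]∷ d x))) (zero-lin (St.st-linear u v) (λ x → FN.δ-[]∷ (suc (c ℕ.+ d)) x))))
  dual (a ∷ w) [] [] = trans (0+0 (0+0 (left a w [] []) (right a w [] [])) (both a w [] [])) (sym (FN.δ-≢ {a ∷ w} {[]} (λ ())))
  dual (a ∷ w) [] (d ∷ v) = trans (+0 (both a w [] (d ∷ v))) (trans (0+ (left a w [] (d ∷ v))) (trans (right a w [] (d ∷ v)) (trans (δN d a ⊠ dual w [] v) (sym (FN.δ-∷ d v a w)))))
  dual (a ∷ w) (c ∷ u) [] = trans (+0 (both a w (c ∷ u) [])) (trans (+0 (right a w (c ∷ u) [])) (trans (left a w (c ∷ u) []) (trans (δN c a ⊠ trans (dual w u []) (St.st-[] _ u)) (sym (FN.δ-∷ c u a w)))))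
  dual (a ∷ w) (c ∷ u) (d ∷ v) = trans (left a w (c ∷ u) (d ∷ v) ⊞ right a w (c ∷ u) (d ∷ v) ⊞ both a w (c ∷ u) (d ∷ v))
    (trans (δN c a ⊠ dual w u (d ∷ v)) (sym (step a w c u (d ∷ v))) ⊞ trans (δN d a ⊠ dual w (c ∷ u) v) (sym (step a w d (c ∷ u) v))
      ⊞ trans (δN (suc (c ℕ.+ d)) a ⊠ dual w u v) (sym (step a w (suc (c ℕ.+ d)) u v)))

zeros : ℕ → List ℕ
zeros n = replicate n 0

ratio : ℕ → ℚ
ratio m = sgn (suc m) ℚ.* (ℤ.+ 1 ℚ./ suc (suc m))

correction : (Word → ℚ) → ℕ → ℚ
correction Ψ zero = 0ℚ
correction Ψ (suc zero) = 0ℚ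
correction Ψ (suc (suc m)) = ratio m * Ψ (blk (suc m) [])

-- coefficients of ψ_*
P₀ : (Word → ℚ) → List ℕ → ℚ
P₀ Ψ w = Ψ (ι w) + corr (correction Ψ) w

ι-zs-∷ : ∀ k w m u → piY′ k w ≡ just (m ∷ u) → w ≡ blk (m ℕ.∸ k) (ι u) × k ≤ m
piY′-just : ∀ w u → piY′ zero w ≡ just u → w ≡ ι u

private
  map-∷-just : ∀ (k : ℕ) (o : Maybe (List ℕ)) m u → Maybe.map (k ∷_) o ≡ just (m ∷ u) → k ≡ m × o ≡ just u
  map-∷-just k (just _) m u refl = refl , refl
  map-∷-just k nothing m u ()

ι-zs-∷ zero (x0 ∷ w) zero u e with ι-zs-∷ 1 w zero u e
... | _ , ()
ι-zs-∷ zero (x0 ∷ w) (suc m) u e with ι-zs-∷ 1 w (suc m) u e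
... | e′ , _ = cong (x0 ∷_) e′ , z≤n
ι-zs-∷ (suc k) (x0 ∷ w) m u e with ι-zs-∷ (suc (suc k)) w m u e
... | e′ , le = trans (cong (x0 ∷_) e′) (cong (λ n → blk n (ι u)) (sym (ℕP.+-∸-assoc 1 le))) , ℕP.≤-trans (ℕP.n≤1+n _) le
ι-zs-∷ zero (x1 ∷ w) m u e with map-∷-just 0 (piY′ zero w) m u e
... | refl , e′ = cong (x1 ∷_) (piY′-just w u e′) , z≤n
ι-zs-∷ (suc k) (x1 ∷ w) m u e with map-∷-just (suc k) (piY′ zero w) m u e
... | refl , e′ = trans (cong (x1 ∷_) (piY′-just w u e′)) (cong (λ n → blk n (ι u)) (sym (ℕP.n∸n≡0 (suc k)))) , ℕP.≤-refl

piY′-just [] [] refl = refl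
piY′-just (x0 ∷ w) [] e = ⊥-elim (no-nil 0 w e)
  where
  no-nil : ∀ k w → piY′ (suc k) w ≡ just [] → ⊥
  no-nil k [] ()
  no-nil k (x0 ∷ w) e = no-nil (suc k) w e
  no-nil k (x1 ∷ w) e with piY′ zero w
  no-nil k (x1 ∷ w) () | just _
  no-nil k (x1 ∷ w) () | nothing
piY′-just (x1 ∷ w) [] e with piY′ zero w
piY′-just (x1 ∷ w) [] () | just _
piY′-just (x1 ∷ w) [] () | nothing
piY′-just w (m ∷ u) e = proj₁ (ι-zs-∷ zero w m u e)

onY : (List ℕ → ℚ) → Word → ℚ
onY A x = Maybe.maybe′ A 0ℚ (piY′ zero x)

δ-ι : ∀ w x → onY (FN.δ w) x ≡ FX.δ (ι w) x
δ-ι w x = go (piY′ zero x) refl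
  where
  go : ∀ o → piY′ zero x ≡ o → Maybe.maybe′ (FN.δ w) 0ℚ o ≡ FX.δ (ι w) x
  go nothing e = sym (FX.δ-≢ {x} {ι w} (λ e′ → absurd (trans (sym (piY′-ι w)) (trans (cong (piY′ zero) (sym e′)) e))))
    where
    absurd : just w ≡ nothing → ⊥
    absurd ()
  go (just y) e = trans (same (LP.≡-dec ℕ._≟_ y w)) (cong (FX.δ (ι w)) (sym (piY′-just x y e)))
    where
    same : Dec (y ≡ w) → FN.δ w y ≡ FX.δ (ι w) (ι y)
    same (yes refl) = trans (FN.δ-refl y) (sym (FX.δ-refl (ι y)))
    same (no ne) = trans (FN.δ-≢ ne) (sym (FX.δ-≢ {ι y} {ι w} (λ e → ne (trans (sym (ιinv-ι y)) (trans (cong ιinv e) (ιinv-ι w))))))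

-- Transpose of the correction in ψ_*: at y_n it reads the value at y₁^n, with n = m + 2.
corrected : (List ℕ → ℚ) → List ℕ → ℚ
corrected A (suc m ∷ []) = ratio m * A (zeros (suc (suc m)))
corrected A _ = 0ℚ

starred : Poly → (List ℕ → ℚ) → ℚ
starred ψ A = ev (onY (λ y → A y + corrected A y)) ψ

ev-ψ* : ∀ F ψ → ev F (ψ* ψ) ≡ starred ψ (λ y → F (map suc y))
ev-ψ* F ψ = trans (ev-++ F (ΠY ψ) _) (trans (refl ⊞ trans (ev-bind F corrTerm K corrTerm-ev (ΠY ψ)) refl)
  (trans (ev-ΠY F ⊞ ev-ΠY K) (trans (sym (ev-+ _ _ ψ)) (ev-cong (λ x → combine (piYW x) (piY′ zero x) (piYAux-suc zero x)) ψ))))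
  where
  K : YWord → ℚ
  K [] = 0ℚ
  K (zero ∷ _) = 0ℚ
  K (suc zero ∷ _) = 0ℚ
  K (suc (suc m) ∷ []) = ratio m * F (replicate (suc (suc m)) 1)
  K (suc (suc m) ∷ _ ∷ _) = 0ℚ
  corrTerm-ev : ∀ c y → ev F (corrTerm (c , y)) ≡ c * K y
  corrTerm-ev c [] = sym (zeroʳ c)
  corrTerm-ev c (zero ∷ _) = sym (zeroʳ c)
  corrTerm-ev c (suc zero ∷ _) = sym (zeroʳ c)
  corrTerm-ev c (suc (suc m) ∷ []) = trans (+-identityʳ _) (trans (cong (_* F _) (*-def c (ratio m))) (*-assoc _ _ _))
  corrTerm-ev c (suc (suc m) ∷ _ ∷ _) = sym (zeroʳ c)
  ev-ΠY : ∀ F → ev F (ΠY ψ) ≡ ev (λ x → Maybe.maybe′ F 0ℚ (piYW x)) ψ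
  ev-ΠY F = ev-bind F _ _ (λ c x → one c (piYW x)) ψ
    where
    one : ∀ c o → ev F (Maybe.maybe (λ y → (c , y) ∷ []) [] o) ≡ c * Maybe.maybe′ F 0ℚ o
    one c (just y) = +-identityʳ _
    one c nothing = sym (zeroʳ c)
  ones : ∀ n → replicate n 1 ≡ map suc (zeros n)
  ones zero = refl
  ones (suc n) = cong (1 ∷_) (ones n)
  K-suc : ∀ y → K (map suc y) ≡ corrected (λ y → F (map suc y)) y
  K-suc [] = refl
  K-suc (zero ∷ _) = refl
  K-suc (suc m ∷ []) = cong (λ w → ratio m * F w) (ones (suc (suc m)))
  K-suc (suc m ∷ _ ∷ _) = refl
  combine : ∀ o o′ → o ≡ Maybe.map (map suc) o′ → Maybe.maybe′ F 0ℚ o + Maybe.maybe′ K 0ℚ o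
    ≡ Maybe.maybe′ (λ y → F (map suc y) + corrected (λ y → F (map suc y)) y) 0ℚ o′
  combine _ nothing refl = +-identityˡ 0ℚ
  combine _ (just y) refl = refl ⊞ K-suc y

corrected-linear : ∀ y → IsLinear (λ A → corrected A y)
corrected-linear [] = record { cong-lin = λ _ → refl ; add = λ _ _ → sym (+-identityˡ 0ℚ) ; hom = λ k _ → sym (zeroʳ k) }
corrected-linear (zero ∷ _) = record { cong-lin = λ _ → refl ; add = λ _ _ → sym (+-identityˡ 0ℚ) ; hom = λ k _ → sym (zeroʳ k) }
corrected-linear (suc m ∷ []) = record { cong-lin = λ e → ratio m ⊠ e _ ; add = λ _ _ → distribˡ _ _ _
  ; hom = λ k _ → solve 3 (λ c k x → c :* (k :* x) := k :* (c :* x)) refl _ _ _ }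
corrected-linear (suc m ∷ _ ∷ _) = record { cong-lin = λ _ → refl ; add = λ _ _ → sym (+-identityˡ 0ℚ) ; hom = λ k _ → sym (zeroʳ k) }

starred-linear : ∀ ψ → IsLinear (starred ψ)
starred-linear ψ = record
  { cong-lin = λ {A} {B} e → ev-cong (λ x → c {A} {B} e (piY′ zero x)) ψ
  ; add = λ A B → trans (ev-cong (λ x → a A B (piY′ zero x)) ψ) (ev-+ _ _ ψ)
  ; hom = λ k A → trans (ev-cong (λ x → h k A (piY′ zero x)) ψ) (ev-* k _ ψ) }
  where
  both : (List ℕ → ℚ) → Maybe (List ℕ) → ℚ
  both A = Maybe.maybe′ (λ y → A y + corrected A y) 0ℚ
  c : ∀ {A B} → (∀ y → A y ≡ B y) → ∀ o → both A o ≡ both B o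
  c e (just y) = e y ⊞ cong-lin (corrected-linear y) e
  c e nothing = refl
  a : ∀ A B o → both (λ y → A y + B y) o ≡ both A o + both B o
  a A B (just y) = trans (refl ⊞ add (corrected-linear y) A B) (+-swap _ _ _ _)
  a A B nothing = sym (+-identityˡ 0ℚ)
  h : ∀ k A o → both (λ y → k * A y) o ≡ k * both A o
  h k A (just y) = trans (refl ⊞ hom (corrected-linear y) k A) (sym (distribˡ k _ _))
  h k A nothing = sym (zeroʳ k)

corr-cong : ∀ {c d} → (∀ n → c n ≡ d n) → ∀ w → corr c w ≡ corr d w
corr-cong e [] = e 0
corr-cong e (zero ∷ w) = corr-cong (λ n → e (suc n)) w
corr-cong e (suc _ ∷ w) = refl

corr-δ : ∀ v k w → corr (λ n → v * FN.δ (zeros n) (zeros k)) w ≡ v * FN.δ w (zeros k)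
corr-δ v k [] = refl
corr-δ v zero (zero ∷ w) = trans (vanish w _ (λ n → trans (cong (v *_) (FN.δ-[]∷ 0 (zeros n))) (zeroʳ v))) (sym (*0 (FN.δ-[]∷ 0 w)))
  where
  vanish : ∀ w c → (∀ n → c n ≡ 0ℚ) → corr c w ≡ 0ℚ
  vanish [] c z = z 0
  vanish (zero ∷ w) c z = vanish w _ (λ n → z (suc n))
  vanish (suc _ ∷ w) c z = refl
corr-δ v (suc k) (zero ∷ w) = trans (corr-cong (λ n → v ⊠ peel (zeros n)) w) (trans (corr-δ v k w) (v ⊠ sym (peel w)))
  where
  peel : ∀ u → FN.δ (0 ∷ u) (0 ∷ zeros k) ≡ FN.δ u (zeros k)
  peel u = trans (FN.δ-∷ 0 u 0 (zeros k)) (trans (cong (_* FN.δ u (zeros k)) (FN.δ-refl (0 ∷ []))) (*-identityˡ _))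
corr-δ v zero (suc m ∷ w) = sym (*0 (FN.δ-[]∷ (suc m) w))
corr-δ v (suc k) (suc m ∷ w) = sym (*0 (trans (FN.δ-∷ (suc m) w 0 (zeros k)) (0* (δN-suc0 m))))

starred-δ : ∀ ψ w → starred ψ (λ y → FN.δ w y) ≡ P₀ (coeff ψ) w
starred-δ ψ w = trans (ev-cong pointwise ψ) (trans (ev-+ _ _ ψ) (sym (coeff-ev ψ (ι w)) ⊞
    trans (sym (ev-corr w support)) (corr-cong weights w)))
  where
  support : ℕ → Word → ℚ
  support zero x = 0ℚ
  support (suc zero) x = 0ℚ
  support (suc (suc m)) x = ratio m * FX.δ (blk (suc m) []) x
  ev-corr : ∀ w (c : ℕ → Word → ℚ) → corr (λ n → ev (c n) ψ) w ≡ ev (λ x → corr (λ n → c n x) w) ψ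
  ev-corr [] c = refl
  ev-corr (zero ∷ w) c = ev-corr w (λ n → c (suc n))
  ev-corr (suc _ ∷ w) c = sym (ev-zero ψ (λ _ → refl))
  weights : ∀ n → ev (support n) ψ ≡ correction (coeff ψ) n
  weights zero = ev-zero ψ (λ _ → refl)
  weights (suc zero) = ev-zero ψ (λ _ → refl)
  weights (suc (suc m)) = trans (ev-* (ratio m) _ ψ) (ratio m ⊠ sym (coeff-ev ψ _))
  supportY : ℕ → List ℕ → ℚ
  supportY zero y = 0ℚ
  supportY (suc zero) y = 0ℚ
  supportY (suc (suc m)) y = ratio m * FN.δ (suc m ∷ []) y
  zero-corr : ∀ w c → (∀ n → c n ≡ 0ℚ) → corr c w ≡ 0ℚ
  zero-corr [] c z = z 0
  zero-corr (zero ∷ w) c z = zero-corr w _ (λ n → z (suc n))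
  zero-corr (suc _ ∷ w) c z = refl
  outside : ∀ y → (∀ m → y ≢ suc m ∷ []) → corr (λ n → supportY n y) w ≡ 0ℚ
  outside y ne = zero-corr w (λ n → supportY n y) (λ { zero → refl ; (suc zero) → refl ; (suc (suc m)) → *0 (FN.δ-≢ (ne m)) })
  corrected-δ : ∀ y → corrected (λ y → FN.δ w y) y ≡ corr (λ n → supportY n y) w
  corrected-δ [] = sym (outside [] (λ m ()))
  corrected-δ (zero ∷ y) = sym (outside (zero ∷ y) (λ m ()))
  corrected-δ (suc m ∷ _ ∷ _) = sym (outside (suc m ∷ _ ∷ _) (λ m ()))
  corrected-δ (suc k ∷ []) = trans (sym (corr-δ (ratio k) (suc (suc k)) w)) (corr-cong same w)
    where
    zeros-injective : ∀ m k → zeros m ≡ zeros k → m ≡ k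
    zeros-injective m k e = trans (sym (LP.length-replicate m)) (trans (cong length e) (LP.length-replicate k))
    same : ∀ n → ratio k * FN.δ (zeros n) (zeros (suc (suc k))) ≡ supportY n (suc k ∷ [])
    same zero = *0 (FN.δ-≢ {0 ∷ zeros (suc k)} {[]} (λ ()))
    same (suc zero) = *0 (FN.δ-≢ {0 ∷ zeros (suc k)} {0 ∷ []} (λ ()))
    same (suc (suc m)) = go (k ℕ.≟ m)
      where
      go : Dec (k ≡ m) → ratio k * FN.δ (zeros (suc (suc m))) (zeros (suc (suc k))) ≡ ratio m * FN.δ (suc m ∷ []) (suc k ∷ [])
      go (yes refl) = ratio k ⊠ trans (FN.δ-refl (zeros (suc (suc k)))) (sym (FN.δ-refl (suc k ∷ [])))
      go (no ne) = trans (*0 (FN.δ-≢ (λ e → ne (ℕP.suc-injective (ℕP.suc-injective (zeros-injective _ _ e))))))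
        (sym (*0 (FN.δ-≢ {suc k ∷ []} {suc m ∷ []} (λ e → ne (ℕP.suc-injective (LP.∷-injectiveˡ e))))))
  pointwise : ∀ x → onY (λ y → FN.δ w y + corrected (λ y → FN.δ w y) y) x ≡ FX.δ (ι w) x + corr (λ n → support n x) w
  pointwise x = trans (split (piY′ zero x)) (δ-ι w x ⊞ trans (from (piY′ zero x) refl) (corr-cong (λ { zero → refl ; (suc zero) → refl ; (suc (suc m)) → ratio m ⊠ δ-ι (suc m ∷ []) x }) w))
    where
    supportM : ℕ → ℚ
    supportM zero = 0ℚ
    supportM (suc zero) = 0ℚ
    supportM (suc (suc m)) = ratio m * onY (FN.δ (suc m ∷ [])) x
    split : ∀ o → Maybe.maybe′ (λ y → FN.δ w y + corrected (λ y → FN.δ w y) y) 0ℚ o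
      ≡ Maybe.maybe′ (FN.δ w) 0ℚ o + Maybe.maybe′ (corrected (λ y → FN.δ w y)) 0ℚ o
    split (just y) = refl
    split nothing = sym (+-identityˡ 0ℚ)
    from : ∀ o → piY′ zero x ≡ o → Maybe.maybe′ (corrected (λ y → FN.δ w y)) 0ℚ o ≡ corr supportM w
    from nothing e = sym (zero-corr w supportM (λ { zero → refl ; (suc zero) → refl ; (suc (suc m)) → *0 (cong (Maybe.maybe′ _ 0ℚ) e) }))
    from (just y) e = trans (corrected-δ y) (corr-cong (λ { zero → refl ; (suc zero) → refl ; (suc (suc m)) → ratio m ⊠ sym (cong (Maybe.maybe′ _ 0ℚ) e) }) w)

starred-st : ∀ ψ u v → FN.coproduct Δ* (ψ* ψ) (map suc u) (map suc v) ≡ st (P₀ (coeff ψ)) u v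
starred-st ψ u v = trans (ev-ψ* _ ψ) (trans (cong-lin (starred-linear ψ) (λ y → st-δ y u v))
  (trans (St.lin-st (starred-linear ψ) (λ y x → FN.δ x y) u v) (St.st-cong (λ x → starred-δ ψ x) u v)))

coeff-ψ* : ∀ ψ w → PN.coeff (ψ* ψ) (map suc w) ≡ P₀ (coeff ψ) w
coeff-ψ* ψ w = trans (FN.coeff-ev (ψ* ψ) (map suc w)) (trans (ev-ψ* _ ψ) (trans (cong-lin (starred-linear ψ) (δ-map-suc w)) (starred-δ ψ w)))

-- Membership in 𝔡𝔪₀ as a condition on coefficients: both primitivity conditions become vanishing on
-- products.
record DoubleShuffle (Ψ : Word → ℚ) : Set where
  field
    kills : Sh.Kills Ψ
    Ψ-x₀ : Ψ (x0 ∷ []) ≡ 0ℚ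
    Ψ-x₁ : Ψ (x1 ∷ []) ≡ 0ℚ
    Ψ-x₀x₁ : Ψ (x0 ∷ x1 ∷ []) ≡ 0ℚ
    P₀-st : ∀ a u b v → st (P₀ Ψ) (a ∷ u) (b ∷ v) ≡ 0ℚ

𝔡𝔪₀⇒ : ∀ ψ → In𝔡𝔪₀ ψ → DoubleShuffle (coeff ψ)
𝔡𝔪₀⇒ ψ (z₀ , z₁ , p , p* , z₀₁) = record
  { kills = primitive⇒kills ψ p ; Ψ-x₀ = z₀ ; Ψ-x₁ = z₁ ; Ψ-x₀x₁ = z₀₁
  ; P₀-st = λ a u b v → trans (sym (starred-st ψ (a ∷ u) (b ∷ v))) (trans (FN.primitive⇒ Δ* (ψ* ψ) p* _ _)
      (0+0 (*0 (FN.δ-[]∷ (suc b) (map suc v))) (0* (FN.δ-[]∷ (suc a) (map suc u))))) }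

⇒𝔡𝔪₀ : ∀ ψ → DoubleShuffle (coeff ψ) → In𝔡𝔪₀ ψ
⇒𝔡𝔪₀ ψ ds = Ψ-x₀ , Ψ-x₁ , kills⇒primitive ψ kills , FN.⇒primitive Δ* (ψ* ψ) go , Ψ-x₀x₁
  where
  open DoubleShuffle ds
  -- The alphabet ℕ contains the letter 0, which is no y_k; on words using it both sides of the
  -- primitivity condition vanish.
  Shape : List ℕ → Set
  Shape u = (∃ λ u′ → u ≡ map suc u′) ⊎ (∀ y → FN.δ u (map suc y) ≡ 0ℚ)
  shape : ∀ u → Shape u
  shape [] = inj₁ ([] , refl)
  shape (zero ∷ u) = inj₂ (λ { [] → FN.δ-[]∷ 0 u ; (y ∷ ys) → FN.δ-≢ {suc y ∷ map suc ys} {0 ∷ u} (λ ()) })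
  shape (suc m ∷ u) with shape u
  ... | inj₁ (u′ , refl) = inj₁ (m ∷ u′ , refl)
  ... | inj₂ z = inj₂ (λ { [] → FN.δ-[]∷ (suc m) u ; (y ∷ ys) → trans (FN.δ-∷ (suc m) u (suc y) (map suc ys)) (*0 (z ys)) })
  coeff-outside : ∀ u → (∀ y → FN.δ u (map suc y) ≡ 0ℚ) → PN.coeff (ψ* ψ) u ≡ 0ℚ
  coeff-outside u z = trans (FN.coeff-ev (ψ* ψ) u) (trans (ev-ψ* _ ψ) (zero-lin (starred-linear ψ) z))
  coproduct-outside : ∀ u v → (∀ p q → FN.δ₂ u v (map suc p , map suc q) ≡ 0ℚ) → FN.coproduct Δ* (ψ* ψ) u v ≡ 0ℚ
  coproduct-outside u v z = trans (ev-ψ* _ ψ) (zero-lin (starred-linear ψ) (λ y → trans (ev-Δ* (FN.δ₂ u v) y) (stuffle-cop-zero y z)))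
  P₀-[] : P₀ (coeff ψ) [] ≡ 0ℚ
  P₀-[] = 0+0 (proj₁ kills) refl
  go : ∀ u v → FN.coproduct Δ* (ψ* ψ) u v ≡ PN.coeff (ψ* ψ) u * FN.δ v [] + FN.δ u [] * PN.coeff (ψ* ψ) v
  go u v with shape u | shape v
  ... | inj₂ z | _ = trans (coproduct-outside u v (λ p q → 0* (z p))) (sym (0+0 (0* (coeff-outside u z)) (0* (z []))))
  ... | inj₁ _ | inj₂ z = trans (coproduct-outside u v (λ p q → *0 (z q))) (sym (0+0 (*0 (z [])) (*0 (coeff-outside v z))))
  ... | inj₁ (u′ , refl) | inj₁ (v′ , refl) = trans (starred-st ψ u′ v′) (trans (cases u′ v′)
      (sym (cong (_* FN.δ (map suc v′) []) (coeff-ψ* ψ u′) ⊞ cong (FN.δ (map suc u′) [] *_) (coeff-ψ* ψ v′))))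
    where
    cases : ∀ u v → st (P₀ (coeff ψ)) u v ≡ P₀ (coeff ψ) u * FN.δ (map suc v) [] + FN.δ (map suc u) [] * P₀ (coeff ψ) v
    cases [] v = trans (sym (*-identityˡ _)) (sym (0+ (0* P₀-[])))
    cases (a ∷ u) [] = sym (trans (+0 (0* (FN.δ-[]∷ (suc a) (map suc u)))) (*-identityʳ _))
    cases (a ∷ u) (b ∷ v) = trans (P₀-st a u b v) (sym (0+0 (*0 (FN.δ-[]∷ (suc b) (map suc v))) (0* (FN.δ-[]∷ (suc a) (map suc u)))))

-- Parity: homogeneous double shuffle elements are admissible

nat-ℚᵘ : ∀ n → ℚ.toℚᵘ (nat n) ℚᵘ.≃ ℚᵘ.mkℚᵘ (ℤ.+ n) 0
nat-ℚᵘ zero = ℚᵘP.≃-refl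
nat-ℚᵘ (suc n) = ℚᵘP.≃-trans (ℚᵘP.≃-reflexive (cong ℚ.toℚᵘ (sym (+-def 1ℚ (nat n)))))
  (ℚᵘP.≃-trans (ℚP.toℚᵘ-homo-+ 1ℚ (nat n)) (ℚᵘP.≃-trans (ℚᵘP.+-cong (ℚᵘP.≃-refl {ℚᵘ.1ℚᵘ}) (nat-ℚᵘ n))
    (ℚᵘ.*≡* (cong (ℤ._* ℤ.+ 1) (cong (λ k → ℤ.+ 1 ℤ.+ k) (ℤP.*-identityʳ (ℤ.+ n)))))))

nat-inverse : NatInverse
nat-inverse = record
  { inv = λ n → ℤ.+ 1 ℚ./ suc n
  ; inv-nat = λ n → trans (sym (*-def _ _)) (ℚP.toℚᵘ-injective (ℚᵘP.≃-trans (ℚP.toℚᵘ-homo-* (ℤ.+ 1 ℚ./ suc n) (nat (suc n)))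
      (ℚᵘP.≃-trans (ℚᵘP.*-cong (ℚP.toℚᵘ-fromℚᵘ (ℚᵘ.mkℚᵘ (ℤ.+ 1) n)) (nat-ℚᵘ (suc n)))
        (ℚᵘ.*≡* (cong ℤ.+_ (trans (ℕP.*-identityʳ (suc n ℕ.+ 0)) (cong (λ k → suc k ℕ.+ 0) (sym (ℕP.*-identityʳ n)))))))))
  }

open NatInverse nat-inverse public

Hom : ℕ → (Word → ℚ) → Set
Hom n Ψ = ∀ w → length w ≢ n → Ψ w ≡ 0ℚ

sgn-square : ∀ n → sgn n * sgn n ≡ 1ℚ
sgn-square zero = *-identityˡ 1ℚ
sgn-square (suc n) = trans (cong (λ x → x * x) (neg-def (sgn n))) (trans (solve 1 (λ x → :- x :* :- x := x :* x) refl _) (sgn-square n))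

-- The antipode gives reversal the sign -(-1)^N in weight N. Shuffling with x₀ expresses the
-- coefficient at x₀^k x₁ x₀^i through those with fewer trailing x₀, so it is enough that the sign
-- fixes the coefficients at x₀^n x₁.
admissible : ∀ {Ψ} N → Hom N Ψ → DoubleShuffle Ψ → (∀ n → - sgn N * Ψ (blk n []) ≡ Ψ (blk n [])) → Admissible Ψ
admissible {Ψ} N homogeneous ds depth1 = record
  { kills = kills ; Ψ-x₀ = Ψ-x₀ ; Ψ-x₁ = Ψ-x₁ ; Ψ-x₀x₁ = Ψ-x₀x₁
  ; on-𝔥¹ = λ F z w → trans (sym (+0 (spl-zero w (λ p q → *0 (z q))))) (trans (Rac.bridge F w) (zero-lin (Rac.Stuffle.s-linear w) z))
  ; on-stuffle = Rac.racinet ιinv ιinv-ι }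
  where
  open DoubleShuffle ds
  ε : ℚ
  ε = - sgn N
  Ψ-reverse : ∀ w → Ψ (reverse w) ≡ ε * Ψ w
  Ψ-reverse w with length w ℕ.≟ N
  ... | no ne = trans (homogeneous (reverse w) (λ e → ne (trans (sym (LP.length-reverse w)) e))) (sym (*0 (homogeneous w ne)))
  ... | yes refl = lin (cong (λ x → sgn N * x) (antipode Ψ kills w) ⊞ cong (_* Ψ (reverse w)) (sym (sgn-square N)))
    (solve 3 (λ s r p → r :+ (s :* :- p :+ (s :* s) :* r) := :- s :* p :+ (s :* (s :* r) :+ con 1ℚ :* r)) refl (sgn N) _ _)
  Ψ-depth1 : ∀ k i → ε * Ψ (blk k (zs i)) ≡ Ψ (blk k (zs i))
  Ψ-depth1 k zero = depth1 k
  Ψ-depth1 k (suc i) = lin (nat-cancel i {ε * x + - x} zero-diff) (solve 2 (λ a b → a :+ con 0ℚ := b :+ (a :+ :- b)) refl _ _)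
    where
    x : ℚ
    x = Ψ (blk k (zs (suc i)))
    y : ℚ
    y = Ψ (blk (suc k) (zs i))
    relation : nat (suc k) * y + 0ℚ + nat (suc i) * x ≡ 0ℚ
    relation = trans (sym (sh-x₀ Ψ (k ∷ []) i)) (proj₂′ (blk k (zs i)) (blk≢[] k (zs i)))
      where
      proj₂′ : ∀ w → w ≢ [] → sh Ψ (x0 ∷ []) w ≡ 0ℚ
      proj₂′ [] ne = ⊥-elim (ne refl)
      proj₂′ (b ∷ v) ne = proj₂ kills x0 [] b v
    zero-diff : nat (suc i) * (ε * x + - x) ≡ 0ℚ
    zero-diff = lin ((ε ⊠ relation) ⊞ cong -_ relation ⊞ cong (λ z → nat (suc k) * (- z)) (Ψ-depth1 (suc k) i))
      (solve 5 (λ i ε x k y → i :* (ε :* x :+ :- x) :+ (ε :* con 0ℚ :+ :- con 0ℚ :+ k :* :- y)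
        := con 0ℚ :+ (ε :* (k :* y :+ con 0ℚ :+ i :* x) :+ :- (k :* y :+ con 0ℚ :+ i :* x) :+ k :* :- (ε :* y))) refl (nat (suc i)) _ _ (nat (suc k)) _)
  c-ε : ∀ n → ε * correction Ψ n ≡ correction Ψ n
  c-ε zero = zeroʳ ε
  c-ε (suc zero) = zeroʳ ε
  c-ε (suc (suc m)) = lin (ratio m ⊠ depth1 (suc m)) (solve 3 (λ e r p → e :* (r :* p) :+ r :* p := r :* p :+ r :* (e :* p)) refl _ _ _)
  module Rac = Racinet nat-inverse Ψ kills Ψ-x₀ ε
    (trans (solve 1 (λ s → :- s :* :- s := s :* s) refl (sgn N)) (sgn-square N))
    Ψ-reverse Ψ-depth1 (correction Ψ) c-ε refl refl P₀-st

-- Goncharov's coproduct, paired with Ψ ⊗ F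

gsum : (Poly → Word → ℚ) → List (Poly × Word) → ℚ
gsum f [] = 0ℚ
gsum f ((p , v) ∷ l) = f p v + gsum f l

gsum-++ : ∀ f l l′ → gsum f (l ++ l′) ≡ gsum f l + gsum f l′
gsum-++ f [] l′ = sym (+-identityˡ _)
gsum-++ f ((p , v) ∷ l) l′ = trans (refl ⊞ gsum-++ f l l′) (sym (+-assoc _ _ _))

gsum-cong : ∀ {f g} → (∀ p v → f p v ≡ g p v) → ∀ l → gsum f l ≡ gsum g l
gsum-cong e [] = refl
gsum-cong e ((p , v) ∷ l) = e p v ⊞ gsum-cong e l

gsum-+ : ∀ f g l → gsum (λ p v → f p v + g p v) l ≡ gsum f l + gsum g l
gsum-+ f g [] = sym (+-identityˡ 0ℚ)
gsum-+ f g ((p , v) ∷ l) = trans (refl ⊞ gsum-+ f g l) (+-swap _ _ _ _)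

gsum-* : ∀ k f l → gsum (λ p v → k * f p v) l ≡ k * gsum f l
gsum-* k f [] = sym (zeroʳ k)
gsum-* k f ((p , v) ∷ l) = trans (refl ⊞ gsum-* k f l) (sym (distribˡ k _ _))

gsum-map : ∀ f (h : Poly → Poly) e l → gsum f (map (λ p → (h (proj₁ p) , e ∷ proj₂ p)) l) ≡ gsum (λ p v → f (h p) (e ∷ v)) l
gsum-map f h e [] = refl
gsum-map f h e (_ ∷ l) = refl ⊞ gsum-map f h e l

ev-gonList : ∀ (T : Word × Word → ℚ) l → ev T (concatMap (λ p → map (λ q → (proj₁ q , proj₂ q , proj₂ p)) (proj₁ p)) l) ≡ gsum (λ p v → ev (λ u → T (u , v)) p) l
ev-gonList T [] = refl
ev-gonList T ((p , v) ∷ l) = trans (ev-++ T (map (λ q → (proj₁ q , proj₂ q , v)) p) _) (ev-mapʳ T (_, v) p ⊞ ev-gonList T l)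

counit : Word → ℚ
counit w = ifNil w 1ℚ

counit-Iseg : ∀ a seg b → ev counit (Iseg a seg b) ≡ ifNil seg 1ℚ
counit-Iseg x1 [] x0 = ev-single counit []
counit-Iseg x1 (s ∷ seg) x0 = ev-single counit (s ∷ seg)
counit-Iseg x0 [] x1 = trans (ev-scale counit 1ℚ (word [])) (trans (*-identityˡ _) (ev-single counit []))
counit-Iseg x0 (s ∷ seg) x1 = trans (ev-scale counit (sgn (suc (length seg))) (word (reverse (s ∷ seg)))) (*0 (trans (ev-single counit (reverse (s ∷ seg)))
  (trans (cong counit (LP.unfold-reverse s seg)) (nonempty (reverse seg)))))
  where
  nonempty : ∀ u → counit (u ∷ʳ s) ≡ 0ℚ
  nonempty [] = refl
  nonempty (_ ∷ _) = refl
counit-Iseg x0 [] x0 = ev-single counit []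
counit-Iseg x0 (_ ∷ _) x0 = refl
counit-Iseg x1 [] x1 = ev-single counit []
counit-Iseg x1 (_ ∷ _) x1 = refl

sh-counit : ∀ u v → sh counit u v ≡ counit u * counit v
sh-counit [] v = sym (*-identityˡ _)
sh-counit (a ∷ u) [] = sym (zeroˡ _)
sh-counit (a ∷ u) (b ∷ v) = trans (0+0 (0+0 (zero-lin (Sh.st-linear u (b ∷ v)) (λ _ → refl)) (zero-lin (Sh.st-linear (a ∷ u) v) (λ _ → refl))) refl) (sym (zeroˡ _))

counit-shP : ∀ p q → ev counit (shP p q) ≡ ev counit p * ev counit q
counit-shP p q = trans (ev-shP counit p q) (trans (ev-cong (λ u → trans (ev-cong (λ v → sh-counit u v) q) (trans (ev-* (counit u) counit q) (*-comm _ _))) p)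
  (trans (ev-* (ev counit q) counit p) (*-comm _ _)))

-- Under the counit only the summand with all segments empty survives, that is 1 ⊗ w.
gon-counit : ∀ a seg w (F : Word → ℚ) → gsum (λ p v → ev counit p * F v) (gonAux a seg w) ≡ ifNil seg (F w)
gon-counit a seg [] F = trans (+-identityʳ _) (trans (cong (_* F []) (counit-Iseg a seg x0)) (last seg))
  where
  last : ∀ (seg : Word) → ifNil seg 1ℚ * F [] ≡ ifNil seg (F [])
  last [] = *-identityˡ _
  last (_ ∷ _) = zeroˡ _
gon-counit a seg (e ∷ rest) F = trans (gsum-++ _ (gonAux a (seg ++ e ∷ []) rest) _)
  (trans (0+ (trans (gon-counit a (seg ++ e ∷ []) rest F) (extended seg)))
  (trans (gsum-map _ (shP (Iseg a seg e)) e (gonAux e [] rest))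
  (trans (gsum-cong (λ p v → trans (cong (_* F (e ∷ v)) (counit-shP (Iseg a seg e) p)) (*-assoc _ _ _)) (gonAux e [] rest))
  (trans (gsum-* _ _ (gonAux e [] rest)) (trans (cong₂ _*_ (counit-Iseg a seg e) (gon-counit e [] rest (λ v → F (e ∷ v)))) (last seg))))))
  where
  last : ∀ (seg : Word) → ifNil seg 1ℚ * F (e ∷ rest) ≡ ifNil seg (F (e ∷ rest))
  last [] = *-identityˡ _
  last (_ ∷ _) = zeroˡ _
  extended : ∀ (seg : Word) → ifNil (seg ++ e ∷ []) (F rest) ≡ 0ℚ
  extended [] = refl
  extended (_ ∷ _) = refl

gapLetter : Letter → Letter → ℚ
gapLetter a x0 = gap a (x0 ∷ [])
gapLetter a x1 = gap a (x1 ∷ [])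

gap-∷ : ∀ a b w → gap a (b ∷ w) ≡ gapLetter a b
gap-∷ x0 x0 w = refl
gap-∷ x0 x1 w = refl
gap-∷ x1 x0 w = refl
gap-∷ x1 x1 w = refl

gap-[] : ∀ a → gap a [] ≡ gapLetter a x0
gap-[] x0 = refl
gap-[] x1 = refl

-- An infinitesimal character is nonzero on a shuffle product of segments only if all but one of
-- them are empty, so the coproduct collapses to a single cut.
module GoncharovPairing (Ψ : Word → ℚ) (kills : Sh.Kills Ψ) where

  infinitesimal : ∀ u v → sh Ψ u v ≡ Ψ u * counit v + counit u * Ψ v
  infinitesimal [] v = trans (sym (*-identityˡ _)) (sym (0+ (0* (proj₁ kills))))
  infinitesimal (a ∷ u) [] = sym (trans (+0 (zeroˡ _)) (*-identityʳ _))
  infinitesimal (a ∷ u) (b ∷ v) = trans (proj₂ kills a u b v) (sym (0+0 (zeroʳ _) (zeroˡ _)))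

  ev-shP-infinitesimal : ∀ p q → ev Ψ (shP p q) ≡ ev Ψ p * ev counit q + ev counit p * ev Ψ q
  ev-shP-infinitesimal p q = trans (ev-shP Ψ p q) (trans (ev-cong (λ u → trans (ev-cong (infinitesimal u) q) (trans (ev-+ _ _ q)
      (trans (ev-* (Ψ u) counit q) (*-comm _ _) ⊞ trans (ev-* (counit u) Ψ q) (*-comm _ _)))) p)
    (trans (ev-+ _ _ p) (trans (ev-* (ev counit q) Ψ p) (*-comm _ _) ⊞ trans (ev-* (ev Ψ q) counit p) (*-comm _ _))))

  ev-Iseg : ∀ a seg b → ev Ψ (Iseg a seg b) ≡ gapLetter a b * Ψ seg
  ev-Iseg x1 seg x0 = trans (ev-single Ψ seg) (sym (*-identityˡ _))
  ev-Iseg x0 seg x1 = trans (ev-scale Ψ _ (word (reverse seg))) (trans (cong (sgn (length seg) *_) (ev-single Ψ (reverse seg)))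
    (trans (antipode Ψ kills seg) (solve 1 (λ x → :- x := con (ℚ.- 1ℚ) :* x) refl _)))
  ev-Iseg x0 [] x0 = trans (ev-single Ψ []) (trans (proj₁ kills) (sym (zeroˡ _)))
  ev-Iseg x0 (_ ∷ _) x0 = sym (zeroˡ _)
  ev-Iseg x1 [] x1 = trans (ev-single Ψ []) (trans (proj₁ kills) (sym (zeroˡ _)))
  ev-Iseg x1 (_ ∷ _) x1 = sym (zeroˡ _)

  inner : (Word → ℚ) → Word → ℚ
  inner F [] = 0ℚ
  inner F (e ∷ w) = gaps Ψ e (λ v → F (e ∷ v)) w

  gaps-inner : ∀ a (F : Word → ℚ) w → gaps Ψ a F w ≡ spl (λ p q → gap a q * Ψ p * F q) w + inner F w
  gaps-inner a F [] = sym (+-identityʳ _)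
  gaps-inner a F (e ∷ w) = refl

  -- In the first sum the segment collected so far is extended by p and then closed; the second,
  -- present only if nothing has been collected, makes its cut later.
  gon-gaps : ∀ a seg w (F : Word → ℚ) → gsum (λ p v → ev Ψ p * F v) (gonAux a seg w) ≡ spl (λ p q → gap a q * Ψ (seg ++ p) * F q) w + ifNil seg (inner F w)
  gon-gaps a seg [] F = trans (cong (λ x → x * F [] + 0ℚ) (trans (ev-Iseg a seg x0) (cong₂ (λ g v → g * Ψ v) (sym (gap-[] a)) (sym (LP.++-identityʳ seg)))))
    (refl ⊞ last seg)
    where
    last : ∀ (seg : Word) → 0ℚ ≡ ifNil seg 0ℚ
    last [] = refl
    last (_ ∷ _) = refl
  gon-gaps a seg (e ∷ rest) F = trans (gsum-++ _ (gonAux a (seg ++ e ∷ []) rest) _)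
    (trans (trans (gon-gaps a (seg ++ e ∷ []) rest F) (trans (+0 (extended seg)) (spl-cong (λ p q → cong (λ v → gap a q * Ψ v * F q) (LP.++-assoc seg (e ∷ []) p)) rest))
      ⊞ trans (gsum-map _ (shP (Iseg a seg e)) e (gonAux e [] rest))
        (trans (gsum-cong (λ p v → trans (cong (_* F (e ∷ v)) (ev-shP-infinitesimal (Iseg a seg e) p))
            (solve 5 (λ x y z t f → (x :* y :+ z :* t) :* f := x :* (y :* f) :+ z :* (t :* f)) refl _ _ _ _ _)) (gonAux e [] rest))
        (trans (gsum-+ _ _ (gonAux e [] rest)) (trans (gsum-* _ _ (gonAux e [] rest)) (cong₂ _*_ (trans (ev-Iseg a seg e) (cong₂ (λ g v → g * Ψ v) (sym (gap-∷ a e rest)) (sym (LP.++-identityʳ seg)))) (gon-counit e [] rest (λ v → F (e ∷ v))))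
          ⊞ trans (gsum-* _ _ (gonAux e [] rest)) (trans (cong₂ _*_ (counit-Iseg a seg e)
              (trans (gon-gaps e [] rest (λ v → F (e ∷ v))) (sym (gaps-inner e (λ v → F (e ∷ v)) rest)))) (last seg))))))
    (solve 3 (λ x y z → x :+ (y :+ z) := (y :+ x) :+ z) refl _ _ _))
    where
    extended : ∀ (seg : Word) → ifNil (seg ++ e ∷ []) (inner F rest) ≡ 0ℚ
    extended [] = refl
    extended (_ ∷ _) = refl
    last : ∀ (seg : Word) → ifNil seg 1ℚ * gaps Ψ e (λ v → F (e ∷ v)) rest ≡ ifNil seg (gaps Ψ e (λ v → F (e ∷ v)) rest)
    last [] = *-identityˡ _
    last (_ ∷ _) = zeroˡ _

  ev-ΔGon : ∀ (F : Word → ℚ) f → ev (λ t → Ψ (proj₁ t) * F (proj₂ t)) (ΔGon f) ≡ ev F (D Ψ f)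
  ev-ΔGon F f = trans (FX.ev-linT _ ΔGonW f) (trans (ev-cong (λ w → trans (ev-gonList _ (gonAux x1 [] w))
      (trans (gsum-cong (λ p v → trans (trans (ev-cong (λ u → *-comm _ _) p) (ev-* (F v) Ψ p)) (*-comm _ _)) (gonAux x1 [] w))
      (trans (gon-gaps x1 [] w F) (trans (sym (gaps-inner x1 F w)) (sym (sX≡gaps Ψ (proj₁ kills) F w)))))) f)
    (sym (ev-D F Ψ f (proj₁ kills))))

  ev-leftWeight : ∀ n → Hom n Ψ → ∀ (F : Word → ℚ) T → ev (λ t → Ψ (proj₁ t) * F (proj₂ t)) (leftWeight n T) ≡ ev (λ t → Ψ (proj₁ t) * F (proj₂ t)) T
  ev-leftWeight n h F [] = refl
  ev-leftWeight n h F ((c , u , v) ∷ T) = go (length u ℕ.≟ n)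
    where
    G : Word × Word → ℚ
    G t = Ψ (proj₁ t) * F (proj₂ t)
    P? : ∀ (t : ℚ × Word × Word) → Dec (length (proj₁ (proj₂ t)) ≡ n)
    P? t = length (proj₁ (proj₂ t)) ℕ.≟ n
    go : Dec (length u ≡ n) → ev G (leftWeight n ((c , u , v) ∷ T)) ≡ c * (Ψ u * F v) + ev G T
    go (yes e) = trans (cong (ev G) (LP.filter-accept P? {c , u , v} {T} e)) (cong (c * (Ψ u * F v) +_) (ev-leftWeight n h F T))
    go (no ne) = trans (cong (ev G) (LP.filter-reject P? {c , u , v} {T} ne)) (trans (ev-leftWeight n h F T) (sym (0+ (*0 (0* (h u ne))))))

-- The Ihara bracket of polynomials and commutators of D_ψ

δ-++ : ∀ w u v → FX.δ w (u ++ v) ≡ spl (λ p q → FX.δ p u * FX.δ q v) w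
δ-++ w [] v = sym (trans (spl-cong {G = λ p q → ifNil p (FX.δ q v)} (λ { [] q → trans (cong (_* FX.δ q v) (FX.δ-refl [])) (*-identityˡ _) ; (a ∷ p) q → 0* (FX.δ-[]∷ a p) }) w) (spl-ifNil (λ q → FX.δ q v) w))
δ-++ [] (a ∷ u) v = trans (FX.δ-≢ {a ∷ u ++ v} {[]} (λ ())) (sym (0* (FX.δ-≢ {a ∷ u} {[]} (λ ()))))
δ-++ (b ∷ w) (a ∷ u) v = trans (FX.δ-∷ b w a (u ++ v)) (trans (FX.δ (b ∷ []) (a ∷ []) ⊠ δ-++ w u v)
  (trans (sym (spl-* _ (λ p q → FX.δ p u * FX.δ q v) w)) (trans (spl-cong (λ p q → trans (sym (*-assoc _ _ _)) (cong (_* FX.δ q v) (sym (FX.δ-∷ b p a u)))) w)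
  (sym (0+ (0* (FX.δ-≢ {a ∷ u} {[]} (λ ()))))))))

coeff-· : ∀ f g w → coeff (f · g) w ≡ (coeff f ⋆ coeff g) w
coeff-· f g w = trans (coeff-ev (f · g) w) (trans (ev-bind (FX.δ w) _ (λ u → ev (λ v → FX.δ w (u ++ v)) g) (λ c u → ev-scaleMap (FX.δ w) (u ++_) c g) f)
  (trans (ev-cong (λ u → trans (ev-cong (λ v → δ-++ w u v) g) (sym (lin-pull u))) f)
  (sym (trans (spl-cong (λ p q → trans (cong₂ _*_ (coeff-ev f p) (coeff-ev g q)) (trans (*-comm _ _) (trans (sym (ev-* _ (FX.δ p) f)) (ev-cong (λ u → *-comm _ _) f)))) w)
     (sym (lin-spl (ev-linear f) (λ u p q → FX.δ p u * ev (FX.δ q) g) w))))))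
  where
  lin-pull : ∀ u → spl (λ p q → FX.δ p u * ev (FX.δ q) g) w ≡ ev (λ v → spl (λ p q → FX.δ p u * FX.δ q v) w) g
  lin-pull u = sym (trans (lin-spl (ev-linear g) (λ v p q → FX.δ p u * FX.δ q v) w) (spl-cong (λ p q → ev-* (FX.δ p u) (FX.δ q) g) w))

coeff-⊕ : ∀ f g w → coeff (f ⊕ g) w ≡ coeff f w + coeff g w
coeff-⊕ f g w = trans (coeff-ev (f ⊕ g) w) (trans (ev-++ (FX.δ w) f g) (sym (coeff-ev f w) ⊞ sym (coeff-ev g w)))

coeff-⊖ : ∀ f g w → coeff (f ⊖ g) w ≡ coeff f w + - coeff g w
coeff-⊖ f g w = trans (coeff-ev (f ⊖ g) w) (trans (ev-⊖ (FX.δ w) f g) (sym (coeff-ev f w) ⊞ cong -_ (sym (coeff-ev g w))))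

coeff-word : ∀ u w → coeff (word u) w ≡ FX.δ w u
coeff-word u w = trans (coeff-ev (word u) w) (ev-single (FX.δ w) u)

private
  X₀-δ : ∀ x → FX.δ x (x0 ∷ []) ≡ X₀ x
  X₀-δ [] = refl
  X₀-δ (x0 ∷ []) = refl
  X₀-δ (x1 ∷ []) = refl
  X₀-δ (x0 ∷ a ∷ x) = FX.δ-≢ {x0 ∷ []} {x0 ∷ a ∷ x} (λ ())
  X₀-δ (x1 ∷ a ∷ x) = FX.δ-≢ {x0 ∷ []} {x1 ∷ a ∷ x} (λ ())

  ε-δ : ∀ x → FX.δ x [] ≡ ifNil x 1ℚ
  ε-δ [] = refl
  ε-δ (a ∷ x) = FX.δ-[]∷ a x

  sX-X₁ : ∀ f → f [] ≡ 0ℚ → ∀ w → sX f (λ x → FX.δ x (x1 ∷ [])) w ≡ ((λ x → FX.δ x (x1 ∷ [])) ⋆ f) w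
  sX-X₁ f z [] = sym (zeroˡ _)
  sX-X₁ f z (m ∷ w) = trans (0+ (0+0 (zeroˡ _) (spl-zero (m ∷ w) (λ p q → *0 {comm₀ f p} (FX.δ-≢ {x1 ∷ []} {x0 ∷ q} (λ ())))))) (trans (tail m) (sym (0+ (zeroˡ _))))
    where
    tail : ∀ m → sX f (λ v → FX.δ (m ∷ v) (x1 ∷ [])) w ≡ spl (λ p q → FX.δ (m ∷ p) (x1 ∷ []) * f q) w
    tail x0 = trans (zero-lin (sX-linear f w) (λ v → FX.δ-≢ {x1 ∷ []} {x0 ∷ v} (λ ()))) (sym (spl-zero w (λ p q → 0* (FX.δ-≢ {x1 ∷ []} {x0 ∷ p} (λ ())))))
    tail x1 = trans (cong-lin (sX-linear f w) peel) (trans (sX-scalar f z 1ℚ w)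
      (sym (trans (spl-cong {G = λ p q → ifNil p (1ℚ * f q)} (λ { [] q → refl ; (a ∷ p) q → 0* (peel (a ∷ p)) }) w) (spl-ifNil (λ q → 1ℚ * f q) w))))
      where
      peel : ∀ v → FX.δ (x1 ∷ v) (x1 ∷ []) ≡ ifNil v 1ℚ
      peel v = trans (FX.δ-∷ x1 v x1 []) (trans (*-identityˡ _) (ε-δ v))

-- The derivation x₀ ↦ [f , x₀], x₁ ↦ 0 is d_f plus the inner derivation [f , ·], which trades right
-- multiplication by f for left multiplication.
sX-word : ∀ f → coeff f [] ≡ 0ℚ → ∀ u w → sX (coeff f) (λ x → FX.δ x u) w ≡ (coeff f ⋆ (λ x → FX.δ x u)) w + coeff (dWord f u) w
sX-word f z [] w = trans (trans (cong-lin (sX-linear (coeff f) w) ε-δ) (trans (sX-scalar (coeff f) z 1ℚ w) (*-identityˡ _)))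
  (sym (+0′ (trans (spl-cong {G = λ p q → ifNil q (coeff f p)} (λ { p [] → *-identityʳ _ ; p (a ∷ q) → *0 (FX.δ-[]∷ a q) }) w) (spl-end (coeff f) w))))
  where
  +0′ : ∀ {a b : ℚ} → a ≡ b → a + 0ℚ ≡ b
  +0′ e = trans (+-identityʳ _) e
sX-word f z (a ∷ u) w = lin
  (cong-lin (sX-linear F w) (λ x → δ-++ x (a ∷ []) u)
   ⊞ leibniz F z Xa Du w
   ⊞ trans (cong-lin (⋆-linearˡ Du w) (letter a)) (trans (add (⋆-linearˡ Du w) (F ⋆ Xa) (coeff (dLetter f a))) (⋆-assoc F Xa Du w ⊞ refl))
   ⊞ trans (cong-lin (⋆-linearʳ Xa w) (sX-word f z u)) (add (⋆-linearʳ Xa w) (F ⋆ Du) (coeff (dWord f u)))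
   ⊞ sym (trans (coeff-⊕ (dLetter f a · word u) _ w) (trans (coeff-· (dLetter f a) (word u) w) (cong-lin (⋆-linearʳ (coeff (dLetter f a)) w) (coeff-word u))
        ⊞ trans (coeff-· (word (a ∷ [])) (dWord f u) w) (cong-lin (⋆-linearˡ (coeff (dWord f u)) w) (coeff-word (a ∷ [])))))
   ⊞ cong-lin (⋆-linearʳ F w) (λ x → sym (δ-++ x (a ∷ []) u)))
  (solve 10 (λ S S′ A B C dl N dw T Z → S :+ (S′ :+ (B :+ C) :+ (T :+ dl) :+ (A :+ N) :+ dw :+ Z)
      := (Z :+ dw) :+ (S :+ (S′ :+ A) :+ B :+ C :+ (dl :+ N) :+ T)) refl _ _ _ _ _ _ _ _ _ _)
  where
  F Xa Du : Word → ℚ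
  F = coeff f
  Xa x = FX.δ x (a ∷ [])
  Du x = FX.δ x u
  letter : ∀ a w → sX F (λ x → FX.δ x (a ∷ [])) w ≡ (F ⋆ (λ x → FX.δ x (a ∷ []))) w + coeff (dLetter f a) w
  letter x0 w = trans (cong-lin (sX-linear F w) X₀-δ) (trans (sX-X₀ F z w) (trans (cong-lin (⋆-linearʳ F w) (λ x → sym (X₀-δ x))) (sym (+-identityʳ _))))
  letter x1 w = lin (sX-X₁ F z w ⊞ sym (trans (coeff-⊖ (word (x1 ∷ []) · f) _ w) (trans (coeff-· (word (x1 ∷ [])) f w) (cong-lin (⋆-linearˡ F w) (coeff-word (x1 ∷ [])))
      ⊞ cong -_ (trans (coeff-· f (word (x1 ∷ [])) w) (cong-lin (⋆-linearʳ F w) (coeff-word (x1 ∷ [])))))))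
    (solve 4 (λ s a b c → s :+ (a :+ c) := (b :+ c) :+ (s :+ (a :+ :- b))) refl _ _ _ _)

coeff-ihara : ∀ f g → coeff f [] ≡ 0ℚ → coeff g [] ≡ 0ℚ → ∀ w → coeff (ihara f g) w ≡ sX (coeff f) (coeff g) w + - sX (coeff g) (coeff f) w
coeff-ihara f g zf zg w = lin
  (trans (coeff-⊖ (linP (dWord f) g ⊖ linP (dWord g) f ⊕ f · g) (g · f) w)
    (trans (coeff-⊕ (linP (dWord f) g ⊖ linP (dWord g) f) (f · g) w) (coeff-⊖ (linP (dWord f) g) (linP (dWord g) f) w ⊞ coeff-· f g w) ⊞ cong -_ (coeff-· g f w))
   ⊞ sym (expand f g zf) ⊞ cong -_ (sym (expand g f zg)))
  (solve 7 (λ i a b c d s t → i :+ ((a :+ :- b :+ c :+ :- d) :+ s :+ :- t) := (s :+ :- t) :+ (i :+ (c :+ a) :+ :- (d :+ b))) refl _ _ _ _ _ _ _)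
  where
  expand : ∀ f g → coeff f [] ≡ 0ℚ → sX (coeff f) (coeff g) w ≡ (coeff f ⋆ coeff g) w + coeff (linP (dWord f) g) w
  expand f g z = trans (cong-lin (sX-linear (coeff f) w) (coeff-ev g))
    (trans (ev-lin (sX-linear (coeff f) w) (λ x u → FX.δ x u) g) (trans (ev-cong (λ u → sX-word f z u w) g) (trans (ev-+ _ _ g)
      (trans (sym (ev-lin (⋆-linearʳ (coeff f) w) (λ x u → FX.δ x u) g)) (cong-lin (⋆-linearʳ (coeff f) w) (λ x → sym (coeff-ev g x)))
       ⊞ sym (trans (coeff-ev (linP (dWord f) g) w) (trans (ev-linP (FX.δ w) (dWord f) g) (ev-cong (λ u → sym (coeff-ev (dWord f u) w)) g)))))))

D-cong : ∀ {Ψ Φ} → Ψ [] ≡ 0ℚ → (∀ w → Ψ w ≡ Φ w) → ∀ f → D Ψ f ~ D Φ f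
D-cong {Ψ} {Φ} z e f = tested λ F → trans (ev-linP F (gapsP Ψ x1) f) (trans (ev-cong (λ w → trans (ev-gapsP F Ψ x1 w) (trans (gaps-cong x1 F w) (sym (ev-gapsP F Φ x1 w)))) f) (sym (ev-linP F (gapsP Φ x1) f)))
  where
  gaps-cong : ∀ a F w → gaps Ψ a F w ≡ gaps Φ a F w
  gaps-cong a F [] = cong (λ x → gap a [] * x * F []) (e [])
  gaps-cong a F (b ∷ w) = spl-cong (λ p q → cong (λ x → gap a q * x * F q) (e p)) (b ∷ w) ⊞ gaps-cong b (λ w → F (b ∷ w)) w

-- `D` is the transpose of the operator in `bracket`, which reverses the order of composition.
D-ihara : ∀ f g → coeff f [] ≡ 0ℚ → coeff g [] ≡ 0ℚ → ∀ p →
  D (coeff (ihara f g)) p ~ D (coeff g) (D (coeff f) p) ⊖ D (coeff f) (D (coeff g) p)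
D-ihara f g zf zg p = ~-trans (D-cong i₀ (coeff-ihara f g zf zg) p) (tested λ F →
  trans (ev-D F Br.h p refl′) (trans (ev-cong (λ w → sym (Br.bracket F w)) p) (trans (ev-+ _ _ p)
    (trans (trans (sym (ev-D _ (coeff f) p zf)) (sym (ev-D F (coeff g) (D (coeff f) p) zg))
       ⊞ trans (ev-neg _ p) (cong -_ (trans (sym (ev-D _ (coeff g) p zg)) (sym (ev-D F (coeff f) (D (coeff g) p) zf)))))
     (sym (ev-⊖ F (D (coeff g) (D (coeff f) p)) _))))))
  where
  module Br = Bracket (coeff f) (coeff g) zf zg
  refl′ : Br.h [] ≡ 0ℚ
  refl′ = -‿inverseʳ 0ℚ
  i₀ : coeff (ihara f g) [] ≡ 0ℚ
  i₀ = trans (coeff-ihara f g zf zg []) refl′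

-- Regularisation by Newton's identities

HasPos? : ∀ w → HasPos w ⊎ ∃ λ n → w ≡ zeros n
HasPos? [] = inj₂ (0 , refl)
HasPos? (suc m ∷ w) = inj₁ here
HasPos? (zero ∷ w) with HasPos? w
... | inj₁ p = inj₁ (there p)
... | inj₂ (n , e) = inj₂ (suc n , cong (0 ∷_) e)

-- at most k leading zeros, followed by a positive letter
data Leading : ℕ → List ℕ → Set where
  pos : ∀ {k m u} → Leading k (suc m ∷ u)
  zer : ∀ {k w} → Leading k w → Leading (suc k) (0 ∷ w)

leading : ∀ {w} → HasPos w → ∃ λ k → Leading k w
leading here = 0 , pos
leading (there {zero} p) with leading p
... | k , l = suc k , zer l
leading (there {suc m} p) = 0 , pos

-- A contraction, or an insertion behind the leading zeros, leaves at most k leading zeros, where F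
-- vanishes. The other insertions all give 0 ∷ w, and the factor counts them.
st-zero-letter : ∀ k F w → (∀ v → Leading k v → F v ≡ 0ℚ) → Leading k w → ∃ λ j → st F (0 ∷ []) w ≡ nat (suc j) * F (0 ∷ w)
st-zero-letter k F (suc m ∷ u) z pos = 0 , trans (+0 (zero-lin (St.st-linear [] u) (λ v → z (suc (suc m) ∷ v) pos)))
  (trans (+0 (zero-lin (St.st-linear (0 ∷ []) u) (λ v → z (suc m ∷ v) pos))) (solve 1 (λ x → x := (con 1ℚ :+ con 0ℚ) :* x) refl _))
st-zero-letter (suc k) F (0 ∷ w) z (zer l) with st-zero-letter k (λ v → F (0 ∷ v)) w (λ v l → z (0 ∷ v) (zer l)) l
... | j , e = suc j , trans (cong₂ (λ x y → F (0 ∷ 0 ∷ w) + x + y) e (z (1 ∷ w) pos))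
  (solve 2 (λ x n → x :+ n :* x :+ con 0ℚ := (con 1ℚ :+ n) :* x) refl (F (0 ∷ 0 ∷ w)) (nat (suc j)))

st-nonempty : ∀ G a u v → (∀ b y → G (b ∷ y) ≡ 0ℚ) → st G (a ∷ u) v ≡ 0ℚ
st-nonempty G a u [] z = z a u
st-nonempty G a u (b ∷ v) z = 0+0 (0+0 (zero-lin (St.st-linear u (b ∷ v)) (z a)) (zero-lin (St.st-linear (a ∷ u) v) (z b))) (zero-lin (St.st-linear u v) (z (suc (a ℕ.+ b))))

-- (y₁ ∗ w) ∗ b = w ∗ (y₁ ∗ b)
st-exchange : ∀ F w b → st (λ x → st F x b) (0 ∷ []) w ≡ st (λ y → st F w y) (0 ∷ []) b
st-exchange F w b = trans (St.st-comm (λ x → st F x b) (0 ∷ []) w) (St.st-assoc F w (0 ∷ []) b)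

-- Sum over the q + 1 positions of the letter r among q zeros.
insertions : (List ℕ → ℚ) → ℕ → ℕ → ℚ
insertions F r zero = F (r ∷ [])
insertions F r (suc q) = F (r ∷ zeros (suc q)) + insertions (λ w → F (0 ∷ w)) r q

insertions-zero : ∀ F r q → (∀ w → HasPos w → F w ≡ 0ℚ) → insertions F (suc r) q ≡ 0ℚ
insertions-zero F r zero z = z _ here
insertions-zero F r (suc q) z = 0+0 (z _ here) (insertions-zero _ r q (λ w p → z _ (there p)))

insertions-0 : ∀ F q → insertions F 0 q ≡ nat (suc q) * F (zeros (suc q))
insertions-0 F zero = solve 1 (λ x → x := (con 1ℚ :+ con 0ℚ) :* x) refl _
insertions-0 F (suc q) = trans (refl ⊞ insertions-0 _ q) (solve 2 (λ x n → x :+ n :* x := (con 1ℚ :+ n) :* x) refl _ (nat (suc q)))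

st-letter-zeros : ∀ F r q → st F (r ∷ []) (zeros (suc q)) ≡ insertions F r (suc q) + insertions F (suc r) q
st-letter-zeros F r zero = cong (λ n → F (r ∷ 0 ∷ []) + F (0 ∷ r ∷ []) + F (suc n ∷ [])) (ℕP.+-identityʳ r)
st-letter-zeros F r (suc q) = lin (st-letter-zeros (λ w → F (0 ∷ w)) r q ⊞ cong (λ n → F (suc n ∷ zeros (suc q))) (ℕP.+-identityʳ r))
  (solve 6 (λ x s t i₁ i₂ t′ → (x :+ s :+ t) :+ ((i₁ :+ i₂) :+ t′) := ((x :+ i₁) :+ (t′ :+ i₂)) :+ (s :+ t)) refl _ _ _ _ _ _)

sh-x₁-power : ∀ F n → sh F (x1 ∷ []) (ι (zeros n)) ≡ nat (suc n) * F (ι (zeros (suc n)))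
sh-x₁-power F zero = solve 1 (λ x → x := (con 1ℚ :+ con 0ℚ) :* x) refl _
sh-x₁-power F (suc n) = trans (cong (λ z → F _ + z + 0ℚ) (sh-x₁-power (λ w → F (x1 ∷ w)) n)) (solve 2 (λ x n → x :+ n :* x :+ con 0ℚ := (con 1ℚ :+ n) :* x) refl _ (nat (suc n)))

corr-zeros : ∀ c n → corr c (zeros n) ≡ c n
corr-zeros c zero = refl
corr-zeros c (suc n) = corr-zeros (λ n → c (suc n)) n

ratio-nat : ∀ q → nat (suc (suc q)) * ratio q ≡ - sgn q
ratio-nat q = trans (cong (nat (suc (suc q)) *_) (trans (*-def _ _) (cong (_* inv (suc q)) (neg-def (sgn q)))))
  (lin (sgn q ⊠ sym (inv-nat (suc q))) (solve 3 (λ n i s → n :* (:- s :* i) :+ s :* (i :* n) := :- s :+ s :* con 1ℚ) refl _ _ _))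

-- regularisation: the double shuffle relations with one convergent factor determine
-- all products through Newton's identities between y₁ ∗ ⋯ ∗ y₁ and the y_n
module Newton (Ψ : Word → ℚ) (kills : Sh.Kills Ψ) (Ψ-x₁ : Ψ (x1 ∷ []) ≡ 0ℚ)
  (convergent : ∀ m u b v → st (λ w → Ψ (ι w)) (suc m ∷ u) (b ∷ v) ≡ 0ℚ) where

  Φ : List ℕ → ℚ
  Φ = P₀ Ψ

  private
    base : ∀ m u b v → st Φ (suc m ∷ u) (b ∷ v) ≡ 0ℚ
    base m u b v = trans (add (St.st-linear (suc m ∷ u) (b ∷ v)) (λ w → Ψ (ι w)) (corr (correction Ψ)))
      (0+0 (convergent m u b v) (st-pos (corr (correction Ψ)) (suc m ∷ u) (b ∷ v) (λ w → corr-pos (correction Ψ)) here))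

    -- Induction on the number of leading y₁: produce the longer word as y₁ ∗ w, move y₁ to the
    -- other factor by associativity and divide by the multiplicity.
    onLeading : ∀ k w → Leading k w → ∀ b v → st Φ w (b ∷ v) ≡ 0ℚ
    onLeading k (suc m ∷ u) pos b v = base m u b v
    onLeading (suc k) (0 ∷ w) (zer l) b v with st-zero-letter k (λ x → st Φ x (b ∷ v)) w (λ x l → onLeading k x l b v) l
    ... | j , e = nat-cancel j (trans (sym e) (trans (st-exchange Φ w (b ∷ v)) (st-nonempty (λ y → st Φ w y) 0 [] (b ∷ v) (λ c y → onLeading k w l c y))))

    onPos : ∀ w → HasPos w → ∀ b v → st Φ w (b ∷ v) ≡ 0ℚ
    onPos w p with leading p
    ... | k , l = onLeading k w l

    power : ∀ q → Ψ (ι (zeros (suc (suc q)))) ≡ 0ℚ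
    power q = nat-cancel (suc q) (trans (sym (sh-x₁-power Ψ (suc q))) (proj₂ kills x1 [] x1 (ι (zeros q))))

    -- The relation for y_{r+2} ∗ y₁^{q+1} exchanges inserting y_{r+2} for inserting y_{r+3} among
    -- one y₁ less, with a sign; this continues down to a single letter.
    chain : ∀ r q → insertions Φ (suc r) q ≡ sgn q * Φ (suc (r ℕ.+ q) ∷ [])
    chain r zero = trans (cong (λ n → Φ (suc n ∷ [])) (sym (ℕP.+-identityʳ r))) (sym (*-identityˡ _))
    chain r (suc q) = lin (trans (sym (st-letter-zeros Φ (suc r) q)) (base r [] 0 (zeros q)) ⊞ cong -_ (chain (suc r) q))
      (trans (solve 4 (λ a b s p → a :+ (con 0ℚ :+ :- (s :* p)) := (:- s :* p) :+ (a :+ b :+ :- b)) refl _ _ (sgn q) _)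
        (cong₂ (λ s n → s * Φ (suc n ∷ [])) (sym (neg-def (sgn q))) (sym (ℕP.+-suc r q)) ⊞ refl))

    -- Here the coefficient (-1)^{n-1}/n of ψ_* is forced: Ψ vanishes at x₁^n, so the correction at
    -- y₁^n alone must cancel the end of the Newton chain.
    newton : ∀ q → st Φ (0 ∷ []) (zeros (suc q)) ≡ 0ℚ
    newton q = trans (st-letter-zeros Φ 0 q) (trans (insertions-0 Φ (suc q) ⊞ chain 0 q)
      (lin (cong (nat (suc (suc q)) *_) (trans (cong (_+ corr (correction Ψ) (zeros (suc (suc q)))) (power q)) (trans (+-identityˡ _) (corr-zeros (correction Ψ) (suc (suc q)))))
           ⊞ cong (_* Ψ (blk (suc q) [])) (ratio-nat q))
        (solve 5 (λ n φ s p r → (n :* φ :+ s :* (p :+ con 0ℚ)) :+ (n :* (r :* p) :+ :- s :* p) := con 0ℚ :+ (n :* φ :+ (n :* r) :* p)) refl (nat (suc (suc q))) _ (sgn q) _ (ratio q))))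

    onZeros : ∀ i j → st Φ (zeros (suc i)) (zeros (suc j)) ≡ 0ℚ
    onZeros zero j = newton j
    onZeros (suc i) j = nat-cancel (suc i) (trans (sym (insertions-0 Φ′ (suc i)))
      (lin (trans (sym (st-letter-zeros Φ′ 0 i)) (trans (st-exchange Φ (zeros (suc i)) (zeros (suc j)))
              (trans (st-letter-zeros G 0 j) (insertions-0 G (suc j) ⊞ refl)))
            ⊞ (nat (suc (suc j)) ⊠ onZeros i (suc j))
            ⊞ insertions-zero G 0 j (λ y p → trans (St.st-comm Φ (zeros (suc i)) y) (onPos y p 0 (zeros i)))
            ⊞ sym (insertions-zero Φ′ 0 i (λ x p → onPos x p 0 (zeros j))))
        (solve 5 (λ a b n g c → a :+ ((n :* g :+ c) :+ n :* con 0ℚ :+ con 0ℚ :+ b) := con 0ℚ :+ ((a :+ b) :+ n :* g :+ c :+ con 0ℚ)) refl _ _ (nat (suc (suc j))) _ _)))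
      where
      Φ′ G : List ℕ → ℚ
      Φ′ x = st Φ x (zeros (suc j))
      G y = st Φ (zeros (suc i)) y

  stuffle : ∀ a u b v → st Φ (a ∷ u) (b ∷ v) ≡ 0ℚ
  stuffle a u b v with HasPos? (a ∷ u) | HasPos? (b ∷ v)
  ... | inj₁ p | _ = onPos (a ∷ u) p b v
  ... | inj₂ _ | inj₁ p = trans (St.st-comm Φ (a ∷ u) (b ∷ v)) (onPos (b ∷ v) p a u)
  ... | inj₂ (suc i , refl) | inj₂ (suc j , refl) = onZeros i j

-- Homogeneity and dual bases by elimination

pair : Poly → Poly → ℚ
pair ψ g = ev (coeff ψ) g

-- Support in length n tested by functionals; unlike a condition on the listed words it is stable
-- under `~`.
HomP : ℕ → Poly → Set
HomP n g = ∀ (F : Word → ℚ) → (∀ w → length w ≡ n → F w ≡ 0ℚ) → ev F g ≡ 0ℚ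

HomP-⊕ : ∀ {n} f g → HomP n f → HomP n g → HomP n (f ⊕ g)
HomP-⊕ f g hf hg F z = trans (ev-++ F f g) (0+0 (hf F z) (hg F z))

HomP-scale : ∀ {n} c f → HomP n f → HomP n (scale c f)
HomP-scale c f h F z = trans (ev-scale F c f) (*0 (h F z))

HomP-⊖ : ∀ {n} f g → HomP n f → HomP n g → HomP n (f ⊖ g)
HomP-⊖ f g hf hg = HomP-⊕ f (scale (ℚ.- 1ℚ) g) hf (HomP-scale (ℚ.- 1ℚ) g hg)

HomP-word : ∀ w → HomP (length w) (word w)
HomP-word w F z = trans (ev-single F w) (z w refl)

HomP-agree : ∀ {n} g → HomP n g → ∀ F G → (∀ w → length w ≡ n → F w ≡ G w) → ev F g ≡ ev G g
HomP-agree g h F G e = lin (h (λ w → F w + - G w) (λ w l → trans (cong (_+ - G w) (e w l)) (-‿inverseʳ _)))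
  (trans (solve 2 (λ a b → a :+ con 0ℚ := b :+ (a :+ :- b)) refl _ _) (cong (ev G g +_) (sym (trans (ev-+ F (λ w → - G w) g) (cong (ev F g +_) (ev-neg G g))))))

sh-length : ∀ F u v → (∀ w → length w ≡ length u ℕ.+ length v → F w ≡ 0ℚ) → sh F u v ≡ 0ℚ
sh-length F [] v z = z v refl
sh-length F (a ∷ u) [] z = z (a ∷ u) (cong suc (sym (ℕP.+-identityʳ _)))
sh-length F (a ∷ u) (b ∷ v) z = 0+0 (0+0 (sh-length _ u (b ∷ v) (λ w e → z (a ∷ w) (cong suc e)))
  (sh-length _ (a ∷ u) v (λ w e → z (b ∷ w) (cong suc (trans e (sym (ℕP.+-suc (length u) (length v)))))))) refl

length-blk : ∀ m x → length (blk m x) ≡ suc m ℕ.+ length x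
length-blk zero x = refl
length-blk (suc m) x = cong suc (length-blk m x)

st-length : ∀ F u v → (∀ w → length (ι w) ≡ length (ι u) ℕ.+ length (ι v) → F w ≡ 0ℚ) → st F u v ≡ 0ℚ
st-length F [] v z = z v refl
st-length F (a ∷ u) [] z = z (a ∷ u) (sym (ℕP.+-identityʳ _))
st-length F (a ∷ u) (b ∷ v) z = 0+0 (0+0
  (st-length _ u (b ∷ v) (λ w e → z (a ∷ w) (trans (length-blk a (ι w)) (trans (cong (suc a ℕ.+_) e)
    (trans (sym (ℕP.+-assoc (suc a) (length (ι u)) _)) (cong (ℕ._+ length (ι (b ∷ v))) (sym (length-blk a (ι u)))))))))
  (st-length _ (a ∷ u) v (λ w e → z (b ∷ w) (trans (length-blk b (ι w)) (trans (cong (suc b ℕ.+_) e)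
    (trans (rotate (suc b) (length (ι (a ∷ u))) (length (ι v))) (cong (length (ι (a ∷ u)) ℕ.+_) (sym (length-blk b (ι v))))))))))
  (st-length _ u v (λ w e → z (suc (a ℕ.+ b) ∷ w) (trans (length-blk (suc (a ℕ.+ b)) (ι w)) (trans (cong (suc (suc (a ℕ.+ b)) ℕ.+_) e)
    (trans (shuffle a b (length (ι u)) (length (ι v))) (sym (cong₂ ℕ._+_ (length-blk a (ι u)) (length-blk b (ι v)))))))))
  where
  rotate : ∀ x y z → x ℕ.+ (y ℕ.+ z) ≡ y ℕ.+ (x ℕ.+ z)
  rotate x y z = trans (sym (ℕP.+-assoc x y z)) (trans (cong (ℕ._+ z) (ℕP.+-comm x y)) (ℕP.+-assoc y x z))
  shuffle : ∀ a b x y → suc (suc (a ℕ.+ b)) ℕ.+ (x ℕ.+ y) ≡ (suc a ℕ.+ x) ℕ.+ (suc b ℕ.+ y)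
  shuffle a b x y = cong suc (trans (cong suc (trans (ℕP.+-assoc a b (x ℕ.+ y)) (trans (cong (a ℕ.+_) (rotate b x y)) (sym (ℕP.+-assoc a x (b ℕ.+ y))))))
    (sym (ℕP.+-suc (a ℕ.+ x) (b ℕ.+ y))))

allWords : ℕ → List Word
allWords zero = [] ∷ []
allWords (suc n) = map (x0 ∷_) (allWords n) ++ map (x1 ∷_) (allWords n)

allWords-∈ : ∀ w → w ∈ allWords (length w)
allWords-∈ [] = here refl
allWords-∈ (x0 ∷ w) = MP.∈-++⁺ˡ (MP.∈-map⁺ (x0 ∷_) (allWords-∈ w))
allWords-∈ (x1 ∷ w) = MP.∈-++⁺ʳ (map (x0 ∷_) (allWords (length w))) (MP.∈-map⁺ (x1 ∷_) (allWords-∈ w))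

allWords-length : ∀ n → All (λ w → length w ≡ n) (allWords n)
allWords-length zero = refl ∷ []
allWords-length (suc n) = AllP.++⁺ (AllP.map⁺ (All.map (cong suc) (allWords-length n))) (AllP.map⁺ (All.map (cong suc) (allWords-length n)))

private
  lsum : ∀ {A : Set} → (A → ℚ) → List A → ℚ
  lsum f [] = 0ℚ
  lsum f (a ∷ l) = f a + lsum f l

  lsum-++ : ∀ {A : Set} (f : A → ℚ) l l′ → lsum f (l ++ l′) ≡ lsum f l + lsum f l′
  lsum-++ f [] l′ = sym (+-identityˡ _)
  lsum-++ f (a ∷ l) l′ = trans (refl ⊞ lsum-++ f l l′) (sym (+-assoc _ _ _))

  lsum-map : ∀ {A B : Set} (f : B → ℚ) (g : A → B) l → lsum f (map g l) ≡ lsum (λ a → f (g a)) l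
  lsum-map f g [] = refl
  lsum-map f g (a ∷ l) = refl ⊞ lsum-map f g l

  lsum-cong : ∀ {A : Set} {f g : A → ℚ} → (∀ a → f a ≡ g a) → ∀ l → lsum f l ≡ lsum g l
  lsum-cong e [] = refl
  lsum-cong e (a ∷ l) = e a ⊞ lsum-cong e l

  lsum-* : ∀ {A : Set} k (f : A → ℚ) l → lsum (λ a → k * f a) l ≡ k * lsum f l
  lsum-* k f [] = sym (zeroʳ k)
  lsum-* k f (a ∷ l) = trans (refl ⊞ lsum-* k f l) (sym (distribˡ k _ _))

  ev-lsum : ∀ {A B : Set} (F : A → B → ℚ) l p → ev (λ b → lsum (λ a → F a b) l) p ≡ lsum (λ a → ev (F a) p) l
  ev-lsum F [] p = ev-zero p (λ _ → refl)
  ev-lsum F (a ∷ l) p = trans (ev-+ _ _ p) (refl ⊞ ev-lsum F l p)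

  δ-sum : ∀ (F : Word → ℚ) x → lsum (λ w → FX.δ x w * F w) (allWords (length x)) ≡ F x
  δ-sum F [] = trans (+-identityʳ _) (trans (cong (_* F []) (FX.δ-refl [])) (*-identityˡ _))
  δ-sum F (a ∷ x) = trans (lsum-++ _ (map (x0 ∷_) (allWords (length x))) _)
    (trans (trans (lsum-map _ (x0 ∷_) (allWords (length x))) (peel x0) ⊞ trans (lsum-map _ (x1 ∷_) (allWords (length x))) (peel x1)) (pick a))
    where
    peel : ∀ b → lsum (λ w → FX.δ (a ∷ x) (b ∷ w) * F (b ∷ w)) (allWords (length x)) ≡ FX.δ (a ∷ []) (b ∷ []) * F (b ∷ x)
    peel b = trans (lsum-cong (λ w → trans (cong (_* F (b ∷ w)) (FX.δ-∷ a x b w)) (*-assoc _ _ _)) (allWords (length x)))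
      (trans (lsum-* _ _ (allWords (length x))) (cong (FX.δ (a ∷ []) (b ∷ []) *_) (δ-sum (λ w → F (b ∷ w)) x)))
    pick : ∀ a → FX.δ (a ∷ []) (x0 ∷ []) * F (x0 ∷ x) + FX.δ (a ∷ []) (x1 ∷ []) * F (x1 ∷ x) ≡ F (a ∷ x)
    pick x0 = solve 2 (λ p q → con 1ℚ :* p :+ con 0ℚ :* q := p) refl _ _
    pick x1 = solve 2 (λ p q → con 0ℚ :* p :+ con 1ℚ :* q := q) refl _ _

project : List (Poly × Poly) → Poly → Poly
project [] g = []
project ((a , ψ) ∷ B) g = scale (pair ψ g) a ⊕ project B g

ev-project : ∀ F B g → ev F (project B g) ≡ lsum (λ t → pair (proj₂ t) g * ev F (proj₁ t)) B
ev-project F [] g = refl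
ev-project F ((a , ψ) ∷ B) g = trans (ev-++ F (scale (pair ψ g) a) _) (ev-scale F (pair ψ g) a ⊞ ev-project F B g)

inverse : ∀ x → x ≢ 0ℚ → ∃ λ c → c * x ≡ 1ℚ
inverse x ne = (ℚ.1/ x) {{ℚ.≢-nonZero ne}} , trans (sym (*-def _ _)) (ℚP.*-inverseˡ x {{ℚ.≢-nonZero ne}})

-- Gaussian elimination in weight n. It starts from the words paired with themselves; each relation
-- is made to vanish under all forms while the vectors keep spanning modulo `Q`.
module LinearAlgebra (n : ℕ) (Q : Poly → Set) (Q-~ : ∀ {f g} → f ~ g → Q f → Q g)
  (Q-zero : Q []) (Q-⊕ : ∀ {f g} → Q f → Q g → Q (f ⊕ g)) (Q-scale : ∀ c {f} → Q f → Q (scale c f)) where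

  Entry : List Poly → Poly × Poly → Set
  Entry S (a , ψ) = HomP n a × Hom n (coeff ψ) × All (λ s → pair ψ s ≡ 0ℚ) S

  DualBasis : List Poly → Set
  DualBasis S = ∃ λ B → All (Entry S) B × (∀ g → HomP n g → Q (g ⊖ project B g))

  initial : DualBasis []
  initial = map (λ w → word w , word w) (allWords n) , AllP.map⁺ (All.map entry (allWords-length n)) , λ g h →
    Q-~ (~-sym (remainder g h)) Q-zero
    where
    entry : ∀ {w} → length w ≡ n → Entry [] (word w , word w)
    entry {w} refl = HomP-word w , (λ x ne → trans (coeff-word w x) (FX.δ-≢ {w} {x} (λ e → ne (cong length (sym e))))) , []
    remainder : ∀ g → HomP n g → g ⊖ project (map (λ w → word w , word w) (allWords n)) g ~ []
    remainder g h = tested λ F → trans (ev-⊖ F g _) (trans (cong (λ x → ev F g + - x) (trans (ev-project F (map (λ w → word w , word w) (allWords n)) g)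
      (trans (lsum-map _ (λ w → word w , word w) (allWords n))
      (trans (lsum-cong (λ w → trans (cong₂ _*_ (ev-cong (coeff-word w) g) (ev-single F w)) (trans (*-comm _ _) (trans (sym (ev-* (F w) _ g)) (ev-cong (λ x → *-comm (F w) (FX.δ x w)) g)))) (allWords n))
      (trans (sym (ev-lsum (λ w x → FX.δ x w * F w) (allWords n) g)) (HomP-agree g h _ F (λ { x refl → δ-sum F x }))))))) (-‿inverseʳ _))

  private
    data Pivot (s : Poly) : List (Poly × Poly) → Set where
      none : ∀ {B} → All (λ t → pair (proj₂ t) s ≡ 0ℚ) B → Pivot s B
      some : ∀ B₁ a ψ B₂ → pair ψ s ≢ 0ℚ → Pivot s (B₁ ++ (a , ψ) ∷ B₂)

    pivot : ∀ s B → Pivot s B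
    pivot s [] = none []
    pivot s ((a , ψ) ∷ B) with pair ψ s ℚP.≟ 0ℚ
    ... | no ne = some [] a ψ B ne
    ... | yes z with pivot s B
    ... | none zs = none (z ∷ zs)
    ... | some B₁ b φ B₂ ne = some ((a , ψ) ∷ B₁) b φ B₂ ne

    reduce : Poly → ℚ → Poly → Poly × Poly → Poly × Poly
    reduce s c ψ (a , φ) = a , φ ⊖ scale (pair φ s * c) ψ

    pair-reduce : ∀ s c ψ φ g → pair (φ ⊖ scale (pair φ s * c) ψ) g ≡ pair φ g + - (pair φ s * c * pair ψ g)
    pair-reduce s c ψ φ g = trans (ev-cong (λ w → trans (coeff-⊖ φ (scale (pair φ s * c) ψ) w) (cong (λ x → coeff φ w + - x)
        (trans (coeff-ev (scale (pair φ s * c) ψ) w) (trans (ev-scale (FX.δ w) (pair φ s * c) ψ) (cong (pair φ s * c *_) (sym (coeff-ev ψ w))))))) g)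
      (trans (ev-+ (coeff φ) (λ w → - (pair φ s * c * coeff ψ w)) g) (cong (pair φ g +_) (trans (ev-neg (λ w → pair φ s * c * coeff ψ w) g) (cong -_ (ev-* (pair φ s * c) (coeff ψ) g)))))

  -- If some form does not vanish on s, its pair is dropped and the other forms are corrected by
  -- multiples of it. The projection changes by a multiple of the projection of s, which lies in `Q`
  -- because s and s minus its projection do.
  extend : ∀ s {S} → HomP n s → Q s → DualBasis S → DualBasis (s ∷ S)
  extend s {S} hs qs (B , entries , spans) = go B entries spans (pivot s B)
    where
    go : ∀ B → All (Entry S) B → (∀ g → HomP n g → Q (g ⊖ project B g)) → Pivot s B → DualBasis (s ∷ S)
    go B entries spans (none zs) = B , All.zipWith (λ { (z , (h , hψ , k)) → h , hψ , z ∷ k }) (zs , entries) , spans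
    go _ entries spans (some B₁ a ψ B₂ ne) = map (reduce s c ψ) (B₁ ++ B₂) ,
        AllP.map⁺ (All.map {P = Entry S} {Q = λ t → Entry (s ∷ S) (reduce s c ψ t)} (λ {t} → entry {t}) (AllP.++⁺ (AllP.++⁻ˡ B₁ entries) (All.tail (AllP.++⁻ʳ B₁ entries)))) ,
        λ g h → Q-~ (~-sym (remainder g)) (Q-⊕ (spans g h) (Q-scale (c * pair ψ g) (Q-⊕ qs (Q-scale (ℚ.- 1ℚ) (spans s hs)))))
      where
      c : ℚ
      c = proj₁ (inverse (pair ψ s) ne)
      c-inv : c * pair ψ s ≡ 1ℚ
      c-inv = proj₂ (inverse (pair ψ s) ne)
      ψ-entry : Entry S (a , ψ)
      ψ-entry = All.head (AllP.++⁻ʳ B₁ entries)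
      entry : ∀ {t} → Entry S t → Entry (s ∷ S) (reduce s c ψ t)
      entry {b , φ} (hb , hφ , k) = hb ,
        (λ w l → trans (coeff-⊖ φ (scale (pair φ s * c) ψ) w) (0+0 (hφ w l) (trans (cong -_ (trans (coeff-ev (scale (pair φ s * c) ψ) w)
          (trans (ev-scale (FX.δ w) (pair φ s * c) ψ) (*0 (trans (sym (coeff-ev ψ w)) (proj₁ (proj₂ ψ-entry) w l)))))) neg0))) ,
        (trans (pair-reduce s c ψ φ s) (lin (pair φ s ⊠ sym c-inv) (solve 3 (λ p c q → (p :+ :- (p :* c :* q)) :+ p :* (c :* q) := con 0ℚ :+ p :* con 1ℚ) refl _ _ _))) ∷
        All.zipWith (λ { {r} (z , z′) → trans (pair-reduce s c ψ φ r) (0+0 z (trans (cong -_ (*0 z′)) neg0)) }) (k , proj₂ (proj₂ ψ-entry))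
      remainder : ∀ g → g ⊖ project (map (reduce s c ψ) (B₁ ++ B₂)) g ~
        (g ⊖ project (B₁ ++ (a , ψ) ∷ B₂) g) ⊕ scale (c * pair ψ g) (s ⊖ (s ⊖ project (B₁ ++ (a , ψ) ∷ B₂) s))
      remainder g = tested λ F → lin
        (trans (ev-⊖ F g _) (cong (λ x → ev F g + - x) (trans (ev-project F (map (reduce s c ψ) (B₁ ++ B₂)) g) (trans (lsum-map _ (reduce s c ψ) (B₁ ++ B₂))
            (trans (lsum-cong (λ t → trans (cong (_* ev F (proj₁ t)) (pair-reduce s c ψ (proj₂ t) g))
                (solve 5 (λ x y c p e → (x :+ :- (y :* c :* p)) :* e := x :* e :+ (:- (c :* p)) :* (y :* e)) refl _ _ _ _ _)) (B₁ ++ B₂))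
            (trans (lsum-+ _ _ (B₁ ++ B₂)) (lsum-++ _ B₁ B₂ ⊞ trans (lsum-* _ _ (B₁ ++ B₂)) (cong (- (c * pair ψ g) *_) (lsum-++ _ B₁ B₂))))))))
         ⊞ sym (trans (ev-++ F (g ⊖ project (B₁ ++ (a , ψ) ∷ B₂) g) _) (trans (ev-⊖ F g _) (cong (λ x → ev F g + - x) (full F g))
             ⊞ trans (ev-scale F (c * pair ψ g) (s ⊖ (s ⊖ project (B₁ ++ (a , ψ) ∷ B₂) s))) (cong (c * pair ψ g *_) (trans (ev-⊖ F s (s ⊖ project (B₁ ++ (a , ψ) ∷ B₂) s)) (cong (λ x → ev F s + - x) (trans (ev-⊖ F s (project (B₁ ++ (a , ψ) ∷ B₂) s)) (cong (λ x → ev F s + - x) (full F s))))))))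
         ⊞ ((pair ψ g * ev F a) ⊠ sym c-inv))
        (solve 12 (λ L R G x₁ x₂ c p y₁ y₂ S q e →
          L :+ ((G :+ :- ((x₁ :+ x₂) :+ :- (c :* p) :* (y₁ :+ y₂))) :+ R :+ (p :* e) :* (c :* q))
          := R :+ (L :+ ((G :+ :- (x₁ :+ (p :* e :+ x₂))) :+ (c :* p) :* (S :+ :- (S :+ :- (y₁ :+ (q :* e :+ y₂))))) :+ (p :* e) :* con 1ℚ)) refl _ _ _ _ _ _ _ _ _ _ _ _)
        where
        lsum-+ : ∀ {A : Set} (f g : A → ℚ) l → lsum (λ a → f a + g a) l ≡ lsum f l + lsum g l
        lsum-+ f g [] = sym (+-identityˡ 0ℚ)
        lsum-+ f g (a ∷ l) = trans (refl ⊞ lsum-+ f g l) (+-swap _ _ _ _)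
        full : ∀ F g → ev F (project (B₁ ++ (a , ψ) ∷ B₂) g) ≡ lsum (λ t → pair (proj₂ t) g * ev F (proj₁ t)) B₁
          + (pair ψ g * ev F a + lsum (λ t → pair (proj₂ t) g * ev F (proj₁ t)) B₂)
        full F g = trans (ev-project F (B₁ ++ (a , ψ) ∷ B₂) g) (lsum-++ _ B₁ _)

  dualBasis : ∀ S → All (λ s → HomP n s × Q s) S → DualBasis S
  dualBasis [] [] = initial
  dualBasis (s ∷ S) ((h , q) ∷ ps) = extend s h q (dualBasis S ps)

-- Euler's formula for even zeta values

Pos : ℚ → Set
Pos x = 0ℚ ℚ.< x

pos-+ : ∀ {a b} → Pos a → Pos b → Pos (a + b)
pos-+ {a} {b} p q = subst (0ℚ ℚ.<_) (+-def a b) (ℚP.+-mono-< p q)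

pos-* : ∀ {a b} → Pos a → Pos b → Pos (a * b)
pos-* {a} {b} p q = subst (0ℚ ℚ.<_) (*-def a b) (ℚP.positive⁻¹ (a ℚ.* b) {{ℚP.pos*pos⇒pos a {{ℚ.positive p}} b {{ℚ.positive q}}}})

pos-1 : Pos 1ℚ
pos-1 = ℚP.positive⁻¹ 1ℚ

pos⇒≢0 : ∀ {a} → Pos a → a ≢ 0ℚ
pos⇒≢0 p refl = ℚP.<-irrefl refl p

pos-inverse : ∀ {c q} → c * q ≡ 1ℚ → Pos q → Pos c
pos-inverse {c} {q} e p with ℚP.<-cmp 0ℚ c
... | tri< lt _ _ = lt
... | tri≈ _ refl _ = ⊥-elim (pos⇒≢0 pos-1 (trans (sym e) (zeroˡ q)))
... | tri> _ _ gt = ⊥-elim (ℚP.<-asym pos-1 (subst₂ ℚ._<_ (trans (*-def c q) e) (trans (*-def 0ℚ q) (zeroˡ q)) (ℚP.*-monoˡ-<-pos q {{ℚ.positive p}} gt)))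

pos-nat : ∀ n → Pos (nat (suc n))
pos-nat zero = pos-+′
  where
  pos-+′ : Pos (1ℚ + 0ℚ)
  pos-+′ = subst Pos (sym (+-identityʳ 1ℚ)) pos-1
pos-nat (suc n) = pos-+ pos-1 (pos-nat n)

csum : (ℕ → ℕ → ℚ) → ℕ → ℚ
csum f zero = f 0 0
csum f (suc m) = f (suc m) 0 + csum (λ i j → f i (suc j)) m

csum-cong : ∀ {f g} m → (∀ i j → f i j ≡ g i j) → csum f m ≡ csum g m
csum-cong zero e = e 0 0
csum-cong (suc m) e = e (suc m) 0 ⊞ csum-cong m (λ i j → e i (suc j))

csum-+ : ∀ f g m → csum (λ i j → f i j + g i j) m ≡ csum f m + csum g m
csum-+ f g zero = refl
csum-+ f g (suc m) = trans (refl ⊞ csum-+ _ _ m) (+-swap _ _ _ _)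

csum-* : ∀ k f m → csum (λ i j → k * f i j) m ≡ k * csum f m
csum-* k f zero = refl
csum-* k f (suc m) = trans (refl ⊞ csum-* k _ m) (sym (distribˡ k _ _))

csum-expand : ∀ (c s p q : ℕ → ℕ → ℚ) t m → csum (λ i j → c i j * (s i j + - (p i j + q i j + t))) m ≡
  csum (λ i j → c i j * s i j) m + - (csum (λ i j → c i j * p i j) m + csum (λ i j → c i j * q i j) m + t * csum c m)
csum-expand c s p q t zero = solve 5 (λ c s p q t → c :* (s :+ :- (p :+ q :+ t)) := c :* s :+ :- (c :* p :+ c :* q :+ t :* c)) refl _ _ _ _ _
csum-expand c s p q t (suc m) = trans (refl ⊞ csum-expand (λ i j → c i (suc j)) (λ i j → s i (suc j)) (λ i j → p i (suc j)) (λ i j → q i (suc j)) t m)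
  (solve 9 (λ c s p q t x y z w → c :* (s :+ :- (p :+ q :+ t)) :+ (x :+ :- (y :+ z :+ t :* w))
    := (c :* s :+ x) :+ :- ((c :* p :+ y) :+ (c :* q :+ z) :+ t :* (c :+ w))) refl _ _ _ _ _ _ _ _ _)

csum-first : ∀ f m → csum f (suc m) ≡ f 0 (suc m) + csum (λ i j → f (suc i) j) m
csum-first f zero = +-comm _ _
csum-first f (suc m) = trans (refl ⊞ csum-first (λ i j → f i (suc j)) m) (solve 3 (λ a b c → a :+ (b :+ c) := b :+ (a :+ c)) refl _ _ _)

csum-flip : ∀ f m → csum (λ i j → f j i) m ≡ csum f m
csum-flip f zero = refl
csum-flip f (suc m) = trans (refl ⊞ csum-flip (λ i j → f (suc i) j) m) (sym (csum-first f m))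

dbl : ℕ → ℕ
dbl zero = zero
dbl (suc a) = suc (suc (dbl a))

csum-parity : ∀ f m → csum f (dbl (suc m)) ≡ csum (λ a b → f (dbl a) (dbl b)) (suc m) + csum (λ a b → f (suc (dbl a)) (suc (dbl b))) m
csum-parity f zero = solve 3 (λ a b c → a :+ (b :+ c) := (a :+ c) :+ b) refl _ _ _
csum-parity f (suc m) = trans (refl ⊞ (refl ⊞ csum-parity (λ i j → f i (suc (suc j))) m)) (solve 4 (λ a b c d → a :+ (b :+ (c :+ d)) := (a :+ c) :+ (b :+ d)) refl _ _ _ _)

y : ℕ → Word
y i = blk i []

z : ℕ → ℕ → Word
z i j = blk i (blk j [])

-- Telescoping: shuffles at (i+1 , j) that begin with the x₀ of the first factor cancel those at (i
-- , j+1) that begin with the x₀ of the second. Only words starting with x₁ remain.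
alternating-sh : ∀ F m → csum (λ i j → sgn i * sh F (y i) (y j)) m ≡ F (z 0 m) + sgn m * F (z 0 m)
alternating-sh F zero = solve 1 (λ x → con 1ℚ :* (x :+ x :+ con 0ℚ) := x :+ con 1ℚ :* x) refl _
alternating-sh F (suc m) = trans (csum-cong (suc m) split) (trans (csum-+ U V (suc m)) (lin
  (csum-first U m ⊞ cancel)
  (solve 5 (λ cu u b v x → (cu :+ (v :+ b)) :+ (x :+ u :+ con 0ℚ) := (x :+ v) :+ (cu :+ (u :+ b))) refl _ _ _ _ _)))
  where
  F₀ : Word → ℚ
  F₀ w = F (x0 ∷ w)
  U V : ℕ → ℕ → ℚ
  U zero j = F (z 0 j)
  U (suc i) j = sgn (suc i) * sh F₀ (y i) (y j)
  V i zero = sgn i * F (z 0 i)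
  V i (suc j) = sgn i * sh F₀ (y i) (y j)
  split : ∀ i j → sgn i * sh F (y i) (y j) ≡ U i j + V i j
  split zero zero = solve 1 (λ x → con 1ℚ :* (x :+ x :+ con 0ℚ) := x :+ con 1ℚ :* x) refl _
  split zero (suc j) = solve 2 (λ x s → con 1ℚ :* (x :+ s :+ con 0ℚ) := x :+ con 1ℚ :* s) refl _ _
  split (suc i) zero = solve 3 (λ k x s → k :* (s :+ x :+ con 0ℚ) := k :* s :+ k :* x) refl (sgn (suc i)) _ _
  split (suc i) (suc j) = solve 3 (λ k x s → k :* (s :+ x :+ con 0ℚ) := k :* s :+ k :* x) refl (sgn (suc i)) _ _
  cancel : csum (λ i j → U (suc i) j) m + csum (λ i j → V i (suc j)) m ≡ 0ℚ
  cancel = trans (sym (csum-+ (λ i j → U (suc i) j) (λ i j → V i (suc j)) m))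
    (trans (csum-cong m (λ i j → trans (cong (λ s → s * sh F₀ (y i) (y j) + sgn i * sh F₀ (y i) (y j)) (neg-def (sgn i)))
      (solve 2 (λ s x → :- s :* x :+ s :* x := con 0ℚ :* x) refl _ _))) (trans (csum-* 0ℚ (λ i j → sh F₀ (y i) (y j)) m) (zeroˡ _)))

sh-y-x₁ : ∀ F m → sh F (y m) (x1 ∷ []) ≡ csum (λ i j → F (z i j)) m + F (z m 0)
sh-y-x₁ F zero = +-identityʳ _
sh-y-x₁ F (suc m) = lin (sh-y-x₁ (λ w → F (x0 ∷ w)) m ⊞ sym (csum-first (λ i j → F (z i j)) m))
  (solve 5 (λ s x c l t → (s :+ x :+ con 0ℚ) :+ ((c :+ l) :+ t) := (t :+ l) :+ (s :+ (x :+ c))) refl _ _ _ _ _)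

-- the class of y_{i+1} ⧢ y_{j+1} − y_{i+1} ∗ y_{j+1}
depth2 : ℕ → ℕ → Poly
depth2 (suc i) j = rel (y (suc i)) (y j)
depth2 zero j = rel (y j) (y 0)

depth2∈R : ∀ i j → i ℕ.+ j ≢ 0 → IR.I (depth2 i j)
depth2∈R (suc i) j ne = rel∈R {suc i ∷ []} (j ∷ []) cons
depth2∈R zero (suc j) ne = rel∈R {suc j ∷ []} (0 ∷ []) cons
depth2∈R zero zero ne = ⊥-elim (ne refl)

ev-depth2 : ∀ F i j → ev F (depth2 i j) ≡ sh F (y i) (y j) + - (F (z i j) + F (z j i) + F (y (suc (i ℕ.+ j))))
ev-depth2 F (suc i) j = trans (ev-rel F (y (suc i)) (y j)) (cong₂ (λ u v → sh F (y (suc i)) (y j) + - st (λ w → F (ι w)) u v) (ιinv-ι (suc i ∷ [])) (ιinv-ι (j ∷ [])))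
ev-depth2 F zero j = trans (ev-rel F (y j) (y 0)) (trans (cong₂ (λ u v → sh F (y j) (y 0) + - st (λ w → F (ι w)) u v) (ιinv-ι (j ∷ [])) (ιinv-ι (0 ∷ [])))
  (cong₂ (λ s t → s + - t) (Sh.st-comm F (y j) (y 0)) (cong₂ _+_ (+-comm _ _) (cong (λ n → F (y (suc n))) (ℕP.+-identityʳ j)))))

psum : (ℕ → ℕ → Poly) → ℕ → Poly
psum f zero = f 0 0
psum f (suc m) = f (suc m) 0 ⊕ psum (λ i j → f i (suc j)) m

ev-psum : ∀ F f m → ev F (psum f m) ≡ csum (λ i j → ev F (f i j)) m
ev-psum F f zero = refl
ev-psum F f (suc m) = trans (ev-++ F (f (suc m) 0) _) (refl ⊞ ev-psum F (λ i j → f i (suc j)) m)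

csum-on : ∀ {f g} m → (∀ i j → i ℕ.+ j ≡ m → f i j ≡ g i j) → csum f m ≡ csum g m
csum-on zero e = e 0 0 refl
csum-on (suc m) e = e (suc m) 0 (ℕP.+-identityʳ (suc m)) ⊞ csum-on m (λ i j p → e i (suc j) (trans (ℕP.+-suc i j) (cong suc p)))

csum-1 : ∀ m → csum (λ _ _ → 1ℚ) m ≡ nat (suc m)
csum-1 zero = sym (+-identityʳ 1ℚ)
csum-1 (suc m) = refl ⊞ csum-1 m

sgn-dbl : ∀ a → sgn (dbl a) ≡ 1ℚ
sgn-dbl zero = refl
sgn-dbl (suc a) = trans (neg-def _) (trans (cong -_ (trans (neg-def _) (cong -_ (sgn-dbl a)))) (solve 0 (:- (:- con 1ℚ) := con 1ℚ) refl))

sgn-suc-dbl : ∀ a → sgn (suc (dbl a)) ≡ - 1ℚ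
sgn-suc-dbl a = trans (neg-def _) (cong -_ (sgn-dbl a))

dbl-+ : ∀ a b → dbl a ℕ.+ dbl b ≡ dbl (a ℕ.+ b)
dbl-+ zero b = refl
dbl-+ (suc a) b = cong (λ n → suc (suc n)) (dbl-+ a b)

psum∈R : ∀ {f} m → (∀ i j → i ℕ.+ j ≡ m → IR.I (f i j)) → IR.I (psum f m)
psum∈R zero p = p 0 0 refl
psum∈R (suc m) p = IR.I-⊕ (p (suc m) 0 (ℕP.+-identityʳ (suc m))) (psum∈R m (λ i j e → p i (suc j) (trans (ℕP.+-suc i j) (cong suc e))))

half : ℚ
half = inv 1

-- The m + 1 counts the contraction terms of the relations between even zeta values; eliminating the
-- odd-indexed double sums adds 3/2.
euler-constant : ℕ → ℚ
euler-constant m = nat (suc m) + (half + half + half)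

-- Σ ζ(2a+2) ζ(2b+2) over a+b = m is (m + 5/2) ζ(2m+4): the alternating sum of all depth two
-- relations and the relation for (x₀^M x₁ , x₁) together evaluate the sum of the odd entries z
even-products : ∀ m → IR.I (psum (λ a b → shP (word (y (suc (dbl a)))) (word (y (suc (dbl b))))) m ⊖ scale (euler-constant m) (word (y (suc (dbl (suc m))))))
even-products m = IR.I-~ (tested identity) (IR.I-⊕ C∈R (IR.I-scale half (IR.I-⊕ A∈R (IR.I-⊕ B∈R B∈R))))
  where
  M : ℕ
  M = dbl (suc m)
  A B C : Poly
  A = psum (λ i j → scale (sgn i) (depth2 i j)) M
  B = depth2 M 0
  C = psum (λ a b → depth2 (suc (dbl a)) (suc (dbl b))) m
  A∈R : IR.I A
  A∈R = psum∈R M (λ i j e → IR.I-scale (sgn i) (depth2∈R i j (λ e′ → absurd (trans (sym e) e′))))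
    where
    absurd : M ≢ 0
    absurd ()
  B∈R : IR.I B
  B∈R = depth2∈R M 0 (λ ())
  C∈R : IR.I C
  C∈R = psum∈R m (λ a b e → depth2∈R (suc (dbl a)) (suc (dbl b)) (λ ()))
  identity : ∀ F → ev F (C ⊕ scale half (A ⊕ (B ⊕ B))) ≡ ev F (psum (λ a b → shP (word (y (suc (dbl a)))) (word (y (suc (dbl b))))) m ⊖ scale (euler-constant m) (word (y (suc (dbl (suc m))))))
  identity F = lin
    (trans (ev-++ F C (scale half (A ⊕ (B ⊕ B)))) (refl ⊞ trans (ev-scale F half (A ⊕ (B ⊕ B))) (half ⊠ trans (ev-++ F A (B ⊕ B)) (refl ⊞ ev-++ F B B)))
     ⊞ evC ⊞ (half ⊠ evA) ⊞ ((half + half) ⊠ evB) ⊞ ((Od + Od) ⊠ inv-nat 1)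
     ⊞ sym (trans (ev-⊖ F (psum (λ a b → shP (word (y (suc (dbl a)))) (word (y (suc (dbl b))))) m) (scale (euler-constant m) (word (y (suc M))))) (evP ⊞ cong -_ (trans (ev-scale F (euler-constant m) (word (y (suc M)))) (euler-constant m ⊠ ev-single F (y (suc M)))))))
    (solve 12 (λ L R a b c h P O E Y n x₀ → L :+ ((c :+ h :* (a :+ (b :+ b))) :+ (P :+ :- (O :+ O :+ n :* Y))
           :+ h :* ((x₀ :+ x₀) :+ :- ((E :+ :- O) :+ (E :+ :- O) :+ Y)) :+ (h :+ h) :* ((E :+ O :+ con 0ℚ) :+ :- (con 0ℚ :+ x₀ :+ Y)) :+ (O :+ O) :* con 1ℚ :+ R)
        := R :+ (L :+ c :+ h :* a :+ (h :+ h) :* b :+ (O :+ O) :* (h :* (con 1ℚ :+ (con 1ℚ :+ con 0ℚ))) :+ (P :+ :- ((n :+ (h :+ h :+ h)) :* Y))))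
      refl _ _ _ _ _ half P Od Ev Y (nat (suc m)) (F (z 0 M)))
    where
    Ev Od Y P : ℚ
    Ev = csum (λ a b → F (z (dbl a) (dbl b))) (suc m)
    Od = csum (λ a b → F (z (suc (dbl a)) (suc (dbl b)))) m
    Y = F (y (suc M))
    P = csum (λ a b → sh F (y (suc (dbl a))) (y (suc (dbl b)))) m
    evP : ev F (psum (λ a b → shP (word (y (suc (dbl a)))) (word (y (suc (dbl b))))) m) ≡ P
    evP = trans (ev-psum F (λ a b → shP (word (y (suc (dbl a)))) (word (y (suc (dbl b))))) m) (csum-cong m (λ a b → trans (ev-shP F (word (y (suc (dbl a)))) (word (y (suc (dbl b)))))
      (trans (ev-single (λ u → ev (sh F u) (word (y (suc (dbl b))))) (y (suc (dbl a)))) (ev-single (sh F (y (suc (dbl a)))) (y (suc (dbl b)))))))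
    evC : ev F C ≡ P + - (Od + Od + nat (suc m) * Y)
    evC = trans (ev-psum F (λ a b → depth2 (suc (dbl a)) (suc (dbl b))) m) (trans (csum-on m (λ a b e → trans (ev-depth2 F (suc (dbl a)) (suc (dbl b)))
        (trans (cong (λ n → sh F (y (suc (dbl a))) (y (suc (dbl b))) + - (zo a b + zo b a + F (y n)))
            (cong (λ k → suc (suc k)) (trans (ℕP.+-suc (dbl a) (dbl b)) (cong suc (trans (dbl-+ a b) (cong dbl e))))))
          (sym (*-identityˡ _)))))
      (trans (csum-expand (λ _ _ → 1ℚ) (λ a b → sh F (y (suc (dbl a))) (y (suc (dbl b)))) zo (λ a b → zo b a) Y m)
        (unit m (λ a b → sh F (y (suc (dbl a))) (y (suc (dbl b)))) ⊞ cong -_ (unit m zo ⊞ trans (unit m (λ a b → zo b a)) (csum-flip zo m) ⊞ trans (*-comm _ _) (cong (_* Y) (csum-1 m))))))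
      where
      zo : ℕ → ℕ → ℚ
      zo a b = F (z (suc (dbl a)) (suc (dbl b)))
      unit : ∀ m f → csum (λ a b → 1ℚ * f a b) m ≡ csum f m
      unit m f = csum-cong m (λ a b → *-identityˡ _)
    parity : ∀ f → csum (λ i j → sgn i * f i j) M ≡ csum (λ a b → f (dbl a) (dbl b)) (suc m) + - csum (λ a b → f (suc (dbl a)) (suc (dbl b))) m
    parity f = trans (csum-parity (λ i j → sgn i * f i j) m)
      (csum-cong (suc m) (λ a b → trans (cong (_* f (dbl a) (dbl b)) (sgn-dbl a)) (*-identityˡ _))
       ⊞ trans (csum-cong m (λ a b → cong (_* f (suc (dbl a)) (suc (dbl b))) (sgn-suc-dbl a))) (trans (csum-* (- 1ℚ) (λ a b → f (suc (dbl a)) (suc (dbl b))) m) (solve 1 (λ x → :- con 1ℚ :* x := :- x) refl _)))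
    evA : ev F A ≡ (F (z 0 M) + F (z 0 M)) + - ((Ev + - Od) + (Ev + - Od) + Y)
    evA = trans (ev-psum F (λ i j → scale (sgn i) (depth2 i j)) M) (trans (csum-on M (λ i j e → trans (ev-scale F (sgn i) (depth2 i j)) (trans (sgn i ⊠ ev-depth2 F i j)
        (cong (λ n → sgn i * (sh F (y i) (y j) + - (F (z i j) + F (z j i) + F (y (suc n))))) e))))
      (trans (csum-expand (λ i _ → sgn i) (λ i j → sh F (y i) (y j)) (λ i j → F (z i j)) (λ i j → F (z j i)) Y M)
        (trans (trans (alternating-sh F M) (cong (λ s → F (z 0 M) + s * F (z 0 M)) (sgn-dbl (suc m)))
          ⊞ cong -_ (parity (λ i j → F (z i j))
             ⊞ trans (parity (λ i j → F (z j i))) (csum-flip (λ a b → F (z (dbl a) (dbl b))) (suc m) ⊞ cong -_ (csum-flip (λ a b → F (z (suc (dbl a)) (suc (dbl b)))) m))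
             ⊞ (Y ⊠ trans (csum-cong {λ i _ → sgn i} {λ i _ → sgn i * 1ℚ} M (λ i j → sym (*-identityʳ _))) (trans (parity (λ _ _ → 1ℚ)) (csum-1 (suc m) ⊞ cong -_ (csum-1 m))))))
        (solve 5 (λ x e o t n → (x :+ con 1ℚ :* x) :+ :- ((e :+ :- o) :+ (e :+ :- o) :+ t :* ((con 1ℚ :+ n) :+ :- n)) := (x :+ x) :+ :- ((e :+ :- o) :+ (e :+ :- o) :+ t)) refl _ _ _ _ (nat (suc m))))))
    evB : ev F B ≡ (Ev + Od + 0ℚ) + - (0ℚ + F (z 0 M) + Y)
    evB = trans (ev-depth2 F M 0) (trans (cong₂ (λ s n → s + - (F (z M 0) + F (z 0 M) + F (y (suc n))))
      (trans (sh-y-x₁ F M) (csum-parity (λ i j → F (z i j)) m ⊞ refl)) (ℕP.+-identityʳ M))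
      (solve 5 (λ e o t s v → (e :+ o :+ t) :+ :- (t :+ s :+ v) := (e :+ o :+ con 0ℚ) :+ :- (con 0ℚ :+ s :+ v)) refl _ _ _ _ _))

infix 4 _≃_
record _≃_ (f g : Poly) : Set where
  constructor congruent
  field difference : IR.I (f ⊖ g)

open _≃_

~⇒≃ : ∀ {f g} → f ~ g → f ≃ g
~⇒≃ {f} {g} e = congruent (IR.I-zero (tested λ F → trans (ev-⊖ F f g) (trans (cong (_+ - ev F g) (at e F)) (-‿inverseʳ _))))

≃-trans : ∀ {f g h} → f ≃ g → g ≃ h → f ≃ h
≃-trans {f} {g} {h} (congruent p) (congruent q) = congruent (IR.I-~ (tested λ F → trans (ev-++ F (f ⊖ g) (g ⊖ h)) (trans (ev-⊖ F f g ⊞ ev-⊖ F g h)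
  (trans (solve 3 (λ a b c → (a :+ :- b) :+ (b :+ :- c) := a :+ :- c) refl _ _ _) (sym (ev-⊖ F f h))))) (IR.I-⊕ p q))

≃-sym : ∀ {f g} → f ≃ g → g ≃ f
≃-sym {f} {g} (congruent p) = congruent (IR.I-~ (tested λ F → trans (ev-scale F (ℚ.- 1ℚ) (f ⊖ g)) (trans (cong (ℚ.- 1ℚ *_) (ev-⊖ F f g))
  (trans (solve 2 (λ a b → con (ℚ.- 1ℚ) :* (a :+ :- b) := b :+ :- a) refl _ _) (sym (ev-⊖ F g f))))) (IR.I-scale (ℚ.- 1ℚ) p))

≃-⊕ : ∀ {f f′ g g′} → f ≃ f′ → g ≃ g′ → f ⊕ g ≃ f′ ⊕ g′
≃-⊕ {f} {f′} {g} {g′} (congruent p) (congruent q) = congruent (IR.I-~ (tested λ F → trans (ev-++ F (f ⊖ f′) (g ⊖ g′)) (trans (ev-⊖ F f f′ ⊞ ev-⊖ F g g′)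
  (trans (solve 4 (λ a a′ b b′ → (a :+ :- a′) :+ (b :+ :- b′) := (a :+ b) :+ :- (a′ :+ b′)) refl _ _ _ _)
    (sym (trans (ev-⊖ F (f ⊕ g) (f′ ⊕ g′)) (ev-++ F f g ⊞ cong -_ (ev-++ F f′ g′))))))) (IR.I-⊕ p q))

≃-scale : ∀ c {f g} → f ≃ g → scale c f ≃ scale c g
≃-scale c {f} {g} (congruent p) = congruent (IR.I-~ (tested λ F → trans (ev-scale F c (f ⊖ g)) (trans (cong (c *_) (ev-⊖ F f g))
  (trans (solve 3 (λ c a b → c :* (a :+ :- b) := c :* a :+ :- (c :* b)) refl _ _ _) (sym (trans (ev-⊖ F (scale c f) (scale c g)) (ev-scale F c f ⊞ cong -_ (ev-scale F c g))))))) (IR.I-scale c p))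

shP-⊖ʳ : ∀ f g h → shP f (g ⊖ h) ~ shP f g ⊖ shP f h
shP-⊖ʳ f g h = ~-trans (shP-++ʳ f g (scale (ℚ.- 1ℚ) h)) (⊕-cong ~-refl (shP-scaleʳ f (ℚ.- 1ℚ) h))

≃-shPʳ : ∀ f {g g′} → g ≃ g′ → shP f g ≃ shP f g′
≃-shPʳ f {g} {g′} (congruent p) = congruent (IR.I-~ (shP-⊖ʳ f g g′) (IR.I-shP f p))

≃-shP : ∀ {f f′ g g′} → f ≃ f′ → g ≃ g′ → shP f g ≃ shP f′ g′
≃-shP {f} {f′} {g} {g′} p q = ≃-trans (≃-shPʳ f q) (≃-trans (~⇒≃ (shP-comm f g′)) (≃-trans (≃-shPʳ g′ p) (~⇒≃ (shP-comm g′ f′))))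

scale-scale : ∀ c d f → scale c (scale d f) ~ scale (c * d) f
scale-scale c d f = tested λ F → trans (ev-scale F c (scale d f)) (trans (c ⊠ ev-scale F d f) (trans (sym (*-assoc _ _ _)) (sym (ev-scale F (c * d) f))))

scale-1 : ∀ f → scale 1ℚ f ~ f
scale-1 f = tested λ F → trans (ev-scale F 1ℚ f) (*-identityˡ _)

ζ₂ : Poly
ζ₂ = word (x0 ∷ x1 ∷ [])

pow : ℕ → Poly
pow zero = word []
pow (suc k) = shP ζ₂ (pow k)

pow-+ : ∀ a b → shP (pow a) (pow b) ~ pow (a ℕ.+ b)
pow-+ zero b = shP-unitˡ (pow b)
pow-+ (suc a) b = ~-trans (shP-assoc ζ₂ (pow a) (pow b)) (shP-cong {f = ζ₂} ~-refl (pow-+ a b))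

-- Positivity survives sums and products of factors and so guarantees that they can be inverted.
record PositiveMultiple (f : Poly) (k : ℕ) : Set where
  constructor multiple
  field
    {factor} : ℚ
    positive : Pos factor
    equation : f ≃ scale factor (pow k)

multiple-shP : ∀ {f g a b} → PositiveMultiple f a → PositiveMultiple g b → PositiveMultiple (shP f g) (a ℕ.+ b)
multiple-shP {f} {g} {a} {b} (multiple {c} pc e) (multiple {d} pd e′) = multiple {factor = c * d} (pos-* pc pd)
  (≃-trans (≃-shP e e′)
    (~⇒≃ (~-trans (shP-scaleˡ (pow a) c (scale d (pow b))) (~-trans (scale-cong c {g = scale d (pow (a ℕ.+ b))} (~-trans (shP-scaleʳ (pow a) d (pow b)) (scale-cong d {g = pow (a ℕ.+ b)} (pow-+ a b)))) (scale-scale c d (pow (a ℕ.+ b)))))))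

multiple-⊕ : ∀ {f g k} → PositiveMultiple f k → PositiveMultiple g k → PositiveMultiple (f ⊕ g) k
multiple-⊕ {f} {g} {k} (multiple {c} pc e) (multiple {d} pd e′) = multiple {factor = c + d} (pos-+ pc pd)
  (≃-trans (≃-⊕ e e′)
    (~⇒≃ (tested λ F → trans (ev-++ F (scale c (pow k)) (scale d (pow k))) (trans (ev-scale F c (pow k) ⊞ ev-scale F d (pow k)) (trans (sym (distribʳ _ _ _)) (sym (ev-scale F (c + d) (pow k))))))))

psum-multiple : ∀ n s (U V : ℕ → Poly) → (∀ i → i ≤ n → PositiveMultiple (U i) (suc i)) → (∀ j → j ≤ n → PositiveMultiple (V j) (suc (s ℕ.+ j))) →
  PositiveMultiple (psum (λ i j → shP (U i) (V j)) n) (suc (suc (n ℕ.+ s)))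
psum-multiple zero s U V u v = subst (λ k → PositiveMultiple (shP (U 0) (V 0)) (suc (suc k))) (ℕP.+-identityʳ s) (multiple-shP {U 0} {V 0} (u 0 z≤n) (v 0 z≤n))
psum-multiple (suc n) s U V u v = multiple-⊕ {shP (U (suc n)) (V 0)} {psum (λ i j → shP (U i) (V (suc j))) n}
  (subst (λ k → PositiveMultiple (shP (U (suc n)) (V 0)) (suc (suc k))) (trans (ℕP.+-suc n _) (cong (λ k → suc (n ℕ.+ k)) (ℕP.+-identityʳ s))) (multiple-shP {U (suc n)} {V 0} (u (suc n) ℕP.≤-refl) (v 0 z≤n)))
  (subst (PositiveMultiple (psum (λ i j → shP (U i) (V (suc j))) n)) (cong (λ k → suc (suc k)) (ℕP.+-suc n s))
    (psum-multiple n (suc s) U (λ j → V (suc j)) (λ i le → u i (ℕP.m≤n⇒m≤1+n le)) (λ j le → subst (λ k → PositiveMultiple (V (suc j)) (suc k)) (ℕP.+-suc s j) (v (suc j) (s≤s le)))))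

evenZeta : ℕ → Poly
evenZeta a = word (y (suc (dbl a)))

-- Strong induction: in `even-products` all products are already positive multiples of one power of
-- ζ(2), and the constant in front of the new zeta value is positive.
euler : ∀ a → PositiveMultiple (evenZeta a) (suc a)
euler a = upTo′ a a ℕP.≤-refl
  where
  divide : ∀ m → PositiveMultiple (psum (λ i j → shP (evenZeta i) (evenZeta j)) m) (suc (suc m)) → PositiveMultiple (evenZeta (suc m)) (suc (suc m))
  divide m (multiple {c} pc e) = multiple {factor = d * c} (pos-* (pos-inverse d-inv pos-q) pc)
    (≃-trans
      (~⇒≃ (~-trans (~-sym (scale-1 (evenZeta (suc m)))) (~-trans (tested λ F → cong (λ k → ev F (scale k (evenZeta (suc m)))) {x = 1ℚ} {y = d * q} (sym d-inv)) (~-sym (scale-scale d q (evenZeta (suc m)))))))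
      (≃-trans
        (≃-scale d (≃-trans (≃-sym (congruent (even-products m))) e))
        (~⇒≃ (scale-scale d c (pow (suc (suc m)))))))
    where
    q : ℚ
    q = euler-constant m
    pos-half : Pos half
    pos-half = pos-inverse (inv-nat 1) (pos-nat 1)
    pos-q : Pos q
    pos-q = pos-+ (pos-nat m) (pos-+ (pos-+ pos-half pos-half) pos-half)
    d : ℚ
    d = proj₁ (inverse q (pos⇒≢0 pos-q))
    d-inv : d * q ≡ 1ℚ
    d-inv = proj₂ (inverse q (pos⇒≢0 pos-q))
  upTo′ : ∀ m a → a ≤ m → PositiveMultiple (evenZeta a) (suc a)
  upTo′ m zero _ = multiple {factor = 1ℚ} pos-1 (~⇒≃ (~-trans {q = pow 1} (~-sym (shP-unitʳ ζ₂)) (~-sym (scale-1 (pow 1)))))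
  upTo′ (suc m) (suc a) (s≤s le) = divide a (subst (λ k → PositiveMultiple (psum (λ i j → shP (evenZeta i) (evenZeta j)) a) (suc (suc k))) (ℕP.+-identityʳ a)
    (psum-multiple a 0 evenZeta evenZeta (λ i le′ → upTo′ m i (ℕP.≤-trans le′ le)) (λ j le′ → upTo′ m j (ℕP.≤-trans le′ le))))

-- The kernel of the projection to indecomposables and its annihilator

-- A linear form of `InK` in weight n: products keep homogeneous factors, whose weights the
-- filtration argument counts.
data KSpan (n : ℕ) : Poly → Set where
  k-R : ∀ {f} → IR.I f → KSpan n f
  k-ζ₂ : n ≡ 2 → KSpan n ζ₂
  k-shP : ∀ {a b p q} → HomP a p → HomP b q → 1 ≤ a → 1 ≤ b → a ℕ.+ b ≡ n → KSpan n (shP p q)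
  k-⊕ : ∀ {f g} → KSpan n f → KSpan n g → KSpan n (f ⊕ g)
  k-scale : ∀ c {f} → KSpan n f → KSpan n (scale c f)
  k-~ : ∀ {f g} → f ~ g → KSpan n f → KSpan n g

splits : Word → List (Word × Word)
splits [] = ([] , []) ∷ []
splits (a ∷ w) = ([] , a ∷ w) ∷ map (λ t → (a ∷ proj₁ t , proj₂ t)) (splits w)

splits-∈ : ∀ u v → (u , v) ∈ splits (u ++ v)
splits-∈ [] [] = here refl
splits-∈ [] (a ∷ v) = here refl
splits-∈ (a ∷ u) v = there (MP.∈-map⁺ (λ t → (a ∷ proj₁ t , proj₂ t)) (splits-∈ u v))

splits-length : ∀ w → All (λ t → length (proj₁ t) ℕ.+ length (proj₂ t) ≡ length w) (splits w)
splits-length [] = refl ∷ []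
splits-length (a ∷ w) = refl ∷ AllP.map⁺ (All.map (cong suc) (splits-length w))

shuffleRelations stuffleRelations : Word → Word → List Poly
shuffleRelations (a ∷ u) (b ∷ v) = shW (a ∷ u) (b ∷ v) ∷ []
shuffleRelations _ _ = []
stuffleRelations u v with In𝔥⁰? u | In𝔥¹? v
... | yes _ | yes _ = rel u v ∷ []
... | _ | _ = []

lowRelations : ℕ → List Poly
lowRelations 1 = word (x0 ∷ []) ∷ word (x1 ∷ []) ∷ []
lowRelations 2 = ζ₂ ∷ []
lowRelations _ = []

pairRelations : Word × Word → List Poly
pairRelations t = shuffleRelations (proj₁ t) (proj₂ t) ++ stuffleRelations (proj₁ t) (proj₂ t)

productRelations relations : ℕ → List Poly
productRelations n = concatMap pairRelations (concatMap splits (allWords n))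
relations n = productRelations n ++ lowRelations n

relations-KSpan : ∀ n → All (λ s → HomP n s × KSpan n s) (relations n)
relations-KSpan n = AllP.++⁺ (AllP.concat⁺ (AllP.map⁺ (All.map (λ {t} e → AllP.++⁺ (shuffles (proj₁ t) (proj₂ t) e) (stuffles (proj₁ t) (proj₂ t) e))
    (AllP.concat⁺ (AllP.map⁺ (All.map (λ {w} e → All.map (λ e′ → trans e′ e) (splits-length w)) (allWords-length n))))))) (low n)
  where
  shuffles : ∀ u v → length u ℕ.+ length v ≡ n → All (λ s → HomP n s × KSpan n s) (shuffleRelations u v)
  shuffles [] v e = []
  shuffles (a ∷ u) [] e = []
  shuffles (a ∷ u) (b ∷ v) e = ((λ F z → trans (ev-shW F (a ∷ u) (b ∷ v)) (sh-length F (a ∷ u) (b ∷ v) (λ w l → z w (trans l e)))) ,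
    k-~ {f = shP (word (a ∷ u)) (word (b ∷ v))} (tested λ F → trans (ev-shP F (word (a ∷ u)) (word (b ∷ v))) (trans (ev-single (λ x → ev (sh F x) (word (b ∷ v))) (a ∷ u)) (trans (ev-single (sh F (a ∷ u)) (b ∷ v)) (sym (ev-shW F (a ∷ u) (b ∷ v))))))
      (k-shP {p = word (a ∷ u)} {word (b ∷ v)} (HomP-word (a ∷ u)) (HomP-word (b ∷ v)) (s≤s z≤n) (s≤s z≤n) e)) ∷ []
  stuffles : ∀ u v → length u ℕ.+ length v ≡ n → All (λ s → HomP n s × KSpan n s) (stuffleRelations u v)
  stuffles u v e with In𝔥⁰? u | In𝔥¹? v
  ... | no _ | yes _ = []
  ... | no _ | no _ = []
  ... | yes _ | no _ = []
  ... | yes (a , h , refl) | yes (b , refl) = ((λ F z → trans (ev-rel F (ι a) (ι b)) (0+0 (sh-length F (ι a) (ι b) (λ w l → z w (trans l e)))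
      (trans (cong -_ (trans (cong₂ (st (λ w → F (ι w))) (ιinv-ι a) (ιinv-ι b)) (st-length (λ w → F (ι w)) a b (λ w l → z (ι w) (trans l e))))) neg0))) , k-R (rel∈R b h)) ∷ []
  low : ∀ n → All (λ s → HomP n s × KSpan n s) (lowRelations n)
  low 0 = []
  low 1 = (HomP-word (x0 ∷ []) , k-R (IR.I-gen gx0)) ∷ (HomP-word (x1 ∷ []) , k-R (IR.I-gen gx1)) ∷ []
  low 2 = (HomP-word (x0 ∷ x1 ∷ []) , k-ζ₂ refl) ∷ []
  low (suc (suc (suc n))) = []

-- The listed stuffle relations have a convergent factor; the remaining stuffle conditions, with the
-- correction term, come from `Newton.stuffle`.
annihilator⇒doubleShuffle : ∀ {n} ψ → 1 ≤ n → Hom n (coeff ψ) → All (λ s → pair ψ s ≡ 0ℚ) (relations n) → DoubleShuffle (coeff ψ)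
annihilator⇒doubleShuffle {n} ψ 1≤n h ann = record { kills = kills ; Ψ-x₀ = letter x0 ; Ψ-x₁ = letter x1 ; Ψ-x₀x₁ = Ψ-x₀x₁ ; P₀-st = Newton.stuffle Ψ kills (letter x1) convergent }
  where
  Ψ : Word → ℚ
  Ψ = coeff ψ
  pairs-∈ : ∀ u v → length u ℕ.+ length v ≡ n → (u , v) ∈ concatMap splits (allWords n)
  pairs-∈ u v refl = MP.∈-concatMap⁺ splits (lose (subst (λ k → u ++ v ∈ allWords k) (LP.length-++ u) (allWords-∈ (u ++ v))) (splits-∈ u v))
  find : ∀ u v s → length u ℕ.+ length v ≡ n → s ∈ shuffleRelations u v ++ stuffleRelations u v → pair ψ s ≡ 0ℚ
  find u v s e m = All.lookup (AllP.++⁻ˡ (productRelations n) ann) (MP.∈-concatMap⁺ pairRelations (lose (pairs-∈ u v e) m))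
  sh-kills : ∀ a u b v → sh Ψ (a ∷ u) (b ∷ v) ≡ 0ℚ
  sh-kills a u b v = go (length (a ∷ u) ℕ.+ length (b ∷ v) ℕ.≟ n)
    where
    go : Dec (length (a ∷ u) ℕ.+ length (b ∷ v) ≡ n) → sh Ψ (a ∷ u) (b ∷ v) ≡ 0ℚ
    go (yes e) = trans (sym (ev-shW Ψ (a ∷ u) (b ∷ v))) (find (a ∷ u) (b ∷ v) (shW (a ∷ u) (b ∷ v)) e (here refl))
    go (no ne) = sh-length Ψ (a ∷ u) (b ∷ v) (λ w l → h w (λ e → ne (trans (sym l) e)))
  kills : Sh.Kills Ψ
  kills = h [] (λ { refl → absurd 1≤n }) , sh-kills
    where
    absurd : ¬ (1 ≤ 0)
    absurd ()
  letter : ∀ a → Ψ (a ∷ []) ≡ 0ℚ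
  letter a = go (1 ℕ.≟ n) a
    where
    go : Dec (1 ≡ n) → ∀ a → Ψ (a ∷ []) ≡ 0ℚ
    go (no ne) a = h (a ∷ []) ne
    go (yes refl) x0 = trans (sym (ev-single Ψ (x0 ∷ []))) (All.head (AllP.++⁻ʳ (productRelations 1) ann))
    go (yes refl) x1 = trans (sym (ev-single Ψ (x1 ∷ []))) (All.head (All.tail (AllP.++⁻ʳ (productRelations 1) ann)))
  Ψ-x₀x₁ : Ψ (x0 ∷ x1 ∷ []) ≡ 0ℚ
  Ψ-x₀x₁ = go (2 ℕ.≟ n)
    where
    go : Dec (2 ≡ n) → Ψ (x0 ∷ x1 ∷ []) ≡ 0ℚ
    go (no ne) = h (x0 ∷ x1 ∷ []) ne
    go (yes refl) = trans (sym (ev-single Ψ (x0 ∷ x1 ∷ []))) (All.head (AllP.++⁻ʳ (productRelations 2) ann))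
  convergent : ∀ m u b v → st (λ w → Ψ (ι w)) (suc m ∷ u) (b ∷ v) ≡ 0ℚ
  convergent m u b v = go (length (ι (suc m ∷ u)) ℕ.+ length (ι (b ∷ v)) ℕ.≟ n)
    where
    nonempty : sh Ψ (ι (suc m ∷ u)) (ι (b ∷ v)) ≡ 0ℚ
    nonempty = Sh.kills-≢ Ψ kills (ι (suc m ∷ u)) (ι (b ∷ v)) (λ ()) (blk≢[] b (ι v))
    member′ : rel (ι (suc m ∷ u)) (ι (b ∷ v)) ∈ stuffleRelations (ι (suc m ∷ u)) (ι (b ∷ v))
    member′ with In𝔥⁰? (ι (suc m ∷ u)) | In𝔥¹? (ι (b ∷ v))
    ... | yes _ | yes _ = here refl
    ... | no ne | _ = ⊥-elim (ne (suc m ∷ u , cons , refl))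
    ... | yes _ | no ne = ⊥-elim (ne (b ∷ v , refl))
    go : Dec (length (ι (suc m ∷ u)) ℕ.+ length (ι (b ∷ v)) ≡ n) → st (λ w → Ψ (ι w)) (suc m ∷ u) (b ∷ v) ≡ 0ℚ
    go (no ne) = st-length (λ w → Ψ (ι w)) (suc m ∷ u) (b ∷ v) (λ w l → h (ι w) (λ e → ne (trans (sym l) e)))
    go (yes e) = neg-injective-zero (trans (cong -_ (sym (cong₂ (st (λ w → Ψ (ι w))) (ιinv-ι (suc m ∷ u)) (ιinv-ι (b ∷ v)))))
      (trans (sym (0+ nonempty)) (trans (sym (ev-rel Ψ (ι (suc m ∷ u)) (ι (b ∷ v)))) (find (ι (suc m ∷ u)) (ι (b ∷ v)) (rel (ι (suc m ∷ u)) (ι (b ∷ v))) e (MP.∈-++⁺ʳ (shuffleRelations (ι (suc m ∷ u)) (ι (b ∷ v))) member′)))))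

-- Absolute value estimates

infix 4 _≪_
record _≪_ (x c : ℚ) : Set where
  constructor bounded
  field bound : ℚ.∣ x ∣ ℚ.≤ c

open _≪_

≤-+ : ∀ {a b c d} → a ℚ.≤ b → c ℚ.≤ d → a + c ℚ.≤ b + d
≤-+ {a} {b} {c} {d} p q = subst₂ ℚ._≤_ (+-def a c) (+-def b d) (ℚP.+-mono-≤ p q)

≤-* : ∀ {a b c d} → 0ℚ ℚ.≤ a → a ℚ.≤ b → 0ℚ ℚ.≤ c → c ℚ.≤ d → a * c ℚ.≤ b * d
≤-* {a} {b} {c} {d} p q r s = subst₂ ℚ._≤_ (*-def a c) (*-def b d) (ℚP.≤-trans (ℚP.*-monoʳ-≤-nonNeg c {{ℚ.nonNegative r}} q)
  (ℚP.*-monoˡ-≤-nonNeg b {{ℚ.nonNegative (ℚP.≤-trans p q)}} s))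

0≤-+ : ∀ {a b} → 0ℚ ℚ.≤ a → 0ℚ ℚ.≤ b → 0ℚ ℚ.≤ a + b
0≤-+ {a} {b} p q = subst (ℚ._≤ a + b) (+-identityʳ 0ℚ) (≤-+ p q)

0≤-* : ∀ {a b} → 0ℚ ℚ.≤ a → 0ℚ ℚ.≤ b → 0ℚ ℚ.≤ a * b
0≤-* {a} {b} p q = subst (ℚ._≤ a * b) (zeroˡ 0ℚ) (≤-* ℚP.≤-refl p ℚP.≤-refl q)

0≤1 : 0ℚ ℚ.≤ 1ℚ
0≤1 = ℚP.<⇒≤ pos-1

≪-≤ : ∀ {x c d} → x ≪ c → c ℚ.≤ d → x ≪ d
≪-≤ (bounded p) q = bounded (ℚP.≤-trans p q)

≪-≡ : ∀ {x y c} → x ≡ y → x ≪ c → y ≪ c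
≪-≡ refl p = p

≪-+ : ∀ {x y c d} → x ≪ c → y ≪ d → x + y ≪ c + d
≪-+ {x} {y} (bounded p) (bounded q) = bounded (ℚP.≤-trans (subst₂ (λ t r → ℚ.∣ t ∣ ℚ.≤ r) (+-def x y) (+-def ℚ.∣ x ∣ ℚ.∣ y ∣) (ℚP.∣p+q∣≤∣p∣+∣q∣ x y)) (≤-+ p q))

abs-* : ∀ x y → ℚ.∣ x * y ∣ ≡ ℚ.∣ x ∣ * ℚ.∣ y ∣
abs-* x y = trans (cong ℚ.∣_∣ (sym (*-def x y))) (trans (ℚP.∣p*q∣≡∣p∣*∣q∣ x y) (*-def _ _))

≪-* : ∀ {x y c d} → x ≪ c → y ≪ d → x * y ≪ c * d
≪-* {x} {y} {c} {d} (bounded p) (bounded q) = bounded (subst (ℚ._≤ c * d) (sym (abs-* x y)) (≤-* (ℚP.0≤∣p∣ x) p (ℚP.0≤∣p∣ y) q))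

≪-neg : ∀ {x c} → x ≪ c → - x ≪ c
≪-neg {x} (bounded p) = bounded (subst (ℚ._≤ _) (trans (sym (ℚP.∣-p∣≡∣p∣ x)) (cong ℚ.∣_∣ (neg-def x))) p)

≪-self : ∀ {c} → 0ℚ ℚ.≤ c → c ≪ c
≪-self p = bounded (ℚP.≤-reflexive (ℚP.0≤p⇒∣p∣≡p p))

≪-zero : ∀ {x c} → x ≡ 0ℚ → 0ℚ ℚ.≤ c → x ≪ c
≪-zero refl p = bounded p

≪-lower : ∀ {a b x c} → 0ℚ ℚ.≤ a → a ℚ.≤ b → b * x ≪ c → a * x ≪ c
≪-lower {a} {b} {x} p q (bounded r) = bounded (ℚP.≤-trans (subst₂ ℚ._≤_ (sym (scaled p)) (sym (scaled (ℚP.≤-trans p q))) (≤-* p q (ℚP.0≤∣p∣ x) ℚP.≤-refl)) r)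
  where
  scaled : ∀ {a} → 0ℚ ℚ.≤ a → ℚ.∣ a * x ∣ ≡ a * ℚ.∣ x ∣
  scaled {a} p = trans (abs-* a x) (cong (_* ℚ.∣ x ∣) (ℚP.0≤p⇒∣p∣≡p p))

0≤nat : ∀ n → 0ℚ ℚ.≤ nat n
0≤nat zero = ℚP.≤-refl
0≤nat (suc n) = 0≤-+ 0≤1 (0≤nat n)

nat-mono : ∀ {m n} → m ≤ n → nat m ℚ.≤ nat n
nat-mono {n = n} z≤n = 0≤nat n
nat-mono {suc m} {suc n} (s≤s le) = ≤-+ (ℚP.≤-refl {1ℚ}) (nat-mono {m} {n} le)

0≤inv : ∀ n → 0ℚ ℚ.≤ inv n
0≤inv n = ℚP.<⇒≤ (pos-inverse (inv-nat n) (pos-nat n))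

1≤nat : ∀ n → 1ℚ ℚ.≤ nat (suc n)
1≤nat n = subst (ℚ._≤ nat (suc n)) (+-identityʳ 1ℚ) (nat-mono {1} {suc n} (s≤s z≤n))

inv≤1 : ∀ n → inv n ℚ.≤ 1ℚ
inv≤1 n = subst₂ ℚ._≤_ (*-identityʳ _) (inv-nat n) (≤-* (0≤inv n) ℚP.≤-refl 0≤1 (1≤nat n))

≪-divide : ∀ n {x c} → nat (suc n) * x ≪ c → x ≪ inv n * c
≪-divide n {x} p = ≪-≡ (trans (sym (*-assoc _ _ _)) (trans (cong (_* x) (inv-nat n)) (*-identityˡ x))) (≪-* (≪-self (0≤inv n)) p)

nat-injective : ∀ n {a b} → nat (suc n) * a ≡ nat (suc n) * b → a ≡ b
nat-injective n {a} {b} e = lin (nat-cancel n {a + - b} (lin e (solve 3 (λ k a b → k :* (a :+ :- b) :+ k :* b := con 0ℚ :+ k :* a) refl _ _ _)))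
  (solve 2 (λ a b → a :+ con 0ℚ := b :+ (a :+ :- b)) refl _ _)

linear-+ : ∀ {Z : Set} {L M : (Z → ℚ) → ℚ} → IsLinear L → IsLinear M → IsLinear (λ F → L F + M F)
linear-+ l m = record
  { cong-lin = λ e → cong-lin l e ⊞ cong-lin m e ; add = λ f g → trans (add l f g ⊞ add m f g) (+-swap _ _ _ _)
  ; hom = λ k f → trans (hom l k f ⊞ hom m k f) (sym (distribˡ _ _ _)) }

linear-neg : ∀ {Z : Set} {L : (Z → ℚ) → ℚ} → IsLinear L → IsLinear (λ F → - L F)
linear-neg l = record
  { cong-lin = λ e → cong -_ (cong-lin l e) ; add = λ f g → trans (cong -_ (add l f g)) (solve 2 (λ a b → :- (a :+ b) := :- a :+ :- b) refl _ _)
  ; hom = λ k f → trans (cong -_ (hom l k f)) (solve 2 (λ k a → :- (k :* a) := k :* :- a) refl _ _) }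

linear-at : ∀ {Z Y : Set} {L : (Y → ℚ) → ℚ} (i : Y → Z) → IsLinear L → IsLinear (λ F → L (F ∘ i))
linear-at i l = record { cong-lin = λ e → cong-lin l (e ∘ i) ; add = λ f g → add l (f ∘ i) (g ∘ i) ; hom = λ k f → hom l k (f ∘ i) }

-- Polylogarithm coefficients and truncated harmonic sums

stripFirst stripLast : (Letter → ℚ) → (Word → ℚ) → Word → ℚ
stripFirst k F = lf (λ m a → k m * F a)
stripLast k F = rl (λ a m → k m * F a)

stripFirst-linear : ∀ k w → IsLinear (λ F → stripFirst k F w)
stripFirst-linear k [] = record { cong-lin = λ _ → refl ; add = λ _ _ → sym (+-identityˡ 0ℚ) ; hom = λ c _ → sym (zeroʳ c) }
stripFirst-linear k (m ∷ w) = record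
  { cong-lin = λ e → k m ⊠ e w ; add = λ f g → distribˡ _ _ _ ; hom = λ c f → solve 3 (λ k c f → k :* (c :* f) := c :* (k :* f)) refl _ _ _ }

stripLast-linear : ∀ k w → IsLinear (λ F → stripLast k F w)
stripLast-linear k w = record
  { cong-lin = λ e → rl-cong (λ a m → k m ⊠ e a) w ; add = λ f g → trans (rl-cong (λ a m → distribˡ (k m) (f a) (g a)) w) (rl-+ (λ a m → k m * f a) (λ a m → k m * g a) w)
  ; hom = λ c f → trans (rl-cong (λ a m → solve 3 (λ k c f → k :* (c :* f) := c :* (k :* f)) refl (k m) c (f a)) w) (rl-* c (λ a m → k m * f a) w) }

stripFirst-sh : ∀ k G u v → sh (stripFirst k G) u v ≡ stripFirst k (λ a → sh G a v) u + stripFirst k (λ b → sh G u b) v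
stripFirst-sh k G [] [] = sym (+-identityˡ 0ℚ)
stripFirst-sh k G [] (b ∷ v) = sym (+-identityˡ _)
stripFirst-sh k G (a ∷ u) [] = trans (k a ⊠ sym (Sh.st-[] G u)) (sym (+-identityʳ _))
stripFirst-sh k G (a ∷ u) (b ∷ v) = trans (+-identityʳ _) (hom (Sh.st-linear u (b ∷ v)) (k a) G ⊞ hom (Sh.st-linear (a ∷ u) v) (k b) G)

stripLast-sh : ∀ k G u v → sh (stripLast k G) u v ≡ stripLast k (λ a → sh G a v) u + stripLast k (λ b → sh G u b) v
stripLast-sh k G [] v = sym (+-identityˡ _)
stripLast-sh k G (a ∷ u) [] = trans (rl-cong (λ w m → k m ⊠ sym (Sh.st-[] G w)) (a ∷ u)) (sym (+-identityʳ _))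
stripLast-sh k G (a ∷ u) (b ∷ v) with snoc-view a u | snoc-view b v
... | u′ , i , e | v′ , j , e′ = subst₂ (λ U V → sh (stripLast k G) U V ≡ stripLast k (λ a → sh G a V) U + stripLast k (λ b → sh G U b) V) (sym e) (sym e′)
  (trans (Sh.st-∷ʳ (stripLast k G) u′ i v′ j) (trans (+-identityʳ _)
    (trans (onLast u′ i (v′ ∷ʳ j)) (sym (rl-∷ʳ (λ a m → k m * sh G a (v′ ∷ʳ j)) u′ i))
     ⊞ trans (Sh.st-cong (λ w → rl-∷ʳ (λ a m → k m * G a) w j) (u′ ∷ʳ i) v′) (trans (hom (Sh.st-linear (u′ ∷ʳ i) v′) (k j) G) (sym (rl-∷ʳ (λ b m → k m * sh G (u′ ∷ʳ i) b) v′ j))))))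
  where
  onLast : ∀ u i V → sh (λ w → stripLast k G (w ∷ʳ i)) u V ≡ k i * sh G u V
  onLast u i V = trans (Sh.st-cong (λ w → rl-∷ʳ (λ a m → k m * G a) w i) u V) (hom (Sh.st-linear u V) (k i) G)

z₁ : Letter → ℚ
z₁ x0 = 0ℚ
z₁ x1 = 1ℚ

-- right-hand side of z dG/dz = (x₀ + x₁ z/(1-z)) G - G x₀, the second factor of x₁ being kept separate
ode : (Letter × Word → ℚ) → Word → ℚ
ode f w = stripFirst z₀ (λ a → f (x0 , a)) w + - stripLast z₀ (λ a → f (x0 , a)) w + stripFirst z₁ (λ a → f (x1 , a)) w

ode-linear : ∀ w → IsLinear (λ f → ode f w)
ode-linear w = linear-+ (linear-+ (linear-at (x0 ,_) (stripFirst-linear z₀ w)) (linear-neg (linear-at (x0 ,_) (stripLast-linear z₀ w)))) (linear-at (x1 ,_) (stripFirst-linear z₁ w))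

ode-sh : ∀ f u v → sh (ode f) u v ≡ ode (λ t → sh (λ w → f (proj₁ t , w)) (proj₂ t) v) u + ode (λ t → sh (λ w → f (proj₁ t , w)) u (proj₂ t)) v
ode-sh f u v = trans (add₃ (Sh.st-linear u v) (stripFirst z₀ F₀) (λ w → - stripLast z₀ F₀ w) (stripFirst z₁ F₁))
  (trans (stripFirst-sh z₀ F₀ u v ⊞ trans (neg-lin (Sh.st-linear u v) (stripLast z₀ F₀)) (cong -_ (stripLast-sh z₀ F₀ u v)) ⊞ stripFirst-sh z₁ F₁ u v)
  (solve 6 (λ a b c d e f → ((a :+ b) :+ :- (c :+ d)) :+ (e :+ f) := (a :+ :- c :+ e) :+ (b :+ :- d :+ f)) refl _ _ _ _ _ _))
  where
  F₀ F₁ : Word → ℚ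
  F₀ w = f (x0 , w)
  F₁ w = f (x1 , w)

rl-cong-length : ∀ {A : Set} {H G : List A → A → ℚ} l w → length w ≡ suc l → (∀ a m → length a ≡ l → H a m ≡ G a m) → rl H w ≡ rl G w
rl-cong-length zero (m ∷ []) le e = e [] m refl
rl-cong-length (suc l) (m ∷ w@(_ ∷ _)) le e = rl-cong-length l w (ℕP.suc-injective le) (λ a i q → e (m ∷ a) i (cong suc q))

ode-cong-length : ∀ {f g} w → (∀ m a → suc (length a) ≡ length w → f (m , a) ≡ g (m , a)) → ode f w ≡ ode g w
ode-cong-length [] e = refl
ode-cong-length (m ∷ w) e = (z₀ m ⊠ e x0 w refl) ⊞ cong -_ (rl-cong-length (length w) (m ∷ w) refl (λ a i q → z₀ i ⊠ e x0 a (cong suc q))) ⊞ (z₁ m ⊠ e x1 w refl)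

-- h n w is the coefficient of zⁿ in the polylogarithm of the word w, with log z set to 0
grow : (Word → ℚ) → ℕ → ℕ → Word → ℚ
stage : (Word → ℚ) → ℕ → ℕ → Letter × Word → ℚ
-- Only the empty word has length zero, and its series is the constant 1, without terms of positive
-- degree.
grow G n zero w = 0ℚ
grow G n (suc l) w = inv n * ode (stage G n l) w
stage G n l (x0 , a) = grow G n l a
stage G n l (x1 , a) = G a

-- `H n` is the partial sum of coefficients up to degree n; `below n` is the coefficient of z^n
-- after multiplication by z/(1-z), hence the sum up to degree n - 1.
H h below : ℕ → Word → ℚ
H zero = counit
H (suc n) w = H n w + grow (H n) n (length w) w
h zero = counit
h (suc n) w = grow (H n) n (length w) w
below zero w = 0ℚ
below (suc n) = H n

phase : ℕ → Letter × Word → ℚ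
phase n (x0 , a) = h n a
phase n (x1 , a) = below n a

-- The coefficient of z^n in the differential equation. The length argument of `stage` fits because
-- `ode` removes exactly one letter.
h-ode : ∀ n w → nat n * h n w ≡ ode (phase n) w
h-ode zero w = trans (zeroˡ _) (sym (0+0 (trans (cong (λ x → stripFirst z₀ counit w + - x) (sym (initial w))) (-‿inverseʳ _)) (zero-lin (stripFirst-linear z₁ w) (λ _ → refl))))
  where
  initial : ∀ w → stripFirst z₀ counit w ≡ stripLast z₀ counit w
  initial [] = refl
  initial (m ∷ []) = refl
  initial (m ∷ n ∷ w) = trans (zeroʳ _) (sym (zero-lin (record { cong-lin = λ {f} {g} e → rl-cong (λ a i → z₀ i ⊠ e a) (n ∷ w) ; add = add (stripLast-linear z₀ (n ∷ w)) ; hom = hom (stripLast-linear z₀ (n ∷ w)) }) {λ a → counit (m ∷ a)} (λ _ → refl)))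
h-ode (suc n) [] = trans (zeroʳ (nat (suc n))) (solve 0 (con 0ℚ := con 0ℚ :+ :- con 0ℚ :+ con 0ℚ) refl)
h-ode (suc n) (m ∷ w) = trans (solve 3 (λ k i x → k :* (i :* x) := (i :* k) :* x) refl (nat (suc n)) (inv n) (ode (stage (H n) n (length w)) (m ∷ w))) (trans (cong (_* ode (stage (H n) n (length w)) (m ∷ w)) (inv-nat n)) (trans (*-identityˡ _)
  (ode-cong-length {stage (H n) n (length w)} {phase (suc n)} (m ∷ w) (λ { x0 a e → cong (λ l → grow (H n) n l a) (sym (ℕP.suc-injective e)) ; x1 a e → refl }))))

H-below : ∀ n w → H n w ≡ below n w + h n w
H-below zero w = sym (+-identityˡ _)
H-below (suc n) w = refl

conv≡csum : ∀ f X m → conv f X m ≡ csum (λ i j → f i * X j) m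
conv≡csum f X zero = refl
conv≡csum f X (suc m) = refl ⊞ conv≡csum f (λ n → X (suc n)) m

conv-comm : ∀ f X m → conv f X m ≡ conv X f m
conv-comm f X m = trans (conv≡csum f X m) (trans (csum-cong m (λ i j → *-comm (f i) (X j))) (trans (csum-flip (λ i j → X i * f j) m) (sym (conv≡csum X f m))))

conv-weight : ∀ f X k m → nat (k ℕ.+ m) * conv f X m ≡ conv (λ i → nat i * f i) X m + conv f (λ n → nat (k ℕ.+ n) * X n) m
conv-weight f X k zero = solve 3 (λ k f x → k :* (f :* x) := con 0ℚ :* f :* x :+ f :* (k :* x)) refl _ _ _
conv-weight f X k (suc m) = lin
  (trans (cong (λ j → nat j * conv f X′ m) (ℕP.+-suc k m)) (trans (conv-weight f X′ (suc k) m) (cong (conv (λ i → nat i * f i) X′ m +_) (conv-congʳ f m (λ n → cong (λ j → nat j * X (suc n)) (sym (ℕP.+-suc k n))))))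
    ⊞ cong (_* (f (suc m) * X 0)) (trans (nat-+ k (suc m)) (cong (λ j → nat j + nat (suc m)) (sym (ℕP.+-identityʳ k)))))
  (solve 8 (λ k f x c c₁ c₂ s t → k :* (f :* x :+ c) :+ ((c₁ :+ c₂) :+ (t :+ s) :* (f :* x)) := ((s :* f :* x :+ c₁) :+ (f :* (t :* x) :+ c₂)) :+ (k :* c :+ k :* (f :* x))) refl _ _ _ _ _ _ _ _)
  where
  X′ : ℕ → ℚ
  X′ n = X (suc n)

-- Multiplicativity of the generating series. Multiplied by the degree, both sides obey the same
-- differential equation, whose right-hand side involves shorter words only.
cauchy : ∀ l u v → length u ℕ.+ length v ≤ l → ∀ n → sh (h n) u v ≡ conv (λ i → h i u) (λ j → h j v) n
cauchy l u v le zero = sh-counit u v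
cauchy zero [] [] le (suc n) = sym (trans (conv-first (λ i → h i []) (λ j → h j []) n) (0+0 (zeroʳ _) (conv-zero (λ j → h j []) n (λ _ → refl))))
cauchy (suc l) u v le (suc n) = nat-injective n (trans (sym (hom (Sh.st-linear u v) (nat (suc n)) (h (suc n))))
  (trans (Sh.st-cong (h-ode (suc n)) u v) (trans (ode-sh (phase (suc n)) u v)
  (trans (left ⊞ right) (sym (trans (conv-weight (λ i → h i u) (λ j → h j v) 0 (suc n))
    (conv-cong (λ j → h j v) (suc n) (λ i → h-ode i u) ⊞ conv-congʳ (λ i → h i u) (suc n) (λ j → h-ode j v))))))))
  where
  smaller : ∀ (m : Letter) a b → suc (length a ℕ.+ length b) ≤ suc l → ∀ n → sh (λ w → phase n (m , w)) a b ≡ conv (λ i → phase i (m , a)) (λ j → h j b) n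
  smaller x0 a b (s≤s le) = cauchy l a b le
  smaller x1 a b (s≤s le) = go
    where
    go : ∀ n → sh (below n) a b ≡ conv (λ i → below i a) (λ j → h j b) n
    go zero = trans (zero-lin (Sh.st-linear a b) (λ _ → refl)) (sym (zeroˡ _))
    go (suc n) = trans (Sh.st-cong (H-below n) a b) (trans (add (Sh.st-linear a b) (below n) (h n)) (trans (go n ⊞ cauchy l a b le n)
      (sym (trans (conv-first (λ i → below i a) (λ j → h j b) n) (trans (0+ (zeroˡ _)) (trans (conv-cong (λ j → h j b) n (λ i → H-below i a)) (conv-+ (λ i → below i a) (λ i → h i a) (λ j → h j b) n)))))))
  left : ode (λ t → sh (λ w → phase (suc n) (proj₁ t , w)) (proj₂ t) v) u ≡ conv (λ i → ode (phase i) u) (λ j → h j v) (suc n)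
  left = trans (ode-cong-length u (λ m a e → smaller m a v (subst (λ k → k ℕ.+ length v ≤ suc l) (sym e) le) (suc n)))
    (lin-conv (ode-linear u) (λ t i → phase i t) (λ j → h j v) (suc n))
  right : ode (λ t → sh (λ w → phase (suc n) (proj₁ t , w)) u (proj₂ t)) v ≡ conv (λ i → h i u) (λ j → ode (phase j) v) (suc n)
  right = trans (ode-cong-length v (λ m b e → trans (Sh.st-comm (λ w → phase (suc n) (m , w)) u b)
      (smaller m b u (subst (_≤ suc l) (trans (ℕP.+-comm (length u) (length v)) (cong (ℕ._+ length u) (sym e))) le) (suc n))))
    (trans (lin-conv (ode-linear v) (λ t i → phase i t) (λ j → h j u) (suc n)) (conv-comm (λ i → ode (phase i) v) (λ j → h j u) (suc n)))

ipow : ℕ → ℕ → ℚ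
ipow n zero = inv n
ipow n (suc k) = inv n * ipow n k

ipow-+ : ∀ n a b → ipow n (suc (a ℕ.+ b)) ≡ ipow n a * ipow n b
ipow-+ n zero b = refl
ipow-+ n (suc a) b = trans (inv n ⊠ ipow-+ n a b) (sym (*-assoc _ _ _))

-- On words ending in x₁ the term -G x₀ does not act, and the recursion yields the part of a nested
-- harmonic sum with largest index n + 1.
h-blk : ∀ n k w → h (suc n) (blk k (ι w)) ≡ ipow n k * H n (ι w)
h-blk n k w = nat-injective n (trans (h-ode (suc n) (blk k (ι w))) (go k))
  where
  last : ∀ k → stripLast z₀ (h (suc n)) (blk k (ι w)) ≡ 0ℚ
  last k with ends-x₁ k w
  ... | u , e = trans (cong (stripLast z₀ (h (suc n))) e) (trans (rl-∷ʳ (λ a m → z₀ m * h (suc n) a) u x1) (zeroˡ _))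
  go : ∀ k → ode (phase (suc n)) (blk k (ι w)) ≡ nat (suc n) * (ipow n k * H n (ι w))
  go zero = trans (cong (λ x → 0ℚ * h (suc n) (ι w) + - x + 1ℚ * H n (ι w)) (last zero)) (lin (cong (_* H n (ι w)) (sym (inv-nat n)))
    (solve 4 (λ h H i k → (con 0ℚ :* h :+ :- con 0ℚ :+ con 1ℚ :* H) :+ (i :* k) :* H := k :* (i :* H) :+ con 1ℚ :* H) refl _ _ _ _))
  go (suc k) = trans (cong (λ x → 1ℚ * h (suc n) (blk k (ι w)) + - x + 0ℚ * H n (blk k (ι w))) (last (suc k)))
    (lin (h-blk n k w ⊞ cong (_* (ipow n k * H n (ι w))) (sym (inv-nat n)))
    (solve 6 (λ h b i k p H → (con 1ℚ :* h :+ :- con 0ℚ :+ con 0ℚ :* b) :+ (p :* H :+ (i :* k) :* (p :* H)) := k :* (i :* p :* H) :+ (h :+ con 1ℚ :* (p :* H))) refl _ _ _ _ _ _))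

counit-blk : ∀ k x → counit (blk k x) ≡ 0ℚ
counit-blk zero x = refl
counit-blk (suc k) x = refl

H-[] : ∀ n → H n [] ≡ 1ℚ
H-[] zero = refl
H-[] (suc n) = trans (+-identityʳ _) (H-[] n)

-- Truncated harmonic sums multiply exactly: the three terms of the stuffle say which of the two
-- factors has the largest index, or that both have it.
stuffle : ∀ n u v → st (λ w → H n (ι w)) u v ≡ H n (ι u) * H n (ι v)
stuffle n [] v = sym (trans (cong (_* H n (ι v)) (H-[] n)) (*-identityˡ _))
stuffle n (a ∷ u) [] = trans (stuffle n [] (a ∷ u)) (*-comm _ _)
stuffle zero (a ∷ u) (b ∷ v) = trans (0+0 (0+0 (zero-lin (St.st-linear u (b ∷ v)) (λ w → counit-blk a (ι w))) (zero-lin (St.st-linear (a ∷ u) v) (λ w → counit-blk b (ι w))))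
  (zero-lin (St.st-linear u v) (λ w → counit-blk (suc (a ℕ.+ b)) (ι w)))) (sym (0* (counit-blk a (ι u))))
stuffle (suc n) (a ∷ u) (b ∷ v) = trans (peel a u (b ∷ v) ⊞ peel b (a ∷ u) v ⊞ peel (suc (a ℕ.+ b)) u v)
  (trans (solve 9 (λ s₁ s₂ s₃ p q r t₁ t₂ t₃ → (s₁ :+ p :* t₁) :+ (s₂ :+ q :* t₂) :+ (s₃ :+ r :* t₃) := (s₁ :+ s₂ :+ s₃) :+ p :* t₁ :+ q :* t₂ :+ r :* t₃) refl _ _ _ _ _ _ _ _ _)
  (trans (stuffle n (a ∷ u) (b ∷ v) ⊞ ipow n a ⊠ stuffle n u (b ∷ v) ⊞ ipow n b ⊠ stuffle n (a ∷ u) v ⊞ cong₂ _*_ (ipow-+ n a b) (stuffle n u v))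
  (trans (solve 6 (λ A B U V p q → A :* B :+ p :* (U :* B) :+ q :* (A :* V) :+ (p :* q) :* (U :* V) := (A :+ p :* U) :* (B :+ q :* V)) refl _ _ _ _ _ _)
  (cong₂ _*_ (refl ⊞ sym (h-blk n a u)) (refl ⊞ sym (h-blk n b v))))))
  where
  peel : ∀ k x y → st (λ w → H (suc n) (ι (k ∷ w))) x y ≡ st (λ w → H n (ι (k ∷ w))) x y + ipow n k * st (λ w → H n (ι w)) x y
  peel k x y = trans (St.st-cong (λ w → refl ⊞ h-blk n k w) x y) (trans (add (St.st-linear x y) (λ w → H n (ι (k ∷ w))) (λ w → ipow n k * H n (ι w))) (refl ⊞ hom (St.st-linear x y) (ipow n k) (λ w → H n (ι w))))

p≤∣p∣ : ∀ p → p ℚ.≤ ℚ.∣ p ∣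
p≤∣p∣ p with ℚP.≤-total 0ℚ p
... | inj₁ q = ℚP.≤-reflexive (sym (ℚP.0≤p⇒∣p∣≡p q))
... | inj₂ q = ℚP.≤-trans q (ℚP.0≤∣p∣ p)

≪⇒≤ : ∀ {x c} → x ≪ c → x ℚ.≤ c
≪⇒≤ {x} (bounded p) = ℚP.≤-trans (p≤∣p∣ x) p

-- Growth bounds and the defect of the shuffle product

infixr 8 _↑_
_↑_ : ℚ → ℕ → ℚ
b ↑ zero = 1ℚ
b ↑ suc k = b * b ↑ k

two : ℚ
two = 1ℚ + 1ℚ

1≤two : 1ℚ ℚ.≤ two
1≤two = subst (ℚ._≤ two) (+-identityʳ 1ℚ) (≤-+ (ℚP.≤-refl {1ℚ}) 0≤1)

↑-+ : ∀ b k l → b ↑ (k ℕ.+ l) ≡ b ↑ k * b ↑ l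
↑-+ b zero l = sym (*-identityˡ _)
↑-+ b (suc k) l = trans (b ⊠ ↑-+ b k l) (sym (*-assoc _ _ _))

module _ {β : ℚ} (two≤β : two ℚ.≤ β) where

  1≤β : 1ℚ ℚ.≤ β
  1≤β = ℚP.≤-trans 1≤two two≤β

  0≤β : 0ℚ ℚ.≤ β
  0≤β = ℚP.≤-trans 0≤1 1≤β

  1≤↑ : ∀ k → 1ℚ ℚ.≤ β ↑ k
  1≤↑ zero = ℚP.≤-refl
  1≤↑ (suc k) = subst (ℚ._≤ β * β ↑ k) (*-identityˡ 1ℚ) (≤-* 0≤1 1≤β 0≤1 (1≤↑ k))

  0≤↑ : ∀ k → 0ℚ ℚ.≤ β ↑ k
  0≤↑ k = ℚP.≤-trans 0≤1 (1≤↑ k)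

  ↑-≤ : ∀ k l → β ↑ k ℚ.≤ β ↑ (k ℕ.+ l)
  ↑-≤ k l = subst₂ ℚ._≤_ (*-identityʳ _) (sym (↑-+ β k l)) (≤-* (0≤↑ k) ℚP.≤-refl 0≤1 (1≤↑ l))

  double-≤ : ∀ {x} → 0ℚ ℚ.≤ x → x + x ℚ.≤ β * x
  double-≤ {x} p = subst (ℚ._≤ β * x) (solve 1 (λ x → (con 1ℚ :+ con 1ℚ) :* x := x :+ x) refl x) (≤-* (0≤-+ 0≤1 0≤1) two≤β p ℚP.≤-refl)

harm : ℕ → ℚ
harm zero = 0ℚ
harm (suc n) = harm n + inv n

0≤harm : ∀ n → 0ℚ ℚ.≤ harm n
0≤harm zero = ℚP.≤-refl
0≤harm (suc n) = 0≤-+ (0≤harm n) (0≤inv n)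

harm-mono : ∀ m i → harm m ℚ.≤ harm (i ℕ.+ m)
harm-mono m zero = ℚP.≤-refl
harm-mono m (suc i) = ℚP.≤-trans (harm-mono m i) (subst (ℚ._≤ harm (suc i ℕ.+ m)) (+-identityʳ _) (≤-+ (ℚP.≤-refl {harm (i ℕ.+ m)}) (0≤inv (i ℕ.+ m))))

-- With increments of size B/n, the sum grows like B times a harmonic number, and from k to k + i it
-- moves by at most iB/(k+1).
module PartialSums (x S : ℕ → ℚ) (S-suc : ∀ n → S (suc n) ≡ S n + x n) (B : ℚ) (N : ℕ) (x-bound : ∀ n → suc n ≤ N → nat (suc n) * x n ≪ B) (0≤B : 0ℚ ℚ.≤ B) where

  drift : ∀ k i → k ℕ.+ i ≤ N → nat (suc k) * (S (k ℕ.+ i) + - S k) ≪ nat i * B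
  drift k zero le = ≪-zero (trans (nat (suc k) ⊠ trans (cong (λ j → S j + - S k) (ℕP.+-identityʳ k)) (-‿inverseʳ (S k))) (zeroʳ _)) (0≤-* (0≤nat 0) 0≤B)
  drift k (suc i) le = ≪-≡ (trans (sym (distribˡ _ _ _)) (nat (suc k) ⊠ trans (solve 3 (λ s x t → (s :+ :- t) :+ x := (s :+ x) :+ :- t) refl _ _ _) (cong (_+ - S k) (trans (sym (S-suc (k ℕ.+ i))) (cong S (sym (ℕP.+-suc k i)))))))
    (≪-≤ (≪-+ (drift k i (ℕP.≤-trans (ℕP.+-monoʳ-≤ k (ℕP.n≤1+n i)) le))
             (≪-lower (0≤nat (suc k)) (nat-mono (s≤s (ℕP.m≤m+n k i))) (x-bound (k ℕ.+ i) (subst (_≤ N) (ℕP.+-suc k i) le))))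
      (ℚP.≤-reflexive (solve 2 (λ n b → n :* b :+ b := (con 1ℚ :+ n) :* b) refl _ _)))

  total : ∀ n → n ≤ N → S n ≪ ℚ.∣ S 0 ∣ + harm n * B
  total zero le = bounded (ℚP.≤-reflexive (sym (+0 (zeroˡ B))))
  total (suc n) le = ≪-≡ (sym (S-suc n)) (≪-≤ (≪-+ (total n (ℕP.≤-trans (ℕP.n≤1+n n) le)) (≪-divide n (x-bound n le)))
    (ℚP.≤-reflexive (solve 4 (λ s h b i → (s :+ h :* b) :+ i :* b := s :+ (h :+ i) :* b) refl _ _ _ _)))

z₀-bound : ∀ m → z₀ m ≪ 1ℚ
z₀-bound x0 = ≪-self 0≤1
z₀-bound x1 = ≪-zero refl 0≤1

≪-undo : ∀ n {x c} → nat (suc n) * x ≪ c → x ≪ c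
≪-undo n {x} p = ≪-≡ (*-identityˡ x) (≪-lower 0≤1 (1≤nat n) p)

-- Each letter multiplies the bounds by at most 2 + harm N: the harmonic number comes from the
-- partial sum behind x₁, the 2 from the other terms. β absorbs this factor.
module Bounds (N : ℕ) (β : ℚ) (harm≤β : two + harm N ℚ.≤ β) where

  two≤β : two ℚ.≤ β
  two≤β = ℚP.≤-trans (subst (ℚ._≤ two + harm N) (+-identityʳ two) (≤-+ (ℚP.≤-refl {two}) (0≤harm N))) harm≤β

  private
    stripLast-bound : ∀ l k F w → length w ≡ suc l → (∀ u → length u ≡ l → k * F u ≪ β ↑ l) → k * stripLast z₀ F w ≪ β ↑ l
    stripLast-bound l k F (m ∷ t) e b with snoc-view m t
    ... | u , i , e′ = ≪-≡ (trans (solve 3 (λ z k f → z :* (k :* f) := k :* (z :* f)) refl _ _ _) (k ⊠ sym (trans (cong (stripLast z₀ F) e′) (rl-∷ʳ (λ a m → z₀ m * F a) u i))))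
      (≪-≤ (≪-* (z₀-bound i) (b u (ℕP.suc-injective (trans (sym (trans (cong length e′) (trans (LP.length-++ u) (ℕP.+-comm (length u) 1)))) e)))) (ℚP.≤-reflexive (*-identityˡ _)))

  h-bound : ∀ l w → length w ≡ l → ∀ n → suc n ≤ N → nat (suc n) * h (suc n) w ≪ β ↑ l
  H-bound : ∀ l w → length w ≡ l → ∀ n → n ≤ N → H n w ≪ 1ℚ + harm N * β ↑ l
  h-bound zero [] e n le = ≪-zero (zeroʳ _) 0≤1
  h-bound (suc l) (m ∷ t) e n le = ≪-≡ (sym (h-ode (suc n) (m ∷ t))) (≪-≤ (go m) growth)
    where
    B : ℚ
    B = β ↑ l
    0≤B : 0ℚ ℚ.≤ B
    0≤B = 0≤↑ two≤β l
    0≤hB : 0ℚ ℚ.≤ harm N * B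
    0≤hB = 0≤-* (0≤harm N) 0≤B
    small : ∀ u → length u ≡ l → 1ℚ * h (suc n) u ≪ B
    small u e = ≪-≡ (sym (*-identityˡ _)) (≪-undo n (h-bound l u e n le))
    last : ∀ m → - stripLast z₀ (h (suc n)) (m ∷ t) ≪ B
    last m = ≪-neg (≪-≡ (*-identityˡ _) (stripLast-bound l 1ℚ (h (suc n)) (m ∷ t) e small))
    growth : (two + harm N) * B ℚ.≤ β * B
    growth = ≤-* (0≤-+ (0≤-+ 0≤1 0≤1) (0≤harm N)) harm≤β 0≤B ℚP.≤-refl
    go : ∀ m → z₀ m * h (suc n) t + - stripLast z₀ (h (suc n)) (m ∷ t) + z₁ m * H n t ≪ (two + harm N) * B
    go x0 = ≪-≤ (≪-+ (≪-+ (small t (ℕP.suc-injective e)) (last x0)) (≪-zero (zeroˡ (H n t)) 0≤hB))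
      (ℚP.≤-reflexive (solve 2 (λ b h → b :+ b :+ h :* b := (con 1ℚ :+ con 1ℚ :+ h) :* b) refl B (harm N)))
    go x1 = ≪-≤ (≪-+ (≪-+ (≪-zero (zeroˡ (h (suc n) t)) (ℚP.≤-refl {0ℚ})) (last x1)) (≪-≡ (sym (*-identityˡ _)) (H-bound l t (ℕP.suc-injective e) n (ℕP.≤-trans (ℕP.n≤1+n n) le))))
      (ℚP.≤-trans (≤-+ (ℚP.≤-refl {0ℚ + B}) (≤-+ (1≤↑ two≤β l) (ℚP.≤-refl {harm N * B})))
        (ℚP.≤-reflexive (solve 2 (λ b h → (con 0ℚ :+ b) :+ (b :+ h :* b) := (con 1ℚ :+ con 1ℚ :+ h) :* b) refl B (harm N))))
  H-bound l w e n le = ≪-≤ (PartialSums.total (λ n → h (suc n) w) (λ n → H n w) (λ n → refl) (β ↑ l) N (h-bound l w e) (0≤↑ two≤β l) n le)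
    (≤-+ (initial w) (≤-* (0≤harm n) (subst (λ k → harm n ℚ.≤ harm k) (ℕP.m∸n+n≡m le) (harm-mono n (N ℕ.∸ n))) (0≤↑ two≤β l) ℚP.≤-refl))
    where
    initial : ∀ w → ℚ.∣ counit w ∣ ℚ.≤ 1ℚ
    initial [] = ℚP.≤-refl
    initial (_ ∷ _) = 0≤1

  H-tempered : ∀ w → H N w ≪ β ↑ suc (length w)
  H-tempered w = ≪-≤ (H-bound (length w) w refl N ℕP.≤-refl) (ℚP.≤-trans (≤-+ (1≤↑ two≤β (length w)) (ℚP.≤-refl {harm N * β ↑ length w}))
    (ℚP.≤-trans (ℚP.≤-reflexive (solve 2 (λ b h → b :+ h :* b := (con 1ℚ :+ h) :* b) refl (β ↑ length w) (harm N)))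
      (≤-* (0≤-+ 0≤1 (0≤harm N)) (ℚP.≤-trans (≤-+ 1≤two (ℚP.≤-refl {harm N})) harm≤β) (0≤↑ two≤β (length w)) ℚP.≤-refl)))

  -- For a word starting with x₀ the differential equation involves coefficients but no partial
  -- sums, which gains a second factor 1/(n+1).
  h-convergent : ∀ t n → suc n ≤ N → nat (suc n) * (nat (suc n) * h (suc n) (x0 ∷ t)) ≪ β ↑ suc (length t)
  h-convergent t n le = ≪-≡ (nat (suc n) ⊠ sym (h-ode (suc n) (x0 ∷ t))) (≪-≡ (solve 4 (λ k a b c → k :* a :+ :- (k :* b) := k :* (con 1ℚ :* a :+ :- b :+ con 0ℚ :* c)) refl _ _ _ _)
    (≪-≤ (≪-+ (h-bound (length t) t refl n le) (≪-neg (stripLast-bound (length t) (nat (suc n)) (h (suc n)) (x0 ∷ t) refl (λ u e → h-bound (length t) u e n le)))) (double-≤ two≤β (0≤↑ two≤β (length t)))))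

conv-H : ∀ u v n → conv (λ i → h i u) (λ j → H j v) n ≡ sh (H n) u v
conv-H u v zero = sym (sh-counit u v)
conv-H u v (suc n) = trans (trans (refl ⊞ add (conv-linear (λ i → h i u) n) (λ j → H j v) (λ j → h (suc j) v))
    (solve 3 (λ a b c → a :+ (b :+ c) := b :+ (a :+ c)) refl _ _ _))
  (trans (conv-H u v n ⊞ sym (cauchy _ u v ℕP.≤-refl (suc n))) (sym (add (Sh.st-linear u v) (H n) (h (suc n)))))

conv-constant : ∀ u x n → conv (λ i → h i u) (λ _ → x) n ≡ H n u * x
conv-constant u x zero = refl
conv-constant u x (suc n) = trans (refl ⊞ conv-constant u x n) (solve 3 (λ a b x → a :* x :+ b :* x := (b :+ a) :* x) refl _ _ _)

-- The shuffle product of partial sums keeps the pairs with i + j ≤ n; the missing ones are the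
-- tails H n v - H j v.
defect : ∀ u v n → H n u * H n v + - sh (H n) u v ≡ conv (λ i → h i u) (λ j → H n v + - H j v) n
defect u v n = sym (trans (add (conv-linear (λ i → h i u) n) (λ _ → H n v) (λ j → - H j v)) (conv-constant u (H n v) n ⊞ trans (neg-lin (conv-linear (λ i → h i u) n) (λ j → H j v)) (cong -_ (conv-H u v n))))

conv-bound : ∀ f X (c : ℕ → ℕ → ℚ) m → (∀ i j → i ℕ.+ j ≡ m → f i * X j ≪ c i j) → conv f X m ≪ csum c m
conv-bound f X c zero b = b 0 0 refl
conv-bound f X c (suc m) b = ≪-+ (b (suc m) 0 (ℕP.+-identityʳ (suc m))) (conv-bound f (λ n → X (suc n)) (λ i j → c i (suc j)) m (λ i j e → b i (suc j) (trans (ℕP.+-suc i j) (cong suc e))))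

inverse-index : ℕ → ℚ
inverse-index zero = 0ℚ
inverse-index (suc i) = inv i

csum-harm : ∀ n → csum (λ i j → inverse-index i + inv j) n ≡ harm n + harm (suc n)
csum-harm n = trans (csum-+ (λ i j → inverse-index i) (λ i j → inv j) n) (first n ⊞ trans (csum-flip (λ i j → inv i) n) (second n))
  where
  first : ∀ n → csum (λ i j → inverse-index i) n ≡ harm n
  first zero = refl
  first (suc n) = trans (refl ⊞ first n) (+-comm _ _)
  second : ∀ n → csum (λ i j → inv i) n ≡ harm (suc n)
  second zero = sym (+-identityˡ _)
  second (suc n) = trans (refl ⊞ second n) (+-comm _ _)

partial-fractions : ∀ i j → inv i * inv j ≡ inv (suc (i ℕ.+ j)) * (inv i + inv j)
partial-fractions i j = nat-injective (suc (i ℕ.+ j)) (trans (cong (λ k → k * (inv i * inv j)) (trans (cong nat (sym (cong suc (ℕP.+-suc i j)))) (nat-+ (suc i) (suc j))))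
  (lin (inv j ⊠ inv-nat i ⊞ inv i ⊠ inv-nat j ⊞ cong (_* (inv i + inv j)) (sym (inv-nat (suc (i ℕ.+ j)))))
    (solve 6 (λ a b i j x y → (a :+ b) :* (i :* j) :+ (j :* con 1ℚ :+ i :* con 1ℚ :+ (x :* y) :* (i :+ j)) := y :* (x :* (i :+ j)) :+ (j :* (i :* a) :+ i :* (j :* b) :+ con 1ℚ :* (i :+ j))) refl _ _ _ _ _ _)))

module _ (n : ℕ) (β : ℚ) (harm≤β : two + harm n ℚ.≤ β) where
  open Bounds n β harm≤β

  -- For i ≥ 1 the convergent factor contributes 1/i², the tail i/(j+1). Partial fractions turn
  -- 1/(i(j+1)) with i + j = n into 1/(n+1) times terms that sum to harmonic numbers.
  defect-bound : ∀ t v → nat n * (H n (x0 ∷ t) * H n v + - sh (H n) (x0 ∷ t) v) ≪ β ↑ (suc (length t) ℕ.+ (length v ℕ.+ 2))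
  defect-bound t v = ≪-≡ (nat n ⊠ sym (defect (x0 ∷ t) v n)) (≪-≤ (≪-* (≪-self (0≤nat n)) (conv-bound _ _ (λ i j → A * B * inv n * (inverse-index i + inv j)) n term))
    (ℚP.≤-trans (ℚP.≤-reflexive (trans (nat n ⊠ trans (csum-* (A * B * inv n) (λ i j → inverse-index i + inv j) n) ((A * B * inv n) ⊠ csum-harm n))
        (solve 5 (λ N A B i h → N :* (A :* B :* i :* h) := (i :* N) :* (A :* B :* h)) refl (nat n) A B (inv n) (harm n + harm (suc n)))))
    (ℚP.≤-trans (≤-* (0≤-* (0≤inv n) (0≤nat n)) inv-below (0≤-* (0≤-* 0≤A 0≤B) (0≤-+ (0≤harm n) (0≤harm (suc n)))) (≤-* (0≤-* 0≤A 0≤B) ℚP.≤-refl (0≤-+ (0≤harm n) (0≤harm (suc n))) harmonic))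
    (ℚP.≤-reflexive (trans (solve 3 (λ A B b → con 1ℚ :* (A :* B :* (b :* b)) := A :* (B :* (b :* (b :* con 1ℚ)))) refl A B β)
      (sym (trans (↑-+ β (suc (length t)) (length v ℕ.+ 2)) (A ⊠ ↑-+ β (length v) 2))))))))
    where
    A B : ℚ
    A = β ↑ suc (length t)
    B = β ↑ length v
    0≤A : 0ℚ ℚ.≤ A
    0≤A = 0≤↑ two≤β (suc (length t))
    0≤B : 0ℚ ℚ.≤ B
    0≤B = 0≤↑ two≤β (length v)
    inv-below : inv n * nat n ℚ.≤ 1ℚ
    inv-below = ℚP.≤-trans (≤-* (0≤inv n) ℚP.≤-refl (0≤nat n) (nat-mono (ℕP.n≤1+n n))) (ℚP.≤-reflexive (inv-nat n))
    below-β : ∀ {x} → x ℚ.≤ two + harm n → x ℚ.≤ β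
    below-β p = ℚP.≤-trans p harm≤β
    harmonic : harm n + harm (suc n) ℚ.≤ β * β
    harmonic = ℚP.≤-trans (≤-+ (below-β (subst (ℚ._≤ two + harm n) (+-identityˡ _) (≤-+ (0≤-+ 0≤1 0≤1) ℚP.≤-refl)))
        (below-β (ℚP.≤-trans (≤-+ (ℚP.≤-refl {harm n}) (ℚP.≤-trans (inv≤1 n) 1≤two)) (ℚP.≤-reflexive (+-comm _ _)))))
      (double-≤ two≤β (0≤β two≤β))
    tail : ∀ i j → i ℕ.+ j ≡ n → nat (suc j) * (H n v + - H j v) ≪ nat i * B
    tail i j refl = subst (λ k → nat (suc j) * (H k v + - H j v) ≪ nat i * B) (ℕP.+-comm j i)
      (PartialSums.drift (λ n → h (suc n) v) (λ n → H n v) (λ n → refl) B n (h-bound (length v) v refl) 0≤B j i (ℕP.≤-reflexive (ℕP.+-comm j i)))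
    term : ∀ i j → i ℕ.+ j ≡ n → h i (x0 ∷ t) * (H n v + - H j v) ≪ A * B * inv n * (inverse-index i + inv j)
    term zero j e = ≪-zero (zeroˡ (H n v + - H j v)) (0≤-* (0≤-* (0≤-* 0≤A 0≤B) (0≤inv n)) (0≤-+ ℚP.≤-refl (0≤inv j)))
    term (suc i) j refl = ≪-≤ (≪-* (≪-divide i (≪-divide i (h-convergent t i (s≤s (ℕP.m≤m+n i j))))) (≪-divide j (tail (suc i) j refl)))
      (ℚP.≤-reflexive (lin (cong (λ x → A * B * x) (partial-fractions i j) ⊞ cong (λ x → A * B * inv i * inv j * x) (inv-nat i))
        (solve 7 (λ A B i j s k p → (i :* (i :* A)) :* (j :* (s :* B)) :+ (A :* B :* (k :* p) :+ A :* B :* i :* j :* con 1ℚ) := A :* B :* k :* p :+ (A :* B :* (i :* j) :+ A :* B :* i :* j :* (i :* s))) refl A B (inv i) (inv j) (nat (suc i)) (inv (suc (i ℕ.+ j))) (inv i + inv j))))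

-- Sampling at powers of two: tempered and null sequences

≤-pow : ∀ s → suc s ≤ 2 ℕ.^ s
≤-pow zero = ℕP.≤-refl
≤-pow (suc s) = ℕP.≤-trans (ℕP.+-monoʳ-≤ 1 (≤-pow s)) (ℕP.≤-trans (ℕP.+-monoˡ-≤ (2 ℕ.^ s) (ℕP.≤-trans (s≤s z≤n) (≤-pow s))) (ℕP.+-monoʳ-≤ (2 ℕ.^ s) (ℕP.m≤m+n (2 ℕ.^ s) 0)))

exponential-wins : ∀ K → ∃ λ m → (3 ℕ.+ m) ℕ.^ K < 2 ℕ.^ m
exponential-wins K = m , subst (λ b → b ℕ.^ K < 2 ℕ.^ m) (sym base-eq) (subst (_< 2 ℕ.^ m) (sym (ℕP.^-*-assoc 2 j K)) (ℕP.^-monoʳ-< 2 (s≤s (s≤s z≤n)) (ℕP.+-cancelˡ-< 3 (j ℕ.* K) m (subst (3 ℕ.+ j ℕ.* K <_) (sym base-eq) large))))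
  where
  s j m : ℕ
  s = suc K
  -- j = 3(K+1) gives 2^j ≥ (K+2)³, which exceeds 3 + jK. With 3 + m = 2^j the claim is exactly this
  -- comparison of exponents.
  j = s ℕ.* 3
  m = 2 ℕ.^ j ℕ.∸ 3
  cube : ℕ
  cube = (2 ℕ.+ K) ℕ.^ 3
  cube≤ : cube ≤ 2 ℕ.^ j
  cube≤ = subst (cube ≤_) (ℕP.^-*-assoc 2 s 3) (ℕP.^-monoˡ-≤ 3 (≤-pow s))
  large : 3 ℕ.+ j ℕ.* K < 2 ℕ.^ j
  large = ℕP.≤-trans (subst (suc (3 ℕ.+ j ℕ.* K) ≤_)
    (NS.solve 1 (λ k → (NS.con 4 NS.:+ (NS.con 1 NS.:+ k) NS.:* NS.con 3 NS.:* k) NS.:+ (k NS.:* k NS.:* k NS.:+ NS.con 3 NS.:* k NS.:* k NS.:+ NS.con 9 NS.:* k NS.:+ NS.con 4)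
      NS.:= (NS.con 2 NS.:+ k) NS.:^ 3) refl K) (ℕP.m≤m+n _ _)) cube≤
  base-eq : 3 ℕ.+ m ≡ 2 ℕ.^ j
  base-eq = ℕP.m+[n∸m]≡n (ℕP.≤-trans (ℕP.m≤m+n 3 (j ℕ.* K)) (ℕP.<⇒≤ large))

nat-* : ∀ a b → nat (a ℕ.* b) ≡ nat a * nat b
nat-* zero b = sym (zeroˡ _)
nat-* (suc a) b = trans (nat-+ b (a ℕ.* b)) (trans (cong (nat b +_) (nat-* a b)) (solve 2 (λ a b → b :+ a :* b := (con 1ℚ :+ a) :* b) refl _ _))

nat-^ : ∀ a k → nat (a ℕ.^ k) ≡ nat a ↑ k
nat-^ a zero = +-identityʳ 1ℚ
nat-^ a (suc k) = trans (nat-* a (a ℕ.^ k)) (nat a ⊠ nat-^ a k)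

nat-cancel-< : ∀ {a b} → a < b → ¬ (nat b ℚ.≤ nat a)
nat-cancel-< {a} {b} lt le = ℚP.<-irrefl refl (ℚP.<-≤-trans (ℚP.+-monoˡ-< (nat a) pos-1) (ℚP.≤-trans (ℚP.≤-trans (ℚP.≤-reflexive (+-def 1ℚ (nat a))) (nat-mono lt)) (ℚP.≤-trans le (ℚP.≤-reflexive (sym (ℚP.+-identityˡ (nat a)))))))

p2 : ℕ → ℕ
p2 zero = 1
p2 (suc m) = p2 m ℕ.+ p2 m

p2≡^ : ∀ m → p2 m ≡ 2 ℕ.^ m
p2≡^ zero = refl
p2≡^ (suc m) = cong₂ ℕ._+_ (p2≡^ m) (trans (p2≡^ m) (sym (ℕP.+-identityʳ _)))

p2-suc : ∀ m → ∃ λ n → p2 m ≡ suc n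
p2-suc zero = 0 , refl
p2-suc (suc m) with p2-suc m
... | n , e = n ℕ.+ p2 m , cong (ℕ._+ p2 m) e

-- Each dyadic block adds at most 1.
harm-p2 : ∀ m → harm (p2 m) ℚ.≤ nat (suc m)
harm-p2 zero = ℚP.≤-trans (≤-+ (ℚP.≤-refl {0ℚ}) (inv≤1 0)) (ℚP.≤-reflexive (+-comm 0ℚ 1ℚ))
harm-p2 (suc m) = ℚP.≤-trans (ℚP.≤-reflexive (solve 2 (λ a b → a := (a :+ :- b) :+ b) refl (harm (p2 m ℕ.+ p2 m)) (harm (p2 m)))) (≤-+ (≪⇒≤ step) (harm-p2 m))
  where
  k : ℕ
  k = p2 m
  step : harm (k ℕ.+ k) + - harm k ≪ 1ℚ
  step = ≪-≤ (≪-divide k (PartialSums.drift inv harm (λ n → refl) 1ℚ (k ℕ.+ k) (λ n _ → ≪-≡ (trans (sym (inv-nat n)) (*-comm _ _)) (≪-self 0≤1)) 0≤1 k k ℕP.≤-refl))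
    (ℚP.≤-trans (≤-* (0≤inv k) ℚP.≤-refl (0≤-* (0≤nat k) 0≤1) (≤-* (0≤nat k) (nat-mono (ℕP.n≤1+n k)) 0≤1 ℚP.≤-refl))
      (ℚP.≤-reflexive (trans (inv k ⊠ *-identityʳ _) (inv-nat k))))

-- 3 + m bounds 2 + harm(2^m), so it serves as β at the sampling point 2^m.
base : ℕ → ℚ
base m = nat (3 ℕ.+ m)

harm≤base : ∀ m → two + harm (p2 m) ℚ.≤ base m
harm≤base m = ℚP.≤-trans (≤-+ (ℚP.≤-refl {two}) (harm-p2 m)) (ℚP.≤-reflexive (solve 1 (λ m → con 1ℚ :+ con 1ℚ :+ (con 1ℚ :+ m) := con 1ℚ :+ (con 1ℚ :+ (con 1ℚ :+ m))) refl (nat m)))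

two≤base : ∀ m → two ℚ.≤ base m
two≤base m = ℚP.≤-trans (ℚP.≤-reflexive (cong (1ℚ +_) (sym (+-identityʳ 1ℚ)))) (nat-mono {2} {3 ℕ.+ m} (s≤s (s≤s z≤n)))

-- polynomial growth of s · a in m; with n = 2^m, Null is O((log n)^k / n)
record Growth (s a : ℕ → ℚ) : Set where
  constructor growth
  field
    order : ℕ
    rate : ∀ m → s m * a m ≪ base m ↑ order

one sampled : ℕ → ℚ
one _ = 1ℚ
sampled m = nat (p2 m)

Tempered Null : (ℕ → ℚ) → Set
Tempered = Growth one
Null = Growth sampled

growth-cong : ∀ {s a b} → (∀ m → a m ≡ b m) → Growth s a → Growth s b
growth-cong e (growth k r) = growth k (λ m → ≪-≡ (cong (_ *_) (e m)) (r m))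

growth-zero : ∀ {s a} → (∀ m → a m ≡ 0ℚ) → Growth s a
growth-zero e = growth 0 (λ m → ≪-zero (*0 (e m)) 0≤1)

growth-+ : ∀ {s a b} → Growth s a → Growth s b → Growth s (λ m → a m + b m)
growth-+ {s} {a} {b} (growth k r) (growth l q) = growth (suc (k ℕ.+ l)) (λ m → ≪-≡ (sym (distribˡ (s m) (a m) (b m)))
  (≪-≤ (≪-+ (≪-≤ (r m) (↑-≤ (two≤base m) k l)) (≪-≤ (q m) (subst (λ j → base m ↑ l ℚ.≤ base m ↑ j) (ℕP.+-comm l k) (↑-≤ (two≤base m) l k)))) (double-≤ (two≤base m) (0≤↑ (two≤base m) (k ℕ.+ l)))))

growth-* : ∀ {s a b} → Growth s a → Tempered b → Growth s (λ m → a m * b m)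
growth-* {s} {a} {b} (growth k r) (growth l q) = growth (k ℕ.+ l) (λ m → ≪-≡ (solve 3 (λ s a b → (s :* a) :* (con 1ℚ :* b) := s :* (a :* b)) refl (s m) (a m) (b m))
  (≪-≤ (≪-* (r m) (q m)) (ℚP.≤-reflexive (sym (↑-+ (base m) k l)))))

nat≤base : ∀ m n → nat n ℚ.≤ base m ↑ n
nat≤base m zero = 0≤1
nat≤base m (suc n) = ℚP.≤-trans (≤-+ (1≤↑ (two≤base m) n) (nat≤base m n)) (double-≤ (two≤base m) (0≤↑ (two≤base m) n))

archimedean : ∀ c → ∃ λ n → c ≪ nat n
archimedean c@(ℚ.mkℚ z d-1 cop) = n , bounded (ℚP.toℚᵘ-cancel-≤ (ℚᵘP.≤-trans {j = ℚᵘ.mkℚᵘ (ℤ.+ n) 0} (ℚᵘ.*≤* (subst₂ ℤ._≤_ (ℤP.pos-* n 1) (ℤP.pos-* n (suc d-1))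
    (ℤ.+≤+ (ℕP.*-monoʳ-≤ n (s≤s (z≤n {d-1})))))) (ℚᵘP.≤-reflexive (ℚᵘP.≃-sym (nat-ℚᵘ n)))))
  where
  n : ℕ
  n = ℤ.∣ z ∣

tempered-constant : ∀ c → Tempered (λ _ → c)
tempered-constant c with archimedean c
... | n , p = growth n (λ m → ≪-≡ (sym (*-identityˡ c)) (≪-≤ p (nat≤base m n)))

growth-scale : ∀ {s a} c → Growth s a → Growth s (λ m → c * a m)
growth-scale {s} {a} c g = growth-cong (λ m → *-comm (a m) c) (growth-* g (tempered-constant c))

growth-neg : ∀ {s a} → Growth s a → Growth s (λ m → - a m)
growth-neg {s} {a} (growth k r) = growth k (λ m → ≪-≡ (solve 2 (λ s a → :- (s :* a) := s :* :- a) refl (s m) (a m)) (≪-neg (r m)))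

growth-minus : ∀ {s a b} → Growth s a → Growth s (λ m → a m + - b m) → Growth s b
growth-minus {s} {a} {b} g d = growth-cong (λ m → solve 2 (λ a b → a :+ :- (a :+ :- b) := b) refl (a m) (b m)) (growth-+ g (growth-neg d))

growth-ev : ∀ {B : Set} {s} (F : ℕ → B → ℚ) p → (∀ b → Growth s (λ m → F m b)) → Growth s (λ m → ev (F m) p)
growth-ev F [] g = growth-zero (λ _ → refl)
growth-ev F ((c , b) ∷ p) g = growth-+ (growth-scale c (g b)) (growth-ev F p g)

growth-sh : ∀ {s} (F : ℕ → Word → ℚ) u v → (∀ w → Growth s (λ m → F m w)) → Growth s (λ m → sh (F m) u v)
growth-sh F [] v g = g v
growth-sh F (a ∷ u) [] g = g (a ∷ u)
growth-sh F (a ∷ u) (b ∷ v) g = growth-+ (growth-+ (growth-sh _ u (b ∷ v) (λ w → g (a ∷ w))) (growth-sh _ (a ∷ u) v (λ w → g (b ∷ w)))) (growth-zero (λ _ → refl))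

growth-st : ∀ {s} (F : ℕ → List ℕ → ℚ) u v → (∀ w → Growth s (λ m → F m w)) → Growth s (λ m → st (F m) u v)
growth-st F [] v g = g v
growth-st F (a ∷ u) [] g = g (a ∷ u)
growth-st F (a ∷ u) (b ∷ v) g = growth-+ (growth-+ (growth-st _ u (b ∷ v) (λ w → g (a ∷ w))) (growth-st _ (a ∷ u) v (λ w → g (b ∷ w)))) (growth-st _ u v (λ w → g (suc (a ℕ.+ b) ∷ w)))

null-≱1 : ∀ {a} → Null a → ¬ (∀ m → 1ℚ ℚ.≤ a m)
null-≱1 {a} (growth k r) p with exponential-wins k
... | m , lt = nat-cancel-< lt (ℚP.≤-trans (ℚP.≤-reflexive (trans (cong nat (sym (p2≡^ m))) (sym (*-identityʳ _)))) (ℚP.≤-trans (≤-* (0≤nat (p2 m)) ℚP.≤-refl 0≤1 (p m))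
  (ℚP.≤-trans (≪⇒≤ (r m)) (ℚP.≤-reflexive (sym (nat-^ (3 ℕ.+ m) k))))))

-- Shuffle regularisation over ℚ: zeta values do not lie in R

ones : ℕ → Word
ones zero = []
ones (suc k) = x1 ∷ ones k

data Convergent : Word → Set where
  empty : Convergent []
  starts-x₀ : ∀ {t} → Convergent (x0 ∷ t)

sh-ones : ∀ G k → sh G (x1 ∷ []) (ones k) ≡ nat (suc k) * G (ones (suc k))
sh-ones G zero = solve 1 (λ x → x := (con 1ℚ :+ con 0ℚ) :* x) refl _
sh-ones G (suc k) = trans (+-identityʳ _) (trans (refl ⊞ sh-ones (λ w → G (x1 ∷ w)) k) (solve 2 (λ x n → x :+ n :* x := (con 1ℚ :+ n) :* x) refl _ _))

sh-exchange : ∀ F c a b → sh (λ x → sh F c x) a b ≡ sh (λ x → sh F a x) c b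
sh-exchange F c a b = trans (sym (Sh.st-assoc F c a b)) (trans (Sh.st-comm (λ x → sh F x b) c a) (Sh.st-assoc F a c b))

-- the shuffle algebra is spanned by the c ⧢ x₁^k with c convergent
null-on-products : ∀ (L : ℕ → Word → ℚ) → (∀ {c} k → Convergent c → Null (λ m → sh (L m) c (ones k))) → ∀ w → Null (λ m → L m w)
null-on-products L z [] = z 0 empty
null-on-products L z (x0 ∷ t) = z 0 starts-x₀
null-on-products L z (x1 ∷ w) = null-on-products (λ m w → L m (x1 ∷ w)) z′ w
  where
  z′ : ∀ {c} k → Convergent c → Null (λ m → sh (λ w → L m (x1 ∷ w)) c (ones k))
  z′ k empty = z (suc k) empty
  z′ k (starts-x₀ {t}) = growth-cong (λ m → solve 2 (λ a b → (a :+ b :+ con 0ℚ) :+ :- a := b) refl _ (sh (λ w → L m (x1 ∷ w)) (x0 ∷ t) (ones k)))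
    (growth-+ (z (suc k) (starts-x₀ {t})) (growth-neg (growth-sh (λ m w → L m (x0 ∷ w)) t (ones (suc k)) (λ w → z 0 (starts-x₀ {w})))))

-- Since x₁ ⧢ x₁^j = (j+1) x₁^{j+1}, a product c ⧢ x₁^k with k ≥ 1 is a rational multiple of x₁ ⧢ (c
-- ⧢ x₁^{k-1}).
null-modulo-x₁ : ∀ (L : ℕ → Word → ℚ) → (∀ {c} → Convergent c → Null (λ m → L m c)) → (∀ w → Null (λ m → sh (L m) (x1 ∷ []) w)) → ∀ w → Null (λ m → L m w)
null-modulo-x₁ L z k = null-on-products L products
  where
  products : ∀ {c} k → Convergent c → Null (λ m → sh (L m) c (ones k))
  products {c} zero p = growth-cong (λ m → sym (Sh.st-[] (L m) c)) (z p)
  products {c} (suc j) p = growth-cong (λ m → trans (inv j ⊠ trans (sym (sh-exchange (L m) c (x1 ∷ []) (ones j))) (sh-ones (sh (L m) c) j))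
      (trans (sym (*-assoc _ _ _)) (trans (cong (_* sh (L m) c (ones (suc j))) (inv-nat j)) (*-identityˡ _))))
    (growth-scale (inv j) (growth-sh (λ m x → sh (L m) (x1 ∷ []) x) c (ones j) k))

-- shuffle regularisation: x₁^r x₀ w ↦ (-1)^r x₀ (x₁^r ⧢ w)
reg : ℕ → (Word → ℚ) → Word → ℚ
reg r F [] = δ₀ r * F []
reg r F (x0 ∷ w) = sgn r * sh (λ t → F (x0 ∷ t)) (ones r) w
reg r F (x1 ∷ w) = reg (suc r) F w

-- The induction through leading x₁ forces general r; at r = 0 the factor vanishes, so `reg 0` kills
-- every product with x₁.
reg-sh-x₁ : ∀ r F w → sh (reg r F) (x1 ∷ []) w ≡ - (nat r * reg (suc r) F w)
reg-sh-x₁ r F [] = solve 2 (λ r f → con 0ℚ :* f := :- (r :* (con 0ℚ :* f))) refl _ _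
reg-sh-x₁ r F (x0 ∷ t) = trans (+-identityʳ _) (trans
  (cong (_* sh F₀ (ones (suc r)) t) (neg-def (sgn r)) ⊞ trans (hom (Sh.st-linear (x1 ∷ []) t) (sgn r) (sh F₀ (ones r))) (sgn r ⊠ trans (sym (Sh.st-assoc F₀ (ones r) (x1 ∷ []) t))
    (trans (Sh.st-comm (λ x → sh F₀ x t) (ones r) (x1 ∷ [])) (sh-ones (λ x → sh F₀ x t) r))))
  (trans (solve 3 (λ s x r → :- s :* x :+ s :* ((con 1ℚ :+ r) :* x) := :- (r :* (:- s :* x))) refl _ _ _) (cong (λ s → - (nat r * (s * sh F₀ (ones (suc r)) t))) (sym (neg-def (sgn r))))))
  where
  F₀ : Word → ℚ
  F₀ t = F (x0 ∷ t)
reg-sh-x₁ r F (x1 ∷ t) = trans (+-identityʳ _) (trans (refl ⊞ reg-sh-x₁ (suc r) F t) (solve 2 (λ x r → x :+ :- ((con 1ℚ :+ r) :* x) := :- (r :* x)) refl _ _))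

growth-reg : ∀ {s} r (F : ℕ → Word → ℚ) w → (∀ w → Growth s (λ m → F m w)) → Growth s (λ m → reg r (F m) w)
growth-reg r F [] g = growth-scale (δ₀ r) (g [])
growth-reg r F (x0 ∷ w) g = growth-scale (sgn r) (growth-sh (λ m t → F m (x0 ∷ t)) (ones r) w (λ t → g (x0 ∷ t)))
growth-reg r F (x1 ∷ w) g = growth-reg (suc r) F w g

H-tempered : ∀ w → Tempered (λ m → H (p2 m) w)
H-tempered w = growth (suc (length w)) (λ m → ≪-≡ (sym (*-identityˡ _)) (Bounds.H-tempered (p2 m) (base m) (harm≤base m) w))

-- shuffle-regularised truncated multiple zeta values at level 2^m
ζr : ℕ → Word → ℚ
ζr m = reg 0 (H (p2 m))

ζr-tempered : ∀ w → Tempered (λ m → ζr m w)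
ζr-tempered w = growth-reg 0 (λ m → H (p2 m)) w H-tempered

ζr-convergent : ∀ m {c} → Convergent c → ζr m c ≡ H (p2 m) c
ζr-convergent m empty = *-identityˡ _
ζr-convergent m starts-x₀ = *-identityˡ _

ζr-[] : ∀ m → ζr m [] ≡ 1ℚ
ζr-[] m = trans (ζr-convergent m empty) (H-[] (p2 m))

ζr-x₁ : ∀ m w → sh (ζr m) (x1 ∷ []) w ≡ 0ℚ
ζr-x₁ m w = trans (reg-sh-x₁ 0 (H (p2 m)) w) (trans (cong -_ (zeroˡ _)) neg0)

ζr-ones : ∀ m c k → sh (ζr m) c (ones (suc k)) ≡ 0ℚ
ζr-ones m c k = nat-cancel k (trans (sym (sh-ones (sh (ζr m) c) k)) (trans (sh-exchange (ζr m) c (x1 ∷ []) (ones k)) (zero-lin (Sh.st-linear c (ones k)) (ζr-x₁ m))))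

private
  Δ⧢ : ℕ → Word → Word → ℚ
  Δ⧢ m u v = ζr m u * ζr m v + - sh (ζr m) u v

  Δ⧢-[] : ∀ m v → Δ⧢ m [] v ≡ 0ℚ
  Δ⧢-[] m v = trans (cong (λ x → x * ζr m v + - ζr m v) (ζr-[] m)) (solve 1 (λ x → con 1ℚ :* x :+ :- x := con 0ℚ) refl _)

  Δ⧢-comm : ∀ m u v → Δ⧢ m u v ≡ Δ⧢ m v u
  Δ⧢-comm m u v = *-comm _ _ ⊞ cong -_ (Sh.st-comm (ζr m) u v)

  Δ⧢-x₁ : ∀ m u w → sh (Δ⧢ m u) (x1 ∷ []) w ≡ 0ℚ
  Δ⧢-x₁ m u w = trans (add (Sh.st-linear (x1 ∷ []) w) (λ v → ζr m u * ζr m v) (λ v → - sh (ζr m) u v))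
    (0+0 (trans (hom (Sh.st-linear (x1 ∷ []) w) (ζr m u) (ζr m)) (*0 (ζr-x₁ m w)))
         (trans (neg-lin (Sh.st-linear (x1 ∷ []) w) (sh (ζr m) u)) (trans (cong -_ (trans (sh-exchange (ζr m) u (x1 ∷ []) w) (zero-lin (Sh.st-linear u w) (ζr-x₁ m)))) neg0)))

  Δ⧢-convergent : ∀ {u v} → Convergent u → Convergent v → Null (λ m → Δ⧢ m u v)
  Δ⧢-convergent {v = v} empty _ = growth-zero (λ m → Δ⧢-[] m v)
  Δ⧢-convergent (starts-x₀ {t}) empty = growth-zero (λ m → trans (Δ⧢-comm m (x0 ∷ t) []) (Δ⧢-[] m (x0 ∷ t)))
  Δ⧢-convergent (starts-x₀ {t}) (starts-x₀ {s}) = growth-cong (λ m → cong₂ _*_ (sym (ζr-convergent m starts-x₀)) (sym (ζr-convergent m starts-x₀))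
      ⊞ cong -_ (Sh.st-cong (λ w → sym (*-identityˡ (H (p2 m) (x0 ∷ w)))) t (x0 ∷ s) ⊞ Sh.st-cong (λ w → sym (*-identityˡ (H (p2 m) (x0 ∷ w)))) (x0 ∷ t) s ⊞ refl))
    (growth (suc (length t) ℕ.+ (suc (length s) ℕ.+ 2)) (λ m → defect-bound (p2 m) (base m) (harm≤base m) t (x0 ∷ s)))

-- The defect vanishes exactly when either argument is a product with x₁. So both arguments may be
-- taken convergent, where the regularisation is `H` itself and `defect-bound` applies.
ζr-shuffle : ∀ u v → Null (λ m → ζr m u * ζr m v + - sh (ζr m) u v)
ζr-shuffle u v = null-modulo-x₁ (λ m u → Δ⧢ m u v)
  (λ {c} p → null-modulo-x₁ (λ m v → Δ⧢ m c v) (λ q → Δ⧢-convergent p q) (λ w → growth-zero (λ m → Δ⧢-x₁ m c w)) v)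
  (λ w → growth-zero (λ m → trans (Sh.st-cong (λ u → Δ⧢-comm m u v) (x1 ∷ []) w) (Δ⧢-x₁ m v w))) u

-- if e k are the values at x₁^k, the values of F follow from its regularisation G
restore : (ℕ → ℚ) → (Word → ℚ) → Word → ℚ
restore e G [] = G [] * e 0
restore e G (x0 ∷ w) = G (x0 ∷ w) * e 0
restore e G (x1 ∷ w) = G (x1 ∷ w) * e 0 + restore (λ k → e (suc k)) G w

-- G kills c ⧢ x₁^{k+1}, so only the terms in which all of x₁^k stands in front, read by `e`,
-- survive.
restore-sh : ∀ G → (∀ c k → sh G c (ones (suc k)) ≡ 0ℚ) → ∀ {c} → Convergent c → ∀ e k → sh (restore e G) c (ones k) ≡ G c * e k
restore-sh G z empty e zero = refl
restore-sh G z empty e (suc k) = trans (0+ (0* (z [] k))) (restore-sh G z empty (λ k → e (suc k)) k)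
restore-sh G z (starts-x₀ {t}) e zero = refl
restore-sh G z (starts-x₀ {t}) e (suc k) = trans (+-identityʳ _) (lin
  (restore-sh G z (starts-x₀ {t}) (λ k → e (suc k)) k ⊞ pull t (ones (suc k)) (λ w → G (x0 ∷ w)) ⊞ pull (x0 ∷ t) (ones k) (λ w → G (x1 ∷ w))
    ⊞ add (Sh.st-linear (x0 ∷ t) (ones k)) (λ w → G (x1 ∷ w) * e 0) (restore (λ k → e (suc k)) G) ⊞ cong (_* e 0) (z (x0 ∷ t) k))
  (solve 8 (λ a b c d g x y e₀ → (a :+ b) :+ (g :+ x :* e₀ :+ y :* e₀ :+ (c :+ d) :+ con 0ℚ :* e₀) := g :+ (d :+ a :+ c :+ b :+ (x :+ y :+ con 0ℚ) :* e₀)) refl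
    _ _ _ _ _ _ _ _))
  where
  pull : ∀ u v F → sh (λ w → F w * e 0) u v ≡ sh F u v * e 0
  pull u v F = trans (Sh.st-cong (λ w → *-comm (F w) (e 0)) u v) (trans (hom (Sh.st-linear u v) (e 0) F) (*-comm _ _))

divergence : ℕ → ℕ → ℚ
divergence m k = H (p2 m) (ones k)

-- Both functions agree up to null sequences on c ⧢ x₁^k: `H` by the defect bound, its restoration
-- by `restore-sh`.
H-restored : ∀ w → Null (λ m → H (p2 m) w + - restore (divergence m) (ζr m) w)
H-restored = null-on-products _ products
  where
  products : ∀ {c} k → Convergent c → Null (λ m → sh (λ w → H (p2 m) w + - restore (divergence m) (ζr m) w) c (ones k))
  products {c} k p = growth-cong (λ m → sym (trans (add (Sh.st-linear c (ones k)) (H (p2 m)) (λ w → - restore (divergence m) (ζr m) w))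
      (refl ⊞ trans (neg-lin (Sh.st-linear c (ones k)) (restore (divergence m) (ζr m))) (cong -_ (trans (restore-sh (ζr m) (ζr-ones m) p (divergence m) k) (cong (_* divergence m k) (ζr-convergent m p)))))))
    (go p)
    where
    go : ∀ {c} → Convergent c → Null (λ m → sh (H (p2 m)) c (ones k) + - (H (p2 m) c * divergence m k))
    go empty = growth-zero (λ m → trans (cong (λ x → divergence m k + - (x * divergence m k)) (H-[] (p2 m))) (solve 1 (λ x → x :+ :- (con 1ℚ :* x) := con 0ℚ) refl _))
    go (starts-x₀ {t}) = growth-cong (λ m → solve 2 (λ a b → :- (a :+ :- b) := b :+ :- a) refl (H (p2 m) (x0 ∷ t) * divergence m k) (sh (H (p2 m)) (x0 ∷ t) (ones k)))
      (growth-neg (growth (suc (length t) ℕ.+ (length (ones k) ℕ.+ 2)) (λ m → defect-bound (p2 m) (base m) (harm≤base m) t (ones k))))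

restoreʸ : (ℕ → ℚ) → (List ℕ → ℚ) → List ℕ → ℚ
restoreʸ e G [] = G [] * e 0
restoreʸ e G (zero ∷ w) = G (zero ∷ w) * e 0 + restoreʸ (λ k → e (suc k)) G w
restoreʸ e G (suc m ∷ w) = G (suc m ∷ w) * e 0

restore-ι : ∀ e G w → restore e G (ι w) ≡ restoreʸ e (λ w → G (ι w)) w
restore-ι e G [] = refl
restore-ι e G (zero ∷ w) = refl ⊞ restore-ι (λ k → e (suc k)) G w
restore-ι e G (suc m ∷ w) = refl

restoreʸ-linear : ∀ e w → IsLinear (λ G → restoreʸ e G w)
restoreʸ-linear e w = record { cong-lin = λ q → congruence e q w ; add = λ f g → additive e f g w ; hom = λ k f → homogeneous e k f w }
  where
  congruence : ∀ e {f g} → (∀ w → f w ≡ g w) → ∀ w → restoreʸ e f w ≡ restoreʸ e g w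
  congruence e q [] = cong (_* e 0) (q [])
  congruence e q (zero ∷ w) = cong (_* e 0) (q (zero ∷ w)) ⊞ congruence _ q w
  congruence e q (suc m ∷ w) = cong (_* e 0) (q (suc m ∷ w))
  additive : ∀ e f g w → restoreʸ e (λ w → f w + g w) w ≡ restoreʸ e f w + restoreʸ e g w
  additive e f g [] = distribʳ _ _ _
  additive e f g (zero ∷ w) = trans (distribʳ _ _ _ ⊞ additive _ f g w) (+-swap _ _ _ _)
  additive e f g (suc m ∷ w) = distribʳ _ _ _
  homogeneous : ∀ e k f w → restoreʸ e (λ w → k * f w) w ≡ k * restoreʸ e f w
  homogeneous e k f [] = *-assoc _ _ _
  homogeneous e k f (zero ∷ w) = trans (*-assoc _ _ _ ⊞ homogeneous _ k f w) (sym (distribˡ _ _ _))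
  homogeneous e k f (suc m ∷ w) = *-assoc _ _ _

-- A nonempty u starts with y_n, n ≥ 2, so the leading y₁ that `e` reads off in u ∗ v can only come
-- from v.
restoreʸ-st : ∀ G {u} → In𝔥⁰′ u → ∀ e v → st (restoreʸ e G) u v ≡ restoreʸ e (st G u) v
restoreʸ-st G nil e v = refl
restoreʸ-st G (cons {m} {u}) e [] = refl
restoreʸ-st G (cons {m} {u}) e (suc k ∷ v) = trans (pull u (suc k ∷ v) (λ w → G (suc m ∷ w)) ⊞ pull (suc m ∷ u) v (λ w → G (suc k ∷ w)) ⊞ pull u v (λ w → G (suc (suc m ℕ.+ suc k) ∷ w)))
  (solve 4 (λ a b c e → a :* e :+ b :* e :+ c :* e := (a :+ b :+ c) :* e) refl _ _ _ _)
  where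
  pull : ∀ u v F → st (λ w → F w * e 0) u v ≡ st F u v * e 0
  pull u v F = trans (St.st-cong (λ w → *-comm (F w) (e 0)) u v) (trans (hom (St.st-linear u v) (e 0) F) (*-comm _ _))
restoreʸ-st G (cons {m} {u}) e (zero ∷ v) = lin
  (pull u (zero ∷ v) (λ w → G (suc m ∷ w)) ⊞ (trans (add (St.st-linear (suc m ∷ u) v) (λ w → G (zero ∷ w) * e 0) (restoreʸ (λ k → e (suc k)) G)) (pull (suc m ∷ u) v (λ w → G (zero ∷ w)) ⊞ restoreʸ-st G (cons {m} {u}) (λ k → e (suc k)) v))
    ⊞ pull u v (λ w → G (suc (suc m ℕ.+ zero) ∷ w)))
  (solve 8 (λ a b c x y z e r → (a :+ b :+ c) :+ (x :* e :+ (y :* e :+ r) :+ z :* e) := ((x :+ y :+ z) :* e :+ r) :+ (a :+ b :+ c)) refl _ _ _ _ _ _ _ _)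
  where
  pull : ∀ u v F → st (λ w → F w * e 0) u v ≡ st F u v * e 0
  pull u v F = trans (St.st-cong (λ w → *-comm (F w) (e 0)) u v) (trans (hom (St.st-linear u v) (e 0) F) (*-comm _ _))

-- Restoration is unitriangular in the number of leading y₁, with tempered entries, hence invertible
-- modulo null sequences. The second component ranges over all weights because each stripped y₁
-- shifts them.
null-restoreʸ : ∀ (e : ℕ → ℕ → ℚ) (T : ℕ → List ℕ → ℚ) → (∀ k → Tempered (λ m → e m k)) → (∀ m → e m 0 ≡ 1ℚ) →
  (∀ v → Null (λ m → restoreʸ (e m) (T m) v)) → ∀ v → Null (λ m → T m v)
null-restoreʸ e T t e₀ z v = proj₁ (go v)
  where
  leading₁ : ∀ v → Null (λ m → T m v * e m 0) → Null (λ m → T m v)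
  leading₁ v = growth-cong (λ m → trans (cong (T m v *_) (e₀ m)) (*-identityʳ _))
  go : ∀ v → Null (λ m → T m v) × (∀ (e : ℕ → ℕ → ℚ) → (∀ k → Tempered (λ m → e m k)) → Null (λ m → restoreʸ (e m) (T m) v))
  go [] = leading₁ [] (z []) , λ e t → growth-* (leading₁ [] (z [])) (t 0)
  go (suc k ∷ v) = leading₁ (suc k ∷ v) (z (suc k ∷ v)) , λ e t → growth-* (leading₁ (suc k ∷ v) (z (suc k ∷ v))) (t 0)
  go (zero ∷ v) = first , λ e t → growth-+ (growth-* first (t 0)) (rest e t)
    where
    rest : ∀ (e : ℕ → ℕ → ℚ) → (∀ k → Tempered (λ m → e m k)) → Null (λ m → restoreʸ (λ k → e m (suc k)) (T m) v)
    rest e t = proj₂ (go v) (λ m k → e m (suc k)) (λ k → t (suc k))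
    first : Null (λ m → T m (zero ∷ v))
    first = leading₁ (zero ∷ v) (growth-cong (λ m → solve 2 (λ a b → (a :+ b) :+ :- b := a) refl (T m (zero ∷ v) * e m 0) _) (growth-+ (z (zero ∷ v)) (growth-neg (rest e t))))

convergent-ι : ∀ {u} → In𝔥⁰′ u → Convergent (ι u)
convergent-ι nil = empty
convergent-ι cons = starts-x₀

-- `H` obeys the stuffle product exactly. Its values are restorations of the regularised ones with
-- the same divergent weights on both sides of the relation, because u converges; inverting the
-- restoration transfers the relation to `ζr`.
ζr-stuffle : ∀ {u} → In𝔥⁰′ u → ∀ v → Null (λ m → ζr m (ι u) * ζr m (ι v) + - st (λ w → ζr m (ι w)) u v)
ζr-stuffle {u} p = null-restoreʸ divergence (λ m v → ζr m (ι u) * ζr m (ι v) + - st (λ w → ζr m (ι w)) u v) (λ k → H-tempered (ones k)) (λ m → H-[] (p2 m)) restored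
  where
  restored : ∀ v → Null (λ m → restoreʸ (divergence m) (λ v → ζr m (ι u) * ζr m (ι v) + - st (λ w → ζr m (ι w)) u v) v)
  restored v = growth-cong expand (growth-+ (growth-neg (growth-* (H-restored (ι v)) (H-tempered (ι u))))
      (growth-st (λ m w → H (p2 m) (ι w) + - restore (divergence m) (ζr m) (ι w)) u v (λ w → H-restored (ι w))))
    where
    expand : ∀ m → - ((H (p2 m) (ι v) + - restore (divergence m) (ζr m) (ι v)) * H (p2 m) (ι u)) + st (λ w → H (p2 m) (ι w) + - restore (divergence m) (ζr m) (ι w)) u v
      ≡ restoreʸ (divergence m) (λ v → ζr m (ι u) * ζr m (ι v) + - st (λ w → ζr m (ι w)) u v) v
    expand m = lin
      ((trans (add (St.st-linear u v) (λ w → H (p2 m) (ι w)) (λ w → - restore (divergence m) (ζr m) (ι w))) (stuffle (p2 m) u v ⊞ trans (neg-lin (St.st-linear u v) (λ w → restore (divergence m) (ζr m) (ι w)))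
          (cong -_ (trans (St.st-cong (restore-ι (divergence m) (ζr m)) u v) (restoreʸ-st (λ w → ζr m (ι w)) p (divergence m) v)))))
       ⊞ sym (trans (add (restoreʸ-linear (divergence m) v) (λ v → ζr m (ι u) * ζr m (ι v)) (λ v → - st (λ w → ζr m (ι w)) u v))
          (trans (hom (restoreʸ-linear (divergence m) v) (ζr m (ι u)) (λ v → ζr m (ι v))) (cong₂ _*_ (ζr-convergent m (convergent-ι p)) (sym (restore-ι (divergence m) (ζr m) v)))
           ⊞ neg-lin (restoreʸ-linear (divergence m) v) (st (λ w → ζr m (ι w)) u))))
      (solve 6 (λ hv r hu s b t → (:- ((hv :+ :- r) :* hu) :+ s) :+ ((hu :* hv :+ :- t) :+ b) := b :+ (s :+ (hu :* r :+ :- t))) refl _ _ _ _ _ _)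

-- Modulo null sequences `ζr` is a character with tempered values, so the ideal inherits nullity
-- from its generators.
R-null : ∀ {f} → IR.I f → Null (λ m → ev (ζr m) f)
R-null = IR.I-elim (λ f → Null (λ m → ev (ζr m) f)) (λ e → growth-cong (λ m → at e (ζr m))) (growth-zero (λ _ → refl))
  (λ {f} {g} p q → growth-cong (λ m → sym (ev-++ (ζr m) f g)) (growth-+ p q))
  (λ p i → growth-cong (λ m → sym (ev-shP (ζr m) p (rgen i))) (growth-ev (λ m u → ev (λ v → sh (ζr m) u v) (rgen i)) p (λ u → product u i)))
  where
  H-x₀ : ∀ n → H n (x0 ∷ []) ≡ 0ℚ
  H-x₀ zero = refl
  H-x₀ (suc n) = 0+0 (H-x₀ n) (solve 2 (λ i g → i :* (con 1ℚ :* con 0ℚ :+ :- (con 1ℚ :* con 0ℚ) :+ con 0ℚ :* g) := con 0ℚ) refl (inv n) (H n []))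
  gen : ∀ i → Null (λ m → ev (ζr m) (rgen i))
  gen gx0 = growth-zero (λ m → trans (ev-single (ζr m) (x0 ∷ [])) (trans (*-identityˡ _) (H-x₀ (p2 m))))
  gen gx1 = growth-zero (λ m → trans (ev-single (ζr m) (x1 ∷ [])) (zeroˡ _))
  gen (gds u v hu hv) with from-𝔥⁰ hu | from-𝔥¹ hv
  ... | a , p , refl | b , refl = growth-cong (λ m → sym (trans (ev-rel (ζr m) (ι a) (ι b)) (trans (cong₂ (λ x y → sh (ζr m) (ι a) (ι b) + - st (λ w → ζr m (ι w)) x y) (ιinv-ι a) (ιinv-ι b))
      (solve 3 (λ s t z → s :+ :- t := (z :+ :- t) :+ :- (z :+ :- s)) refl _ _ (ζr m (ι a) * ζr m (ι b))))))
    (growth-+ (ζr-stuffle p b) (growth-neg (ζr-shuffle (ι a) (ι b))))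
  product : ∀ u i → Null (λ m → ev (λ v → sh (ζr m) u v) (rgen i))
  product u i = growth-minus {a = λ m → ζr m u * ev (ζr m) (rgen i)} (growth-cong (λ m → *-comm _ _) (growth-* (gen i) (ζr-tempered u)))
    (growth-cong (λ m → trans (ev-+ (λ v → ζr m u * ζr m v) (λ v → - sh (ζr m) u v) (rgen i)) (ev-* (ζr m u) (ζr m) (rgen i) ⊞ ev-neg (sh (ζr m) u) (rgen i)))
      (growth-ev (λ m v → ζr m u * ζr m v + - sh (ζr m) u v) (rgen i) (λ v → ζr-shuffle u v)))

zeta∉R : ∀ k → ¬ IR.I (word (y (suc k)))
zeta∉R k r = null-≱1 (R-null r) (λ m → ℚP.≤-trans (large m) (ℚP.≤-reflexive (sym (trans (ev-single (ζr m) (y (suc k))) (ζr-convergent m starts-x₀)))))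
  where
  inv-0 : inv 0 ≡ 1ℚ
  inv-0 = trans (sym (*-identityʳ _)) (trans (inv 0 ⊠ sym (+-identityʳ 1ℚ)) (inv-nat 0))
  ipow-0 : ∀ j → ipow 0 j ≡ 1ℚ
  ipow-0 zero = inv-0
  ipow-0 (suc j) = trans (cong₂ _*_ inv-0 (ipow-0 j)) (*-identityˡ 1ℚ)
  0≤ipow : ∀ n j → 0ℚ ℚ.≤ ipow n j
  0≤ipow n zero = 0≤inv n
  0≤ipow n (suc j) = 0≤-* (0≤inv n) (0≤ipow n j)
  1≤H : ∀ n → 1ℚ ℚ.≤ H (suc n) (y (suc k))
  1≤H zero = ℚP.≤-reflexive (sym (trans (+-identityˡ _) (trans (h-blk 0 (suc k) []) (trans (*-identityʳ _) (ipow-0 (suc k))))))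
  1≤H (suc n) = ℚP.≤-trans (ℚP.≤-reflexive (sym (+-identityʳ 1ℚ))) (≤-+ (1≤H n) (subst (0ℚ ℚ.≤_) (sym (trans (h-blk (suc n) (suc k) []) (trans (cong (ipow (suc n) (suc k) *_) (H-[] (suc n))) (*-identityʳ _)))) (0≤ipow (suc n) (suc k))))
  large : ∀ m → 1ℚ ℚ.≤ H (p2 m) (y (suc k))
  large m with p2-suc m
  ... | n , e = subst (λ j → 1ℚ ℚ.≤ H j (y (suc k))) (sym e) (1≤H n)

-- Double shuffle elements as linear forms on indecomposables

counit-rgen : ∀ i → ev counit (rgen i) ≡ 0ℚ
counit-rgen gx0 = ev-single counit (x0 ∷ [])
counit-rgen gx1 = ev-single counit (x1 ∷ [])
counit-rgen (gds u v hu hv) with from-𝔥⁰ hu | from-𝔥¹ hv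
... | a , p , refl | b , refl =
  trans (ev-rel counit (ι a) (ι b)) (trans (cong₂ (λ x y → sh counit (ι a) (ι b) + - st (λ w → counit (ι w)) x y) (ιinv-ι a) (ιinv-ι b))
    (trans (cong₂ (λ x y → x + - y) (sh-counit (ι a) (ι b)) (stuffle 0 a b)) (-‿inverseʳ _)))

module _ {Ψ : Word → ℚ} (ds : DoubleShuffle Ψ) where
  open DoubleShuffle ds

  private
    module GP = GoncharovPairing Ψ kills

  -- An infinitesimal character kills an ideal as soon as it and the counit kill the generators.
  doubleShuffle-R : ∀ {f} → IR.I f → ev Ψ f ≡ 0ℚ
  doubleShuffle-R = IR.I-elim (λ f → ev Ψ f ≡ 0ℚ) (λ e p → trans (sym (at e Ψ)) p) refl (λ {f} {g} p q → trans (ev-++ Ψ f g) (0+0 p q))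
    (λ p i → trans (GP.ev-shP-infinitesimal p (rgen i)) (0+0 (*0 (counit-rgen i)) (*0 (gen i))))
    where
    stuffle-zero : ∀ {a} → In𝔥⁰′ a → ∀ b → sh Ψ (ι a) (ι b) + - st (λ w → Ψ (ι w)) a b ≡ 0ℚ
    stuffle-zero nil b = -‿inverseʳ _
    stuffle-zero (cons {m} {u}) [] = -‿inverseʳ (Ψ (ι (suc m ∷ u)))
    stuffle-zero (cons {m} {u}) (b ∷ v) = 0+0 (Sh.kills-≢ Ψ kills (ι (suc m ∷ u)) (ι (b ∷ v)) (λ ()) (blk≢[] b (ι v)))
      (trans (cong -_ (trans (sym (+0 (st-pos (corr (correction Ψ)) (suc m ∷ u) (b ∷ v) (λ w → corr-pos (correction Ψ)) here)))
        (trans (sym (add (St.st-linear (suc m ∷ u) (b ∷ v)) (λ w → Ψ (ι w)) (corr (correction Ψ)))) (P₀-st (suc m) u b v)))) neg0)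
    gen : ∀ i → ev Ψ (rgen i) ≡ 0ℚ
    gen gx0 = trans (ev-single Ψ (x0 ∷ [])) Ψ-x₀
    gen gx1 = trans (ev-single Ψ (x1 ∷ [])) Ψ-x₁
    gen (gds u v hu hv) with from-𝔥⁰ hu | from-𝔥¹ hv
    ... | a , p , refl | b , refl =
      trans (ev-rel Ψ (ι a) (ι b)) (trans (cong₂ (λ x y → sh Ψ (ι a) (ι b) + - st (λ w → Ψ (ι w)) x y) (ιinv-ι a) (ιinv-ι b)) (stuffle-zero p b))

  doubleShuffle-K : ∀ {f} → IK.I f → ev Ψ f ≡ 0ℚ
  doubleShuffle-K = IK.I-elim (λ f → ev Ψ f ≡ 0ℚ) (λ e p → trans (sym (at e Ψ)) p) refl (λ {f} {g} p q → trans (ev-++ Ψ f g) (0+0 p q))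
    (λ p i → trans (GP.ev-shP-infinitesimal p (kgen i)) (0+0 (*0 (proj₁ (gen i))) (*0 (proj₂ (gen i)))))
    where
    gen : ∀ i → (ev counit (kgen i) ≡ 0ℚ) × (ev Ψ (kgen i) ≡ 0ℚ)
    gen (kR i) = counit-rgen i , doubleShuffle-R (IR.I-gen i)
    gen kζ2 = ev-single counit (x0 ∷ x1 ∷ []) , trans (ev-single Ψ (x0 ∷ x1 ∷ [])) Ψ-x₀x₁
    gen (kprod (a ∷ u) (b ∷ v) _ _) = trans (ev-shW counit (a ∷ u) (b ∷ v)) (trans (sh-counit (a ∷ u) (b ∷ v)) (zeroˡ _)) , trans (ev-shW Ψ (a ∷ u) (b ∷ v)) (proj₂ kills a u b v)

  doubleShuffle-pow : ∀ k → ev Ψ (pow (suc k)) ≡ 0ℚ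
  doubleShuffle-pow k = trans (GP.ev-shP-infinitesimal ζ₂ (pow k)) (0+0 (0* (trans (ev-single Ψ (x0 ∷ x1 ∷ [])) Ψ-x₀x₁)) (0* (ev-single counit (x0 ∷ x1 ∷ []))))

  doubleShuffle-≃ : ∀ {f g} → f ≃ g → ev Ψ f ≡ ev Ψ g
  doubleShuffle-≃ {f} {g} (congruent p) = lin (trans (sym (ev-⊖ Ψ f g)) (doubleShuffle-R p)) (solve 2 (λ a b → a :+ con 0ℚ := b :+ (a :+ :- b)) refl _ _)

  doubleShuffle-even : ∀ a → Ψ (y (suc (dbl a))) ≡ 0ℚ
  doubleShuffle-even a = trans (sym (ev-single Ψ (y (suc (dbl a))))) (trans (doubleShuffle-≃ (PositiveMultiple.equation (euler a)))
    (trans (ev-scale Ψ (PositiveMultiple.factor (euler a)) (pow (suc a))) (*0 (doubleShuffle-pow a))))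

parity : ∀ n → (∃ λ a → n ≡ dbl a) ⊎ (∃ λ a → n ≡ suc (dbl a))
parity zero = inj₁ (0 , refl)
parity (suc n) with parity n
... | inj₁ (a , e) = inj₂ (a , cong suc e)
... | inj₂ (a , e) = inj₁ (suc a , cong suc e)

doubleShuffle⇒admissible : ∀ {Ψ} N → Hom N Ψ → DoubleShuffle Ψ → Admissible Ψ
doubleShuffle⇒admissible {Ψ} N h ds = admissible N h ds (λ n → go n (suc n ℕ.≟ N))
  where
  zero-case : ∀ n → Ψ (y n) ≡ 0ℚ → - sgn N * Ψ (y n) ≡ Ψ (y n)
  zero-case n z = trans (*0 z) (sym z)
  go : ∀ n → Dec (suc n ≡ N) → - sgn N * Ψ (y n) ≡ Ψ (y n)
  go n (no ne) = zero-case n (h (y n) (λ e → ne (trans (sym (trans (length-blk n []) (ℕP.+-identityʳ (suc n)))) e)))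
  go n (yes refl) with parity n
  ... | inj₁ (a , refl) = trans (cong (λ s → - s * Ψ (y (dbl a))) (sgn-suc-dbl a)) (solve 1 (λ x → :- (:- con 1ℚ) :* x := x) refl _)
  ... | inj₂ (a , refl) = zero-case (suc (dbl a)) (doubleShuffle-even ds a)

-- Weights and derivations of the shuffle algebra modulo R

spl-zero-length : ∀ {A : Set} {G : List A → List A → ℚ} w → (∀ x y → length x ℕ.+ length y ≡ length w → G x y ≡ 0ℚ) → spl G w ≡ 0ℚ
spl-zero-length [] e = e [] [] refl
spl-zero-length (a ∷ w) e = 0+0 (e [] (a ∷ w) refl) (spl-zero-length w (λ x y l → e (a ∷ x) y (cong suc l)))

gaps-zero-length : ∀ {Ψ} k → Hom k Ψ → ∀ a F w → (∀ v → k ℕ.+ length v ≡ length w → F v ≡ 0ℚ) → gaps Ψ a F w ≡ 0ℚ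
gaps-zero-length {Ψ} k h a F w z = go a F w z
  where
  term : ∀ a (F : Word → ℚ) w → (∀ v → k ℕ.+ length v ≡ length w → F v ≡ 0ℚ) → ∀ p q → length p ℕ.+ length q ≡ length w → gap a q * Ψ p * F q ≡ 0ℚ
  term a F w z p q l with length p ℕ.≟ k
  ... | yes refl = *0 (z q l)
  ... | no ne = 0* (*0 (h p ne))
  go : ∀ a F w → (∀ v → k ℕ.+ length v ≡ length w → F v ≡ 0ℚ) → gaps Ψ a F w ≡ 0ℚ
  go a F [] z = term a F [] z [] [] refl
  go a F (b ∷ w) z = 0+0 (spl-zero-length (b ∷ w) (term a F (b ∷ w) z)) (go b (λ w → F (b ∷ w)) w (λ v l → z (b ∷ v) (trans (ℕP.+-suc k (length v)) (cong suc l))))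

D-vanishes : ∀ {Ψ} k → Hom k Ψ → ∀ {n} g → HomP n g → ∀ F → (∀ v → k ℕ.+ length v ≡ n → F v ≡ 0ℚ) → ev F (D Ψ g) ≡ 0ℚ
D-vanishes {Ψ} k h {n} g hg F z = trans (ev-linP F (gapsP Ψ x1) g) (hg _ (λ w l → trans (ev-gapsP F Ψ x1 w) (gaps-zero-length k h x1 F w (λ v e → z v (trans e l)))))

D-weight : ∀ {Ψ} k → Hom k Ψ → ∀ m g → HomP (k ℕ.+ m) g → HomP m (D Ψ g)
D-weight k h m g hg F z = D-vanishes k h g hg F (λ v l → z v (ℕP.+-cancelˡ-≡ k (length v) m l))

D-low : ∀ {Ψ} k → Hom k Ψ → ∀ {n} g → HomP n g → n < k → D Ψ g ~ []
D-low k h g hg lt = tested λ F → D-vanishes k h g hg F (λ v l → ⊥-elim (ℕP.<-irrefl refl (ℕP.<-≤-trans lt (subst (k ≤_) l (ℕP.m≤m+n k (length v))))))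

-- In its own weight Ψ can only be cut out of the whole word, which leaves a constant.
D-top : ∀ {Ψ} k → Hom k Ψ → Ψ [] ≡ 0ℚ → ∀ g → HomP k g → D Ψ g ~ scale (ev Ψ g) (word [])
D-top {Ψ} k h z g hg = tested λ F → trans (HomP-agree (D Ψ g) hD F (λ v → F [] * counit v) (λ { [] _ → sym (*-identityʳ _) }))
  (trans (ev-* (F []) counit (D Ψ g)) (trans (F [] ⊠ trans (ev-D counit Ψ g z) (ev-cong (λ w → trans (sX-scalar Ψ z 1ℚ w) (*-identityˡ _)) g))
    (trans (*-comm _ _) (sym (trans (ev-scale F (ev Ψ g) (word [])) (ev Ψ g ⊠ ev-single F []))))))
  where
  hD : HomP 0 (D Ψ g)
  hD = D-weight k h 0 g (subst (λ j → HomP j g) (sym (ℕP.+-identityʳ k)) hg)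

-- The property needed of the Euler-type operator: it acts modulo R and commutes with powers of
-- ζ(2). It passes from the D_ψ to their sums and shuffle multiples.
record Derivation (T : Poly → Poly) : Set where
  field
    T-~ : ∀ {f g} → f ~ g → T f ~ T g
    T-⊕ : ∀ f g → T (f ⊕ g) ~ T f ⊕ T g
    T-scale : ∀ c f → T (scale c f) ~ scale c (T f)
    T-shP : ∀ f g → T (shP f g) ~ shP (T f) g ⊕ shP f (T g)
    T-R : ∀ {f} → IR.I f → IR.I (T f)
    T-ζ₂ : T ζ₂ ~ []
    T-1 : T (word []) ~ []

D-derivation : ∀ {Ψ} → Admissible Ψ → Derivation (D Ψ)
D-derivation {Ψ} adm = record
  { T-~ = D-~ Ψ Ψ-[] ; T-⊕ = λ f g → D-⊕ Ψ f g Ψ-[] ; T-scale = λ c f → D-scale Ψ c f Ψ-[] ; T-shP = D-shP adm ; T-R = D-R adm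
  ; T-ζ₂ = on-word (x0 ∷ x1 ∷ []) (λ F → 0+0 (0+0 z[] (0+0 (0* (*0 Ψ-x₀)) (0* (*0 Ψ-x₀x₁)))) (0+0 (0+0 z[] (0* (*0 Ψ-x₁))) z[]))
  ; T-1 = on-word [] (λ F → z[]) }
  where
  open Admissible adm
  Ψ-[] : Ψ [] ≡ 0ℚ
  Ψ-[] = proj₁ kills
  z[] : ∀ {a b} → a * Ψ [] * b ≡ 0ℚ
  z[] = 0* (*0 Ψ-[])
  on-word : ∀ w → (∀ F → gaps Ψ x1 F w ≡ 0ℚ) → D Ψ (word w) ~ []
  on-word w z = tested λ F → trans (ev-linP F (gapsP Ψ x1) (word w)) (trans (ev-single (λ w → ev F (gapsP Ψ x1 w)) w) (trans (ev-gapsP F Ψ x1 w) (z F)))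

⊕-zero : ∀ {f g : Poly} → f ~ [] → g ~ [] → f ⊕ g ~ []
⊕-zero p q = ⊕-cong p q

derivation-zero : Derivation (λ _ → [])
derivation-zero = record
  { T-~ = λ _ → ~-refl ; T-⊕ = λ _ _ → ~-refl ; T-scale = λ _ _ → ~-refl ; T-shP = λ f g → ~-sym (shP-[]ʳ f)
  ; T-R = λ _ → IR.I-zero ~-refl ; T-ζ₂ = ~-refl ; T-1 = ~-refl }

derivation-⊕ : ∀ {T U} → Derivation T → Derivation U → Derivation (λ f → T f ⊕ U f)
derivation-⊕ {T} {U} t u = record
  { T-~ = λ e → ⊕-cong (T.T-~ e) (U.T-~ e)
  ; T-⊕ = λ f g → ~-trans (⊕-cong (T.T-⊕ f g) (U.T-⊕ f g)) (swap (T f) (T g) (U f) (U g))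
  ; T-scale = λ c f → ~-trans (⊕-cong (T.T-scale c f) (U.T-scale c f)) (tested λ F → trans (ev-++ F (scale c (T f)) (scale c (U f))) (trans (ev-scale F c (T f) ⊞ ev-scale F c (U f))
      (trans (sym (distribˡ _ _ _)) (trans (c ⊠ sym (ev-++ F (T f) (U f))) (sym (ev-scale F c (T f ⊕ U f)))))))
  ; T-shP = λ f g → ~-trans (⊕-cong (T.T-shP f g) (U.T-shP f g)) (~-trans (swap (shP (T f) g) (shP f (T g)) (shP (U f) g) (shP f (U g)))
      (⊕-cong (~-trans (⊕-cong (shP-comm (T f) g) (shP-comm (U f) g)) (~-trans (~-sym (shP-++ʳ g (T f) (U f))) (shP-comm g (T f ⊕ U f)))) (~-sym (shP-++ʳ f (T g) (U g)))))
  ; T-R = λ r → IR.I-⊕ (T.T-R r) (U.T-R r)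
  ; T-ζ₂ = ⊕-zero T.T-ζ₂ U.T-ζ₂ ; T-1 = ⊕-zero T.T-1 U.T-1 }
  where
  module T = Derivation t
  module U = Derivation u
  swap : ∀ a b c d → (a ⊕ b) ⊕ (c ⊕ d) ~ (a ⊕ c) ⊕ (b ⊕ d)
  swap a b c d = tested λ F → trans (ev-++ F (a ⊕ b) (c ⊕ d)) (trans (ev-++ F a b ⊞ ev-++ F c d) (trans (+-swap _ _ _ _) (sym (trans (ev-++ F (a ⊕ c) (b ⊕ d)) (ev-++ F a c ⊞ ev-++ F b d)))))

derivation-shP : ∀ a {T} → Derivation T → Derivation (λ f → shP a (T f))
derivation-shP a {T} t = record
  { T-~ = λ e → shP-cong (~-refl {p = a}) (T-~ e)
  ; T-⊕ = λ f g → ~-trans (shP-cong (~-refl {p = a}) (T-⊕ f g)) (shP-++ʳ a (T f) (T g))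
  ; T-scale = λ c f → ~-trans (shP-cong (~-refl {p = a}) (T-scale c f)) (shP-scaleʳ a c (T f))
  ; T-shP = λ f g → ~-trans (shP-cong (~-refl {p = a}) (T-shP f g)) (~-trans (shP-++ʳ a (shP (T f) g) (shP f (T g))) (⊕-cong (~-sym (shP-assoc a (T f) g))
      (~-trans (~-sym (shP-assoc a f (T g))) (~-trans (shP-cong (shP-comm a f) (~-refl {p = T g})) (shP-assoc f a (T g))))))
  ; T-R = λ r → IR.I-shP a (T-R r)
  ; T-ζ₂ = ~-trans (shP-cong (~-refl {p = a}) T-ζ₂) (shP-[]ʳ a) ; T-1 = ~-trans (shP-cong (~-refl {p = a}) T-1) (shP-[]ʳ a) }
  where open Derivation t

-- The operator that counts factors

module Span (n : ℕ) = LinearAlgebra n (KSpan n) k-~ (k-R (IR.I-zero ~-refl)) k-⊕ (λ c → k-scale c)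

DualPair : ℕ → Poly × Poly → Set
DualPair n (a , ψ) = HomP n a × Hom n (coeff ψ) × DoubleShuffle (coeff ψ)

opaque
  dualBasis : ℕ → List (Poly × Poly)
  dualBasis n = proj₁ (Span.dualBasis n (relations n) (relations-KSpan n))

  dualBasis-pairs : ∀ n → 1 ≤ n → All (DualPair n) (dualBasis n)
  dualBasis-pairs n 1≤n = All.map (λ { {a , ψ} (ha , hψ , ann) → ha , hψ , annihilator⇒doubleShuffle ψ 1≤n hψ ann }) (proj₁ (proj₂ (Span.dualBasis n (relations n) (relations-KSpan n))))

  dualBasis-spans : ∀ n g → HomP n g → KSpan n (g ⊖ project (dualBasis n) g)
  dualBasis-spans n = proj₂ (proj₂ (Span.dualBasis n (relations n) (relations-KSpan n)))

shP-++ˡ : ∀ f g h → shP (f ++ g) h ~ shP f h ++ shP g h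
shP-++ˡ f g h = ~-trans (shP-comm (f ++ g) h) (~-trans (shP-++ʳ h f g) (⊕-cong (shP-comm h f) (shP-comm h g)))

weave : List (Poly × Poly) → Poly → Poly
weave [] g = []
weave ((a , ψ) ∷ B) g = shP a (D (coeff ψ) g) ⊕ weave B g

weave-derivation : ∀ {n B} → All (DualPair n) B → Derivation (weave B)
weave-derivation [] = derivation-zero
weave-derivation {n} {(a , ψ) ∷ B} ((_ , h , ds) ∷ ps) = derivation-⊕ {λ g → shP a (D (coeff ψ) g)} {weave B} (derivation-shP a (D-derivation (doubleShuffle⇒admissible n h ds))) (weave-derivation ps)

k-zero : ∀ {n f} → f ~ [] → KSpan n f
k-zero e = k-R (IR.I-zero e)

-- A form of lower weight leaves a product of two elements of positive weight; a form of higher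
-- weight finds nothing to cut.
weave-off : ∀ {w n g B} → 1 ≤ w → 1 ≤ n → w ≢ n → HomP n g → All (DualPair w) B → KSpan n (weave B g)
weave-off 1≤w 1≤n ne hg [] = k-zero ~-refl
weave-off {w} {n} {g} {(a , ψ) ∷ B} 1≤w 1≤n ne hg ((ha , h , ds) ∷ ps) = k-⊕ (go (ℕP.<-cmp w n)) (weave-off 1≤w 1≤n ne hg ps)
  where
  go : Tri (w < n) (w ≡ n) (n < w) → KSpan n (shP a (D (coeff ψ) g))
  go (tri< lt _ _) = k-shP {p = a} {D (coeff ψ) g} ha (D-weight w h (n ℕ.∸ w) g (subst (λ j → HomP j g) (sym e) hg)) 1≤w (ℕP.m<n⇒0<n∸m lt) e
    where
    e : w ℕ.+ (n ℕ.∸ w) ≡ n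
    e = ℕP.m+[n∸m]≡n (ℕP.<⇒≤ lt)
  go (tri≈ _ e _) = ⊥-elim (ne e)
  go (tri> _ _ gt) = k-zero (~-trans (shP-cong (~-refl {p = a}) (D-low w h g hg gt)) (shP-[]ʳ a))

weave-on : ∀ {n B} g → HomP n g → All (DualPair n) B → weave B g ~ project B g
weave-on g hg [] = ~-refl
weave-on {n} {(a , ψ) ∷ B} g hg ((ha , h , ds) ∷ ps) = ⊕-cong (~-trans (shP-cong (~-refl {p = a}) (D-top n h (proj₁ (DoubleShuffle.kills ds)) g hg))
  (~-trans (shP-scaleʳ a (pair ψ g) (word [])) (scale-cong (pair ψ g) (shP-unitʳ a)))) (weave-on g hg ps)

-- sums a ⧢ D_ψ over dual bases; on a generator of weight ≤ N it is the identity modulo products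
grading : ℕ → Poly → Poly
grading zero g = []
grading (suc N) g = weave (dualBasis (suc N)) g ⊕ grading N g

grading-derivation : ∀ N → Derivation (grading N)
grading-derivation zero = derivation-zero
grading-derivation (suc N) = derivation-⊕ {weave (dualBasis (suc N))} {grading N} (weave-derivation (dualBasis-pairs (suc N) (s≤s z≤n))) (grading-derivation N)

-- In the weight of g the summand is the projection of the dual basis, which differs from g by an
-- element of `KSpan`; all other weights contribute to `KSpan` only.
grading-span : ∀ {n} g → HomP n g → 1 ≤ n → ∀ N → (n ≤ N → KSpan n (grading N g ⊖ g)) × (N < n → KSpan n (grading N g))
grading-span {n} g hg 1≤n zero = (λ le → ⊥-elim (ℕP.<-irrefl refl (ℕP.≤-trans 1≤n le))) , λ _ → k-zero ~-refl
grading-span {n} g hg 1≤n (suc N) = go (n ℕ.≟ suc N)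
  where
  new rest : Poly
  new = weave (dualBasis (suc N)) g
  rest = grading N g
  IH : (n ≤ N → KSpan n (rest ⊖ g)) × (N < n → KSpan n rest)
  IH = grading-span g hg 1≤n N
  off : suc N ≢ n → KSpan n new
  off ne = weave-off (s≤s z≤n) 1≤n ne hg (dualBasis-pairs (suc N) (s≤s z≤n))
  go : Dec (n ≡ suc N) → (n ≤ suc N → KSpan n ((new ⊕ rest) ⊖ g)) × (suc N < n → KSpan n (new ⊕ rest))
  go (no ne) = (λ le → k-~ (tested λ F → trans (ev-++ F new (rest ⊖ g)) (trans (refl ⊞ ev-⊖ F rest g) (trans (sym (+-assoc _ _ _)) (sym (trans (ev-⊖ F (new ⊕ rest) g) (ev-++ F new rest ⊞ refl))))))
      (k-⊕ (off (λ e → ne (sym e))) (proj₁ IH (ℕP.≤-pred (ℕP.≤∧≢⇒< le ne))))) ,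
    λ lt → k-⊕ (off (λ e → ne (sym e))) (proj₂ IH (ℕP.<-trans (ℕP.n<1+n N) lt))
  go (yes refl) = (λ _ → k-~ (tested λ F → trans (ev-++ F rest (scale (ℚ.- 1ℚ) (g ⊖ project (dualBasis (suc N)) g)))
        (trans (refl ⊞ trans (ev-scale F (ℚ.- 1ℚ) (g ⊖ project (dualBasis (suc N)) g)) (ℚ.- 1ℚ ⊠ ev-⊖ F g (project (dualBasis (suc N)) g)))
        (trans (solve 3 (λ r g p → r :+ con (ℚ.- 1ℚ) :* (g :+ :- p) := p :+ r :+ :- g) refl _ _ _)
        (sym (trans (ev-⊖ F (new ⊕ rest) g) (trans (ev-++ F new rest) (at (weave-on g hg (dualBasis-pairs (suc N) (s≤s z≤n))) F ⊞ refl) ⊞ refl))))))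
      (k-⊕ (proj₂ IH (ℕP.n<1+n N)) (k-scale (ℚ.- 1ℚ) (dualBasis-spans (suc N) g hg)))) ,
    λ lt → ⊥-elim (ℕP.<-irrefl refl lt)

-- The filtration by powers of ζ(2) and number of factors

data Product : ℕ → ℕ → Poly → Set where
  unit : Product 0 0 (word [])
  times : ∀ {n l w g p} → HomP n g → 1 ≤ n → Product l w p → Product (suc l) (n ℕ.+ w) (shP g p)

product-length : ∀ {l w p} → Product l w p → l ≤ w
product-length unit = z≤n
product-length (times _ le p) = ℕP.+-mono-≤ le (product-length p)

-- weight N, modulo R: spanned by ζ₂^j times l factors of positive weight with (j , l) ≥ (k , m) lexicographically
data Fil (N k m : ℕ) : Poly → Set where
  in-R : ∀ {f} → IR.I f → Fil N k m f
  term : ∀ {j l w p} → Product l w p → dbl j ℕ.+ w ≡ N → (k < j) ⊎ (k ≡ j × m ≤ l) → Fil N k m (shP (pow j) p)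
  fil-⊕ : ∀ {f g} → Fil N k m f → Fil N k m g → Fil N k m (f ⊕ g)
  fil-scale : ∀ c {f} → Fil N k m f → Fil N k m (scale c f)
  fil-~ : ∀ {f g} → f ~ g → Fil N k m f → Fil N k m g

fil-weaken : ∀ {N j l k m f} → (k < j) ⊎ (k ≡ j × m ≤ l) → Fil N j l f → Fil N k m f
fil-weaken o (in-R r) = in-R r
fil-weaken o (term {j} p e o′) = term {j = j} p e (order o o′)
  where
  order : ∀ {k m j l j′ l′} → (k < j) ⊎ (k ≡ j × m ≤ l) → (j < j′) ⊎ (j ≡ j′ × l ≤ l′) → (k < j′) ⊎ (k ≡ j′ × m ≤ l′)
  order (inj₁ a) (inj₁ b) = inj₁ (ℕP.<-trans a b)
  order (inj₁ a) (inj₂ (refl , _)) = inj₁ a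
  order (inj₂ (refl , _)) (inj₁ b) = inj₁ b
  order (inj₂ (refl , a)) (inj₂ (refl , b)) = inj₂ (refl , ℕP.≤-trans a b)
fil-weaken o (fil-⊕ f g) = fil-⊕ (fil-weaken o f) (fil-weaken o g)
fil-weaken o (fil-scale c f) = fil-scale c (fil-weaken o f)
fil-weaken o (fil-~ e f) = fil-~ e (fil-weaken o f)

shP-left-comm : ∀ f g h → shP f (shP g h) ~ shP g (shP f h)
shP-left-comm f g h = ~-trans (~-sym (shP-assoc f g h)) (~-trans (shP-cong (shP-comm f g) (~-refl {p = h})) (shP-assoc g f h))

fil-times : ∀ {N k m n f} g → HomP n g → 1 ≤ n → Fil N k m f → Fil (n ℕ.+ N) k (suc m) (shP g f)
fil-times g hg 1≤n (in-R r) = in-R (IR.I-shP g r)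
fil-times {n = n} g hg 1≤n (term {j} {l} {w} {p} q e o) = fil-~ (shP-left-comm (pow j) g p) (term {j = j} (times {g = g} {p} hg 1≤n q)
  (trans (trans (sym (ℕP.+-assoc (dbl j) n w)) (trans (cong (ℕ._+ w) (ℕP.+-comm (dbl j) n)) (ℕP.+-assoc n (dbl j) w))) (cong (n ℕ.+_) e)) (deeper o))
  where
  deeper : ∀ {k m j l} → (k < j) ⊎ (k ≡ j × m ≤ l) → (k < j) ⊎ (k ≡ j × suc m ≤ suc l)
  deeper (inj₁ a) = inj₁ a
  deeper (inj₂ (a , b)) = inj₂ (a , s≤s b)
fil-times g hg 1≤n (fil-⊕ {f} {f′} p q) = fil-~ (~-sym (shP-++ʳ g f f′)) (fil-⊕ (fil-times g hg 1≤n p) (fil-times g hg 1≤n q))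
fil-times g hg 1≤n (fil-scale c {f} p) = fil-~ (~-sym (shP-scaleʳ g c f)) (fil-scale c (fil-times g hg 1≤n p))
fil-times g hg 1≤n (fil-~ e p) = fil-~ (shP-cong (~-refl {p = g}) e) (fil-times g hg 1≤n p)

-- Replacing one factor by an element of the kernel moves up: ζ(2) raises the power, a product
-- raises the number of factors by one.
fil-KSpan : ∀ {n κ l w p N} j → KSpan n κ → Product l w p → dbl j ℕ.+ (n ℕ.+ w) ≡ N → Fil N j (suc (suc l)) (shP (pow j) (shP κ p))
fil-KSpan {p = p} j (k-R r) q e = in-R (IR.I-shP (pow j) (IR.I-shPˡ p r))
fil-KSpan {w = w} {p} j (k-ζ₂ refl) q e = fil-~ (~-trans (shP-assoc ζ₂ (pow j) p) (shP-left-comm ζ₂ (pow j) p))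
  (term {j = suc j} q (trans (sym (trans (ℕP.+-suc (dbl j) (suc w)) (cong suc (ℕP.+-suc (dbl j) w)))) e) (inj₁ ℕP.≤-refl))
fil-KSpan {w = w} {p} j (k-shP {a} {b} {f} {g} hf hg 1≤a 1≤b refl) q e = fil-~ (shP-cong (~-refl {p = pow j}) (~-sym (shP-assoc f g p)))
  (term {j = j} (times {g = f} {shP g p} hf 1≤a (times {g = g} {p} hg 1≤b q)) (trans (cong (dbl j ℕ.+_) (sym (ℕP.+-assoc a b w))) e) (inj₂ (refl , ℕP.≤-refl)))
fil-KSpan {p = p} j (k-⊕ {f} {g} x y) q e = fil-~ (~-trans (~-sym (shP-++ʳ (pow j) (shP f p) (shP g p))) (shP-cong (~-refl {p = pow j}) (~-sym (shP-++ˡ f g p))))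
  (fil-⊕ (fil-KSpan j x q e) (fil-KSpan j y q e))
fil-KSpan {p = p} j (k-scale c {f} x) q e = fil-~ (~-trans (~-sym (shP-scaleʳ (pow j) c (shP f p))) (shP-cong (~-refl {p = pow j}) (~-sym (shP-scaleˡ f c p)))) (fil-scale c (fil-KSpan j x q e))
fil-KSpan {p = p} j (k-~ x≈ x) q e = fil-~ (shP-cong (~-refl {p = pow j}) (shP-cong x≈ (~-refl {p = p}))) (fil-KSpan j x q e)

≃-pow : ℕ → Poly → Set
≃-pow k f = ∃ λ c → f ≃ scale c (pow k)

-- Factors have positive weight, so there cannot be more of them than the weight; only terms with a
-- higher power of ζ(2) are left.
fil-up : ∀ {N k m f} → N < m → Fil N k m f → Fil N (suc k) 0 f
fil-up lt (in-R r) = in-R r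
fil-up lt (term {j} p e (inj₁ a)) with ℕP.m≤n⇒m<n∨m≡n a
... | inj₁ b = term {j = j} p e (inj₁ b)
... | inj₂ b = term {j = j} p e (inj₂ (b , z≤n))
fil-up lt (term {j} {l} {w} p e (inj₂ (_ , le))) = ⊥-elim (ℕP.<-irrefl refl (ℕP.<-≤-trans lt (ℕP.≤-trans le (ℕP.≤-trans (product-length p) (ℕP.≤-trans (ℕP.m≤n+m w (dbl j)) (ℕP.≤-reflexive e))))))
fil-up lt (fil-⊕ f g) = fil-⊕ (fil-up lt f) (fil-up lt g)
fil-up lt (fil-scale c f) = fil-scale c (fil-up lt f)
fil-up lt (fil-~ e f) = fil-~ e (fil-up lt f)

dbl-mono : ∀ {a b} → a ≤ b → dbl a ≤ dbl b
dbl-mono z≤n = z≤n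
dbl-mono (s≤s le) = s≤s (s≤s (dbl-mono le))

-- A term without factors is a pure power of ζ(2), whose weight would be 2k.
fil-proper : ∀ {N k f} → N ≢ dbl k → Fil N k 0 f → Fil N k 1 f
fil-proper ne (in-R r) = in-R r
fil-proper ne (term {j} p e (inj₁ a)) = term {j = j} p e (inj₁ a)
fil-proper ne (term {j} unit e (inj₂ (refl , _))) = ⊥-elim (ne (trans (sym e) (ℕP.+-identityʳ (dbl j))))
fil-proper ne (term {j} p@(times _ _ _) e (inj₂ (refl , _))) = term {j = j} p e (inj₂ (refl , s≤s z≤n))
fil-proper ne (fil-⊕ f g) = fil-⊕ (fil-proper ne f) (fil-proper ne g)
fil-proper ne (fil-scale c f) = fil-scale c (fil-proper ne f)
fil-proper ne (fil-~ e f) = fil-~ e (fil-proper ne f)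

dbl< : ∀ {k j w} → k < j → dbl k < dbl j ℕ.+ w
dbl< {k} {j} {w} a = ℕP.≤-trans (s≤s (ℕP.n≤1+n (dbl k))) (ℕP.≤-trans (dbl-mono a) (ℕP.m≤m+n (dbl j) w))

fil-empty : ∀ {N k m f} → N < dbl k → Fil N k m f → IR.I f
fil-empty lt (in-R r) = r
fil-empty lt (term {j} {l} {w} p e o) = ⊥-elim (ℕP.<-irrefl refl (ℕP.<-≤-trans lt (ℕP.≤-trans (large o) (ℕP.≤-reflexive e))))
  where
  large : ∀ {k m} → (k < j) ⊎ (k ≡ j × m ≤ l) → dbl k ≤ dbl j ℕ.+ w
  large (inj₁ a) = ℕP.<⇒≤ (dbl< a)
  large (inj₂ (refl , _)) = ℕP.m≤m+n (dbl j) w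
fil-empty lt (fil-⊕ f g) = IR.I-⊕ (fil-empty lt f) (fil-empty lt g)
fil-empty lt (fil-scale c f) = IR.I-scale c (fil-empty lt f)
fil-empty lt (fil-~ e f) = IR.I-~ e (fil-empty lt f)

fil-power : ∀ {k m f} → Fil (dbl k) k m f → ≃-pow k f
fil-power {k} (in-R r) = 0ℚ , congruent (IR.I-⊕ r (IR.I-scale (ℚ.- 1ℚ) (IR.I-zero (tested λ F → trans (ev-scale F 0ℚ (pow k)) (zeroˡ _)))))
fil-power (term p e (inj₁ a)) = ⊥-elim (ℕP.<-irrefl (sym e) (dbl< a))
fil-power {k} (term unit e (inj₂ (refl , _))) = 1ℚ , ~⇒≃ (~-trans (shP-unitʳ (pow k)) (~-sym (scale-1 (pow k))))
fil-power {k} (term (times {suc n} {w = w} _ _ _) e (inj₂ (refl , _))) = ⊥-elim (ℕP.m+1+n≢m (dbl k) e)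
fil-power {k} (fil-⊕ {f} {g} x y) with fil-power x | fil-power y
... | c , p | d , q = c + d , ≃-trans (≃-⊕ p q) (~⇒≃ (tested λ F → trans (ev-++ F (scale c (pow k)) (scale d (pow k))) (trans (ev-scale F c (pow k) ⊞ ev-scale F d (pow k)) (trans (sym (distribʳ _ _ _)) (sym (ev-scale F (c + d) (pow k)))))))
fil-power {k} (fil-scale d f) with fil-power f
... | c , p = d * c , ≃-trans (≃-scale d p) (~⇒≃ (scale-scale d c (pow k)))
fil-power (fil-~ e f) with fil-power f
... | c , p = c , ≃-trans (~⇒≃ (~-sym e)) p

module _ {T : Poly → Poly} (der : Derivation T) (N₀ : ℕ) (span : ∀ {n} g → HomP n g → 1 ≤ n → n ≤ N₀ → KSpan n (T g ⊖ g)) where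
  open Derivation der

  private
    excess : ℕ → Poly → Poly
    excess l p = T p ⊖ scale (nat l) p

    ev-excess : ∀ F l p → ev F (excess l p) ≡ ev F (T p) + - (nat l * ev F p)
    ev-excess F l p = trans (ev-⊖ F (T p) (scale (nat l) p)) (refl ⊞ cong -_ (ev-scale F (nat l) p))

    excess-times : ∀ l g p → shP (T g ⊖ g) p ⊕ shP g (excess l p) ~ excess (suc l) (shP g p)
    excess-times l g p = ~-trans (⊕-cong (~-trans (shP-comm (T g ⊖ g) p) (~-trans (shP-⊖ʳ p (T g) g) (⊕-cong (shP-comm p (T g)) (scale-cong (ℚ.- 1ℚ) (shP-comm p g)))))
        (~-trans (shP-⊖ʳ g (T p) (scale (nat l) p)) (⊕-cong (~-refl {p = shP g (T p)}) (scale-cong (ℚ.- 1ℚ) (shP-scaleʳ g (nat l) p)))))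
      (tested λ F → trans (trans (ev-++ F (shP (T g) p ⊖ shP g p) _) (ev-⊖ F (shP (T g) p) (shP g p) ⊞ trans (ev-⊖ F (shP g (T p)) (scale (nat l) (shP g p))) (refl ⊞ cong -_ (ev-scale F (nat l) (shP g p)))))
        (trans (solve 4 (λ a b c l → (a :+ :- b) :+ (c :+ :- (l :* b)) := (a :+ c) :+ :- ((con 1ℚ :+ l) :* b)) refl _ _ _ _)
        (sym (trans (ev-excess F (suc l) (shP g p)) (trans (at (T-shP g p) F) (ev-++ F (shP (T g) p) (shP g (T p))) ⊞ refl)))))

    -- By the Leibniz rule T multiplies a product of l factors by l, up to replacing one factor at a
    -- time by an element of `KSpan`.
    excess-product : ∀ {l w p} → Product l w p → w ≤ N₀ → ∀ j → Fil (dbl j ℕ.+ w) j (suc l) (shP (pow j) (excess l p))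
    excess-product unit le j = in-R (IR.I-shP (pow j) (IR.I-zero {excess 0 (word [])} (tested λ F → trans (ev-excess F 0 (word [])) (trans (at T-1 F ⊞ refl) (solve 1 (λ x → con 0ℚ :+ :- (con 0ℚ :* x) := con 0ℚ) refl _)))))
    excess-product (times {n} {l} {w} {g} {p} hg 1≤n q) le j = fil-~ (~-trans (~-sym (shP-++ʳ (pow j) (shP (T g ⊖ g) p) (shP g (excess l p)))) (shP-cong (~-refl {p = pow j}) (excess-times l g p)))
      (fil-⊕ (fil-KSpan j (span g hg 1≤n (ℕP.≤-trans (ℕP.m≤m+n n w) le)) q refl)
        (fil-~ (shP-left-comm g (pow j) (excess l p)) (subst (λ N → Fil N j (suc (suc l)) (shP g (shP (pow j) (excess l p)))) (rotate n (dbl j) w)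
          (fil-times g hg 1≤n (excess-product q (ℕP.≤-trans (ℕP.m≤n+m w n) le) j)))))
      where
      rotate : ∀ n j w → n ℕ.+ (j ℕ.+ w) ≡ j ℕ.+ (n ℕ.+ w)
      rotate n j w = trans (sym (ℕP.+-assoc n j w)) (trans (cong (ℕ._+ w) (ℕP.+-comm n j)) (ℕP.+-assoc j n w))

    T-pow : ∀ j → T (pow j) ~ []
    T-pow zero = T-1
    T-pow (suc j) = ~-trans (T-shP ζ₂ (pow j)) (⊕-zero (~-trans (shP-comm (T ζ₂) (pow j)) (~-trans (shP-cong (~-refl {p = pow j}) T-ζ₂) (shP-[]ʳ (pow j)))) (~-trans (shP-cong (~-refl {p = ζ₂}) (T-pow j)) (shP-[]ʳ ζ₂)))

    excess-fil : ∀ {N k m f} → N ≤ N₀ → Fil N k m f → Fil N k (suc m) (excess m f)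
    excess-fil {m = m} {f} le (in-R r) = in-R (IR.I-⊖ (T-R r) (IR.I-scale (nat m) r))
    excess-fil {k = k} {m} le (term {j} {l} {w} {p} q refl o) = fil-~ regroup (fil-⊕ (fil-weaken (deeper o) (excess-product q (ℕP.≤-trans (ℕP.m≤n+m w (dbl j)) le) j)) (surplus o))
      where
      t : Poly
      t = shP (pow j) p
      deeper : (k < j) ⊎ (k ≡ j × m ≤ l) → (k < j) ⊎ (k ≡ j × suc m ≤ suc l)
      deeper (inj₁ a) = inj₁ a
      deeper (inj₂ (a , b)) = inj₂ (a , s≤s b)
      surplus : (k < j) ⊎ (k ≡ j × m ≤ l) → Fil (dbl j ℕ.+ w) k (suc m) (scale (nat l + - nat m) t)
      surplus (inj₁ a) = fil-scale (nat l + - nat m) (term {j = j} q refl (inj₁ a))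
      surplus (inj₂ (a , b)) with ℕP.m≤n⇒m<n∨m≡n b
      ... | inj₁ lt = fil-scale (nat l + - nat m) (term {j = j} q refl (inj₂ (a , lt)))
      ... | inj₂ refl = in-R (IR.I-zero (tested λ F → trans (ev-scale F (nat l + - nat l) t) (0* (-‿inverseʳ (nat l)))))
      T-t : T t ~ shP (pow j) (T p)
      T-t = ~-trans (T-shP (pow j) p) (⊕-cong (~-trans (shP-comm (T (pow j)) p) (~-trans (shP-cong (~-refl {p = p}) (T-pow j)) (shP-[]ʳ p))) (~-refl {p = shP (pow j) (T p)}))
      regroup : shP (pow j) (excess l p) ⊕ scale (nat l + - nat m) t ~ excess m t
      regroup = tested λ F → trans (ev-++ F (shP (pow j) (excess l p)) (scale (nat l + - nat m) t))
        (trans (trans (at (shP-⊖ʳ (pow j) (T p) (scale (nat l) p)) F) (trans (ev-⊖ F (shP (pow j) (T p)) (shP (pow j) (scale (nat l) p))) (refl ⊞ cong -_ (trans (at (shP-scaleʳ (pow j) (nat l) p) F) (ev-scale F (nat l) t)))) ⊞ ev-scale F (nat l + - nat m) t)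
        (trans (solve 4 (λ a l m t → (a :+ :- (l :* t)) :+ (l :+ :- m) :* t := a :+ :- (m :* t)) refl _ _ _ _)
        (sym (trans (ev-excess F m t) (at T-t F ⊞ refl)))))
    excess-fil {m = m} le (fil-⊕ {f} {g} x y) = fil-~ (tested λ F → trans (ev-++ F (excess m f) (excess m g)) (trans (ev-excess F m f ⊞ ev-excess F m g)
        (trans (solve 5 (λ a b c d m → (a :+ :- (m :* b)) :+ (c :+ :- (m :* d)) := (a :+ c) :+ :- (m :* (b :+ d))) refl _ _ _ _ _)
        (sym (trans (ev-excess F m (f ⊕ g)) (trans (at (T-⊕ f g) F) (ev-++ F (T f) (T g)) ⊞ cong (λ z → - (nat m * z)) (ev-++ F f g)))))))
      (fil-⊕ (excess-fil le x) (excess-fil le y))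
    excess-fil {m = m} le (fil-scale c {f} x) = fil-~ (tested λ F → trans (ev-scale F c (excess m f)) (trans (c ⊠ ev-excess F m f)
        (trans (solve 4 (λ c a m b → c :* (a :+ :- (m :* b)) := c :* a :+ :- (m :* (c :* b))) refl _ _ _ _)
        (sym (trans (ev-excess F m (scale c f)) (trans (at (T-scale c f) F) (ev-scale F c (T f)) ⊞ cong (λ z → - (nat m * z)) (ev-scale F c f)))))))
      (fil-scale c (excess-fil le x))
    excess-fil {m = m} le (fil-~ {f} {g} e x) = fil-~ (tested λ F → trans (ev-excess F m f) (trans (at (T-~ e) F ⊞ cong (λ z → - (nat m * z)) (at e F)) (sym (ev-excess F m g)))) (excess-fil le x)

    -- T f lies in R and T acts as m + 1 on this step modulo the next, so (m+1) f is in the next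
    -- step. Starting from at least one factor keeps the divisor nonzero.
    raise : ∀ {N k m f} → N ≤ N₀ → IR.I (T f) → Fil N k (suc m) f → Fil N k (suc (suc m)) f
    raise {m = m} {f} le r x = fil-~ (tested λ F → trans (ev-scale F (inv m) (T f ⊖ excess (suc m) f)) (trans (inv m ⊠ trans (ev-⊖ F (T f) (excess (suc m) f)) (refl ⊞ cong -_ (ev-excess F (suc m) f)))
        (lin (cong (_* ev F f) (inv-nat m)) (solve 4 (λ i t n f → i :* (t :+ :- (t :+ :- (n :* f))) :+ con 1ℚ :* f := f :+ (i :* n) :* f) refl _ _ _ _))))
      (fil-scale (inv m) (fil-⊕ (in-R r) (fil-scale (ℚ.- 1ℚ) (excess-fil le x))))

    raises : ∀ {N k f} → N ≤ N₀ → IR.I (T f) → Fil N k 1 f → ∀ m → Fil N k (suc m) f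
    raises le r x zero = x
    raises le r x (suc m) = raise le r (raises le r x m)

    -- i bounds the remaining powers of ζ(2). Unless N = 2k, the number of factors is raised beyond
    -- the weight and the power must increase; powers heavier than N leave only R.
    climb : ∀ {N f} → N ≤ N₀ → IR.I (T f) → ∀ i k → N < i ℕ.+ dbl k → Fil N k 0 f → IR.I f ⊎ (∃ λ k → (N ≡ dbl k) × ≃-pow k f)
    climb le r zero k lt x = inj₁ (fil-empty lt x)
    climb {N} le r (suc i) k lt x with N ℕ.≟ dbl k
    ... | yes refl = inj₂ (k , refl , fil-power x)
    ... | no ne = climb le r i (suc k) (ℕP.≤-trans lt (ℕP.≤-trans (ℕP.n≤1+n _) (ℕP.≤-reflexive (trans (cong suc (sym (ℕP.+-suc i (dbl k)))) (sym (ℕP.+-suc i (suc (dbl k)))))))) (fil-up ℕP.≤-refl (raises le r (fil-proper ne x) N))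

  grading-kernel : ∀ {N f} → N ≤ N₀ → 1 ≤ N → HomP N f → IR.I (T f) → IR.I f ⊎ (∃ λ k → (N ≡ dbl k) × ≃-pow k f)
  grading-kernel {N} {f} le 1≤N hf r = climb le r (suc N) 0 (s≤s (ℕP.m≤m+n N 0))
    (fil-~ (~-trans (shP-unitˡ (shP f (word []))) (shP-unitʳ f)) (term {j = 0} (times {g = f} hf 1≤N unit) (ℕP.+-identityʳ N) (inj₂ (refl , z≤n))))

-- Weights of brackets, linearity of D_ψ in ψ, and its value on zeta words

homogeneous⇒HomP : ∀ {n f} → PX.Homogeneous n f → HomP n f
homogeneous⇒HomP {n} {f} h F z = trans (at same F) (trans (ev-All (restrict-All length? f) z) (ev-zero (restrict length? f) (λ _ → refl)))
  where
  length? : ∀ w → Dec (length w ≡ n)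
  length? w = length w ℕ.≟ n
  inside : ∀ w → length w ≡ n → ∀ p → ev (FX.δ w) p ≡ ev (FX.δ w) (restrict length? p)
  inside w e [] = refl
  inside w e ((c , u) ∷ p) with length u ℕ.≟ n
  ... | yes _ = refl ⊞ inside w e p
  ... | no ne = trans (0+ (*0 (FX.δ-≢ {u} {w} (λ { refl → ne e })))) (inside w e p)
  same : f ~ restrict length? f
  same = FX.δ-test go
    where
    go : ∀ w → ev (FX.δ w) f ≡ ev (FX.δ w) (restrict length? f)
    go w with length w ℕ.≟ n | coeff f w ℚP.≟ 0ℚ
    ... | yes e | _ = inside w e f
    ... | no ne | no nz = ⊥-elim (ne (h w nz))
    ... | no ne | yes e = trans (sym (coeff-ev f w)) (trans e (sym (trans (ev-All (restrict-All length? f) (λ u l → FX.δ-≢ {u} {w} (λ { refl → ne l }))) (ev-zero (restrict length? f) (λ _ → refl)))))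

HomP⇒Hom : ∀ {n} f → HomP n f → Hom n (coeff f)
HomP⇒Hom f h w ne = trans (coeff-ev f w) (h (FX.δ w) (λ u l → FX.δ-≢ {u} {w} (λ { refl → ne l })))

ev-· : ∀ F f g → ev F (f · g) ≡ ev (λ u → ev (λ v → F (u ++ v)) g) f
ev-· F f g = ev-bind F _ (λ u → ev (λ v → F (u ++ v)) g) (λ c u → ev-scaleMap F (u ++_) c g) f

HomP-· : ∀ {a b} f g → HomP a f → HomP b g → HomP (a ℕ.+ b) (f · g)
HomP-· f g hf hg F z = trans (ev-· F f g) (hf _ (λ u l → hg _ (λ v l′ → z (u ++ v) (trans (LP.length-++ u) (cong₂ ℕ._+_ l l′)))))

HomP-[] : ∀ {n} → HomP n []
HomP-[] F z = refl

HomP-dWord : ∀ {a} f → HomP a f → ∀ w → HomP (a ℕ.+ length w) (dWord f w)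
HomP-dWord f hf [] = HomP-[]
HomP-dWord {a} f hf (m ∷ w) = HomP-⊕ (dLetter f m · word w) (word (m ∷ []) · dWord f w)
  (subst (λ n → HomP n (dLetter f m · word w)) (ℕP.+-assoc a 1 (length w)) (HomP-· (dLetter f m) (word w) (letter m) (HomP-word w)))
  (subst (λ n → HomP n (word (m ∷ []) · dWord f w)) (sym (ℕP.+-suc a (length w))) (HomP-· (word (m ∷ [])) (dWord f w) (HomP-word (m ∷ [])) (HomP-dWord f hf w)))
  where
  letter : ∀ m → HomP (a ℕ.+ 1) (dLetter f m)
  letter x0 = HomP-[]
  letter x1 = HomP-⊖ (word (x1 ∷ []) · f) (f · word (x1 ∷ []))
    (subst (λ n → HomP n (word (x1 ∷ []) · f)) (ℕP.+-comm 1 a) (HomP-· (word (x1 ∷ [])) f (HomP-word (x1 ∷ [])) hf)) (HomP-· f (word (x1 ∷ [])) hf (HomP-word (x1 ∷ [])))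

HomP-linP : ∀ {n b} φ g → HomP b g → (∀ w → length w ≡ b → HomP n (φ w)) → HomP n (linP φ g)
HomP-linP φ g hg h F z = trans (ev-linP F φ g) (hg _ (λ w l → h w l F z))

HomP-ihara : ∀ {a b} f g → HomP a f → HomP b g → HomP (a ℕ.+ b) (ihara f g)
HomP-ihara {a} {b} f g hf hg = HomP-⊖ (linP (dWord f) g ⊖ linP (dWord g) f ⊕ f · g) (g · f)
  (HomP-⊕ (linP (dWord f) g ⊖ linP (dWord g) f) (f · g) (HomP-⊖ (linP (dWord f) g) (linP (dWord g) f)
    (HomP-linP (dWord f) g hg (λ { w refl → HomP-dWord f hf w }))
    (subst (λ n → HomP n (linP (dWord g) f)) (ℕP.+-comm b a) (HomP-linP (dWord g) f hf (λ { w refl → HomP-dWord g hg w })))) (HomP-· f g hf hg))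
  (subst (λ n → HomP n (g · f)) (ℕP.+-comm b a) (HomP-· g f hg hf))

doubleShuffle-cong : ∀ {Ψ Φ} → (∀ w → Ψ w ≡ Φ w) → DoubleShuffle Ψ → DoubleShuffle Φ
doubleShuffle-cong {Ψ} {Φ} e ds = record
  { kills = trans (sym (e [])) (proj₁ kills) , λ a u b v → trans (sym (Sh.st-cong e (a ∷ u) (b ∷ v))) (proj₂ kills a u b v)
  ; Ψ-x₀ = trans (sym (e _)) Ψ-x₀ ; Ψ-x₁ = trans (sym (e _)) Ψ-x₁ ; Ψ-x₀x₁ = trans (sym (e _)) Ψ-x₀x₁
  ; P₀-st = λ a u b v → trans (sym (St.st-cong (λ w → e (ι w) ⊞ corr-cong correction-cong w) (a ∷ u) (b ∷ v))) (P₀-st a u b v) }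
  where
  open DoubleShuffle ds
  correction-cong : ∀ n → correction Ψ n ≡ correction Φ n
  correction-cong zero = refl
  correction-cong (suc zero) = refl
  correction-cong (suc (suc m)) = ratio m ⊠ e (blk (suc m) [])

gaps-linear : ∀ k Ψ Φ a (F : Word → ℚ) w → gaps (λ w → k * Ψ w + Φ w) a F w ≡ k * gaps Ψ a F w + gaps Φ a F w
gaps-linear k Ψ Φ a F [] = solve 5 (λ k p q g f → g :* (k :* p :+ q) :* f := k :* (g :* p :* f) :+ g :* q :* f) refl _ _ _ _ _
gaps-linear k Ψ Φ a F (b ∷ w) = trans (trans (spl-cong (λ p q → solve 5 (λ k p q g f → g :* (k :* p :+ q) :* f := k :* (g :* p :* f) :+ g :* q :* f) refl k (Ψ p) (Φ p) (gap a q) (F q)) (b ∷ w))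
    (trans (spl-+ (λ p q → k * (gap a q * Ψ p * F q)) (λ p q → gap a q * Φ p * F q) (b ∷ w)) (spl-* k (λ p q → gap a q * Ψ p * F q) (b ∷ w) ⊞ refl))
    ⊞ gaps-linear k Ψ Φ b (λ w → F (b ∷ w)) w)
  (solve 5 (λ k a b c d → (k :* a :+ b) :+ (k :* c :+ d) := k :* (a :+ c) :+ (b :+ d)) refl _ _ _ _ _)

D-linear : ∀ k Ψ Φ f → D (λ w → k * Ψ w + Φ w) f ~ scale k (D Ψ f) ⊕ D Φ f
D-linear k Ψ Φ f = tested λ F → trans (D-gaps F (λ w → k * Ψ w + Φ w)) (trans (ev-cong (gaps-linear k Ψ Φ x1 F) f)
  (trans (ev-+ (λ w → k * gaps Ψ x1 F w) (gaps Φ x1 F) f) (trans (trans (ev-* k (gaps Ψ x1 F) f) (k ⊠ sym (D-gaps F Ψ)) ⊞ sym (D-gaps F Φ))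
  (sym (trans (ev-++ F (scale k (D Ψ f)) (D Φ f)) (ev-scale F k (D Ψ f) ⊞ refl))))))
  where
  D-gaps : ∀ F Ψ → ev F (D Ψ f) ≡ ev (gaps Ψ x1 F) f
  D-gaps F Ψ = trans (ev-linP F (gapsP Ψ x1) f) (ev-cong (ev-gapsP F Ψ x1) f)

D-zero : ∀ f → D (λ _ → 0ℚ) f ~ []
D-zero f = tested λ F → trans (ev-linP F (gapsP (λ _ → 0ℚ) x1) f) (ev-zero f (λ w → trans (ev-gapsP F (λ _ → 0ℚ) x1 w) (gaps-zero-length (suc (length w)) (λ _ _ → refl) x1 F w
  (λ v e → ⊥-elim (ℕP.<-irrefl (sym e) (s≤s (ℕP.m≤m+n (length w) (length v))))))))

spl-y : ∀ (G : Word → Word → ℚ) m → (∀ i q → G (zs i) q ≡ 0ℚ) → spl G (y m) ≡ G (y m) []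
spl-y G zero z = 0+ (z 0 (x1 ∷ []))
spl-y G (suc m) z = trans (0+ (z 0 (y (suc m)))) (spl-y (λ p q → G (x0 ∷ p) q) m (λ i q → z (suc i) q))

-- A proper segment of x₀^m x₁ is either a power of x₀, where Ψ vanishes, or it reaches the end and
-- has x₀ on both sides, where the weight of the cut is zero.
D-zeta : ∀ {Ψ} → DoubleShuffle Ψ → ∀ m → D Ψ (word (y m)) ~ scale (Ψ (y m)) (word [])
D-zeta {Ψ} ds m = tested λ F → trans (ev-linP F (gapsP Ψ x1) (word (y m))) (trans (ev-single (λ w → ev F (gapsP Ψ x1 w)) (y m)) (trans (ev-gapsP F Ψ x1 (y m))
  (trans (gaps-y x1 F m) (trans (cong (_* F []) (*-identityˡ (Ψ (y m)))) (sym (trans (ev-scale F (Ψ (y m)) (word [])) (Ψ (y m) ⊠ ev-single F [])))))))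
  where
  open DoubleShuffle ds
  Ψ-zs : ∀ i → Ψ (zs i) ≡ 0ℚ
  Ψ-zs zero = proj₁ kills
  Ψ-zs (suc zero) = Ψ-x₀
  Ψ-zs (suc (suc i)) = nat-cancel (suc i) (trans (sym (sh-x₀-zs Ψ (suc i))) (Sh.kills-≢ Ψ kills (x0 ∷ []) (zs (suc i)) (λ ()) (λ ())))
  gaps-y : ∀ a F m → gaps Ψ a F (y m) ≡ gap a [] * Ψ (y m) * F []
  gaps-y a F zero = trans (+0 (0* (*0 (proj₁ kills)))) (spl-y (λ p q → gap a q * Ψ p * F q) 0 (λ i q → 0* (*0 (Ψ-zs i))))
  gaps-y a F (suc m) = trans (+0 (trans (gaps-y x0 (λ w → F (x0 ∷ w)) m) (0* (zeroˡ (Ψ (y m)))))) (spl-y (λ p q → gap a q * Ψ p * F q) (suc m) (λ i q → 0* (*0 (Ψ-zs i))))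

-- From the generators to all double shuffle elements

module Generators (σ : ℕ → Poly) (σ-homogeneous : ∀ k → PX.Homogeneous (2 ℕ.* k ℕ.+ 3) (σ k)) (σ-𝔡𝔪₀ : ∀ t → In𝔡𝔪₀ (evalIhC σ t))
  (σ-generate : ∀ ψ → In𝔡𝔪₀ ψ → Σ LieComb λ t → ψ ≈ evalIhC σ t) where

  weight : LTree → ℕ
  weight (lgen k) = 2 ℕ.* k ℕ.+ 3
  weight (lbr s t) = weight s ℕ.+ weight t

  tree-HomP : ∀ t → HomP (weight t) (evalIh σ t)
  tree-HomP (lgen k) = homogeneous⇒HomP {f = σ k} (σ-homogeneous k)
  tree-HomP (lbr s t) = HomP-ihara (evalIh σ s) (evalIh σ t) (tree-HomP s) (tree-HomP t)

  tree-doubleShuffle : ∀ t → DoubleShuffle (coeff (evalIh σ t))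
  tree-doubleShuffle t = doubleShuffle-cong {coeff (evalIhC σ ((1ℚ , t) ∷ []))} {coeff (evalIh σ t)}
    (~⇒≈ {evalIhC σ ((1ℚ , t) ∷ [])} {evalIh σ t} (tested λ F → trans (ev-++ F (scale 1ℚ (evalIh σ t)) []) (trans (+-identityʳ _) (at (scale-1 (evalIh σ t)) F))))
    (𝔡𝔪₀⇒ (evalIhC σ ((1ℚ , t) ∷ [])) (σ-𝔡𝔪₀ ((1ℚ , t) ∷ [])))

  tree-Hom : ∀ t → Hom (weight t) (coeff (evalIh σ t))
  tree-Hom t = HomP⇒Hom (evalIh σ t) (tree-HomP t)

  tree-admissible : ∀ t → Admissible (coeff (evalIh σ t))
  tree-admissible t = doubleShuffle⇒admissible (weight t) (tree-Hom t) (tree-doubleShuffle t)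

  module _ {f} (r : ∀ k → IR.I (D (coeff (σ k)) f)) where

    tree-D-R : ∀ t → IR.I (D (coeff (evalIh σ t)) f)
    tree-D-R (lgen k) = r k
    tree-D-R (lbr s t) = IR.I-~ (~-sym (D-ihara (evalIh σ s) (evalIh σ t) (proj₁ (DoubleShuffle.kills (tree-doubleShuffle s))) (proj₁ (DoubleShuffle.kills (tree-doubleShuffle t))) f))
      (IR.I-⊖ (D-R (tree-admissible t) (tree-D-R s)) (D-R (tree-admissible s) (tree-D-R t)))

    comb-D-R : ∀ c → IR.I (D (λ w → ev (FX.δ w) (evalIhC σ c)) f)
    comb-D-R [] = IR.I-zero (D-zero f)
    comb-D-R ((k , t) ∷ c) = IR.I-~ (~-trans (~-sym (D-linear k (coeff (evalIh σ t)) (λ w → ev (FX.δ w) (evalIhC σ c)) f)) (~-sym (D-cong {λ w → ev (FX.δ w) (evalIhC σ ((k , t) ∷ c))} {λ w → k * coeff (evalIh σ t) w + ev (FX.δ w) (evalIhC σ c)} vanish expand f)))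
      (IR.I-⊕ (IR.I-scale k (tree-D-R t)) (comb-D-R c))
      where
      expand : ∀ w → ev (FX.δ w) (evalIhC σ ((k , t) ∷ c)) ≡ k * coeff (evalIh σ t) w + ev (FX.δ w) (evalIhC σ c)
      expand w = trans (ev-++ (FX.δ w) (scale k (evalIh σ t)) (evalIhC σ c)) (trans (ev-scale (FX.δ w) k (evalIh σ t)) (k ⊠ sym (coeff-ev (evalIh σ t) w)) ⊞ refl)
      vanish : ev (FX.δ []) (evalIhC σ ((k , t) ∷ c)) ≡ 0ℚ
      vanish = trans (sym (coeff-ev (evalIhC σ ((k , t) ∷ c)) [])) (proj₁ (DoubleShuffle.kills (𝔡𝔪₀⇒ (evalIhC σ ((k , t) ∷ c)) (σ-𝔡𝔪₀ ((k , t) ∷ c)))))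

    doubleShuffle-D-R : ∀ ψ → DoubleShuffle (coeff ψ) → IR.I (D (coeff ψ) f)
    doubleShuffle-D-R ψ ds = go (σ-generate ψ (⇒𝔡𝔪₀ ψ ds))
      where
      go : (Σ LieComb λ t → ψ ≈ evalIhC σ t) → IR.I (D (coeff ψ) f)
      go (c , e) = IR.I-~ (~-sym (D-cong {coeff ψ} {λ w → ev (FX.δ w) (evalIhC σ c)} (proj₁ (DoubleShuffle.kills ds)) (λ w → trans (e w) (coeff-ev (evalIhC σ c) w)) f)) (comb-D-R c)

    weave-R : ∀ {n B} → All (DualPair n) B → IR.I (weave B f)
    weave-R [] = IR.I-zero ~-refl
    weave-R {B = (a , ψ) ∷ B} ((_ , _ , ds) ∷ ps) = IR.I-⊕ {shP a (D (coeff ψ) f)} {weave B f} (IR.I-shP a (doubleShuffle-D-R ψ ds)) (weave-R ps)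

    grading-R : ∀ N → IR.I (grading N f)
    grading-R zero = IR.I-zero ~-refl
    grading-R (suc N) = IR.I-⊕ {weave (dualBasis (suc N)) f} {grading N f} (weave-R {suc N} {dualBasis (suc N)} (dualBasis-pairs (suc N) (s≤s z≤n))) (grading-R N)

    common-kernel : ∀ {N} → 1 ≤ N → HomP N f → IR.I f ⊎ (∃ λ k → (N ≡ dbl k) × ≃-pow k f)
    common-kernel {N} 1≤N hf = grading-kernel (grading-derivation N) N (λ g hg 1≤n le → proj₁ (grading-span g hg 1≤n N) le) ℕP.≤-refl 1≤N hf (grading-R N)

-- Vanishing of tensors in 𝓛 ⊗ Z^f

R⊂K : ∀ {f} → IR.I f → IK.I f
R⊂K = IR.I-elim IK.I IK.I-~ (IK.I-zero ~-refl) IK.I-⊕ (λ p i → IK.I-shP p (IK.I-gen (kR i)))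

products⊂K : ∀ {a b} p q → HomP a p → HomP b q → 1 ≤ a → 1 ≤ b → IK.I (shP p q)
products⊂K {a} {b} p q hp hq 1≤a 1≤b = IK.I-~ (~-sym expand) (IK.I-linP (λ u → linP (shW u) q′) p′ (mapAll (λ { u refl → IK.I-linP (shW u) q′ (mapAll (λ { v refl → IK.I-gen (kprod u v 1≤a 1≤b) }) (restrict-All (length? b) q)) }) (restrict-All (length? a) p)))
  where
  length? : ∀ n (w : Word) → Dec (length w ≡ n)
  length? n w = length w ℕ.≟ n
  p′ q′ : Poly
  p′ = restrict (length? a) p
  q′ = restrict (length? b) q
  mapAll : ∀ {P Q : Word → Set} {f : Poly} → (∀ w → P w → Q w) → All (P ∘ proj₂) f → All (Q ∘ proj₂) f
  mapAll g [] = []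
  mapAll g (p ∷ ps) = g _ p ∷ mapAll g ps
  expand : shP p q ~ linP (λ u → linP (shW u) q′) p′
  expand = ~-trans (shP-cong (restrict-~ (length? a) p hp) (restrict-~ (length? b) q hq))
    (tested λ F → trans (ev-shP F p′ q′) (sym (trans (ev-linP F (λ u → linP (shW u) q′) p′) (ev-cong (λ u → trans (ev-linP F (shW u) q′) (ev-cong (ev-shW F u) q′)) p′))))

KSpan⊂K : ∀ {n f} → KSpan n f → IK.I f
KSpan⊂K (k-R r) = R⊂K r
KSpan⊂K (k-ζ₂ _) = IK.I-gen kζ2
KSpan⊂K (k-shP {p = p} {q} hp hq 1≤a 1≤b _) = products⊂K p q hp hq 1≤a 1≤b
KSpan⊂K (k-⊕ p q) = IK.I-⊕ (KSpan⊂K p) (KSpan⊂K q)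
KSpan⊂K (k-scale c p) = IK.I-scale c (KSpan⊂K p)
KSpan⊂K (k-~ e p) = IK.I-~ e (KSpan⊂K p)

infixr 7 _⊠⊠_
_⊠⊠_ : (Word → ℚ) → (Word → ℚ) → Word × Word → ℚ
(P ⊠⊠ Q) t = P (proj₁ t) * Q (proj₂ t)

tensors : List (Poly × Poly) → Tens
tensors = concatMap (λ p → proj₁ p ⊗ proj₂ p)

ev-⊠⊠ : ∀ P Q f g → ev (P ⊠⊠ Q) (f ⊗ g) ≡ ev P f * ev Q g
ev-⊠⊠ P Q f g = trans (FX.ev-⊗ (P ⊠⊠ Q) f g) (trans (ev-cong (λ u → trans (ev-* (P u) Q g) (*-comm _ _)) f) (trans (ev-* (ev Q g) P f) (*-comm _ _)))

≈₂⇒~ : ∀ S T → S ≈₂ T → S ~ T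
≈₂⇒~ S T e = Pairs.δ-test (λ { (u , v) → trans (ev-cong (test u v) S) (trans (trans (sym (FX.coeff₂-ev S u v)) (trans (e u v) (FX.coeff₂-ev T u v))) (sym (ev-cong (test u v) T))) })
  where
  module Pairs = Coefficients (ProductP.≡-dec (LP.≡-dec _≟L_) (LP.≡-dec _≟L_))
  test : ∀ u v t → Pairs.δ (u , v) t ≡ FX.δ₂ u v t
  test u v (a , b) = go (LP.≡-dec _≟L_ a u) (LP.≡-dec _≟L_ b v)
    where
    go : Dec (a ≡ u) → Dec (b ≡ v) → Pairs.δ (u , v) (a , b) ≡ FX.δ₂ u v (a , b)
    go (yes refl) (yes refl) = trans (Pairs.δ-refl (a , b)) (sym (trans (cong₂ _*_ (FX.δ-refl a) (FX.δ-refl b)) (*-identityˡ 1ℚ)))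
    go (no ne) _ = trans (Pairs.δ-≢ {a , b} {u , v} (λ { refl → ne refl })) (sym (0* (FX.δ-≢ ne)))
    go (yes _) (no ne) = trans (Pairs.δ-≢ {a , b} {u , v} (λ { refl → ne refl })) (sym (*0 (FX.δ-≢ ne)))

~⇒≈₂ : ∀ S T → (∀ P Q → ev (P ⊠⊠ Q) S ≡ ev (P ⊠⊠ Q) T) → S ≈₂ T
~⇒≈₂ S T e u v = trans (FX.coeff₂-ev S u v) (trans (e (FX.δ u) (FX.δ v)) (sym (FX.coeff₂-ev T u v)))

combine : (Word → ℚ) → List (Poly × Poly) → Poly
combine Ψ [] = []
combine Ψ ((p , q) ∷ l) = scale (ev Ψ p) q ⊕ combine Ψ l

ev-combine : ∀ Ψ F l → ev (Ψ ⊠⊠ F) (tensors l) ≡ ev F (combine Ψ l)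
ev-combine Ψ F [] = refl
ev-combine Ψ F ((p , q) ∷ l) = trans (ev-++ (Ψ ⊠⊠ F) (p ⊗ q) (tensors l)) (trans (trans (ev-⊠⊠ Ψ F p q) (sym (ev-scale F (ev Ψ p) q)) ⊞ ev-combine Ψ F l) (sym (ev-++ F (scale (ev Ψ p) q) (combine Ψ l))))

combine-K : ∀ {Ψ} → DoubleShuffle Ψ → ∀ l → All (λ p → InK (proj₁ p)) l → combine Ψ l ~ []
combine-K ds [] [] = ~-refl
combine-K {Ψ} ds ((p , q) ∷ l) (k ∷ ks) = ⊕-zero (tested λ F → trans (ev-scale F (ev Ψ p) q) (0* (doubleShuffle-K ds {p} (IK.member k)))) (combine-K ds l ks)

combine-R : ∀ Ψ l → All (λ p → InR (proj₂ p)) l → IR.I (combine Ψ l)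
combine-R Ψ [] [] = IR.I-zero ~-refl
combine-R Ψ ((p , q) ∷ l) (r ∷ rs) = IR.I-⊕ (IR.I-scale (ev Ψ p) {q} (IR.member r)) (combine-R Ψ l rs)

ev-weight-part : ∀ {Ψ} n → Hom n Ψ → (ds : DoubleShuffle Ψ) → ∀ F f → ev (Ψ ⊠⊠ F) (leftWeight n (ΔGon f)) ≡ ev F (D Ψ f)
ev-weight-part {Ψ} n h ds F f = trans (GoncharovPairing.ev-leftWeight Ψ (DoubleShuffle.kills ds) n h F (ΔGon f)) (GoncharovPairing.ev-ΔGon Ψ (DoubleShuffle.kills ds) F f)

-- Pair the left factors with Ψ: terms with left factor in K disappear, those with right factor in R
-- remain in R.
tensZero⇒D-R : ∀ {Ψ} n → Hom n Ψ → DoubleShuffle Ψ → ∀ f → TensZero (leftWeight n (ΔGon f)) → IR.I (D Ψ f)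
tensZero⇒D-R {Ψ} n h ds f (A , B , inK , inR , e) = IR.I-~ (~-sym reduced) (combine-R Ψ B inR)
  where
  reduced : D Ψ f ~ combine Ψ B
  reduced = tested λ F → trans (sym (ev-weight-part n h ds F f))
    (trans (at (≈₂⇒~ (leftWeight n (ΔGon f)) (tensors A ++ tensors B) e) (Ψ ⊠⊠ F)) (trans (ev-++ (Ψ ⊠⊠ F) (tensors A) (tensors B))
    (trans (0+ (trans (ev-combine Ψ F A) (at (combine-K ds A inK) F))) (ev-combine Ψ F B))))

-- Reading each left factor w modulo K as Σ ψ_j(w) a_j turns the tensor into Σ a_j ⊗ D_{ψ_j} f.
module Dualise (n : ℕ) where

  contract : Poly → Tens → Poly
  contract ψ [] = []
  contract ψ ((c , w , v) ∷ T) = (c * coeff ψ w , v) ∷ contract ψ T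

  ev-contract : ∀ F ψ T → ev F (contract ψ T) ≡ ev (coeff ψ ⊠⊠ F) T
  ev-contract F ψ [] = refl
  ev-contract F ψ ((c , w , v) ∷ T) = *-assoc _ _ _ ⊞ ev-contract F ψ T

  kernelPart : Tens → List (Poly × Poly)
  kernelPart [] = []
  kernelPart ((c , w , v) ∷ T) = (word w ⊖ project (dualBasis n) (word w) , scale c (word v)) ∷ kernelPart T

  rightPart : List (Poly × Poly) → Tens → List (Poly × Poly)
  rightPart [] T = []
  rightPart ((a , ψ) ∷ B) T = (a , contract ψ T) ∷ rightPart B T

  ev-kernelPart : ∀ P Q T → ev (P ⊠⊠ Q) (tensors (kernelPart T)) ≡ ev ((λ w → P w + - ev P (project (dualBasis n) (word w))) ⊠⊠ Q) T
  ev-kernelPart P Q [] = refl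
  ev-kernelPart P Q ((c , w , v) ∷ T) = trans (ev-++ (P ⊠⊠ Q) ((word w ⊖ project (dualBasis n) (word w)) ⊗ scale c (word v)) (tensors (kernelPart T)))
    (trans (ev-⊠⊠ P Q (word w ⊖ project (dualBasis n) (word w)) (scale c (word v))) (trans (cong₂ _*_ (trans (ev-⊖ P (word w) (project (dualBasis n) (word w))) (ev-single P w ⊞ refl)) (trans (ev-scale Q c (word v)) (c ⊠ ev-single Q v)))
      (solve 3 (λ x c q → x :* (c :* q) := c :* (x :* q)) refl _ _ _)) ⊞ ev-kernelPart P Q T)

  ev-rightPart : ∀ P Q B T → ev (P ⊠⊠ Q) (tensors (rightPart B T)) ≡ ev ((λ w → ev P (project B (word w))) ⊠⊠ Q) T
  ev-rightPart P Q [] T = sym (ev-zero T (λ t → zeroˡ (Q (proj₂ t))))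
  ev-rightPart P Q ((a , ψ) ∷ B) T = trans (ev-++ (P ⊠⊠ Q) (a ⊗ contract ψ T) (tensors (rightPart B T)))
    (trans (trans (ev-⊠⊠ P Q a (contract ψ T)) (trans (ev P a ⊠ ev-contract Q ψ T) (sym (ev-* (ev P a) (coeff ψ ⊠⊠ Q) T))) ⊞ ev-rightPart P Q B T)
    (trans (sym (ev-+ (λ t → ev P a * (coeff ψ ⊠⊠ Q) t) ((λ w → ev P (project B (word w))) ⊠⊠ Q) T))
    (ev-cong (λ t → trans (solve 4 (λ a p q r → a :* (p :* q) :+ r :* q := (p :* a :+ r) :* q) refl (ev P a) (coeff ψ (proj₁ t)) (Q (proj₂ t)) (ev P (project B (word (proj₁ t)))))
      (cong (_* Q (proj₂ t)) (sym (trans (ev-++ P (scale (pair ψ (word (proj₁ t))) a) (project B (word (proj₁ t)))) (trans (ev-scale P (pair ψ (word (proj₁ t))) a) (cong (_* ev P a) (ev-single (coeff ψ) (proj₁ t))) ⊞ refl))))) T)))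

  kernelPart-K : ∀ T → All (λ t → length (proj₁ (proj₂ t)) ≡ n) T → All (λ p → InK (proj₁ p)) (kernelPart T)
  kernelPart-K [] [] = []
  kernelPart-K ((c , w , v) ∷ T) (e ∷ es) = IK.certificate (KSpan⊂K (dualBasis-spans n (word w) (subst (λ k → HomP k (word w)) e (HomP-word w)))) ∷ kernelPart-K T es

  rightPart-R : ∀ B f → (∀ ψ → Hom n (coeff ψ) → DoubleShuffle (coeff ψ) → IR.I (D (coeff ψ) f)) → All (DualPair n) B → All (λ p → InR (proj₂ p)) (rightPart B (leftWeight n (ΔGon f)))
  rightPart-R [] f r [] = []
  rightPart-R ((a , ψ) ∷ B) f r ((_ , h , ds) ∷ ps) = IR.certificate (IR.I-~ (~-sym contracted) (r ψ h ds)) ∷ rightPart-R B f r ps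
    where
    contracted : contract ψ (leftWeight n (ΔGon f)) ~ D (coeff ψ) f
    contracted = tested λ F → trans (ev-contract F ψ (leftWeight n (ΔGon f))) (ev-weight-part n h ds F f)

  D-R⇒tensZero : 1 ≤ n → ∀ f → (∀ ψ → Hom n (coeff ψ) → DoubleShuffle (coeff ψ) → IR.I (D (coeff ψ) f)) → TensZero (leftWeight n (ΔGon f))
  D-R⇒tensZero 1≤n f r = kernelPart T , rightPart (dualBasis n) T , kernelPart-K T (AllP.all-filter (λ t → length (proj₁ (proj₂ t)) ℕ.≟ n) (ΔGon f)) ,
    rightPart-R (dualBasis n) f r (dualBasis-pairs n 1≤n) , ~⇒≈₂ T (tensors (kernelPart T) ++ tensors (rightPart (dualBasis n) T)) (λ P Q → sym (trans (ev-++ (P ⊠⊠ Q) (tensors (kernelPart T)) (tensors (rightPart (dualBasis n) T)))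
      (trans (ev-kernelPart P Q T ⊞ ev-rightPart P Q (dualBasis n) T) (trans (sym (ev-+ ((λ w → P w + - ev P (project (dualBasis n) (word w))) ⊠⊠ Q) ((λ w → ev P (project (dualBasis n) (word w))) ⊠⊠ Q) T))
      (ev-cong (λ t → solve 3 (λ p r q → (p :+ :- r) :* q :+ r :* q := p :* q) refl (P (proj₁ t)) (ev P (project (dualBasis n) (word (proj₁ t)))) (Q (proj₂ t))) T)))))
    where
    T : Tens
    T = leftWeight n (ΔGon f)

-- The kernel of D in weight N

zetaWord-y : ∀ n → zetaWord (suc n) ≡ y n
zetaWord-y n = replicate-blk n []

odd≢even : ∀ a b → suc (dbl a) ≢ dbl b
odd≢even zero (suc zero) ()
odd≢even (suc a) (suc b) e = odd≢even a b (ℕP.suc-injective (ℕP.suc-injective e))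

dbl-injective : ∀ {a b} → dbl a ≡ dbl b → a ≡ b
dbl-injective {zero} {zero} _ = refl
dbl-injective {suc a} {suc b} e = cong suc (dbl-injective (ℕP.suc-injective (ℕP.suc-injective e)))

dbl≡2* : ∀ a → dbl a ≡ 2 ℕ.* a
dbl≡2* zero = refl
dbl≡2* (suc a) = cong suc (trans (cong suc (dbl≡2* a)) (sym (ℕP.+-suc a (a ℕ.+ 0))))

generator-weight : ∀ k → 2 ℕ.* k ℕ.+ 3 ≡ suc (dbl (suc k))
generator-weight k = trans (ℕP.+-comm (2 ℕ.* k) 3) (cong (3 ℕ.+_) (sym (dbl≡2* k)))

D-weight-r : ∀ k → 2 ℕ.* suc k ℕ.+ 1 ≡ 2 ℕ.* k ℕ.+ 3
D-weight-r k = trans (ℕP.+-comm (2 ℕ.* suc k) 1) (trans (cong suc (sym (dbl≡2* (suc k)))) (sym (generator-weight k)))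

length-y : ∀ n → length (y n) ≡ suc n
length-y n = trans (length-blk n []) (ℕP.+-identityʳ (suc n))

inQζ : ∀ n f c → f ≃ scale c (word (y n)) → InQζ (suc n) f
inQζ n f c (congruent r) = c , subst (λ w → InR (f ⊖ scale c (word w))) (sym (zetaWord-y n)) (IR.certificate r)

-- D_ψ of ζ(N) is the constant ⟨ψ , ζ(N)⟩, which is zero for ψ of weight below N; the relation
-- itself stays in R under D_ψ.
ζ-multiple⇒kernel : ∀ n f → InQζ (suc n) f → InKerD< (suc n) f
ζ-multiple⇒kernel n f (c , r) i 3≤ lt = Dualise.D-R⇒tensZero (2 ℕ.* i ℕ.+ 1) (ℕP.≤-trans (s≤s z≤n) 3≤) f in-kernel
  where
  w : ℕ
  w = 2 ℕ.* i ℕ.+ 1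
  ζ : Poly
  ζ = word (y n)
  relation : f ≃ scale c ζ
  relation = congruent (IR.member (subst (λ w → InR (f ⊖ scale c (word w))) (zetaWord-y n) r))
  in-kernel : ∀ ψ → Hom w (coeff ψ) → DoubleShuffle (coeff ψ) → IR.I (D (coeff ψ) f)
  in-kernel ψ h ds = IR.I-~ (~-sym (~-trans (T-~ split) (T-⊕ (f ⊖ scale c ζ) (scale c ζ)))) (IR.I-⊕ (T-R (_≃_.difference relation))
    (IR.I-~ (~-sym (T-scale c ζ)) (IR.I-scale c (IR.I-zero (~-trans (D-zeta ds n) (tested λ F → trans (ev-scale F (coeff ψ (y n)) (word [])) (0* (h (y n) (λ e → ℕP.<-irrefl (trans (sym e) (length-y n)) lt)))))))))
    where
    open Derivation (D-derivation (doubleShuffle⇒admissible w h ds))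
    split : f ~ (f ⊖ scale c ζ) ⊕ scale c ζ
    split = tested λ F → sym (trans (ev-++ F (f ⊖ scale c ζ) (scale c ζ)) (trans (ev-⊖ F f (scale c ζ) ⊞ refl) (solve 2 (λ a b → (a :+ :- b) :+ b := a) refl _ _)))

module _ (σ : ℕ → Poly) (σ-homogeneous : ∀ k → PX.Homogeneous (2 ℕ.* k ℕ.+ 3) (σ k)) (σ-𝔡𝔪₀ : ∀ t → In𝔡𝔪₀ (evalIhC σ t))
  (σ-generate : ∀ ψ → In𝔡𝔪₀ ψ → Σ LieComb λ t → ψ ≈ evalIhC σ t) where
  open Generators σ σ-homogeneous σ-𝔡𝔪₀ σ-generate

  private
    σ-Hom : ∀ k → Hom (2 ℕ.* k ℕ.+ 3) (coeff (σ k))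
    σ-Hom k = tree-Hom (lgen k)

    σ-doubleShuffle : ∀ k → DoubleShuffle (coeff (σ k))
    σ-doubleShuffle k = tree-doubleShuffle (lgen k)

    σ-derivation : ∀ k → Derivation (D (coeff (σ k)))
    σ-derivation k = D-derivation (tree-admissible (lgen k))

    σ-kernel : ∀ {N} f → HomP N f → InKerD< N f → ∀ k → 2 ℕ.* k ℕ.+ 3 ≢ N → IR.I (D (coeff (σ k)) f)
    σ-kernel {N} f hf ker k ne with ℕP.<-cmp (2 ℕ.* k ℕ.+ 3) N
    -- The generator of weight 2k + 3 belongs to D_{2r+1} with r = k + 1.
    ... | tri< lt _ _ = tensZero⇒D-R (2 ℕ.* k ℕ.+ 3) (σ-Hom k) (σ-doubleShuffle k) f (subst (λ n → TensZero (leftWeight n (ΔGon f))) (D-weight-r k)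
      (ker (suc k) (subst (3 ≤_) (sym (D-weight-r k)) (ℕP.m≤n+m 3 (2 ℕ.* k))) (subst (_< N) (sym (D-weight-r k)) lt)))
    ... | tri≈ _ e _ = ⊥-elim (ne e)
    ... | tri> _ _ gt = IR.I-zero (D-low (2 ℕ.* k ℕ.+ 3) (σ-Hom k) f hf gt)

    σ-ζ : ∀ k n → 2 ℕ.* k ℕ.+ 3 ≢ suc n → coeff (σ k) (y n) ≡ 0ℚ
    σ-ζ k n ne = σ-Hom k (y n) (λ e → ne (trans (sym e) (length-y n)))

    σ-ζ-odd : ∀ k → coeff (σ k) (y (dbl (suc k))) ≢ 0ℚ
    σ-ζ-odd k z = case (common-kernel {word (y (dbl (suc k)))} vanish (s≤s z≤n) (subst (λ j → HomP j (word (y (dbl (suc k))))) (length-y (dbl (suc k))) (HomP-word (y (dbl (suc k))))))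
      where
      pairing : ∀ j → Dec (j ≡ k) → coeff (σ j) (y (dbl (suc k))) ≡ 0ℚ
      pairing j (yes refl) = z
      pairing j (no ne) = σ-ζ j (dbl (suc k)) (λ e → ne (ℕP.suc-injective (dbl-injective {suc j} {suc k} (ℕP.suc-injective (trans (sym (generator-weight j)) e)))))
      vanish : ∀ j → IR.I (D (coeff (σ j)) (word (y (dbl (suc k)))))
      vanish j = IR.I-zero (~-trans (D-zeta (σ-doubleShuffle j) (dbl (suc k))) (tested λ F → trans (ev-scale F (coeff (σ j) (y (dbl (suc k)))) (word [])) (0* (pairing j (j ℕ.≟ k)))))
      case : IR.I (word (y (dbl (suc k)))) ⊎ (∃ λ a → (suc (dbl (suc k)) ≡ dbl a) × ≃-pow a (word (y (dbl (suc k))))) → ⊥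
      case (inj₁ r) = zeta∉R (suc (dbl k)) r
      case (inj₂ (a , e , _)) = odd≢even (suc k) a e

  even-kernel : ∀ a f → HomP (dbl (suc a)) f → InKerD< (dbl (suc a)) f → InQζ (dbl (suc a)) f
  even-kernel a f hf ker = case (common-kernel {f} (λ k → σ-kernel f hf ker k (λ e → odd≢even (suc k) (suc a) (trans (sym (generator-weight k)) e))) (s≤s z≤n) hf)
    where
    module Euler = PositiveMultiple (euler a)
    ζ : Poly
    ζ = evenZeta a
    d : ℚ
    d = proj₁ (inverse Euler.factor (pos⇒≢0 Euler.positive))
    -- Euler's formula read backwards, with the positive factor inverted.
    pow≃ζ : pow (suc a) ≃ scale d ζ
    pow≃ζ = ≃-trans (~⇒≃ (~-trans (~-sym (scale-1 (pow (suc a)))) (~-trans (tested λ F → cong (λ k → ev F (scale k (pow (suc a)))) {x = 1ℚ} {y = d * Euler.factor} (sym (proj₂ (inverse Euler.factor (pos⇒≢0 Euler.positive))))) (~-sym (scale-scale d Euler.factor (pow (suc a)))))))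
      (≃-scale d (≃-sym Euler.equation))
    case : IR.I f ⊎ (∃ λ k → (dbl (suc a) ≡ dbl k) × ≃-pow k f) → InQζ (dbl (suc a)) f
    case (inj₁ r) = inQζ (suc (dbl a)) f 0ℚ (congruent (IR.I-⊕ r (IR.I-scale (ℚ.- 1ℚ) (IR.I-zero (tested λ F → trans (ev-scale F 0ℚ ζ) (zeroˡ _))))))
    case (inj₂ (k , e , c , p)) = inQζ (suc (dbl a)) f (c * d) (≃-trans (subst (λ j → f ≃ scale c (pow j)) (sym (dbl-injective e)) p) (≃-trans (≃-scale c pow≃ζ) (~⇒≃ (scale-scale c d ζ))))

  odd-kernel : ∀ a f → HomP (suc (dbl (suc a))) f → InKerD< (suc (dbl (suc a))) f → InQζ (suc (dbl (suc a))) f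
  odd-kernel a f hf ker = case (common-kernel {f ⊖ scale c ζ} vanish (s≤s z≤n) (HomP-⊖ f (scale c ζ) hf (HomP-scale c ζ ζ-HomP)))
    where
    n : ℕ
    n = dbl (suc a)
    ζ : Poly
    ζ = word (y n)
    ζ-HomP : HomP (suc n) ζ
    ζ-HomP = subst (λ j → HomP j ζ) (length-y n) (HomP-word (y n))
    invert : ∃ λ d → d * coeff (σ a) (y n) ≡ 1ℚ
    invert = inverse (coeff (σ a) (y n)) (σ-ζ-odd a)
    c : ℚ
    -- Chosen so that σ_a vanishes on f - c ζ(N); in weight N this pairing is the whole of D_{σ_a}.
    c = pair (σ a) f * proj₁ invert
    expand : ∀ k → D (coeff (σ k)) (f ⊖ scale c ζ) ~ D (coeff (σ k)) f ⊖ scale c (scale (coeff (σ k) (y n)) (word []))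
    expand k = ~-trans (T-⊕ f (scale (ℚ.- 1ℚ) (scale c ζ))) (⊕-cong (~-refl {p = D (coeff (σ k)) f}) (~-trans (T-scale (ℚ.- 1ℚ) (scale c ζ)) (scale-cong (ℚ.- 1ℚ) (~-trans (T-scale c ζ) (scale-cong c (D-zeta (σ-doubleShuffle k) n))))))
      where open Derivation (σ-derivation k)
    vanish : ∀ k → IR.I (D (coeff (σ k)) (f ⊖ scale c ζ))
    vanish k = go (k ℕ.≟ a)
      where
      go : Dec (k ≡ a) → IR.I (D (coeff (σ k)) (f ⊖ scale c ζ))
      go (yes refl) = IR.I-zero (~-trans (expand a) (tested λ F → trans (ev-⊖ F (D (coeff (σ a)) f) (scale c (scale (coeff (σ a) (y n)) (word []))))
        (trans (trans (at (D-top (suc n) (subst (λ j → Hom j (coeff (σ a))) (generator-weight a) (σ-Hom a)) (proj₁ (DoubleShuffle.kills (σ-doubleShuffle a))) f hf) F) (ev-scale F (pair (σ a) f) (word []))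
           ⊞ cong -_ (trans (ev-scale F c (scale (coeff (σ a) (y n)) (word []))) (c ⊠ ev-scale F (coeff (σ a) (y n)) (word []))))
        (lin ((pair (σ a) f * ev F (word [])) ⊠ sym (proj₂ invert))
          (solve 4 (λ p e d s → (p :* e :+ :- (p :* d :* (s :* e))) :+ p :* e :* (d :* s) := con 0ℚ :+ p :* e :* con 1ℚ) refl _ _ _ _)))))
      go (no ne) = IR.I-~ (~-sym (expand k)) (IR.I-⊖ (σ-kernel f hf ker k odd≢) (IR.I-scale c (IR.I-zero (tested λ F → trans (ev-scale F (coeff (σ k) (y n)) (word [])) (0* (σ-ζ k n odd≢))))))
        where
        odd≢ : 2 ℕ.* k ℕ.+ 3 ≢ suc n
        odd≢ e = ne (ℕP.suc-injective (dbl-injective {suc k} {suc a} (ℕP.suc-injective (trans (sym (generator-weight k)) e))))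
    case : IR.I (f ⊖ scale c ζ) ⊎ (∃ λ k → (suc n ≡ dbl k) × ≃-pow k (f ⊖ scale c ζ)) → InQζ (suc n) f
    case (inj₁ r) = inQζ n f c (congruent r)
    case (inj₂ (k , e , _)) = ⊥-elim (odd≢even (suc a) k e)

  kernel⇒ζ-multiple : ∀ N → 2 ≤ N → ∀ f → HomP N f → InKerD< N f → InQζ N f
  kernel⇒ζ-multiple N 2≤N f hf ker with parity N
  kernel⇒ζ-multiple _ () f hf ker | inj₁ (zero , refl)
  ... | inj₁ (suc a , refl) = even-kernel a f hf ker
  kernel⇒ζ-multiple _ (s≤s ()) f hf ker | inj₂ (zero , refl)
  ... | inj₂ (suc a , refl) = odd-kernel a f hf ker

theorem5p54 : FreeOddGeneration → (N : ℕ) → 2 ≤ N →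
  (f : PX.Poly) → PX.Homogeneous N f →
  (InKerD< N f → InQζ N f) × (InQζ N f → InKerD< N f)
theorem5p54 (σ , homogeneous , in𝔡𝔪₀ , _ , generate) (suc n) 2≤N f hf =
  kernel⇒ζ-multiple σ homogeneous in𝔡𝔪₀ generate (suc n) 2≤N f (homogeneous⇒HomP {f = f} hf) , ζ-multiple⇒kernel n f
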